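{- Let $q$ be a prime power and let $n,s$ be two relatively prime positive integers with $s\le 2n-1$. Suppose that \[ n\geq\begin{cases} 4s+2 & \text{if } q=3 \text{ and } s>1, \text{ or } q=2 \text{ and } s>2; \\ 4s+1 & \text{otherwise}. \end{cases} \] Then, for every $\delta\in\mathbb{F}_{q^{2n}}^*$, the $\mathbb{F}_q$-linear set $L_{\delta,s}$ in $\mathrm{PG}(1,q^{2n})$ is not scattered.
   Context: For $\delta\in\mathbb{F}_{q^{2n}}^*$, let $f_{\delta,s}(x)=x^{q^s}+\delta x^{q^{n+s}}$, viewed as an $\mathbb{F}_q$-linear map of $\mathbb{F}_{q^{2n}}$, and $U_{\delta,s}=\{(x,f_{\delta,s}(x))\colon x\in\mathbb{F}_{q^{2n}}\}$, an $\mathbb{F}_q$-subspace of $\mathbb{F}_{q^{2n}}^2$ of dimension $2n$. The linear set is $L_{\delta,s}=\{\langle \mathbf{u}\rangle_{\mathbb{F}_{q^{2n}}}\colon \mathbf{u}\in U_{\delta,s}\setminus\{\mathbf{0}\}\}\subseteq\mathrm{PG}(1,q^{2n})$. The weight of a point $P=\langle\mathbf{u}\rangle_{\mathbb{F}_{q^{2n}}}$ is $\dim_{\mathbb{F}_q}(U_{\delta,s}\cap\langle\mathbf{u}\rangle_{\mathbb{F}_{q^{2n}}})$. $L_{\delta,s}$ is called (maximum) scattered if every point of $L_{\delta,s}$ has weight one, equivalently $|L_{\delta,s}|=(q^{2n}-1)/(q-1)$, equivalently $\dim_{\mathbb{F}_q}\ker(f_{\delta,s}(x)-\lambda x)\le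 1$ for all $\lambda\in\mathbb{F}_{q^{2n}}$. -}

module Defs where

open import Level using (0ℓ)
open import Algebra.Bundles using (CommutativeRing)
import Data.Nat as ℕ
open ℕ using (ℕ; _≤_; _<_; _≡ᵇ_; _<ᵇ_)
open import Data.Nat.Primality using (Prime)
open import Data.Bool using (if_then_else_; _∧_; _∨_)
open import Data.Fin using (Fin)
open import Data.Product using (Σ; ∃; ∃₂; _×_)
open import Relation.Nullary using (¬_)
open import Function.Bundles using (Bijection)
import Relation.Binary.PropositionalEquality as ≡
open ≡ using (_≡_)

IsPrimePower : ℕ → Set
IsPrimePower q = ∃₂ λ p k → Prime p × 1 ≤ k × q ≡ p ℕ.^ k

record IsField (R : CommutativeRing 0ℓ 0ℓ) : Set where
  open CommutativeRing R
  field
    1≉0     : ¬ (1# ≈ 0#)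
    inverse : ∀ x → ¬ (x ≈ 0#) → ∃ λ y → x * y ≈ 1#

HasCardinality : CommutativeRing 0ℓ 0ℓ → ℕ → Set
HasCardinality R N = Bijection (≡.setoid (Fin N)) (CommutativeRing.setoid R)

nBound : ℕ → ℕ → ℕ
nBound q s =
  if ((q ≡ᵇ 3) ∧ (1 <ᵇ s)) ∨ ((q ≡ᵇ 2) ∧ (2 <ᵇ s))
  then 4 ℕ.* s ℕ.+ 2
  else 4 ℕ.* s ℕ.+ 1

-- Inside a field F (intended: F = F_{q^{2n}})
module LinearSet (R : CommutativeRing 0ℓ 0ℓ) (q n : ℕ) where
  open CommutativeRing R
  open import Algebra.Properties.Semiring.Exp semiring using (_^_)

  InFq : Carrier → Set
  InFq c = c ^ q ≈ c

  f : Carrier → ℕ → Carrier → Carrier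
  f δ s x = x ^ (q ℕ.^ s) + δ * (x ^ (q ℕ.^ (n ℕ.+ s)))

  -- Every point P = ⟨(x, f x)⟩ of L_{δ,s} (x ≠ 0, equivalently (x,f x) ≠ 0)
  -- has weight one: every vector (y, f y) of U_{δ,s} lying in the
  -- F-span of (x, f x), i.e. (y, f y) = a (x, f x) for some a ∈ F,
  -- is an F_q-multiple c (x, f x) of (x, f x).
  Scattered : Carrier → ℕ → Set
  Scattered δ s =
    ∀ x y a → ¬ (x ≈ 0#) →
      y ≈ a * x → f δ s y ≈ a * f δ s x →
      ∃ λ c → InFq c × (y ≈ c * x) × (f δ s y ≈ c * f δ s x)

{-# OPTIONS --safe #-}
module Submission where

-- Put Q = q^n, σ = q^s and N(δ) = δ^(Q+1).  If f(α x) = α f(x) for some x ≠ 0 and α ∉ F_q, the set is not scattered.  For N(δ) = 1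
-- such x and α come from Hilbert 90.  Otherwise let e = N(δ) / (N(δ) - 1) and c = e² - e, and consider the curve
--   u v^(σ-1) = (e - u)(e - 1 - u),  b^q - b = (e - u) v
-- with the semilinear involution τ̄ : u ↦ c/u, v ↦ -v, b ↦ b + v + v^q + … + v^(q^(s-1)).  A rational point which τ̄ takes to
-- its image under x ↦ x^Q yields x and α, again by Hilbert 90.  Suppose that there is no such point.  The functions
-- with poles only at the places u = 0 and u = ∞ form a ring on which a residue ρ is a nondegenerate functional, with dual bases f r
-- and f* r.  For the ring endomorphism Φ x = τ̄(x)^Q the elements x - Φ x generate the unit ideal, so the Casimir element
-- 𝒦 = Σ f r Φ(f* r) is killed by a functional ρ[ χ ] twisted by Φ.  Testing ρ[ χ ] (g 𝒦) = 0 on suitable g = g₁ g₂^(qσ), the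
-- pole orders at both places leave a triangular system of linear equations, which is inconsistent once n ≥ 3s + 2.

open import Defs
open import Level using (0ℓ)
open import Algebra.Bundles using (CommutativeRing)
open import Algebra.Solver.Ring.AlmostCommutativeRing using (fromCommutativeRing; _-Raw-AlmostCommutative⟶_)
import Algebra.Solver.Ring
open import Data.Bool using (true; false; if_then_else_; _∧_; _∨_)
open import Data.Empty using (⊥; ⊥-elim)
open import Data.Fin as Fin using (Fin; toℕ)
open import Data.Fin.Permutation using (Permutation; permutation; _⟨$⟩ʳ_)
import Data.Fin.Properties as Finₚ
open import Data.Integer as ℤ using (ℤ; +_; -[1+_]; _⊖_)
import Data.Integer.DivMod as ℤ/
import Data.Integer.Properties as ℤₚ
open import Data.Integer.Tactic.RingSolver using (solve-∀)
open import Data.List using (List; []; _∷_; _++_; map)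
open import Data.Maybe using (Maybe; just; nothing)
open import Data.Nat as ℕ using (ℕ; zero; suc; _≤_; _<_; z≤n; s≤s; z<s; s<s; _!; _<?_)
open import Data.Nat.Combinatorics as ℕC using (nCn≡1; nCk≡n!/k![n-k]!; k![n∸k]!∣n!)
import Data.Nat.DivMod as ℕ/
open import Data.Nat.Divisibility using (_∣_; divides; ∣⇒≤; m∣m*n)
open import Data.Nat.GCD using (gcd; GCD; gcd-GCD; module Bézout)
open import Data.Nat.Primality using (Prime; euclidsLemma; prime⇒nonTrivial)
import Data.Nat.Properties as ℕₚ
import Data.Nat.Tactic.RingSolver as ℕ-Solver
open import Data.Product using (∃; ∃₂; _,_; proj₁; proj₂; _×_)
open import Data.Sum using (_⊎_; inj₁; inj₂; [_,_]′)
open import Data.Unit using (⊤; tt)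
open import Data.Vec as Vec using (Vec; []; _∷_; tabulate)
open import Data.Vec.Properties using (lookup∘tabulate)
open import Function using (_∘_)
open import Function.Bundles using (Bijection)
open import Relation.Binary.Definitions using (Tri; tri<; tri≈; tri>)
open import Relation.Binary.PropositionalEquality as ≡ using (_≡_)
open import Relation.Nullary using (¬_; yes; no; Dec)
import Relation.Nullary.Decidable as Dec

-- Commutative rings: Frobenius maps and finite sums

-- The curve rewrites the condition f (α x) = α f(x). There v stands for α^Q - α, (e - u) v for α^σ
-- - α, and b for the partial trace Σ α^(q^m), m < s. Hilbert 90 yields x when the norms of α^σ - α
-- and of α^σ - α + v^σ have quotient N(δ); with the given e this is what the equation for v^(σ-1)
-- expresses. The existence of a point is a trace argument in the spirit of Lefschetz: modulo the
-- ideal of all x - Φ x only fixed points survive, so without them ρ[ χ ] (g 𝒦) vanishes for every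
-- g. No single g gives a visible contradiction, hence g varies. As Q is a multiple of qσ, the
-- factor g₂^(qσ) and Φ (f* r) merge into one qσ-th power; expanding its root separates g₁ from g₂,
-- and raising the order of g₁ isolates the coefficients one after the other. Both places u = 0 and
-- u = ∞ are totally ramified and τ̄ exchanges them. Orders at u = 0 give the nonvanishing residues,
-- orders at u = ∞ cut the expansions off.

prime∤! : ∀ {p} → Prime p → ∀ k → k < p → ¬ (p ∣ k !)
prime∤! pr zero k<p p∣ = ℕₚ.<⇒≱ (ℕ.nonTrivial⇒n>1 _ {{prime⇒nonTrivial pr}}) (∣⇒≤ p∣)
prime∤! pr (suc k) k<p p∣ with euclidsLemma (suc k) (k !) pr p∣
... | inj₁ d = ℕₚ.<⇒≱ k<p (∣⇒≤ d)
... | inj₂ d = prime∤! pr k (ℕₚ.<-trans (ℕₚ.n<1+n k) k<p) d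

n∣n! : ∀ n → 0 < n → n ∣ n !
n∣n! (suc n) _ = m∣m*n (n !)

1<⇒2+ : ∀ {n} → 1 < n → ∃ λ m → n ≡ suc (suc m)
1<⇒2+ {suc zero} (s≤s ())
1<⇒2+ {suc (suc m)} _ = m , ≡.refl

prime∣C : ∀ {p} → Prime p → ∀ k → 0 < k → k < p → p ∣ p ℕC.C k
prime∣C {p} pr k 0<k k<p =
  [ (λ d → d) , (λ d → ⊥-elim ([ prime∤! pr k k<p , prime∤! pr (p ℕ.∸ k) p∸k<p ]′ (euclidsLemma (k !) _ pr d))) ]′
  (euclidsLemma (p ℕC.C k) (k ! ℕ.* (p ℕ.∸ k) !) pr p∣prod)
  where
  instance
    nz = k ℕₚ.!* (p ℕ.∸ k) !≢0
  p∸k<p : p ℕ.∸ k < p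
  p∸k<p = ℕₚ.∸-monoʳ-< 0<k (ℕₚ.<⇒≤ k<p)
  eq : (p ℕC.C k) ℕ.* (k ! ℕ.* (p ℕ.∸ k) !) ≡ p !
  eq = ≡.trans (≡.cong (ℕ._* (k ! ℕ.* (p ℕ.∸ k) !)) (nCk≡n!/k![n-k]! (ℕₚ.<⇒≤ k<p)))
               (ℕ/.m/n*n≡m (k![n∸k]!∣n! (ℕₚ.<⇒≤ k<p)))
  p∣prod : p ∣ (p ℕC.C k) ℕ.* (k ! ℕ.* (p ℕ.∸ k) !)
  p∣prod = ≡.subst (p ∣_) (≡.sym eq) (n∣n! p (ℕₚ.<-≤-trans 0<k (ℕₚ.<⇒≤ k<p)))

module Ring (R : CommutativeRing 0ℓ 0ℓ) where
  private
    module C = CommutativeRing R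
    open import Algebra.Properties.Ring C.ring as Rₚ using ()
    open import Algebra.Properties.AbelianGroup C.+-abelianGroup as Gₚ using ()

  open C public using (Carrier; _≈_; _+_; _*_; -_; 0#; 1#; setoid; semiring; commutativeSemiring; +-commutativeMonoid; *-commutativeMonoid)
  open import Algebra.Properties.Semiring.Mult semiring public using (×-homo-+; ×1-homo-*; ×-assoc-*) renaming (_×_ to _·_; ×-congʳ to ·-congʳ; ×-assocˡ to ·-assocˡ)
  open import Algebra.Properties.Semiring.Exp semiring using () renaming (_^_ to _^ᵉ_)

  infixl 6 _-_
  infixr 8 _^_
  infix 1 begin_
  infixr 2 step-≈ step-≈˘ step-≡
  infix 3 _∎

  _-_ : Carrier → Carrier → Carrier
  x - y = x + - y

  -- A separate copy of the power; `^≡` passes to the library power for the binomial theorem and for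
  -- `f` and `InFq`.
  _^_ : Carrier → ℕ → Carrier
  x ^ zero = 1#
  x ^ suc n = x * x ^ n

  -- The laws are restated because the types of the library versions are expensive to unfold during elaboration.
  refl : ∀ {x} → x ≈ x
  refl = C.refl

  sym : ∀ {x y} → x ≈ y → y ≈ x
  sym = C.sym

  trans : ∀ {x y z} → x ≈ y → y ≈ z → x ≈ z
  trans = C.trans

  reflexive : ∀ {x y} → x ≡ y → x ≈ y
  reflexive = C.reflexive

  begin_ : ∀ {x y} → x ≈ y → x ≈ y
  begin p = p

  step-≈ : ∀ x {y z} → y ≈ z → x ≈ y → x ≈ z
  step-≈ x q p = trans p q

  step-≈˘ : ∀ x {y z} → y ≈ z → y ≈ x → x ≈ z
  step-≈˘ x q p = trans (sym p) q

  step-≡ : ∀ x {y z} → y ≈ z → x ≡ y → x ≈ z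
  step-≡ x q p = trans (reflexive p) q

  syntax step-≈ x q p = x ≈⟨ p ⟩ q
  syntax step-≈˘ x q p = x ≈⟨ p ⟨ q
  syntax step-≡ x q p = x ≡⟨ p ⟩ q

  _∎ : ∀ x → x ≈ x
  x ∎ = refl

  +-cong : ∀ {x y u v} → x ≈ y → u ≈ v → x + u ≈ y + v
  +-cong = C.+-cong

  +-congˡ : ∀ {x y z} → y ≈ z → x + y ≈ x + z
  +-congˡ = C.+-congˡ

  +-congʳ : ∀ {x y z} → y ≈ z → y + x ≈ z + x
  +-congʳ = C.+-congʳ

  *-cong : ∀ {x y u v} → x ≈ y → u ≈ v → x * u ≈ y * v
  *-cong = C.*-cong

  *-congˡ : ∀ {x y z} → y ≈ z → x * y ≈ x * z
  *-congˡ = C.*-congˡ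

  *-congʳ : ∀ {x y z} → y ≈ z → y * x ≈ z * x
  *-congʳ = C.*-congʳ

  -‿cong : ∀ {x y} → x ≈ y → - x ≈ - y
  -‿cong = C.-‿cong

  +-assoc : ∀ x y z → (x + y) + z ≈ x + (y + z)
  +-assoc = C.+-assoc

  +-comm : ∀ x y → x + y ≈ y + x
  +-comm = C.+-comm

  +-identityˡ : ∀ x → 0# + x ≈ x
  +-identityˡ = C.+-identityˡ

  +-identityʳ : ∀ x → x + 0# ≈ x
  +-identityʳ = C.+-identityʳ

  -‿inverseˡ : ∀ x → - x + x ≈ 0#
  -‿inverseˡ = C.-‿inverseˡ

  -‿inverseʳ : ∀ x → x - x ≈ 0#
  -‿inverseʳ = C.-‿inverseʳ

  *-assoc : ∀ x y z → (x * y) * z ≈ x * (y * z)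
  *-assoc = C.*-assoc

  *-comm : ∀ x y → x * y ≈ y * x
  *-comm = C.*-comm

  *-identityˡ : ∀ x → 1# * x ≈ x
  *-identityˡ = C.*-identityˡ

  *-identityʳ : ∀ x → x * 1# ≈ x
  *-identityʳ = C.*-identityʳ

  zeroˡ : ∀ x → 0# * x ≈ 0#
  zeroˡ = C.zeroˡ

  zeroʳ : ∀ x → x * 0# ≈ 0#
  zeroʳ = C.zeroʳ

  distribˡ : ∀ x y z → x * (y + z) ≈ x * y + x * z
  distribˡ = C.distribˡ

  distribʳ : ∀ x y z → (y + z) * x ≈ y * x + z * x
  distribʳ = C.distribʳ

  -‿distribˡ-* : ∀ x y → - (x * y) ≈ - x * y
  -‿distribˡ-* = Rₚ.-‿distribˡ-*

  -‿distribʳ-* : ∀ x y → - (x * y) ≈ x * - y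
  -‿distribʳ-* = Rₚ.-‿distribʳ-*

  -‿involutive : ∀ x → - - x ≈ x
  -‿involutive = Rₚ.-‿involutive

  -0#≈0# : - 0# ≈ 0#
  -0#≈0# = Rₚ.-0#≈0#

  ⁻¹-∙-comm : ∀ x y → - x - y ≈ - (x + y)
  ⁻¹-∙-comm = Gₚ.⁻¹-∙-comm

  x-y≈0⇒x≈y : ∀ x y → x - y ≈ 0# → x ≈ y
  x-y≈0⇒x≈y = Gₚ.x∙y⁻¹≈ε⇒x≈y

  x≈y⇒x-y≈0 : ∀ {x y} → x ≈ y → x - y ≈ 0#
  x≈y⇒x-y≈0 = Gₚ.x≈y⇒x∙y⁻¹≈ε

  ^≡ : ∀ x n → x ^ n ≡ x ^ᵉ n
  ^≡ x zero = ≡.refl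
  ^≡ x (suc n) = ≡.cong (x *_) (^≡ x n)

  ^-congˡ : ∀ n {x y} → x ≈ y → x ^ n ≈ y ^ n
  ^-congˡ zero p = refl
  ^-congˡ (suc n) p = *-cong p (^-congˡ n p)

  ^-congʳ : ∀ x {m n} → m ≡ n → x ^ m ≈ x ^ n
  ^-congʳ x ≡.refl = refl

  ^-homo-* : ∀ x m n → x ^ (m ℕ.+ n) ≈ x ^ m * x ^ n
  ^-homo-* x zero n = sym (*-identityˡ _)
  ^-homo-* x (suc m) n = trans (*-congˡ (^-homo-* x m n)) (sym (*-assoc _ _ _))

  ^-assocʳ : ∀ x m n → (x ^ m) ^ n ≈ x ^ (m ℕ.* n)
  ^-assocʳ x m zero = ^-congʳ x (≡.sym (ℕₚ.*-zeroʳ m))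
  ^-assocʳ x m (suc n) = trans (*-congˡ (^-assocʳ x m n)) (trans (sym (^-homo-* x m (m ℕ.* n))) (^-congʳ x (≡.sym (ℕₚ.*-suc m n))))

  ^-distrib-* : ∀ x y n → (x * y) ^ n ≈ x ^ n * y ^ n
  ^-distrib-* x y zero = sym (*-identityˡ _)
  ^-distrib-* x y (suc n) = begin
    (x * y) * (x * y) ^ n ≈⟨ *-congˡ (^-distrib-* x y n) ⟩
    (x * y) * (x ^ n * y ^ n) ≈⟨ *-assoc _ _ _ ⟩
    x * (y * (x ^ n * y ^ n)) ≈⟨ *-congˡ (trans (sym (*-assoc _ _ _)) (trans (*-congʳ (*-comm _ _)) (*-assoc _ _ _))) ⟩
    x * (x ^ n * (y * y ^ n)) ≈⟨ *-assoc _ _ _ ⟨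
    (x * x ^ n) * (y * y ^ n) ∎

  ⟦_⟧ℤ : ℤ → Carrier
  ⟦ + n ⟧ℤ = n · 1#
  ⟦ -[1+ n ] ⟧ℤ = - (suc n · 1#)

  private
    ⊖-homo : ∀ m n → ⟦ m ⊖ n ⟧ℤ ≈ m · 1# - n · 1#
    ⊖-homo zero zero = sym (-‿inverseʳ 0#)
    ⊖-homo zero (suc n) = sym (+-identityˡ _)
    ⊖-homo (suc m) zero = sym (trans (+-congˡ -0#≈0#) (+-identityʳ _))
    ⊖-homo (suc m) (suc n) = begin
      ⟦ suc m ⊖ suc n ⟧ℤ ≡⟨ ≡.cong ⟦_⟧ℤ (ℤₚ.[1+m]⊖[1+n]≡m⊖n m n) ⟩
      ⟦ m ⊖ n ⟧ℤ ≈⟨ ⊖-homo m n ⟩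
      m · 1# - n · 1# ≈⟨ +-identityˡ _ ⟨
      0# + (m · 1# - n · 1#) ≈⟨ +-congʳ (-‿inverseʳ 1#) ⟨
      (1# - 1#) + (m · 1# - n · 1#) ≈⟨ +-assoc _ _ _ ⟩
      1# + (- 1# + (m · 1# - n · 1#)) ≈⟨ +-congˡ (trans (sym (+-assoc _ _ _)) (trans (+-congʳ (+-comm _ _)) (+-assoc _ _ _))) ⟩
      1# + (m · 1# + (- 1# - n · 1#)) ≈⟨ +-assoc _ _ _ ⟨
      suc m · 1# + (- 1# - n · 1#) ≈⟨ +-congˡ (⁻¹-∙-comm _ _) ⟩
      suc m · 1# - suc n · 1# ∎

    ℤ+ : ∀ i j → ⟦ i ℤ.+ j ⟧ℤ ≈ ⟦ i ⟧ℤ + ⟦ j ⟧ℤ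
    ℤ+ (+ m) (+ n) = ×-homo-+ 1# m n
    ℤ+ (+ m) -[1+ n ] = ⊖-homo m (suc n)
    ℤ+ -[1+ m ] (+ n) = trans (⊖-homo n (suc m)) (+-comm _ _)
    ℤ+ -[1+ m ] -[1+ n ] = begin
      - (suc (suc (m ℕ.+ n)) · 1#) ≡⟨ ≡.cong (λ k → - (suc k · 1#)) (≡.sym (ℕₚ.+-suc m n)) ⟩
      - ((suc m ℕ.+ suc n) · 1#) ≈⟨ -‿cong (×-homo-+ 1# (suc m) (suc n)) ⟩
      - (suc m · 1# + suc n · 1#) ≈⟨ ⁻¹-∙-comm _ _ ⟨
      - (suc m · 1#) - (suc n · 1#) ∎

    ℤ- : ∀ i → ⟦ ℤ.- i ⟧ℤ ≈ - ⟦ i ⟧ℤ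
    ℤ- (+ zero) = sym -0#≈0#
    ℤ- (+ suc n) = refl
    ℤ- -[1+ n ] = sym (-‿involutive _)

    ℤ* : ∀ i j → ⟦ i ℤ.* j ⟧ℤ ≈ ⟦ i ⟧ℤ * ⟦ j ⟧ℤ
    ℤ* (+ m) (+ n) = trans (reflexive (≡.cong ⟦_⟧ℤ (≡.sym (ℤₚ.pos-* m n)))) (×1-homo-* m n)
    ℤ* (+ m) -[1+ n ] = begin
      ⟦ + m ℤ.* -[1+ n ] ⟧ℤ ≡⟨ ≡.cong ⟦_⟧ℤ (≡.sym (ℤₚ.neg-distribʳ-* (+ m) (+ suc n))) ⟩
      ⟦ ℤ.- (+ m ℤ.* + suc n) ⟧ℤ ≈⟨ ℤ- (+ m ℤ.* + suc n) ⟩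
      - ⟦ + m ℤ.* + suc n ⟧ℤ ≈⟨ -‿cong (ℤ* (+ m) (+ suc n)) ⟩
      - (m · 1# * suc n · 1#) ≈⟨ -‿distribʳ-* _ _ ⟩
      m · 1# * - (suc n · 1#) ∎
    ℤ* -[1+ m ] (+ n) = begin
      ⟦ -[1+ m ] ℤ.* + n ⟧ℤ ≡⟨ ≡.cong ⟦_⟧ℤ (≡.sym (ℤₚ.neg-distribˡ-* (+ suc m) (+ n))) ⟩
      ⟦ ℤ.- (+ suc m ℤ.* + n) ⟧ℤ ≈⟨ ℤ- (+ suc m ℤ.* + n) ⟩
      - ⟦ + suc m ℤ.* + n ⟧ℤ ≈⟨ -‿cong (ℤ* (+ suc m) (+ n)) ⟩
      - (suc m · 1# * n · 1#) ≈⟨ -‿distribˡ-* _ _ ⟩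
      - (suc m · 1#) * n · 1# ∎
    ℤ* -[1+ m ] -[1+ n ] = begin
      ⟦ + suc m ℤ.* + suc n ⟧ℤ ≈⟨ ℤ* (+ suc m) (+ suc n) ⟩
      suc m · 1# * suc n · 1# ≈⟨ -‿involutive _ ⟨
      - - (suc m · 1# * suc n · 1#) ≈⟨ -‿cong (-‿distribˡ-* _ _) ⟩
      - (- (suc m · 1#) * suc n · 1#) ≈⟨ -‿distribʳ-* _ _ ⟩
      - (suc m · 1#) * - (suc n · 1#) ∎

    -- Unlike `n · 1#`, this sends 1 to `1#` itself, so that the solver constant `con (+ 1)` matches
    -- a literal `1#` in a goal.
    ν : ℕ → Carrier
    ν zero = 0#
    ν (suc zero) = 1#
    ν (suc n@(suc _)) = 1# + ν n

    ν≈ : ∀ n → ν n ≈ n · 1#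
    ν≈ zero = refl
    ν≈ (suc zero) = sym (+-identityʳ 1#)
    ν≈ (suc n@(suc _)) = +-congˡ (ν≈ n)

    ⟪_⟫ : ℤ → Carrier
    ⟪ + n ⟫ = ν n
    ⟪ -[1+ n ] ⟫ = - ν (suc n)

    ⟪⟫≈ : ∀ i → ⟪ i ⟫ ≈ ⟦ i ⟧ℤ
    ⟪⟫≈ (+ n) = ν≈ n
    ⟪⟫≈ -[1+ n ] = -‿cong (ν≈ (suc n))

    morphism : ℤ.+-*-rawRing -Raw-AlmostCommutative⟶ fromCommutativeRing R
    morphism = record
      { ⟦_⟧ = ⟪_⟫
      ; +-homo = λ i j → trans (⟪⟫≈ (i ℤ.+ j)) (trans (ℤ+ i j) (sym (+-cong (⟪⟫≈ i) (⟪⟫≈ j))))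
      ; *-homo = λ i j → trans (⟪⟫≈ (i ℤ.* j)) (trans (ℤ* i j) (sym (*-cong (⟪⟫≈ i) (⟪⟫≈ j))))
      ; -‿homo = λ i → trans (⟪⟫≈ (ℤ.- i)) (trans (ℤ- i) (sym (-‿cong (⟪⟫≈ i))))
      ; 0-homo = refl ; 1-homo = refl }

    _≟ℤ_ : ∀ i j → Maybe (⟪ i ⟫ ≈ ⟪ j ⟫)
    i ≟ℤ j with i ℤ.≟ j
    ... | yes eq = just (reflexive (≡.cong ⟪_⟫ eq))
    ... | no _ = nothing

  module Solver = Algebra.Solver.Ring ℤ.+-*-rawRing (fromCommutativeRing R) morphism _≟ℤ_
  open Solver public using (solve; _:+_; _:*_; _:-_; :-_; con) renaming (_:=_ to _⊜_)

  module _ {p : ℕ} (pr : Prime p) (char : p · 1# ≈ 0#) where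
    open import Algebra.Properties.CommutativeSemiring.Binomial commutativeSemiring
      using (binomialTerm; binomialExpansion; theorem)
    open import Algebra.Properties.Semiring.Sum semiring using (sum; sum-cong-≋; sum-replicate-zero; sum-init-last)
    open import Data.Vec.Functional using (init; last; tail)

    private
      multiple≈0 : ∀ {m} → p ∣ m → ∀ x → m · x ≈ 0#
      multiple≈0 {m} (divides k ≡.refl) x = begin
        (k ℕ.* p) · x ≈⟨ ·-congʳ (k ℕ.* p) (*-identityˡ x) ⟨
        (k ℕ.* p) · (1# * x) ≈⟨ ×-assoc-* (k ℕ.* p) 1# x ⟨
        (k ℕ.* p) · 1# * x ≈⟨ *-congʳ (×1-homo-* k p) ⟩
        k · 1# * (p · 1#) * x ≈⟨ *-congʳ (trans (*-congˡ char) (zeroʳ _)) ⟩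
        0# * x ≈⟨ zeroˡ x ⟩
        0# ∎

      -- The inner binomial coefficients are divisible by p; writing p as 2 + m lets both outer
      -- terms be peeled off.
      middle : ∀ m x y → p ≡ suc (suc m) → binomialExpansion x y p ≈ y ^ᵉ p + x ^ᵉ p
      middle m x y ≡.refl = begin
        first + sum rest ≈⟨ +-congˡ (sum-init-last rest) ⟩
        first + (sum (init rest) + last rest) ≈⟨ +-congˡ (+-congʳ (trans (sum-cong-≋ inner) (sum-replicate-zero (suc m)))) ⟩
        first + (0# + last rest) ≈⟨ +-cong first≈ (trans (+-identityˡ _) last≈) ⟩
        y ^ᵉ p + x ^ᵉ p ∎
        where
        t = binomialTerm x y p
        first = t Fin.zero
        rest = tail t
        first≈ : first ≈ y ^ᵉ p
        first≈ = trans (+-identityʳ _) (*-identityˡ _)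
        inner : ∀ i → init rest i ≈ 0#
        inner i = multiple≈0 (prime∣C pr _ z<s (s<s (≡.subst (_< suc m) (≡.sym (Finₚ.toℕ-inject₁ i)) (Finₚ.toℕ<n i)))) _
        idx : toℕ (Fin.fromℕ (suc m)) ≡ suc m
        idx = Finₚ.toℕ-fromℕ (suc m)
        last≈ : last rest ≈ x ^ᵉ p
        last≈ = begin
          (p ℕC.C suc (toℕ (Fin.fromℕ (suc m)))) · (x ^ᵉ suc (toℕ (Fin.fromℕ (suc m))) * y ^ᵉ (p ℕ.∸ suc (toℕ (Fin.fromℕ (suc m)))))
            ≡⟨ ≡.cong (λ j → (p ℕC.C suc j) · (x ^ᵉ suc j * y ^ᵉ (p ℕ.∸ suc j))) idx ⟩
          (p ℕC.C p) · (x ^ᵉ p * y ^ᵉ (p ℕ.∸ p)) ≡⟨ ≡.cong₂ (λ a b → a · (x ^ᵉ p * y ^ᵉ b)) (nCn≡1 p) (ℕₚ.n∸n≡0 p) ⟩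
          1 · (x ^ᵉ p * 1#) ≈⟨ +-identityʳ _ ⟩
          x ^ᵉ p * 1# ≈⟨ *-identityʳ _ ⟩
          x ^ᵉ p ∎

      p≡2+ : ∃ λ m → p ≡ suc (suc m)
      p≡2+ = 1<⇒2+ (ℕ.nonTrivial⇒n>1 p {{prime⇒nonTrivial pr}})

    frobenius : ∀ x y → (x + y) ^ p ≈ x ^ p + y ^ p
    frobenius x y = begin
      (x + y) ^ p ≡⟨ ^≡ (x + y) p ⟩
      (x + y) ^ᵉ p ≈⟨ theorem p x y ⟩
      binomialExpansion x y p ≈⟨ middle (proj₁ p≡2+) x y (proj₂ p≡2+) ⟩
      y ^ᵉ p + x ^ᵉ p ≈⟨ +-comm _ _ ⟩
      x ^ᵉ p + y ^ᵉ p ≡⟨ ≡.cong₂ _+_ (≡.sym (^≡ x p)) (≡.sym (^≡ y p)) ⟩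
      x ^ p + y ^ p ∎

    frobenius^ : ∀ k x y → (x + y) ^ (p ℕ.^ k) ≈ x ^ (p ℕ.^ k) + y ^ (p ℕ.^ k)
    frobenius^ zero x y = trans (*-identityʳ _) (sym (+-cong (*-identityʳ x) (*-identityʳ y)))
    frobenius^ (suc k) x y = begin
      (x + y) ^ (p ℕ.* p ℕ.^ k) ≈⟨ ^-assocʳ (x + y) p (p ℕ.^ k) ⟨
      ((x + y) ^ p) ^ (p ℕ.^ k) ≈⟨ ^-congˡ (p ℕ.^ k) (frobenius x y) ⟩
      (x ^ p + y ^ p) ^ (p ℕ.^ k) ≈⟨ frobenius^ k (x ^ p) (y ^ p) ⟩
      (x ^ p) ^ (p ℕ.^ k) + (y ^ p) ^ (p ℕ.^ k) ≈⟨ +-cong (^-assocʳ x p (p ℕ.^ k)) (^-assocʳ y p (p ℕ.^ k)) ⟩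
      x ^ (p ℕ.* p ℕ.^ k) + y ^ (p ℕ.* p ℕ.^ k) ∎

  1^ : ∀ n → 1# ^ n ≈ 1#
  1^ zero = refl
  1^ (suc n) = trans (*-identityˡ _) (1^ n)

  0^ : ∀ n → 0 < n → 0# ^ n ≈ 0#
  0^ (suc n) _ = zeroˡ _

  Additive : ℕ → Set
  Additive m = ∀ x y → (x + y) ^ m ≈ x ^ m + y ^ m

  module Additivity {m : ℕ} (0<m : 0 < m) (add : Additive m) where
    neg^ : ∀ x → (- x) ^ m ≈ - (x ^ m)
    neg^ x = begin
      (- x) ^ m ≈⟨ +-identityʳ _ ⟨
      (- x) ^ m + 0# ≈⟨ +-congˡ (-‿inverseʳ (x ^ m)) ⟨
      (- x) ^ m + (x ^ m - x ^ m) ≈⟨ +-assoc _ _ _ ⟨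
      ((- x) ^ m + x ^ m) - x ^ m ≈⟨ +-congʳ (add (- x) x) ⟨
      ((- x) + x) ^ m - x ^ m ≈⟨ +-congʳ (trans (^-congˡ m (-‿inverseˡ x)) (0^ m 0<m)) ⟩
      0# - x ^ m ≈⟨ +-identityˡ _ ⟩
      - (x ^ m) ∎

    sub^ : ∀ x y → (x - y) ^ m ≈ x ^ m - y ^ m
    sub^ x y = trans (add x (- y)) (+-congˡ (neg^ y))

  ∑ : ℕ → (ℕ → Carrier) → Carrier
  ∑ zero f = 0#
  ∑ (suc n) f = ∑ n f + f n

  ∑-cong : ∀ n {f g} → (∀ i → i < n → f i ≈ g i) → ∑ n f ≈ ∑ n g
  ∑-cong zero h = refl
  ∑-cong (suc n) h = +-cong (∑-cong n λ i i<n → h i (ℕₚ.m<n⇒m<1+n i<n)) (h n (ℕₚ.n<1+n n))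

  ∑-zero : ∀ n {f} → (∀ i → i < n → f i ≈ 0#) → ∑ n f ≈ 0#
  ∑-zero zero h = refl
  ∑-zero (suc n) h = trans (+-cong (∑-zero n λ i i<n → h i (ℕₚ.m<n⇒m<1+n i<n)) (h n (ℕₚ.n<1+n n))) (+-identityˡ _)

  ∑-+ : ∀ n f g → ∑ n (λ i → f i + g i) ≈ ∑ n f + ∑ n g
  ∑-+ zero f g = sym (+-identityˡ _)
  ∑-+ (suc n) f g = trans (+-congʳ (∑-+ n f g))
    (solve 4 (λ a b c d → (a :+ b) :+ (c :+ d) ⊜ (a :+ c) :+ (b :+ d)) refl _ _ _ _)

  ∑-*ˡ : ∀ n c f → ∑ n (λ i → c * f i) ≈ c * ∑ n f
  ∑-*ˡ zero c f = sym (zeroʳ c)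
  ∑-*ˡ (suc n) c f = trans (+-congʳ (∑-*ˡ n c f)) (sym (distribˡ _ _ _))

  ∑-comm : ∀ m n (f : ℕ → ℕ → Carrier) → ∑ m (λ i → ∑ n (f i)) ≈ ∑ n (λ j → ∑ m (λ i → f i j))
  ∑-comm zero n f = sym (∑-zero n λ _ _ → refl)
  ∑-comm (suc m) n f = trans (+-congʳ (∑-comm m n f)) (sym (∑-+ n _ _))

  ∑-single : ∀ n j {f} → j < n → (∀ i → i < n → ¬ i ≡ j → f i ≈ 0#) → ∑ n f ≈ f j
  ∑-single (suc n) j {f} j<1+n h with j ℕ.≟ n
  ... | yes ≡.refl = trans (+-congʳ (∑-zero n λ i i<n → h i (ℕₚ.m<n⇒m<1+n i<n) (ℕₚ.<⇒≢ i<n))) (+-identityˡ _)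
  ... | no j≢n = trans (+-cong (∑-single n j (ℕₚ.≤∧≢⇒< (ℕₚ.≤-pred j<1+n) j≢n) λ i i<n → h i (ℕₚ.m<n⇒m<1+n i<n))
                               (h n (ℕₚ.n<1+n n) (λ n≡j → j≢n (≡.sym n≡j)))) (+-identityʳ _)

  -- Symmetric windows of integers, in which Laurent expansions in u are truncated.
  ⨁ : ℕ → (ℤ → Carrier) → Carrier
  ⨁ zero h = h (+ 0)
  ⨁ (suc K) h = ⨁ K h + (h (+ suc K) + h -[1+ K ])

  ∣_∣≤_ : ℤ → ℕ → Set
  ∣ k ∣≤ K = ℤ.∣ k ∣ ≤ K

  ⨁-cong : ∀ K {f g} → (∀ k → ∣ k ∣≤ K → f k ≈ g k) → ⨁ K f ≈ ⨁ K g
  ⨁-cong zero h = h (+ 0) z≤n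
  ⨁-cong (suc K) h = +-cong (⨁-cong K λ k b → h k (ℕₚ.m≤n⇒m≤1+n b)) (+-cong (h _ ℕₚ.≤-refl) (h _ ℕₚ.≤-refl))

  ⨁-zero : ∀ K {f} → (∀ k → ∣ k ∣≤ K → f k ≈ 0#) → ⨁ K f ≈ 0#
  ⨁-zero zero h = h (+ 0) z≤n
  ⨁-zero (suc K) h = trans (+-cong (⨁-zero K λ k b → h k (ℕₚ.m≤n⇒m≤1+n b))
    (trans (+-cong (h _ ℕₚ.≤-refl) (h _ ℕₚ.≤-refl)) (+-identityˡ _))) (+-identityˡ _)

  ⨁-+ : ∀ K f g → ⨁ K (λ k → f k + g k) ≈ ⨁ K f + ⨁ K g
  ⨁-+ zero f g = refl
  ⨁-+ (suc K) f g = trans (+-congʳ (⨁-+ K f g))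
    (solve 6 (λ a b c d e f → (a :+ b) :+ ((c :+ d) :+ (e :+ f)) ⊜ (a :+ (c :+ e)) :+ (b :+ (d :+ f))) refl _ _ _ _ _ _)

  ⨁-*ˡ : ∀ K c f → ⨁ K (λ k → c * f k) ≈ c * ⨁ K f
  ⨁-*ˡ zero c f = refl
  ⨁-*ˡ (suc K) c f = trans (+-cong (⨁-*ˡ K c f) (sym (distribˡ _ _ _))) (sym (distribˡ _ _ _))

  ⨁-∑-comm : ∀ K n (f : ℤ → ℕ → Carrier) → ⨁ K (λ k → ∑ n (f k)) ≈ ∑ n (λ i → ⨁ K (λ k → f k i))
  ⨁-∑-comm zero n f = refl
  ⨁-∑-comm (suc K) n f = trans (+-cong (⨁-∑-comm K n f) (sym (∑-+ n _ _))) (sym (∑-+ n _ _))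

  ⨁-single : ∀ K j {f} → ∣ j ∣≤ K → (∀ k → ∣ k ∣≤ K → ¬ k ≡ j → f k ≈ 0#) → ⨁ K f ≈ f j
  ⨁-single zero (+ 0) _ h = refl
  ⨁-single (suc K) j {f} b h with j ℤ.≟ + suc K | j ℤ.≟ -[1+ K ]
  ... | yes ≡.refl | _ = trans (+-cong (⨁-zero K λ k b′ → h k (ℕₚ.m≤n⇒m≤1+n b′) λ { ≡.refl → ℕₚ.<⇒≱ (ℕₚ.n<1+n K) b′ })
      (+-congˡ (h _ ℕₚ.≤-refl λ ()))) (trans (+-identityˡ _) (+-identityʳ _))
  ... | no _ | yes ≡.refl = trans (+-cong (⨁-zero K λ k b′ → h k (ℕₚ.m≤n⇒m≤1+n b′) λ { ≡.refl → ℕₚ.<⇒≱ (ℕₚ.n<1+n K) b′ })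
      (+-congʳ (h _ ℕₚ.≤-refl λ ()))) (trans (+-identityˡ _) (+-identityˡ _))
  ... | no j≢+ | no j≢- = trans (+-cong (⨁-single K j (smaller j b j≢+ j≢-) λ k b′ → h k (ℕₚ.m≤n⇒m≤1+n b′))
      (trans (+-cong (h _ ℕₚ.≤-refl λ e → j≢+ (≡.sym e)) (h _ ℕₚ.≤-refl λ e → j≢- (≡.sym e))) (+-identityˡ _))) (+-identityʳ _)
    where
    smaller : ∀ j → ∣ j ∣≤ suc K → ¬ j ≡ + suc K → ¬ j ≡ -[1+ K ] → ∣ j ∣≤ K
    smaller (+ n) b ne _ = ℕₚ.≤-pred (ℕₚ.≤∧≢⇒< b λ e → ne (≡.cong +_ e))
    smaller -[1+ n ] b _ ne = ℕₚ.≤-pred (ℕₚ.≤∧≢⇒< b λ e → ne (≡.cong -[1+_] (ℕₚ.suc-injective e)))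

  ∑-additive : ∀ {φ : Carrier → Carrier} → φ 0# ≈ 0# → (∀ x y → φ (x + y) ≈ φ x + φ y) →
               ∀ n f → φ (∑ n f) ≈ ∑ n (λ i → φ (f i))
  ∑-additive φ0 φ+ zero f = φ0
  ∑-additive φ0 φ+ (suc n) f = trans (φ+ _ _) (+-congʳ (∑-additive φ0 φ+ n f))

  ∑-shift : ∀ n f → ∑ n (λ i → f (suc i)) + f 0 ≈ ∑ n f + f n
  ∑-shift zero f = refl
  ∑-shift (suc n) f = trans (solve 3 (λ a b c → (a :+ b) :+ c ⊜ (a :+ c) :+ b) refl _ _ _) (+-congʳ (∑-shift n f))

  ∑-split : ∀ m k f → ∑ (m ℕ.+ k) f ≈ ∑ m f + ∑ k (λ i → f (m ℕ.+ i))
  ∑-split m zero f = trans (reflexive (≡.cong (λ l → ∑ l f) (ℕₚ.+-identityʳ m))) (sym (+-identityʳ _))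
  ∑-split m (suc k) f = trans (reflexive (≡.cong (λ l → ∑ l f) (ℕₚ.+-suc m k))) (trans (+-congʳ (∑-split m k f)) (+-assoc _ _ _))

  ∑-truncate : ∀ {m k} f → m ≤ k → (∀ i → m ≤ i → f i ≈ 0#) → ∑ k f ≈ ∑ m f
  ∑-truncate {m} {k} f m≤k h = trans (reflexive (≡.cong (λ l → ∑ l f) (≡.sym (ℕₚ.m+[n∸m]≡n m≤k))))
    (trans (∑-split m (k ℕ.∸ m) f) (trans (+-congˡ (∑-zero (k ℕ.∸ m) λ i _ → h _ (ℕₚ.m≤m+n m i))) (+-identityʳ _)))

  ∑-flatten : ∀ A B .{{_ : ℕ.NonZero B}} (f : ℕ → ℕ → Carrier) → ∑ A (λ a → ∑ B (f a)) ≈ ∑ (A ℕ.* B) (λ m → f (m ℕ/./ B) (m ℕ/.% B))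
  ∑-flatten zero B f = refl
  ∑-flatten (suc A) B f = trans (+-cong (∑-flatten A B f) (∑-cong B λ b b<B → reflexive (≡.cong₂ f (≡.sym (quotient b b<B)) (≡.sym (remainder b b<B)))))
    (trans (sym (∑-split (A ℕ.* B) B digits)) (reflexive (≡.cong (λ l → ∑ l digits) (ℕₚ.+-comm (A ℕ.* B) B))))
    where
    digits : ℕ → Carrier
    digits m = f (m ℕ/./ B) (m ℕ/.% B)
    remainder : ∀ b → b < B → (A ℕ.* B ℕ.+ b) ℕ/.% B ≡ b
    remainder b b<B = ≡.trans (≡.cong (ℕ/._% B) (ℕₚ.+-comm (A ℕ.* B) b)) (≡.trans (ℕ/.[m+kn]%n≡m%n b A B) (ℕ/.m<n⇒m%n≡m b<B))
    quotient : ∀ b → b < B → (A ℕ.* B ℕ.+ b) ℕ/./ B ≡ A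
    quotient b b<B = ≡.trans (ℕ/.+-distrib-/-∣ˡ b (divides A ≡.refl)) (≡.trans (≡.cong₂ ℕ._+_ (ℕ/.m*n/n≡m A B) (ℕ/.m<n⇒m/n≡0 b<B)) (ℕₚ.+-identityʳ A))

  ∑-reverse : ∀ n f → ∑ n f ≈ ∑ n (λ i → f (n ℕ.∸ suc i))
  ∑-reverse zero f = refl
  ∑-reverse (suc n) f = trans (+-congʳ (∑-reverse n f)) (∑-shift n (λ i → f (n ℕ.∸ i)))

  ⨁-nonneg : ∀ W {h} → (∀ k → h -[1+ k ] ≈ 0#) → ⨁ W h ≈ ∑ (suc W) (λ k → h (+ k))
  ⨁-nonneg zero z = sym (+-identityˡ _)
  ⨁-nonneg (suc W) z = +-cong (⨁-nonneg W z) (trans (+-congˡ (z W)) (+-identityʳ _))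

  -- The q-th power shifts the partial trace by one index. Stated for rings, since it serves both in
  -- the field and in the ring of the curve.
  partial-trace^q : ∀ {q} → 0 < q → Additive q → ∀ s y →
    (∑ s (λ m → y ^ (q ℕ.^ m))) ^ q ≈ ∑ s (λ m → y ^ (q ℕ.^ m)) + y ^ (q ℕ.^ s) - y
  partial-trace^q {q} 0<q add s y = begin
    ∑ s (λ m → y ^ (q ℕ.^ m)) ^ q ≈⟨ ∑-additive (0^ q 0<q) add s _ ⟩
    ∑ s (λ m → (y ^ (q ℕ.^ m)) ^ q) ≈⟨ ∑-cong s (λ m _ → trans (^-assocʳ y (q ℕ.^ m) q) (^-congʳ y (ℕₚ.*-comm (q ℕ.^ m) q))) ⟩
    ∑ s (λ m → y ^ (q ℕ.^ suc m)) ≈⟨ solve 2 (λ x z → x ⊜ (x :+ z) :- z) refl _ (y ^ (q ℕ.^ 0)) ⟩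
    (∑ s (λ m → y ^ (q ℕ.^ suc m)) + y ^ (q ℕ.^ 0)) - y ^ (q ℕ.^ 0) ≈⟨ +-cong (∑-shift s (λ m → y ^ (q ℕ.^ m))) (-‿cong (*-identityʳ y)) ⟩
    ∑ s (λ m → y ^ (q ℕ.^ m)) + y ^ (q ℕ.^ s) - y ∎

-- Finite fields

module Field (F : CommutativeRing 0ℓ 0ℓ) (isField : IsField F) {N : ℕ} (card : HasCardinality F N) where
  open Ring F
  open IsField isField
  private module B = Bijection card
  open B using (to)

  from : Carrier → Fin N
  from y = proj₁ (B.surjective y)

  to-from : ∀ y → to (from y) ≈ y
  to-from y = proj₂ (B.surjective y) ≡.refl

  from-to : ∀ i → from (to i) ≡ i
  from-to i = B.injective (to-from (to i))

  from-cong : ∀ {x y} → x ≈ y → from x ≡ from y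
  from-cong x≈y = B.injective (trans (to-from _) (trans x≈y (sym (to-from _))))

  infix 4 _≟_
  _≟_ : ∀ x y → Dec (x ≈ y)
  x ≟ y = Dec.map′ (λ e → trans (sym (to-from x)) (trans (reflexive (≡.cong to e)) (to-from y))) from-cong (from x Fin.≟ from y)

  cancel : ∀ {x y} → ¬ x ≈ 0# → x * y ≈ 0# → y ≈ 0#
  cancel {x} {y} x≉0 xy≈0 with inverse x x≉0
  ... | x⁻¹ , eq = begin
    y ≈⟨ *-identityˡ y ⟨
    1# * y ≈⟨ *-congʳ (trans (*-comm _ _) eq) ⟨
    x⁻¹ * x * y ≈⟨ *-assoc _ _ _ ⟩
    x⁻¹ * (x * y) ≈⟨ *-congˡ xy≈0 ⟩
    x⁻¹ * 0# ≈⟨ zeroʳ _ ⟩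
    0# ∎

  *≉0 : ∀ {x y} → ¬ x ≈ 0# → ¬ y ≈ 0# → ¬ x * y ≈ 0#
  *≉0 x≉0 y≉0 xy≈0 = y≉0 (cancel x≉0 xy≈0)

  ^≉0 : ∀ {x} n → ¬ x ≈ 0# → ¬ x ^ n ≈ 0#
  ^≉0 zero _ = 1≉0
  ^≉0 (suc n) x≉0 = *≉0 x≉0 (^≉0 n x≉0)

  ≉0ʳ : ∀ {x y} → ¬ x * y ≈ 0# → ¬ y ≈ 0#
  ≉0ʳ xy≉0 y≈0 = xy≉0 (trans (*-congˡ y≈0) (zeroʳ _))

  ≉0ˡ : ∀ {x y} → ¬ x * y ≈ 0# → ¬ x ≈ 0#
  ≉0ˡ xy≉0 x≈0 = xy≉0 (trans (*-congʳ x≈0) (zeroˡ _))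

  inv : ∀ x → ¬ x ≈ 0# → Carrier
  inv x x≉0 = proj₁ (inverse x x≉0)

  inv-inverse : ∀ x x≉0 → x * inv x x≉0 ≈ 1#
  inv-inverse x x≉0 = proj₂ (inverse x x≉0)

  inv≉0 : ∀ x x≉0 → ¬ inv x x≉0 ≈ 0#
  inv≉0 x x≉0 = ≉0ʳ (λ e → 1≉0 (trans (sym (inv-inverse x x≉0)) e))

  private
    module Σ⁺ where
      open import Algebra.Properties.CommutativeMonoid.Sum +-commutativeMonoid public
    module Π where
      open import Algebra.Properties.CommutativeMonoid.Sum *-commutativeMonoid public

    +1 : Permutation N N
    +1 = permutation (λ i → from (to i + 1#)) (λ i → from (to i - 1#))
      (λ i → ≡.trans (from-cong (trans (+-congʳ (to-from _)) (solve 2 (λ a b → (a :- b) :+ b ⊜ a) refl _ _))) (from-to i))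
      (λ i → ≡.trans (from-cong (trans (+-congʳ (to-from _)) (solve 2 (λ a b → (a :+ b) :- b ⊜ a) refl _ _))) (from-to i))

    sum-const : ∀ n → Σ⁺.sum {n} (λ _ → 1#) ≈ n · 1#
    sum-const zero = refl
    sum-const (suc n) = +-congˡ (sum-const n)

  -- Translation by 1 permutes the field, so the sum of all elements does not change when N ones are
  -- added to it.
  card·1≈0 : N · 1# ≈ 0#
  card·1≈0 = begin
    N · 1# ≈⟨ solve 2 (λ a b → a ⊜ (b :+ a) :- b) refl _ S ⟩
    (S + N · 1#) - S ≈⟨ +-congʳ (+-congˡ (sum-const N)) ⟨
    (S + Σ⁺.sum {N} (λ _ → 1#)) - S ≈⟨ +-congʳ (Σ⁺.∑-distrib-+ to (λ _ → 1#)) ⟨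
    Σ⁺.sum (λ i → to i + 1#) - S ≈⟨ +-congʳ (Σ⁺.sum-cong-≋ λ i → to-from (to i + 1#)) ⟨
    Σ⁺.sum (λ i → to (+1 ⟨$⟩ʳ i)) - S ≈⟨ +-congʳ (Σ⁺.sum-permute to +1) ⟨
    S - S ≈⟨ -‿inverseʳ S ⟩
    0# ∎
    where S = Σ⁺.sum to

  -- N · 1 is the m-th power of p · 1, and a field has no nilpotents.
  char-prime : ∀ p m → N ≡ p ℕ.^ m → p · 1# ≈ 0#
  char-prime p m ≡.refl with p · 1# ≟ 0#
  ... | yes e = e
  ... | no ne = ⊥-elim (^≉0 m ne (trans (sym (pow m)) card·1≈0))
    where
    pow : ∀ m → (p ℕ.^ m) · 1# ≈ (p · 1#) ^ m
    pow zero = +-identityʳ _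
    pow (suc m) = trans (×1-homo-* p (p ℕ.^ m)) (*-congˡ (pow m))

  private
    prod-const : ∀ n {t : Fin n → Carrier} {a} → (∀ i → t i ≈ a) → Π.sum t ≈ a ^ n
    prod-const zero h = refl
    prod-const (suc n) h = *-cong (h Fin.zero) (prod-const n (h ∘ Fin.suc))

    prod≉0 : ∀ n {t : Fin n → Carrier} → (∀ i → ¬ t i ≈ 0#) → ¬ Π.sum t ≈ 0#
    prod≉0 zero h = 1≉0
    prod≉0 (suc n) h = *≉0 (h Fin.zero) (prod≉0 n (h ∘ Fin.suc))

    -- Replacing 0 by 1 lets the product of the nonzero elements run over all of `Fin N`; `factor`
    -- is the matching correction for multiplication by a.
    nz : Carrier → Carrier
    nz x with x ≟ 0#
    ... | yes _ = 1#
    ... | no _ = x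

    nz≉0 : ∀ x → ¬ nz x ≈ 0#
    nz≉0 x with x ≟ 0#
    ... | yes _ = 1≉0
    ... | no x≉0 = x≉0

    nz-cong : ∀ {x y} → x ≈ y → nz x ≈ nz y
    nz-cong {x} {y} e with x ≟ 0# | y ≟ 0#
    ... | yes _ | yes _ = refl
    ... | no _ | no _ = e
    ... | yes a | no b = ⊥-elim (b (trans (sym e) a))
    ... | no a | yes b = ⊥-elim (a (trans e b))

    module _ (a : Carrier) (a≉0 : ¬ a ≈ 0#) where
      scale : Permutation N N
      scale = permutation (λ i → from (a * to i)) (λ i → from (inv a a≉0 * to i))
        (λ i → ≡.trans (from-cong (trans (*-congˡ (to-from _)) (trans (sym (*-assoc _ _ _)) (trans (*-congʳ (inv-inverse a a≉0)) (*-identityˡ _))))) (from-to i))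
        (λ i → ≡.trans (from-cong (trans (*-congˡ (to-from _)) (trans (sym (*-assoc _ _ _)) (trans (*-congʳ (trans (*-comm _ _) (inv-inverse a a≉0))) (*-identityˡ _))))) (from-to i))

      factor : Carrier → Carrier
      factor x with x ≟ 0#
      ... | yes _ = 1#
      ... | no _ = a

      nz-scale : ∀ x → nz (a * x) ≈ factor x * nz x
      nz-scale x with a * x ≟ 0# | x ≟ 0#
      ... | yes _ | yes _ = sym (*-identityˡ _)
      ... | yes e | no b = ⊥-elim (b (cancel a≉0 e))
      ... | no e | yes b = ⊥-elim (e (trans (*-congˡ b) (zeroʳ _)))
      ... | no _ | no _ = refl

      factor-0 : ∀ x → x ≈ 0# → factor x ≈ 1#
      factor-0 x e with x ≟ 0#
      ... | yes _ = refl
      ... | no ne = ⊥-elim (ne e)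

      factor-≉0 : ∀ x → ¬ x ≈ 0# → factor x ≈ a
      factor-≉0 x ne with x ≟ 0#
      ... | yes e = ⊥-elim (ne e)
      ... | no _ = refl

      factors≈1 : Π.sum (factor ∘ to) ≈ 1#
      factors≈1 = x-y≈0⇒x≈y _ _ (cancel (prod≉0 N {nz ∘ to} (λ i → nz≉0 (to i))) (begin
        P * (Φ - 1#) ≈⟨ solve 2 (λ p f → p :* (f :- con (ℤ.+ 1)) ⊜ f :* p :- p) refl P Φ ⟩
        Φ * P - P ≈⟨ +-congʳ (Π.∑-distrib-+ (factor ∘ to) (nz ∘ to)) ⟨
        Π.sum (λ i → factor (to i) * nz (to i)) - P ≈⟨ +-congʳ (Π.sum-cong-≋ λ i → trans (nz-cong (to-from _)) (nz-scale (to i))) ⟨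
        Π.sum (λ i → nz (to (scale ⟨$⟩ʳ i))) - P ≈⟨ +-congʳ (Π.sum-permute (nz ∘ to) scale) ⟨
        P - P ≈⟨ -‿inverseʳ P ⟩
        0# ∎))
        where
        P = Π.sum (nz ∘ to)
        Φ = Π.sum (factor ∘ to)

  card>0 : 0 < N
  card>0 = ℕₚ.≤-<-trans z≤n (Finₚ.toℕ<n (from 0#))

  -- Multiplication by a ≠ 0 permutes the field, so `factors≈1` holds; with the trivial factor at 0
  -- removed it reads a^(N-1) = 1.
  x^card≈x : ∀ a → a ^ N ≈ a
  x^card≈x a with a ≟ 0#
  ... | yes e = trans (^-congˡ N e) (trans (0^ N card>0) (sym e))
  ... | no a≉0 = go N ≡.refl
    where
    go : ∀ M → M ≡ N → a ^ M ≈ a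
    go zero e = ⊥-elim (ℕₚ.<⇒≢ card>0 e)
    go (suc M) ≡.refl = trans (*-congˡ (begin
      a ^ M ≈⟨ prod-const M (λ i → factor-≉0 a a≉0 _ λ e → Finₚ.punchInᵢ≢i i₀ i (B.injective (trans e (sym (to-from 0#))))) ⟨
      Π.sum (Functional.removeAt (factor a a≉0 ∘ to) i₀) ≈⟨ *-identityˡ _ ⟨
      1# * Π.sum (Functional.removeAt (factor a a≉0 ∘ to) i₀) ≈⟨ *-congʳ (factor-0 a a≉0 _ (to-from 0#)) ⟨
      factor a a≉0 (to i₀) * Π.sum (Functional.removeAt (factor a a≉0 ∘ to) i₀) ≈⟨ Π.sum-remove {i = i₀} (factor a a≉0 ∘ to) ⟨
      Π.sum (factor a a≉0 ∘ to) ≈⟨ factors≈1 a a≉0 ⟩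
      1# ∎)) (*-identityʳ a)
      where
      import Data.Vec.Functional as Functional
      i₀ = from 0#

  record IsAlgebra (A : CommutativeRing 0ℓ 0ℓ) (ι : Carrier → CommutativeRing.Carrier A) : Set where
    private module A = CommutativeRing A
    field
      ι-cong : ∀ {x y} → x ≈ y → ι x A.≈ ι y
      ι-+ : ∀ x y → ι (x + y) A.≈ ι x A.+ ι y
      ι-* : ∀ x y → ι (x * y) A.≈ ι x A.* ι y
      ι-0 : ι 0# A.≈ A.0#
      ι-1 : ι 1# A.≈ A.1#

  -- Polynomials over F are coefficient vectors, constant term first.
  evalF : ∀ {d} → Vec Carrier d → Carrier → Carrier
  evalF [] x = 0#
  evalF (c ∷ P) x = c + x * evalF P x

  quot : ∀ {d} → Carrier → Vec Carrier (suc d) → Vec Carrier d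
  quot z (c ∷ []) = []
  quot z (c ∷ P@(_ ∷ _)) = evalF P z ∷ quot z P

  lead : ∀ {d} → Vec Carrier (suc d) → Carrier
  lead (c ∷ []) = c
  lead (c ∷ P@(_ ∷ _)) = lead P

  lead-quot : ∀ {d} z (P : Vec Carrier (suc (suc d))) → lead (quot z P) ≈ lead P
  lead-quot z (c ∷ c′ ∷ []) = trans (+-congˡ (zeroʳ z)) (+-identityʳ c′)
  lead-quot z (c ∷ P@(_ ∷ _ ∷ _)) = lead-quot z P

  infixr 5 _∷≉_
  data Distinct : ∀ {d} → Vec Carrier d → Set where
    [] : Distinct []
    _∷≉_ : ∀ {d z} {zs : Vec Carrier d} → (∀ i → ¬ Vec.lookup zs i ≈ z) → Distinct zs → Distinct (z ∷ zs)

  monomial : ∀ d → Carrier → Vec Carrier (suc d)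
  monomial zero l = l ∷ []
  monomial (suc d) l = 0# ∷ monomial d l

  binomial : ∀ k j → Carrier → Carrier → Vec Carrier (suc (k ℕ.+ suc j))
  binomial zero j c l = c ∷ monomial j l
  binomial (suc k) j c l = 0# ∷ binomial k j c l

  private
    lead-0∷ : ∀ {d} c (P : Vec Carrier (suc d)) → lead (c ∷ P) ≡ lead P
    lead-0∷ c (_ ∷ _) = ≡.refl

    lead-monomial : ∀ d l → lead (monomial d l) ≡ l
    lead-monomial zero l = ≡.refl
    lead-monomial (suc d) l = ≡.trans (lead-0∷ 0# (monomial d l)) (lead-monomial d l)

    lead-binomial : ∀ k j c l → lead (binomial k j c l) ≡ l
    lead-binomial zero j c l = ≡.trans (lead-0∷ c (monomial j l)) (lead-monomial j l)
    lead-binomial (suc k) j c l = ≡.trans (lead-0∷ 0# (binomial k j c l)) (lead-binomial k j c l)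

  module Polynomial {A : CommutativeRing 0ℓ 0ℓ} {ι : Carrier → CommutativeRing.Carrier A} (alg : IsAlgebra A ι) where
    open IsAlgebra alg
    private module A = Ring A

    eval : ∀ {d} → Vec Carrier d → A.Carrier → A.Carrier
    eval [] x = A.0#
    eval (c ∷ P) x = ι c A.+ x A.* eval P x

    ∏[_-_] : ∀ {d} → A.Carrier → Vec Carrier d → A.Carrier
    ∏[ x - [] ] = A.1#
    ∏[ x - z ∷ zs ] = (x A.- ι z) A.* ∏[ x - zs ]

    ι-‿ : ∀ x → ι (- x) A.≈ A.- ι x
    ι-‿ x = A.trans (A.sym (A.+-identityʳ _)) (A.trans (A.+-congˡ (A.sym (A.-‿inverseʳ (ι x)))) (A.trans (A.sym (A.+-assoc _ _ _))
      (A.trans (A.+-congʳ (A.trans (A.sym (ι-+ _ _)) (A.trans (ι-cong (-‿inverseˡ x)) ι-0))) (A.+-identityˡ _))))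

    eval-quot : ∀ {d} z (P : Vec Carrier (suc d)) x →
                eval P x A.≈ ι (evalF P z) A.+ (x A.- ι z) A.* eval (quot z P) x
    eval-quot z (c ∷ []) x = A.trans (A.+-congˡ (A.zeroʳ x)) (A.trans
      (A.+-cong (ι-cong (sym (trans (+-congˡ (zeroʳ z)) (+-identityʳ c)))) (A.sym (A.zeroʳ _))) A.refl)
    eval-quot z (c ∷ P@(_ ∷ _)) x = A.begin
      ι c A.+ x A.* eval P x A.≈⟨ A.+-congˡ (A.*-congˡ (eval-quot z P x)) ⟩
      ι c A.+ x A.* (ι r A.+ (x A.- ι z) A.* eval (quot z P) x)
        A.≈⟨ A.solve 5 (λ c x r z y → c A.:+ x A.:* (r A.:+ (x A.:- z) A.:* y) A.⊜ (c A.:+ z A.:* r) A.:+ (x A.:- z) A.:* (r A.:+ x A.:* y)) A.refl _ _ _ _ _ ⟩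
      (ι c A.+ ι z A.* ι r) A.+ (x A.- ι z) A.* (ι r A.+ x A.* eval (quot z P) x)
        A.≈⟨ A.+-congʳ (A.trans (ι-+ _ _) (A.+-congˡ (ι-* _ _))) ⟨
      ι (c + z * r) A.+ (x A.- ι z) A.* (ι r A.+ x A.* eval (quot z P) x) A.∎
      where r = evalF P z

    eval-monomial : ∀ d l x → eval (monomial d l) x A.≈ ι l A.* x A.^ d
    eval-monomial zero l x = A.trans (A.+-congˡ (A.zeroʳ x)) (A.trans (A.+-identityʳ _) (A.sym (A.*-identityʳ _)))
    eval-monomial (suc d) l x = A.trans (A.+-cong ι-0 (A.*-congˡ (eval-monomial d l x)))
      (A.trans (A.+-identityˡ _) (A.solve 3 (λ x l y → x A.:* (l A.:* y) A.⊜ l A.:* (x A.:* y)) A.refl _ _ _))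

    eval-binomial : ∀ k j c l x → eval (binomial k j c l) x A.≈ ι c A.* x A.^ k A.+ ι l A.* x A.^ (k ℕ.+ suc j)
    eval-binomial zero j c l x = A.+-cong (A.sym (A.*-identityʳ _))
      (A.trans (A.*-congˡ (eval-monomial j l x)) (A.solve 3 (λ x l y → x A.:* (l A.:* y) A.⊜ l A.:* (x A.:* y)) A.refl _ _ _))
    eval-binomial (suc k) j c l x = A.trans (A.+-cong ι-0 (A.*-congˡ (eval-binomial k j c l x)))
      (A.trans (A.+-identityˡ _) (A.solve 5 (λ x c y l z → x A.:* (c A.:* y A.:+ l A.:* z) A.⊜ c A.:* (x A.:* y) A.:+ l A.:* (x A.:* z)) A.refl _ _ _ _ _))

  private
    self : IsAlgebra F (λ x → x)
    self = record { ι-cong = λ e → e ; ι-+ = λ _ _ → refl ; ι-* = λ _ _ → refl ; ι-0 = refl ; ι-1 = refl }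

    module S = Polynomial self

    eval≡ : ∀ {d} (P : Vec Carrier d) x → S.eval P x ≡ evalF P x
    eval≡ [] x = ≡.refl
    eval≡ (c ∷ P) x = ≡.cong (λ y → c + x * y) (eval≡ P x)

    evalF-binomial : ∀ k j c l x → evalF (binomial k j c l) x ≈ c * x ^ k + l * x ^ (k ℕ.+ suc j)
    evalF-binomial k j c l x = trans (reflexive (≡.sym (eval≡ (binomial k j c l) x))) (S.eval-binomial k j c l x)

    quot-root : ∀ {d} z (P : Vec Carrier (suc d)) y → evalF P z ≈ 0# → evalF P y ≈ 0# → ¬ y ≈ z → evalF (quot z P) y ≈ 0#
    quot-root z P y z-root y-root y≉z = cancel (λ e → y≉z (x-y≈0⇒x≈y _ _ e)) (begin
      (y - z) * evalF (quot z P) y ≈⟨ *-congˡ (reflexive (≡.sym (eval≡ (quot z P) y))) ⟩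
      (y - z) * S.eval (quot z P) y ≈⟨ +-identityˡ _ ⟨
      0# + (y - z) * S.eval (quot z P) y ≈⟨ +-congʳ z-root ⟨
      evalF P z + (y - z) * S.eval (quot z P) y ≈⟨ S.eval-quot z P y ⟨
      S.eval P y ≡⟨ eval≡ P y ⟩
      evalF P y ≈⟨ y-root ⟩
      0# ∎)

  elements : Vec Carrier N
  elements = tabulate to

  private
    distinct-tabulate : ∀ {n} (f : Fin n → Fin N) → (∀ {i j} → f i ≡ f j → i ≡ j) → Distinct (tabulate (to ∘ f))
    distinct-tabulate {zero} f inj = []
    distinct-tabulate {suc n} f inj =
      (λ i e → Finₚ.0≢1+n (≡.sym (inj (B.injective (trans (reflexive (≡.sym (lookup∘tabulate (to ∘ f ∘ Fin.suc) i))) e)))))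
      ∷≉ distinct-tabulate (f ∘ Fin.suc) (Finₚ.suc-injective ∘ inj)

  module Factorisation {A : CommutativeRing 0ℓ 0ℓ} {ι : Carrier → CommutativeRing.Carrier A} (alg : IsAlgebra A ι) where
    open IsAlgebra alg
    open Polynomial alg
    private module A = Ring A

    -- The roots are split off from coefficient vectors over F before evaluation, so A need not be
    -- an integral domain.
    factorise : ∀ {d} (P : Vec Carrier (suc d)) (zs : Vec Carrier d) → Distinct zs →
                (∀ i → evalF P (Vec.lookup zs i) ≈ 0#) → ∀ x → eval P x A.≈ ∏[ x - zs ] A.* ι (lead P)
    factorise (c ∷ []) [] [] roots x = A.trans (A.+-congˡ (A.zeroʳ x)) (A.trans (A.+-identityʳ _) (A.sym (A.*-identityˡ _)))
    factorise P@(_ ∷ _ ∷ _) (z ∷ zs) (z∉ ∷≉ dist) roots x = A.begin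
      eval P x A.≈⟨ eval-quot z P x ⟩
      ι (evalF P z) A.+ (x A.- ι z) A.* eval (quot z P) x A.≈⟨ A.+-congʳ (A.trans (ι-cong (roots Fin.zero)) ι-0) ⟩
      A.0# A.+ (x A.- ι z) A.* eval (quot z P) x A.≈⟨ A.+-identityˡ _ ⟩
      (x A.- ι z) A.* eval (quot z P) x
        A.≈⟨ A.*-congˡ (factorise (quot z P) zs dist (λ i → quot-root z P _ (roots Fin.zero) (roots (Fin.suc i)) (z∉ i)) x) ⟩
      (x A.- ι z) A.* (∏[ x - zs ] A.* ι (lead (quot z P))) A.≈⟨ A.*-assoc _ _ _ ⟨
      ∏[ x - z ∷ zs ] A.* ι (lead (quot z P)) A.≈⟨ A.*-congˡ (ι-cong (lead-quot z P)) ⟩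
      ∏[ x - z ∷ zs ] A.* ι (lead P) A.∎

    x^N-x : 1 < N → ∀ x → x A.^ N A.- x A.≈ ∏[ x - elements ]
    x^N-x 1<N x = go N elements (distinct-tabulate (λ i → i) (λ e → e)) ≡.refl (λ i → x^card≈x _) 1<N
      where
      go : ∀ M (zs : Vec Carrier M) → Distinct zs → M ≡ N → (∀ i → Vec.lookup zs i ^ M ≈ Vec.lookup zs i) → 1 < M →
           x A.^ M A.- x A.≈ ∏[ x - zs ]
      go (suc zero) _ _ _ _ (s≤s ())
      go (suc (suc j)) zs dist _ roots _ = A.begin
        x A.^ suc (suc j) A.- x
          A.≈⟨ A.solve 2 (λ x y → y A.:- x A.⊜ (A.:- A.con (ℤ.+ 1)) A.:* x A.:+ A.con (ℤ.+ 1) A.:* y) A.refl _ _ ⟩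
        (A.- A.1#) A.* x A.+ A.1# A.* x A.^ suc (suc j)
          A.≈⟨ A.+-cong (A.*-cong (A.trans (ι-‿ 1#) (A.-‿cong ι-1)) (A.*-identityʳ x)) (A.*-congʳ ι-1) ⟨
        ι (- 1#) A.* x A.^ 1 A.+ ι 1# A.* x A.^ suc (suc j) A.≈⟨ eval-binomial 1 j (- 1#) 1# x ⟨
        eval P x A.≈⟨ factorise P zs dist (λ i → trans (evalF-binomial 1 j (- 1#) 1# _) (begin
            (- 1#) * Vec.lookup zs i ^ 1 + 1# * Vec.lookup zs i ^ suc (suc j)
              ≈⟨ +-cong (*-congˡ (*-identityʳ _)) (*-congˡ (roots i)) ⟩
            (- 1#) * Vec.lookup zs i + 1# * Vec.lookup zs i
              ≈⟨ solve 1 (λ z → (:- con (ℤ.+ 1)) :* z :+ con (ℤ.+ 1) :* z ⊜ con (ℤ.+ 0)) refl _ ⟩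
            0# ∎)) x ⟩
        ∏[ x - zs ] A.* ι (lead P) A.≈⟨ A.*-congˡ (A.trans (ι-cong (reflexive (lead-binomial 1 j (- 1#) 1#))) ι-1) ⟩
        ∏[ x - zs ] A.* A.1# A.≈⟨ A.*-identityʳ _ ⟩
        ∏[ x - zs ] A.∎
        where
        P = binomial 1 j (- 1#) 1#

  -- If the binomial vanished on all of F, it would have m + 1 distinct roots: splitting off m of
  -- them and evaluating at one more kills the leading coefficient l.
  nonroot : ∀ k m c l → ¬ l ≈ 0# → k < m → m < N → ∃ λ x → ¬ c * x ^ k + l * x ^ m ≈ 0#
  nonroot k m c l l≉0 k<m m<N with Finₚ.any? (λ i → Dec.¬? (c * to i ^ k + l * to i ^ m ≟ 0#))
  ... | yes (i , ne) = to i , ne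
  ... | no none = ⊥-elim (l≉0 (≡.subst (λ d → d ≡ m → l ≈ 0#) eq vanish ≡.refl))
    where
    j = m ℕ.∸ suc k
    eq : k ℕ.+ suc j ≡ m
    eq = ≡.trans (ℕₚ.+-suc k j) (ℕₚ.m+[n∸m]≡n k<m)
    P = binomial k j c l
    root : ∀ i → evalF P (to i) ≈ 0#
    root i with c * to i ^ k + l * to i ^ m ≟ 0#
    ... | yes e = trans (evalF-binomial k j c l (to i)) (trans (+-congˡ (*-congˡ (^-congʳ (to i) eq))) e)
    ... | no ne = ⊥-elim (none (i , ne))
    d = k ℕ.+ suc j
    d<N : d < N
    d<N = ≡.subst (_< N) (≡.sym eq) m<N
    emb : Fin d → Fin N
    emb i = Fin.inject≤ i (ℕₚ.<⇒≤ d<N)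
    zs : Vec Carrier d
    zs = tabulate (to ∘ emb)
    last : Fin N
    last = Fin.fromℕ< d<N
    ∏≉0 : ∀ {d′} (f : Fin d′ → Fin d) → ¬ S.∏[ to last - tabulate (to ∘ emb ∘ f) ] ≈ 0#
    ∏≉0 {zero} f = 1≉0
    ∏≉0 {suc d′} f = *≉0 (λ e → ℕₚ.<⇒≢ (Finₚ.toℕ<n (f Fin.zero)) (≡.trans (≡.sym (Finₚ.toℕ-inject≤ (f Fin.zero) (ℕₚ.<⇒≤ d<N)))
      (≡.trans (≡.cong toℕ (B.injective (sym (x-y≈0⇒x≈y _ _ e)))) (Finₚ.toℕ-fromℕ< d<N)))) (∏≉0 (f ∘ Fin.suc))
    vanish : d ≡ m → l ≈ 0#
    vanish _ = trans (reflexive (≡.sym (lead-binomial k j c l))) (cancel (∏≉0 (λ i → i)) (trans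
      (sym (Factorisation.factorise self P zs (distinct-tabulate emb λ e → Finₚ.inject≤-injective _ _ _ _ e)
        (λ i → trans (reflexive (≡.cong (evalF P) (lookup∘tabulate (to ∘ emb) i))) (root (emb i))) (to last))) (trans (reflexive (eval≡ P (to last))) (root last))))
      where open import Data.Vec.Properties using (lookup∘tabulate)

-- A commutative K-algebra spanned by a monoid and embedded in a product of copies of K by the functionals ev.
-- The functions cons, induction and extend see the formal sum behind an element and need not respect its equality.
record MonoidAlg (K : CommutativeRing 0ℓ 0ℓ) {M : Set} (_∙_ : M → M → M) (ε : M)
  {Index : Set} (functional : Index → M → CommutativeRing.Carrier K) (shift : Index → M → Index) : Set₁ where
  private module K = CommutativeRing K
  field ring : CommutativeRing 0ℓ 0ℓ
  private module A = CommutativeRing ring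
  field
    ι : K.Carrier → A.Carrier
    mono : M → A.Carrier
    ev : Index → A.Carrier → K.Carrier
    ι-cong : ∀ {c d} → c K.≈ d → ι c A.≈ ι d
    ι-+ : ∀ c d → ι (c K.+ d) A.≈ ι c A.+ ι d
    ι-* : ∀ c d → ι (c K.* d) A.≈ ι c A.* ι d
    ι-0 : ι K.0# A.≈ A.0#
    ι-1 : ι K.1# A.≈ A.1#
    mono-∙ : ∀ m m′ → mono (m ∙ m′) A.≈ mono m A.* mono m′
    mono-ε : mono ε A.≈ A.1#
    ev-cong : ∀ i {x y} → x A.≈ y → ev i x K.≈ ev i y
    ev-0 : ∀ i → ev i A.0# K.≈ K.0#
    ev-+ : ∀ i x y → ev i (x A.+ y) K.≈ ev i x K.+ ev i y
    ev-ι* : ∀ i c x → ev i (ι c A.* x) K.≈ c K.* ev i x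
    ev-mono* : ∀ i m x → ev i (mono m A.* x) K.≈ ev (shift i m) x
    ev-mono : ∀ i m → ev i (mono m) K.≈ functional i m
    separated : ∀ {x y} → (∀ i → ev i x K.≈ ev i y) → x A.≈ y
    nil : A.Carrier
    cons : K.Carrier → M → A.Carrier → A.Carrier
    nil≈0 : nil A.≈ A.0#
    cons≈ : ∀ c m x → cons c m x A.≈ ι c A.* mono m A.+ x
    induction : (P : A.Carrier → Set) → P nil → (∀ c m {x} → P x → P (cons c m x)) → ∀ x → P x
    extend : (K.Carrier → M → A.Carrier) → A.Carrier → A.Carrier
    extend-nil : ∀ g → extend g nil A.≈ A.0#
    extend-cons : ∀ g c m x → extend g (cons c m x) A.≈ g c m A.+ extend g x

-- The algebra K[M] of a commutative monoid M modulo the elements on which all functionals of a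
-- family closed under translation vanish.
module MonoidAlgebra
  (K : CommutativeRing 0ℓ 0ℓ) {M : Set} (_∙_ : M → M → M) (ε : M)
  (assoc : ∀ a b c → (a ∙ b) ∙ c ≡ a ∙ (b ∙ c)) (comm : ∀ a b → a ∙ b ≡ b ∙ a) (identityʳ : ∀ a → a ∙ ε ≡ a)
  {Index : Set} (functional : Index → M → CommutativeRing.Carrier K) (shift : Index → M → Index)
  (shift-functional : ∀ i m m′ → CommutativeRing._≈_ K (functional (shift i m) m′) (functional i (m ∙ m′)))
  where

  private module K = Ring K
  open K using (_≈_; ∑)

  Element : Set
  Element = List (K.Carrier × M)

  apply : (M → K.Carrier) → Element → K.Carrier
  apply φ [] = K.0#
  apply φ ((c , m) ∷ x) = c K.* φ m K.+ apply φ x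

  translate : K.Carrier → M → Element → Element
  translate c m = map (λ { (d , m′) → c K.* d , m ∙ m′ })

  neg : Element → Element
  neg = map (λ { (c , m) → K.- c , m })

  mul : Element → Element → Element
  mul [] y = []
  mul ((c , m) ∷ x) y = translate c m y ++ mul x y

  infix 4 _≃_
  record _≃_ (x y : Element) : Set where
    constructor pointwise
    field at : ∀ i → apply (functional i) x ≈ apply (functional i) y
  open _≃_ public

  apply-cong : ∀ {φ ψ} → (∀ m → φ m ≈ ψ m) → ∀ x → apply φ x ≈ apply ψ x
  apply-cong h [] = K.refl
  apply-cong h ((c , m) ∷ x) = K.+-cong (K.*-congˡ (h m)) (apply-cong h x)

  apply-++ : ∀ φ x y → apply φ (x ++ y) ≈ apply φ x K.+ apply φ y
  apply-++ φ [] y = K.sym (K.+-identityˡ _)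
  apply-++ φ ((c , m) ∷ x) y = K.trans (K.+-congˡ (apply-++ φ x y)) (K.sym (K.+-assoc _ _ _))

  apply-neg : ∀ φ x → apply φ (neg x) ≈ K.- apply φ x
  apply-neg φ [] = K.sym K.-0#≈0#
  apply-neg φ ((c , m) ∷ x) = K.trans (K.+-congˡ (apply-neg φ x))
    (K.solve 3 (λ c f y → (K.:- c) K.:* f K.:+ K.:- y K.⊜ K.:- (c K.:* f K.:+ y)) K.refl _ _ _)

  apply-translate : ∀ φ c m y → apply φ (translate c m y) ≈ c K.* apply (λ m′ → φ (m ∙ m′)) y
  apply-translate φ c m [] = K.sym (K.zeroʳ c)
  apply-translate φ c m ((d , m′) ∷ y) = K.trans (K.+-congˡ (apply-translate φ c m y))
    (K.solve 4 (λ c d f y → (c K.:* d) K.:* f K.:+ c K.:* y K.⊜ c K.:* (d K.:* f K.:+ y)) K.refl _ _ _ _)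

  apply-mul : ∀ φ x y → apply φ (mul x y) ≈ apply (λ m → apply (λ m′ → φ (m ∙ m′)) y) x
  apply-mul φ [] y = K.refl
  apply-mul φ ((c , m) ∷ x) y = K.trans (apply-++ φ (translate c m y) (mul x y)) (K.+-cong (apply-translate φ c m y) (apply-mul φ x y))

  apply-0 : ∀ x → apply (λ _ → K.0#) x ≈ K.0#
  apply-0 [] = K.refl
  apply-0 (_ ∷ x) = K.trans (K.+-cong (K.zeroʳ _) (apply-0 x)) (K.+-identityˡ _)

  apply-+ : ∀ φ ψ x → apply (λ m → φ m K.+ ψ m) x ≈ apply φ x K.+ apply ψ x
  apply-+ φ ψ [] = K.sym (K.+-identityˡ _)
  apply-+ φ ψ ((c , m) ∷ x) = K.trans (K.+-congˡ (apply-+ φ ψ x))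
    (K.solve 5 (λ c f g a b → c K.:* (f K.:+ g) K.:+ (a K.:+ b) K.⊜ (c K.:* f K.:+ a) K.:+ (c K.:* g K.:+ b)) K.refl _ _ _ _ _)

  apply-*ˡ : ∀ d φ x → apply (λ m → d K.* φ m) x ≈ d K.* apply φ x
  apply-*ˡ d φ [] = K.sym (K.zeroʳ d)
  apply-*ˡ d φ ((c , m) ∷ x) = K.trans (K.+-congˡ (apply-*ˡ d φ x))
    (K.solve 4 (λ c d f a → c K.:* (d K.:* f) K.:+ d K.:* a K.⊜ d K.:* (c K.:* f K.:+ a)) K.refl _ _ _ _)

  fubini : ∀ (θ : M → M → K.Carrier) x y →
           apply (λ m → apply (θ m) y) x ≈ apply (λ m′ → apply (λ m → θ m m′) x) y
  fubini θ [] y = K.sym (apply-0 y)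
  fubini θ ((c , m) ∷ x) y = K.trans (K.+-cong (K.sym (apply-*ˡ c (θ m) y)) (fubini θ x y)) (K.sym (apply-+ _ _ y))

  private
    mul-comm : ∀ x y → mul x y ≃ mul y x
    mul-comm x y .at i = K.begin
      apply φ (mul x y) K.≈⟨ apply-mul φ x y ⟩
      apply (λ m → apply (λ m′ → φ (m ∙ m′)) y) x K.≈⟨ fubini (λ m m′ → φ (m ∙ m′)) x y ⟩
      apply (λ m′ → apply (λ m → φ (m ∙ m′)) x) y
        K.≈⟨ apply-cong (λ m′ → apply-cong (λ m → K.reflexive (≡.cong φ (comm m m′))) x) y ⟩
      apply (λ m′ → apply (λ m → φ (m′ ∙ m)) x) y K.≈⟨ apply-mul φ y x ⟨
      apply φ (mul y x) K.∎
      where φ = functional i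

    -- Closure of the family under `shift` enters here: the elements killed by all functionals form
    -- an ideal.
    mul-congʳ : ∀ x {y y′} → y ≃ y′ → mul x y ≃ mul x y′
    mul-congʳ x {y} {y′} y≃y′ .at i = K.trans (apply-mul φ x y) (K.trans
      (apply-cong (λ m → K.trans (K.sym (apply-cong (shift-functional i m) y)) (K.trans (at y≃y′ (shift i m)) (apply-cong (shift-functional i m) y′))) x)
      (K.sym (apply-mul φ x y′)))
      where φ = functional i

    mul-cong : ∀ {x x′ y y′} → x ≃ x′ → y ≃ y′ → mul x y ≃ mul x′ y′
    mul-cong {x} {x′} {y} {y′} x≃x′ y≃y′ .at i = K.trans (at (mul-congʳ x y≃y′) i)
      (K.trans (at (mul-comm x y′) i) (K.trans (at (mul-congʳ y′ x≃x′) i) (at (mul-comm y′ x′) i)))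

    mul-assoc : ∀ x y z → mul (mul x y) z ≃ mul x (mul y z)
    mul-assoc x y z .at i = K.begin
      apply φ (mul (mul x y) z) K.≈⟨ apply-mul φ (mul x y) z ⟩
      apply (λ n → apply (λ p → φ (n ∙ p)) z) (mul x y) K.≈⟨ apply-mul _ x y ⟩
      apply (λ m → apply (λ m′ → apply (λ p → φ ((m ∙ m′) ∙ p)) z) y) x
        K.≈⟨ apply-cong (λ m → apply-cong (λ m′ → apply-cong (λ p → K.reflexive (≡.cong φ (assoc m m′ p))) z) y) x ⟩
      apply (λ m → apply (λ m′ → apply (λ p → φ (m ∙ (m′ ∙ p))) z) y) x
        K.≈⟨ apply-cong (λ m → apply-mul (λ n → φ (m ∙ n)) y z) x ⟨
      apply (λ m → apply (λ n → φ (m ∙ n)) (mul y z)) x K.≈⟨ apply-mul φ x (mul y z) ⟨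
      apply φ (mul x (mul y z)) K.∎
      where φ = functional i

    mul-distribˡ : ∀ x y z → mul x (y ++ z) ≃ (mul x y ++ mul x z)
    mul-distribˡ x y z .at i = K.begin
      apply φ (mul x (y ++ z)) K.≈⟨ apply-mul φ x (y ++ z) ⟩
      apply (λ m → apply (λ m′ → φ (m ∙ m′)) (y ++ z)) x K.≈⟨ apply-cong (λ m → apply-++ _ y z) x ⟩
      apply (λ m → apply (λ m′ → φ (m ∙ m′)) y K.+ apply (λ m′ → φ (m ∙ m′)) z) x K.≈⟨ apply-+ _ _ x ⟩
      apply (λ m → apply (λ m′ → φ (m ∙ m′)) y) x K.+ apply (λ m → apply (λ m′ → φ (m ∙ m′)) z) x
        K.≈⟨ K.+-cong (apply-mul φ x y) (apply-mul φ x z) ⟨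
      apply φ (mul x y) K.+ apply φ (mul x z) K.≈⟨ apply-++ φ (mul x y) (mul x z) ⟨
      apply φ (mul x y ++ mul x z) K.∎
      where φ = functional i

  one : Element
  one = (K.1# , ε) ∷ []

  private
    mul-identityʳ : ∀ x → mul x one ≃ x
    mul-identityʳ x .at i = K.trans (apply-mul φ x one)
      (apply-cong (λ m → K.trans (K.+-identityʳ _) (K.trans (K.*-identityˡ _) (K.reflexive (≡.cong φ (identityʳ m))))) x)
      where φ = functional i

    ++-cong : ∀ {x x′ y y′} → x ≃ x′ → y ≃ y′ → (x ++ y) ≃ (x′ ++ y′)
    ++-cong {x} {x′} {y} {y′} p q .at i = K.trans (apply-++ _ x y) (K.trans (K.+-cong (at p i) (at q i)) (K.sym (apply-++ _ x′ y′)))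

    ++-comm : ∀ x y → (x ++ y) ≃ (y ++ x)
    ++-comm x y .at i = K.trans (apply-++ _ x y) (K.trans (K.+-comm _ _) (K.sym (apply-++ _ y x)))

    ≃-trans : ∀ {x y z} → x ≃ y → y ≃ z → x ≃ z
    ≃-trans p q .at i = K.trans (at p i) (at q i)

    neg-inverseˡ : ∀ x → (neg x ++ x) ≃ []
    neg-inverseˡ x .at i = K.trans (apply-++ _ (neg x) x) (K.trans (K.+-congʳ (apply-neg _ x)) (K.-‿inverseˡ _))

  commutativeRing : CommutativeRing 0ℓ 0ℓ
  commutativeRing = record
    { Carrier = Element ; _≈_ = _≃_ ; _+_ = _++_ ; _*_ = mul ; -_ = neg ; 0# = [] ; 1# = one
    ; isCommutativeRing = record
      { isRing = record
        { +-isAbelianGroup = record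
          { isGroup = record
            { isMonoid = record
              { isSemigroup = record
                { isMagma = record
                  { isEquivalence = record
                    { refl = pointwise λ _ → K.refl ; sym = λ p → pointwise λ i → K.sym (at p i) ; trans = ≃-trans }
                  ; ∙-cong = ++-cong }
                ; assoc = λ x y z → pointwise λ i → K.reflexive (≡.cong (apply (functional i)) (++-assoc x y z)) }
              ; identity = (λ _ → pointwise λ _ → K.refl)
                         , (λ x → pointwise λ i → K.reflexive (≡.cong (apply (functional i)) (++-identityʳ x))) }
            ; inverse = neg-inverseˡ , (λ x → ≃-trans (++-comm x (neg x)) (neg-inverseˡ x))
            ; ⁻¹-cong = λ {x} {y} p → pointwise λ i →
                K.trans (apply-neg _ x) (K.trans (K.-‿cong (at p i)) (K.sym (apply-neg _ y))) }
          ; comm = ++-comm }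
        ; *-cong = mul-cong
        ; *-assoc = mul-assoc
        ; *-identity = (λ x → ≃-trans (mul-comm one x) (mul-identityʳ x)) , mul-identityʳ
        ; distrib = mul-distribˡ , (λ x y z → ≃-trans (mul-comm (y ++ z) x)
            (≃-trans (mul-distribˡ x y z) (++-cong (mul-comm x y) (mul-comm x z)))) }
      ; *-comm = mul-comm } }
    where open import Data.List.Properties using (++-assoc; ++-identityʳ)

  ι : K.Carrier → Element
  ι c = (c , ε) ∷ []

  mono : M → Element
  mono m = (K.1# , m) ∷ []

  ev : Index → Element → K.Carrier
  ev i = apply (functional i)

  private
    εˡ : ∀ m → ε ∙ m ≡ m
    εˡ m = ≡.trans (comm ε m) (identityʳ m)

  ev-ι* : ∀ i c x → ev i (mul (ι c) x) ≈ c K.* ev i x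
  ev-ι* i c x = K.trans (apply-mul _ (ι c) x) (K.trans (K.+-identityʳ _)
    (K.*-congˡ (apply-cong (λ m → K.reflexive (≡.cong (functional i) (εˡ m))) x)))

  ev-mono* : ∀ i m x → ev i (mul (mono m) x) ≈ ev (shift i m) x
  ev-mono* i m x = K.trans (apply-mul _ (mono m) x) (K.trans (K.+-identityʳ _) (K.trans (K.*-identityˡ _)
    (K.sym (apply-cong (shift-functional i m) x))))

  ev-mono : ∀ i m → ev i (mono m) ≈ functional i m
  ev-mono i m = K.trans (K.+-identityʳ _) (K.*-identityˡ _)

  mono-∙ : ∀ m m′ → mono (m ∙ m′) ≃ mul (mono m) (mono m′)
  mono-∙ m m′ .at i = K.+-congʳ (K.*-congʳ (K.sym (K.*-identityˡ _)))

  ι-cong : ∀ {c d} → c ≈ d → ι c ≃ ι d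
  ι-cong e .at i = K.+-congʳ (K.*-congʳ e)

  ι-+ : ∀ c d → ι (c K.+ d) ≃ (ι c ++ ι d)
  ι-+ c d .at i = K.trans (K.+-congʳ (K.distribʳ _ c d)) (K.+-assoc _ _ _)

  ι-* : ∀ c d → ι (c K.* d) ≃ mul (ι c) (ι d)
  ι-* c d .at i = K.+-congʳ (K.*-congˡ (K.reflexive (≡.cong (functional i) (≡.sym (identityʳ ε)))))

  ι-0 : ι K.0# ≃ []
  ι-0 .at i = K.trans (K.+-congʳ (K.zeroˡ _)) (K.+-identityˡ _)

  single : ∀ c m → ((c , m) ∷ []) ≃ mul (ι c) (mono m)
  single c m .at i = K.trans (K.+-cong (K.*-congˡ (K.reflexive (≡.cong (functional i) (≡.sym (εˡ m))))) K.refl)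
    (K.+-congʳ (K.*-congʳ (K.sym (K.*-identityʳ c))))

  private
    linear : (K.Carrier → M → Element) → Element → Element
    linear g [] = []
    linear g ((c , m) ∷ x) = g c m ++ linear g x

    listInduction : (P : Element → Set) → P [] → (∀ c m {x} → P x → P ((c , m) ∷ x)) → ∀ x → P x
    listInduction P n h [] = n
    listInduction P n h ((c , m) ∷ x) = h c m (listInduction P n h x)

    module A = CommutativeRing commutativeRing

  monoidAlg : MonoidAlg K _∙_ ε functional shift
  monoidAlg = record
    { ring = commutativeRing ; ι = ι ; mono = mono ; ev = ev
    ; ι-cong = ι-cong ; ι-+ = ι-+ ; ι-* = ι-* ; ι-0 = ι-0 ; ι-1 = A.refl
    ; mono-∙ = mono-∙ ; mono-ε = A.refl
    ; ev-cong = λ i p → at p i ; ev-0 = λ _ → K.refl ; ev-+ = λ i → apply-++ _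
    ; ev-ι* = ev-ι* ; ev-mono* = ev-mono* ; ev-mono = ev-mono ; separated = pointwise
    ; nil = [] ; cons = λ c m x → (c , m) ∷ x ; nil≈0 = A.refl
    ; cons≈ = λ c m x → A.+-congʳ {x} {(c , m) ∷ []} (single c m)
    ; induction = listInduction ; extend = linear ; extend-nil = λ _ → A.refl ; extend-cons = λ _ _ _ _ → A.refl }

-- The maps x ↦ x^(q^m) on the field with Q² elements

module PowerMaps (F : CommutativeRing 0ℓ 0ℓ) (isField : IsField F) {p r q″ : ℕ} (prime : Prime p) (q≡ : suc (suc q″) ≡ p ℕ.^ r)
  (n : ℕ) (card : HasCardinality F (suc (suc q″) ℕ.^ n ℕ.* suc (suc q″) ℕ.^ n)) where

  open Ring F
  open Field F isField card using (_≟_; cancel; *≉0; ^≉0; inv; inv-inverse; char-prime; x^card≈x; nonroot)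
  open IsField isField using (1≉0)

  private
    q Q : ℕ
    q = suc (suc q″)
    Q = q ℕ.^ n

  q^≡ : ∀ m → p ℕ.^ (r ℕ.* m) ≡ q ℕ.^ m
  q^≡ m = ≡.trans (≡.sym (ℕₚ.^-*-assoc p r m)) (≡.cong (ℕ._^ m) (≡.sym q≡))

  char : p · 1# ≈ 0#
  char = char-prime p (r ℕ.* n ℕ.+ r ℕ.* n)
    (≡.trans (≡.cong₂ ℕ._*_ (≡.sym (q^≡ n)) (≡.sym (q^≡ n))) (≡.sym (ℕₚ.^-distribˡ-+-* p (r ℕ.* n) (r ℕ.* n))))

  q^>0 : ∀ m → 0 < q ℕ.^ m
  q^>0 m = ℕₚ.m^n>0 q m

  module _ (m : ℕ) where
    additive : Additive (q ℕ.^ m)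
    additive x y = ≡.subst (λ N → (x + y) ^ N ≈ x ^ N + y ^ N) (q^≡ m) (frobenius^ prime char (r ℕ.* m) x y)

    open Additivity (q^>0 m) additive public

  ^-comm : ∀ x i j → (x ^ i) ^ j ≈ (x ^ j) ^ i
  ^-comm x i j = trans (^-assocʳ x i j) (trans (^-congʳ x (ℕₚ.*-comm i j)) (sym (^-assocʳ x j i)))

  x^QQ : ∀ x → (x ^ Q) ^ Q ≈ x
  x^QQ x = trans (^-assocʳ x Q Q) (x^card≈x x)

  q-powers : ∀ x i j → (x ^ (q ℕ.^ i)) ^ (q ℕ.^ j) ≈ x ^ (q ℕ.^ (i ℕ.+ j))
  q-powers x i j = trans (^-assocʳ x (q ℕ.^ i) (q ℕ.^ j)) (^-congʳ x (≡.sym (ℕₚ.^-distribˡ-+-* q i j)))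

  ^-fixed : ∀ {x i} → x ^ q ≈ x → x ^ (q ℕ.^ i) ≈ x
  ^-fixed {x} {zero} h = *-identityʳ x
  ^-fixed {x} {suc i} h = trans (sym (^-assocʳ x q (q ℕ.^ i))) (trans (^-congˡ (q ℕ.^ i) h) (^-fixed {i = i} h))

  ^-fixed* : ∀ {x} i m → x ^ (q ℕ.^ i) ≈ x → x ^ (q ℕ.^ (m ℕ.* i)) ≈ x
  ^-fixed* {x} i zero h = *-identityʳ x
  ^-fixed* {x} i (suc m) h = trans (sym (q-powers x i (m ℕ.* i))) (trans (^-congˡ (q ℕ.^ (m ℕ.* i)) h) (^-fixed* i m h))

  nonzero-root : ∀ {x y} m → x ^ m ≈ y → 0 < m → ¬ y ≈ 0# → ¬ x ≈ 0#
  nonzero-root m eq 0<m y≉0 x≈0 = y≉0 (trans (sym eq) (trans (^-congˡ m x≈0) (0^ m 0<m)))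

  root : ∀ m → m ≤ n ℕ.+ n → ∀ x → ∃ λ y → y ^ (q ℕ.^ m) ≈ x
  root m m≤ x = x ^ (q ℕ.^ (n ℕ.+ n ℕ.∸ m)) , trans (q-powers x (n ℕ.+ n ℕ.∸ m) m) (trans
    (^-congʳ x (≡.trans (≡.cong (q ℕ.^_) (ℕₚ.m∸n+n≡m m≤)) (ℕₚ.^-distribˡ-+-* q n n))) (x^card≈x x))

  inv-fixed : ∀ t ne → t ^ Q ≈ t → inv t ne ^ Q ≈ inv t ne
  inv-fixed t ne h = begin
    i ^ Q ≈⟨ *-identityʳ _ ⟨
    i ^ Q * 1# ≈⟨ *-congˡ (inv-inverse t ne) ⟨
    i ^ Q * (t * i) ≈⟨ *-congˡ (*-congʳ h) ⟨
    i ^ Q * (t ^ Q * i) ≈⟨ solve 3 (λ a b c → a :* (b :* c) ⊜ (b :* a) :* c) refl _ _ _ ⟩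
    t ^ Q * i ^ Q * i ≈⟨ *-congʳ (trans (sym (^-distrib-* t i Q)) (trans (^-congˡ Q (inv-inverse t ne)) (1^ Q))) ⟩
    1# * i ≈⟨ *-identityˡ i ⟩
    i ∎
    where i = inv t ne

  module _ (1<n : 1 < n) where

    private
      qq≤Q : q ℕ.* q ≤ Q
      qq≤Q = ≡.subst (_≤ Q) (≡.cong (q ℕ.*_) (ℕₚ.*-identityʳ q)) (ℕₚ.^-monoʳ-≤ q 1<n)

      1<Q : 1 < Q
      1<Q = ℕₚ.≤-trans (s≤s (s≤s z≤n)) qq≤Q

      Q<QQ : Q < Q ℕ.* Q
      Q<QQ = ≡.subst (_< Q ℕ.* Q) (ℕₚ.*-identityʳ Q) (ℕₚ.*-monoʳ-< Q {{ℕₚ.m^n≢0 q n}} 1<Q)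

    -- Hilbert 90 for the involution x ↦ x^Q and the element g / z of norm one.
    hilbert90 : ∀ z g → ¬ z ≈ 0# → z * z ^ Q ≈ g * g ^ Q → ∃ λ x → ¬ x ≈ 0# × z * x ≈ g * x ^ Q
    hilbert90 z g z≉0 norms =
      -- By the equality of norms the resolvent z^Q w + g w^Q solves the equation for every w; being
      -- of degree Q < Q² in w, it takes a nonzero value.
      let w , ne = nonroot 1 Q (z ^ Q) g g≉0 1<Q Q<QQ in
      z ^ Q * w ^ 1 + g * w ^ Q , ne , (begin
        z * (z ^ Q * w ^ 1 + g * w ^ Q) ≈⟨ solve 5 (λ z z̄ w g w̄ → z :* (z̄ :* (w :* con (+ 1)) :+ g :* w̄) ⊜ (z :* z̄) :* w :+ g :* (z :* w̄)) refl z (z ^ Q) w g (w ^ Q) ⟩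
        (z * z ^ Q) * w + g * (z * w ^ Q) ≈⟨ +-congʳ (*-congʳ norms) ⟩
        (g * g ^ Q) * w + g * (z * w ^ Q) ≈⟨ solve 5 (λ g ḡ w z w̄ → (g :* ḡ) :* w :+ g :* (z :* w̄) ⊜ g :* (z :* w̄ :+ ḡ :* w)) refl g (g ^ Q) w z (w ^ Q) ⟩
        g * (z * w ^ Q + g ^ Q * w)
          ≈⟨ *-congˡ (trans (additive n _ _) (+-cong (trans (^-distrib-* _ _ Q) (*-cong (x^QQ z) (^-congˡ Q (*-identityʳ w)))) (trans (^-distrib-* _ _ Q) (*-congˡ (x^QQ w))))) ⟨
        g * (z ^ Q * w ^ 1 + g * w ^ Q) ^ Q ∎)
      where
      g≉0 : ¬ g ≈ 0#
      g≉0 e = *≉0 z≉0 (^≉0 Q z≉0) (trans norms (trans (*-congʳ e) (zeroˡ _)))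

    -- A nonzero value of w + w^Q is fixed by x ↦ x^Q, so dividing w by it normalises the trace.
    trace-one : ∃ λ ω → ω + ω ^ Q ≈ 1#
    trace-one =
      let w , ne = nonroot 1 Q 1# 1# 1≉0 1<Q Q<QQ
          t = 1# * w ^ 1 + 1# * w ^ Q
          t≈ : t ≈ w + w ^ Q
          t≈ = solve 2 (λ w w̄ → con (+ 1) :* (w :* con (+ 1)) :+ con (+ 1) :* w̄ ⊜ w :+ w̄) refl w (w ^ Q)
          t^Q : t ^ Q ≈ t
          t^Q = trans (^-congˡ Q t≈) (trans (additive n _ _) (trans (+-congˡ (x^QQ w)) (trans (+-comm _ _) (sym t≈))))
      in w * inv t ne , (begin
        w * inv t ne + (w * inv t ne) ^ Q ≈⟨ +-congˡ (trans (^-distrib-* _ _ Q) (*-congˡ (inv-fixed t ne t^Q))) ⟩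
        w * inv t ne + w ^ Q * inv t ne ≈⟨ distribʳ _ _ _ ⟨
        (w + w ^ Q) * inv t ne ≈⟨ *-congʳ t≈ ⟨
        t * inv t ne ≈⟨ inv-inverse t ne ⟩
        1# ∎)

    -- Norms w^(Q+1) are fixed by x ↦ x^Q. If all of them were in F_q, a binomial of degree (Q + 1)
    -- q < Q² would vanish identically.
    subfield-gap : ∃ λ a → a ^ Q ≈ a × ¬ a ^ q ≈ a
    subfield-gap =
      let w , ne = nonroot (suc Q) (suc Q ℕ.* q) (- 1#) 1# 1≉0 (ℕₚ.m<m*n (suc Q) q (s≤s (s≤s z≤n))) small
      in w ^ suc Q ,
         trans (^-distrib-* w (w ^ Q) Q) (trans (*-comm _ _) (*-congʳ (x^QQ w))) ,
         λ h → ne (begin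
           - 1# * w ^ suc Q + 1# * w ^ (suc Q ℕ.* q) ≈⟨ +-congˡ (*-congˡ (^-assocʳ w (suc Q) q)) ⟨
           - 1# * w ^ suc Q + 1# * (w ^ suc Q) ^ q ≈⟨ +-congˡ (*-congˡ h) ⟩
           - 1# * w ^ suc Q + 1# * w ^ suc Q ≈⟨ solve 1 (λ x → (:- con (+ 1)) :* x :+ con (+ 1) :* x ⊜ con (+ 0)) refl _ ⟩
           0# ∎)
      where
      small : suc Q ℕ.* q < Q ℕ.* Q
      small = ℕₚ.<-≤-trans (ℕₚ.<-≤-trans (ℕₚ.+-monoˡ-< (Q ℕ.* q) q<Qq) (ℕₚ.≤-reflexive (≡.cong (Q ℕ.* q ℕ.+_) (≡.sym (ℕₚ.+-identityʳ (Q ℕ.* q))))))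
        (ℕₚ.≤-trans (ℕₚ.*-monoˡ-≤ (Q ℕ.* q) {2} {q} (s≤s (s≤s z≤n))) (ℕₚ.≤-trans (ℕₚ.≤-reflexive (eq q Q)) (ℕₚ.*-monoʳ-≤ Q qq≤Q)))
        where
        eq : ∀ q Q → q ℕ.* (Q ℕ.* q) ≡ Q ℕ.* (q ℕ.* q)
        eq = ℕ-Solver.solve-∀
        q<Qq : q < Q ℕ.* q
        q<Qq = ≡.subst (_< Q ℕ.* q) (ℕₚ.*-identityˡ q) (ℕₚ.*-monoˡ-< q 1<Q)

  module _ {s : ℕ} (coprime : gcd n s ≡ 1) where
    private
      σ-power : ℕ → Carrier → Carrier
      σ-power i y = y ^ (q ℕ.^ (i ℕ.* s))

      S : ℕ → Carrier → Carrier
      S j y = ∑ j (λ i → σ-power i y)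

      S-telescopes : ∀ j y → S j y ^ (q ℕ.^ s) - S j y ≈ y ^ (q ℕ.^ (j ℕ.* s)) - y
      S-telescopes j y = begin
        S j y ^ (q ℕ.^ s) - S j y ≈⟨ +-congʳ (trans (∑-additive (0^ (q ℕ.^ s) (q^>0 s)) (additive s) j _) (∑-cong j λ i _ →
          trans (q-powers y (i ℕ.* s) s) (^-congʳ y (≡.cong (q ℕ.^_) (ℕₚ.+-comm (i ℕ.* s) s))))) ⟩
        ∑ j (λ i → σ-power (suc i) y) - S j y ≈⟨ solve 3 (λ a b c → a :- b ⊜ ((a :+ c) :- b) :- c) refl _ _ (σ-power 0 y) ⟩
        ((∑ j (λ i → σ-power (suc i) y) + σ-power 0 y) - S j y) - σ-power 0 y ≈⟨ +-cong (+-congʳ (∑-shift j (λ i → σ-power i y))) (-‿cong (*-identityʳ y)) ⟩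
        ((S j y + σ-power j y) - S j y) - y ≈⟨ solve 3 (λ a b c → ((a :+ b) :- a) :- c ⊜ b :- c) refl _ _ _ ⟩
        y ^ (q ℕ.^ (j ℕ.* s)) - y ∎

      S-fixed : ∀ j y → y ^ Q ≈ y → S j y ^ Q ≈ S j y
      S-fixed j y h = trans (∑-additive (0^ Q (q^>0 n)) (additive n) j _) (∑-cong j λ i _ → trans (^-comm y (q ℕ.^ (i ℕ.* s)) Q) (^-congˡ (q ℕ.^ (i ℕ.* s)) h))

    -- As n and s are coprime, x ↦ x^(q^s) generates the Galois group of the fixed field of x ↦ x^Q over F_q.
    coboundary : ∀ y → y ^ Q ≈ y → ∃ λ t → t ^ Q ≈ t × t ^ (q ℕ.^ s) - t ≈ y ^ q - y
    coboundary y h = from-identity (Bézout.identity (≡.subst (GCD n s) coprime (gcd-GCD n s)))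
      where
      open Bézout.Identity using (+-; -+)
      from-identity : Bézout.Identity 1 n s → ∃ λ t → t ^ Q ≈ t × t ^ (q ℕ.^ s) - t ≈ y ^ q - y
      from-identity (-+ x j eq) = S j y , S-fixed j y h , trans (S-telescopes j y) (+-congʳ (begin
        y ^ (q ℕ.^ (j ℕ.* s)) ≡⟨ ≡.cong (λ m → y ^ (q ℕ.^ m)) (≡.trans (≡.sym eq) (ℕₚ.+-comm 1 (x ℕ.* n))) ⟩
        y ^ (q ℕ.^ (x ℕ.* n ℕ.+ 1)) ≈⟨ q-powers y (x ℕ.* n) 1 ⟨
        (y ^ (q ℕ.^ (x ℕ.* n))) ^ (q ℕ.^ 1) ≈⟨ ^-congˡ (q ℕ.^ 1) (^-fixed* n x h) ⟩
        y ^ (q ℕ.^ 1) ≡⟨ ≡.cong (y ^_) (ℕₚ.*-identityʳ q) ⟩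
        y ^ q ∎))
      -- Now 1 + j s = x n, so it is y^q whose q^(j s)-th power is y; the telescoped difference
      -- comes out as y - y^q, hence the sign.
      from-identity (+- x j eq) = - S j (y ^ q) , trans (neg^ n _) (-‿cong (S-fixed j (y ^ q) (trans (^-comm y q Q) (^-congˡ q h)))) , (begin
        (- S j (y ^ q)) ^ (q ℕ.^ s) - - S j (y ^ q) ≈⟨ +-congʳ (neg^ s _) ⟩
        - (S j (y ^ q) ^ (q ℕ.^ s)) - - S j (y ^ q) ≈⟨ solve 2 (λ a b → :- a :- :- b ⊜ :- (a :- b)) refl _ _ ⟩
        - (S j (y ^ q) ^ (q ℕ.^ s) - S j (y ^ q)) ≈⟨ -‿cong (S-telescopes j (y ^ q)) ⟩
        - ((y ^ q) ^ (q ℕ.^ (j ℕ.* s)) - y ^ q) ≈⟨ -‿cong (+-congʳ (begin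
          (y ^ q) ^ (q ℕ.^ (j ℕ.* s)) ≈⟨ ^-assocʳ y q (q ℕ.^ (j ℕ.* s)) ⟩
          y ^ (q ℕ.^ (1 ℕ.+ j ℕ.* s)) ≡⟨ ≡.cong (λ m → y ^ (q ℕ.^ m)) eq ⟩
          y ^ (q ℕ.^ (x ℕ.* n)) ≈⟨ ^-fixed* n x h ⟩
          y ∎)) ⟩
        - (y - y ^ q) ≈⟨ solve 2 (λ a b → :- (a :- b) ⊜ b :- a) refl _ _ ⟩
        y ^ q - y ∎)

-- Homogeneous linear systems with more unknowns than equations

module LinearSystem (F : CommutativeRing 0ℓ 0ℓ) (isField : IsField F) {N : ℕ} (card : HasCardinality F N) where
  open Ring F
  open Field F isField card using (_≟_; inv; inv-inverse)

  first-nonzero : ∀ m (h : ℕ → Carrier) → (∃ λ i → i < m × ¬ h i ≈ 0# × (∀ j → j < i → h j ≈ 0#)) ⊎ (∀ i → i < m → h i ≈ 0#)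
  first-nonzero zero h = inj₂ λ _ ()
  first-nonzero (suc m) h with first-nonzero m h
  ... | inj₁ (i , i< , ne , z) = inj₁ (i , ℕₚ.m<n⇒m<1+n i< , ne , z)
  ... | inj₂ z with h m ≟ 0#
  ...   | no ne = inj₁ (m , ℕₚ.n<1+n m , ne , z)
  ...   | yes e = inj₂ λ i i< → last i (ℕₚ.m≤n⇒m<n∨m≡n (ℕₚ.≤-pred i<))
    where
    last : ∀ i → i < m ⊎ i ≡ m → h i ≈ 0#
    last i (inj₁ i<) = z i i<
    last i (inj₂ ≡.refl) = e

  Solution : ℕ → ℕ → (ℕ → ℕ → Carrier) → Set
  Solution m k A = ∃ λ (x : ℕ → Carrier) → (∃ λ (t : ℕ) → t < k × ¬ x t ≈ 0#) × (∀ i → i < m → ∑ k (λ t → A i t * x t) ≈ 0#)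

  -- Gaussian elimination on the last unknown. A pivot in column k removes that unknown from the
  -- other rows, leaving m equations in k unknowns; without a pivot the last unit vector is a
  -- solution.
  kernel : ∀ m {k} A → m < k → Solution m k A
  kernel zero {suc k} A _ = (λ _ → 1#) , (0 , s≤s z≤n , IsField.1≉0 isField) , λ _ ()
  kernel (suc m) {suc k} A (s≤s m<k) = split (first-nonzero (suc m) (λ i → A i k))
    where
    split : (∃ λ i → i < suc m × ¬ A i k ≈ 0# × (∀ j → j < i → A j k ≈ 0#)) ⊎ (∀ i → i < suc m → A i k ≈ 0#) → Solution (suc m) (suc k) A
    split (inj₂ z) = x , (k , ℕₚ.n<1+n k , λ e → IsField.1≉0 isField (trans (sym (x-on k (k ℕ.≟ k) ≡.refl)) e)) ,
      λ i i< → trans (+-cong (∑-zero k λ t t< → trans (*-congˡ (x-off t (t ℕ.≟ k) (ℕₚ.<⇒≢ t<))) (zeroʳ _)) (trans (*-congʳ (z i i<)) (zeroˡ _))) (+-identityˡ _)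
      where
      choose : ∀ {t} → Dec (t ≡ k) → Carrier
      choose (yes _) = 1#
      choose (no _) = 0#
      x : ℕ → Carrier
      x t = choose (t ℕ.≟ k)
      x-on : ∀ t (t? : Dec (t ≡ k)) → t ≡ k → choose t? ≈ 1#
      x-on t (yes _) _ = refl
      x-on t (no ne) e = ⊥-elim (ne e)
      x-off : ∀ t (t? : Dec (t ≡ k)) → ¬ t ≡ k → choose t? ≈ 0#
      x-off t (yes e) ne = ⊥-elim (ne e)
      x-off t (no _) _ = refl
    split (inj₁ (p , p< , pivot≉0 , _)) = extend (kernel m B m<k)
      where
      pivot⁻¹ = inv (A p k) pivot≉0
      -- Row m takes the place of the pivot row p.
      swap : ∀ {i} → Dec (i ≡ p) → ℕ → ℕ
      swap (yes _) i = m
      swap (no _) i = i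
      eliminate : ℕ → ℕ → Carrier
      eliminate i t = A i t - A i k * pivot⁻¹ * A p t
      B : ℕ → ℕ → Carrier
      B i = eliminate (swap (i ℕ.≟ p) i)
      extend : Solution m k B → Solution (suc m) (suc k) A
      extend (x , (t , t< , xt≉0) , Bx≈0) = x′ , (t , ℕₚ.m<n⇒m<1+n t< , λ e → xt≉0 (trans (sym (old t (t ℕ.≟ k) (ℕₚ.<⇒≢ t<))) e)) , λ i i< → row i i< (i ℕ.≟ p)
        where
        S = ∑ k (λ t → A p t * x t)
        choose : ∀ {t} → Dec (t ≡ k) → ℕ → Carrier
        choose (yes _) t = - (pivot⁻¹ * S)
        choose (no _) t = x t
        x′ : ℕ → Carrier
        x′ t = choose (t ℕ.≟ k) t
        old : ∀ t (t? : Dec (t ≡ k)) → ¬ t ≡ k → choose t? t ≈ x t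
        old t (yes e) ne = ⊥-elim (ne e)
        old t (no _) _ = refl
        new : ∀ t (t? : Dec (t ≡ k)) → t ≡ k → choose t? t ≈ - (pivot⁻¹ * S)
        new t (yes _) _ = refl
        new t (no ne) e = ⊥-elim (ne e)
        full : ∀ i → ∑ (suc k) (λ t → A i t * x′ t) ≈ ∑ k (λ t → A i t * x t) - A i k * (pivot⁻¹ * S)
        full i = +-cong (∑-cong k λ t t< → *-congˡ (old t (t ℕ.≟ k) (ℕₚ.<⇒≢ t<))) (trans (*-congˡ (new k (k ℕ.≟ k) ≡.refl)) (sym (-‿distribʳ-* _ _)))
        eliminated : ∀ i → ∑ k (λ t → eliminate i t * x t) ≈ 0# → ∑ (suc k) (λ t → A i t * x′ t) ≈ 0#
        eliminated i h = trans (full i) (trans (sym (trans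
          (trans (∑-cong k λ t _ → solve 5 (λ a b w c x → (a :- (b :* w) :* c) :* x ⊜ a :* x :+ (:- (b :* w)) :* (c :* x)) refl (A i t) (A i k) pivot⁻¹ (A p t) (x t))
            (trans (∑-+ k _ _) (+-congˡ (∑-*ˡ k _ _))))
          (solve 4 (λ a b w s → a :+ (:- (b :* w)) :* s ⊜ a :- b :* (w :* s)) refl _ (A i k) pivot⁻¹ S))) h)
        row : ∀ i → i < suc m → Dec (i ≡ p) → ∑ (suc k) (λ t → A i t * x′ t) ≈ 0#
        row i i< (yes ≡.refl) = trans (full i) (trans (+-congˡ (-‿cong (trans (sym (*-assoc _ _ _)) (trans (*-congʳ (inv-inverse (A p k) pivot≉0)) (*-identityˡ S))))) (-‿inverseʳ S))
        row i i< (no i≢p) = other (ℕₚ.m≤n⇒m<n∨m≡n (ℕₚ.≤-pred i<))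
          where
          at : ∀ j (j? : Dec (j ≡ p)) → swap j? j ≡ i → ∑ k (λ t → eliminate (swap j? j) t * x t) ≈ 0# → ∑ (suc k) (λ t → A i t * x′ t) ≈ 0#
          at j j? ≡.refl h = eliminated _ h
          swap-no : ∀ {j} (j? : Dec (j ≡ p)) → ¬ j ≡ p → swap j? j ≡ j
          swap-no (yes e) ne = ⊥-elim (ne e)
          swap-no (no _) _ = ≡.refl
          swap-yes : ∀ {j} (j? : Dec (j ≡ p)) → j ≡ p → swap j? j ≡ m
          swap-yes (yes _) _ = ≡.refl
          swap-yes (no ne) e = ⊥-elim (ne e)
          other : i < m ⊎ i ≡ m → ∑ (suc k) (λ t → A i t * x′ t) ≈ 0#
          other (inj₁ i<m) = at i (i ℕ.≟ p) (swap-no (i ℕ.≟ p) i≢p) (Bx≈0 i i<m)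
          other (inj₂ ≡.refl) = at p (p ℕ.≟ p) (swap-yes (p ℕ.≟ p) ≡.refl) (Bx≈0 p (ℕₚ.≤∧≢⇒< (ℕₚ.≤-pred p<) λ e → i≢p (≡.sym e)))

-- Multipliers outside F_q that contradict scatteredness

module Points (F : CommutativeRing 0ℓ 0ℓ) (isField : IsField F) {p r q″ : ℕ} (prime : Prime p) (q≡ : suc (suc q″) ≡ p ℕ.^ r)
  (n : ℕ) (card : HasCardinality F (suc (suc q″) ℕ.^ n ℕ.* suc (suc q″) ℕ.^ n)) (s : ℕ) where

  open Ring F
  open Field F isField card using (cancel)
  open PowerMaps F isField {r = r} prime q≡ n card
  open LinearSet F (suc (suc q″)) n using (Scattered; f)

  private
    q Q : ℕ
    q = suc (suc q″)
    Q = q ℕ.^ n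

  -- For X = x^(q^s) this says that f (α x) = α f(x), where α ∉ F_q.
  Heavy : Carrier → Set
  Heavy δ = ∃₂ λ α X → ¬ X ≈ 0# × ¬ α ^ q ≈ α ×
    α ^ (q ℕ.^ s) * X + δ * ((α ^ (q ℕ.^ s)) ^ Q * X ^ Q) ≈ α * (X + δ * X ^ Q)

  -- X has a q^s-th root x, and (α x, f (α x)) is α times (x, f x). Scatteredness would replace α by
  -- an element of F_q.
  heavy⇒¬scattered : s ≤ n ℕ.+ n → ∀ {δ} → Heavy δ → ¬ Scattered δ s
  heavy⇒¬scattered s≤ {δ} (α , X , X≉0 , α∉F_q , eq) scattered =
    let c , c^q , αx≈cx , _ = scattered x (α * x) α x≉0 refl (trans (reflexive (f≡ (α * x))) (trans f-eq (*-congˡ (reflexive (≡.sym (f≡ x)))))) in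
    α∉F_q (let α≈c = x-y≈0⇒x≈y _ _ (cancel x≉0 (trans (solve 3 (λ x a c → x :* (a :- c) ⊜ a :* x :- c :* x) refl x α c) (x≈y⇒x-y≈0 αx≈cx)))
           in trans (^-congˡ q α≈c) (trans (trans (reflexive (^≡ c q)) c^q) (sym α≈c)))
    where
    x = proj₁ (root s s≤ X)
    x^σ : x ^ (q ℕ.^ s) ≈ X
    x^σ = proj₂ (root s s≤ X)
    x≉0 : ¬ x ≈ 0#
    x≉0 = nonzero-root (q ℕ.^ s) x^σ (q^>0 s) X≉0
    f≡ : ∀ y → f δ s y ≡ y ^ (q ℕ.^ s) + δ * y ^ (q ℕ.^ (n ℕ.+ s))
    f≡ y = ≡.cong₂ (λ a b → a + δ * b) (≡.sym (^≡ y (q ℕ.^ s))) (≡.sym (^≡ y (q ℕ.^ (n ℕ.+ s))))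
    high : ∀ y → y ^ (q ℕ.^ (n ℕ.+ s)) ≈ (y ^ (q ℕ.^ s)) ^ Q
    high y = trans (^-congʳ y (≡.cong (q ℕ.^_) (ℕₚ.+-comm n s))) (sym (q-powers y s n))
    f-eq : (α * x) ^ (q ℕ.^ s) + δ * (α * x) ^ (q ℕ.^ (n ℕ.+ s)) ≈ α * (x ^ (q ℕ.^ s) + δ * x ^ (q ℕ.^ (n ℕ.+ s)))
    f-eq = begin
      (α * x) ^ (q ℕ.^ s) + δ * (α * x) ^ (q ℕ.^ (n ℕ.+ s))
        ≈⟨ +-cong αx^σ (*-congˡ (trans (high _) (trans (^-congˡ Q αx^σ) (^-distrib-* _ _ Q)))) ⟩
      α ^ (q ℕ.^ s) * X + δ * ((α ^ (q ℕ.^ s)) ^ Q * X ^ Q) ≈⟨ eq ⟩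
      α * (X + δ * X ^ Q) ≈⟨ *-congˡ (+-cong x^σ (*-congˡ (trans (high x) (^-congˡ Q x^σ)))) ⟨
      α * (x ^ (q ℕ.^ s) + δ * x ^ (q ℕ.^ (n ℕ.+ s))) ∎
      where
      αx^σ : (α * x) ^ (q ℕ.^ s) ≈ α ^ (q ℕ.^ s) * X
      αx^σ = trans (^-distrib-* α x (q ℕ.^ s)) (*-congˡ x^σ)

  -- For norm one the map X ↦ X + δ X^Q has a nonzero kernel by Hilbert 90, and the kernel is stable
  -- under every a with a^Q = a; such an a outside F_q is then a multiplier.
  heavy-norm-one : 1 < n → ∀ δ → δ * δ ^ Q ≈ 1# → Heavy δ
  heavy-norm-one 1<n δ norm =
    let a , a^Q , a∉F_q = subfield-gap 1<n
        X , X≉0 , X≈ = hilbert90 1<n 1# (- δ) (IsField.1≉0 isField) (trans (*-identityˡ _) (trans (1^ Q) (sym (begin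
          (- δ) * (- δ) ^ Q ≈⟨ *-congˡ (neg^ n δ) ⟩
          (- δ) * - (δ ^ Q) ≈⟨ solve 2 (λ x y → (:- x) :* (:- y) ⊜ x :* y) refl δ (δ ^ Q) ⟩
          δ * δ ^ Q ≈⟨ norm ⟩
          1# ∎))))
        aσ = a ^ (q ℕ.^ s)
        kernel : X + δ * X ^ Q ≈ 0#
        kernel = trans (+-congʳ (trans (sym (*-identityˡ X)) X≈)) (solve 2 (λ d x → (:- d) :* x :+ d :* x ⊜ con (ℤ.+ 0)) refl δ (X ^ Q))
    in a , X , X≉0 , a∉F_q , (begin
      aσ * X + δ * (aσ ^ Q * X ^ Q) ≈⟨ +-congˡ (*-congˡ (*-congʳ (trans (^-comm a (q ℕ.^ s) Q) (^-congˡ (q ℕ.^ s) a^Q)))) ⟩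
      aσ * X + δ * (aσ * X ^ Q) ≈⟨ solve 4 (λ a x d y → a :* x :+ d :* (a :* y) ⊜ a :* (x :+ d :* y)) refl aσ X δ (X ^ Q) ⟩
      aσ * (X + δ * X ^ Q) ≈⟨ trans (*-congˡ kernel) (zeroʳ _) ⟩
      0# ≈⟨ trans (*-congˡ kernel) (zeroʳ _) ⟨
      a * (X + δ * X ^ Q) ∎)

-- From points of the curve to non-scatteredness

record Setting : Set₁ where
  field
    F : CommutativeRing 0ℓ 0ℓ
    isField : IsField F
  open CommutativeRing F
  field
    -- Writing q = 2 + q″ and σ = 2 + d″ makes the product q (σ - 1) reduce to a successor, and
    -- makes the top exponents q - 1 and σ - 2 available as `suc q″` and `d″`.
    p r s′ n q″ d″ : ℕ
    prime : Prime p
    q≡ : suc (suc q″) ≡ p ℕ.^ r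
    σ≡ : suc (suc d″) ≡ suc (suc q″) ℕ.^ suc s′
    card : HasCardinality F (suc (suc q″) ℕ.^ n ℕ.* suc (suc q″) ℕ.^ n)
    e : Carrier
    n≥ : 3 ℕ.* suc s′ ℕ.+ 2 ≤ n
    e≉0 : ¬ e ≈ 0#
    e≉1 : ¬ e ≈ 1#
    e^Q : Ring._^_ F e (suc (suc q″) ℕ.^ n) ≈ e
  s Q : ℕ
  s = suc s′
  Q = suc (suc q″) ℕ.^ n

module FixedPoints (S : Setting) where

  open Setting S
  open Ring F

  -- The coefficients in (e - u)(e - 1 - u) = u² - m₀ u + c.
  c m₀ : Carrier
  c = e * e - e
  m₀ = e + e - 1#

  c≉0 : ¬ c ≈ 0#
  c≉0 c≈0 = e≉1 (x-y≈0⇒x≈y _ _ (Field.cancel F isField card e≉0 (trans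
    (solve 1 (λ e → e :* (e :- con (+ 1)) ⊜ e :* e :- e) refl e) c≈0)))

  -- A point of the curve whose conjugate is its image under x ↦ x^Q.
  record FixedPoint : Set where
    field
      u₀ v₀ b₀ : Carrier
      norm-u : u₀ * u₀ ^ Q ≈ c
      trace-v : v₀ ^ Q ≈ - v₀
      uv : u₀ * v₀ ^ suc d″ ≈ (u₀ - m₀) * u₀ + c
      bv : b₀ ^ suc (suc q″) ≈ b₀ + (e - u₀) * v₀
      bL : (b₀ + ∑ s (λ m → v₀ ^ (suc (suc q″) ℕ.^ m))) ^ Q ≈ b₀

module FromFixedPoint (S : Setting) (fp : FixedPoints.FixedPoint S) where

  open Setting S
  open FixedPoints S using (c; m₀; c≉0)
  open Ring F
  open PowerMaps F isField {r = r} prime q≡ n card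
  open Points F isField {r = r} prime q≡ n card s using (Heavy)
  open Field F isField card using (_≟_; ≉0ˡ; *≉0; ^≉0; cancel)
  open FixedPoints.FixedPoint fp

  private
    q d : ℕ
    q = suc (suc q″)
    d = suc d″

    1<n : 1 < n
    1<n = ℕₚ.≤-trans (ℕₚ.m≤n+m 2 (3 ℕ.* s)) n≥

    ū w V z : Carrier
    ū = u₀ ^ Q
    w = v₀ ^ d
    V = v₀ ^ (q ℕ.^ s)
    z = (e - u₀) * v₀

    u≉0 : ¬ u₀ ≈ 0#
    u≉0 = ≉0ˡ (λ h → c≉0 (trans (sym norm-u) h))

    -- If v₀ were 0, then u₀ would be e or e - 1, both fixed by x ↦ x^Q; comparing u₀² with c = e² -
    -- e gives e = 0 or e = 1.
    v≉0 : ¬ v₀ ≈ 0#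
    v≉0 v≈0 = decide (u₀ ≟ e)
      where
      product : (e - u₀) * (e - 1# - u₀) ≈ 0#
      product = begin
        (e - u₀) * (e - 1# - u₀) ≈⟨ solve 2 (λ e u → (e :- u) :* (e :- con (+ 1) :- u) ⊜ (u :- (e :+ e :- con (+ 1))) :* u :+ (e :* e :- e)) refl e u₀ ⟩
        (u₀ - m₀) * u₀ + c ≈⟨ uv ⟨
        u₀ * w ≈⟨ *-congˡ (trans (^-congˡ d v≈0) (0^ d (s≤s z≤n))) ⟩
        u₀ * 0# ≈⟨ zeroʳ _ ⟩
        0# ∎
      decide : Dec (u₀ ≈ e) → ⊥
      decide (yes u≈e) = e≉0 (begin
        e ≈⟨ solve 1 (λ e → e ⊜ e :* e :- (e :* e :- e)) refl e ⟩
        e * e - c ≈⟨ x≈y⇒x-y≈0 (trans (sym (*-cong u≈e (trans (^-congˡ Q u≈e) e^Q))) norm-u) ⟩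
        0# ∎)
      decide (no u≉e) = e≉1 (sym (x-y≈0⇒x≈y _ _ (begin
        1# - e ≈⟨ solve 1 (λ e → con (+ 1) :- e ⊜ (e :- con (+ 1)) :* (e :- con (+ 1)) :- (e :* e :- e)) refl e ⟩
        (e - 1#) * (e - 1#) - c ≈⟨ x≈y⇒x-y≈0 (trans (*-cong (sym u≈) (sym (trans (^-congˡ Q u≈) (trans (sub^ n _ _) (+-cong e^Q (-‿cong (1^ Q))))))) norm-u) ⟩
        0# ∎)))
        where
        u≈ : u₀ ≈ e - 1#
        u≈ = sym (x-y≈0⇒x≈y _ _ (cancel (λ h → u≉e (sym (x-y≈0⇒x≈y _ _ h))) product))

    w≈ : w ≈ u₀ - m₀ + ū
    w≈ = x-y≈0⇒x≈y _ _ (cancel u≉0 (begin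
      u₀ * (w - (u₀ - m₀ + ū)) ≈⟨ solve 4 (λ u w m ū → u :* (w :- (u :- m :+ ū)) ⊜ u :* w :- ((u :- m) :* u :+ u :* ū)) refl u₀ w m₀ ū ⟩
      u₀ * w - ((u₀ - m₀) * u₀ + u₀ * ū) ≈⟨ x≈y⇒x-y≈0 (trans uv (+-congˡ (sym norm-u))) ⟩
      0# ∎))

    z^Q : z ^ Q ≈ - ((e - ū) * v₀)
    z^Q = trans (^-distrib-* _ _ Q) (trans (*-cong (trans (sub^ n _ _) (+-congʳ e^Q)) trace-v) (sym (-‿distribʳ-* _ _)))

    -- Together with `norm-z+V` this is the purpose of the curve equation: the norms of z and z + V
    -- are in the ratio e to e - 1, which is the norm of δ.
    norm-z : z * z ^ Q ≈ e * (v₀ * (v₀ * w))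
    norm-z = begin
      z * z ^ Q ≈⟨ *-congˡ z^Q ⟩
      z * - ((e - ū) * v₀) ≈⟨ solve 5 (λ e u ū v w → ((e :- u) :* v) :* (:- ((e :- ū) :* v)) ⊜ e :* (v :* (v :* w)) :- ((e :- u) :* (e :- ū) :+ e :* w) :* (v :* v)) refl e u₀ ū v₀ w ⟩
      e * (v₀ * (v₀ * w)) - ((e - u₀) * (e - ū) + e * w) * (v₀ * v₀) ≈⟨ +-congˡ (-‿cong (trans (*-congʳ key) (zeroˡ _))) ⟩
      e * (v₀ * (v₀ * w)) - 0# ≈⟨ solve 1 (λ x → x :- con (+ 0) ⊜ x) refl _ ⟩
      e * (v₀ * (v₀ * w)) ∎
      where
      key : (e - u₀) * (e - ū) + e * w ≈ 0#
      key = cancel u≉0 (begin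
        u₀ * ((e - u₀) * (e - ū) + e * w) ≈⟨ solve 4 (λ u e ū w → u :* ((e :- u) :* (e :- ū) :+ e :* w) ⊜ (e :- u) :* (e :* u :- u :* ū) :+ e :* (u :* w)) refl u₀ e ū w ⟩
        (e - u₀) * (e * u₀ - u₀ * ū) + e * (u₀ * w) ≈⟨ +-cong (*-congˡ (+-congˡ (-‿cong norm-u))) (*-congˡ uv) ⟩
        (e - u₀) * (e * u₀ - c) + e * ((u₀ - m₀) * u₀ + c)
          ≈⟨ solve 2 (λ e u → (e :- u) :* (e :* u :- (e :* e :- e)) :+ e :* ((u :- (e :+ e :- con (+ 1))) :* u :+ (e :* e :- e)) ⊜ con (+ 0)) refl e u₀ ⟩
        0# ∎)

    z≉0 : ¬ z ≈ 0#
    z≉0 = ≉0ˡ (λ h → *≉0 e≉0 (*≉0 v≉0 (*≉0 v≉0 (^≉0 d v≉0))) (trans (sym norm-z) h))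

    V≈ : V ≈ v₀ * w
    V≈ = ^-congʳ v₀ (≡.sym σ≡)

    V^Q : V ^ Q ≈ - V
    V^Q = trans (^-comm v₀ (q ℕ.^ s) Q) (trans (^-congˡ (q ℕ.^ s) trace-v) (neg^ s v₀))

    norm-z+V : (z + V) * (z ^ Q - V) ≈ (e - 1#) * (v₀ * (v₀ * w))
    norm-z+V = begin
      (z + V) * (z ^ Q - V) ≈⟨ solve 3 (λ z y V → (z :+ V) :* (y :- V) ⊜ z :* y :+ V :* ((y :- z) :- V)) refl z (z ^ Q) V ⟩
      z * z ^ Q + V * ((z ^ Q - z) - V) ≈⟨ +-cong norm-z (*-cong V≈ (+-cong (+-congʳ z^Q) (-‿cong V≈))) ⟩
      e * (v₀ * (v₀ * w)) + (v₀ * w) * ((- ((e - ū) * v₀) - z) - v₀ * w)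
        ≈⟨ solve 5 (λ e u ū v w → e :* (v :* (v :* w)) :+ (v :* w) :* ((:- ((e :- ū) :* v) :- (e :- u) :* v) :- v :* w) ⊜
             (e :- con (+ 1)) :* (v :* (v :* w)) :- (v :* (v :* w)) :* (w :- (u :- (e :+ e :- con (+ 1)) :+ ū))) refl e u₀ ū v₀ w ⟩
      (e - 1#) * (v₀ * (v₀ * w)) - (v₀ * (v₀ * w)) * (w - (u₀ - m₀ + ū)) ≈⟨ +-congˡ (-‿cong (trans (*-congˡ (x≈y⇒x-y≈0 w≈)) (zeroʳ _))) ⟩
      (e - 1#) * (v₀ * (v₀ * w)) - 0# ≈⟨ solve 1 (λ x → x :- con (+ 0) ⊜ x) refl _ ⟩
      (e - 1#) * (v₀ * (v₀ * w)) ∎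

    Λ : Carrier → Carrier
    Λ y = ∑ s (λ m → y ^ (q ℕ.^ m))

    Λ-cong : ∀ {x y} → x ≈ y → Λ x ≈ Λ y
    Λ-cong h = ∑-cong s λ m _ → ^-congˡ (q ℕ.^ m) h

    Λ-+ : ∀ x y → Λ (x + y) ≈ Λ x + Λ y
    Λ-+ x y = trans (∑-cong s λ m _ → additive m x y) (∑-+ s _ _)

    Λ-neg : ∀ x → Λ (- x) ≈ - Λ x
    Λ-neg x = trans (∑-cong s λ m _ → neg^ m x) (sym (∑-additive -0#≈0# (λ x y → sym (⁻¹-∙-comm x y)) s _))

    Λ^Q : ∀ x → Λ x ^ Q ≈ Λ (x ^ Q)
    Λ^Q x = trans (∑-additive (0^ Q (q^>0 n)) (additive n) s _) (∑-cong s λ m _ → ^-comm x (q ℕ.^ m) Q)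

    module _ (ω : Carrier) (ω-trace : ω + ω ^ Q ≈ 1#) where

      -- If b₀ is thought of as Λ α, this is Λ t for t = α + ω v₀, an element fixed by x ↦ x^Q. From
      -- y₀ the element t is then recovered by `coboundary`.
      y₀ : Carrier
      y₀ = b₀ + Λ (ω * v₀)

      y₀^Q : y₀ ^ Q ≈ y₀
      y₀^Q = begin
        y₀ ^ Q ≈⟨ additive n _ _ ⟩
        b₀ ^ Q + Λ (ω * v₀) ^ Q ≈⟨ +-cong (trans (^-congˡ Q (sym bL)) (x^QQ _)) (trans (Λ^Q _) (trans (Λ-cong (trans (^-distrib-* _ _ Q) (trans (*-congˡ trace-v) (sym (-‿distribʳ-* _ _))))) (Λ-neg _))) ⟩
        (b₀ + Λ v₀) - Λ (ω ^ Q * v₀) ≈⟨ +-congʳ (+-congˡ (trans (Λ-cong (trans (sym (*-identityˡ v₀)) (trans (*-congʳ (sym ω-trace)) (distribʳ _ _ _)))) (Λ-+ _ _))) ⟩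
        (b₀ + (Λ (ω * v₀) + Λ (ω ^ Q * v₀))) - Λ (ω ^ Q * v₀) ≈⟨ solve 3 (λ b x y → (b :+ (x :+ y)) :- y ⊜ b :+ x) refl _ _ _ ⟩
        y₀ ∎

      y₀^q : y₀ ^ q - y₀ ≈ z + (ω * v₀) ^ (q ℕ.^ s) - ω * v₀
      y₀^q = begin
        y₀ ^ q - y₀ ≈⟨ +-congʳ (trans (add-q _ _) (+-cong bv (partial-trace^q (s≤s z≤n) add-q s _))) ⟩
        ((b₀ + z) + (Λ (ω * v₀) + (ω * v₀) ^ (q ℕ.^ s) - ω * v₀)) - (b₀ + Λ (ω * v₀))
          ≈⟨ solve 5 (λ b z l x y → ((b :+ z) :+ (l :+ x :- y)) :- (b :+ l) ⊜ z :+ x :- y) refl _ _ _ _ _ ⟩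
        z + (ω * v₀) ^ (q ℕ.^ s) - ω * v₀ ∎
        where
        add-q : ∀ x y → (x + y) ^ q ≈ x ^ q + y ^ q
        add-q x y = ≡.subst (λ N → (x + y) ^ N ≈ x ^ N + y ^ N) (ℕₚ.*-identityʳ q) (additive 1 x y)

      module _ (t : Carrier) (t^Q : t ^ Q ≈ t) (t^σ : t ^ (q ℕ.^ s) - t ≈ y₀ ^ q - y₀) where

        -- Additive Hilbert 90: since ω has trace 1 and v₀ trace 0, the summand - ω v₀ alone
        -- satisfies x^Q - x = v₀; the fixed element t then adjusts α^σ - α to z.
        α : Carrier
        α = t - ω * v₀

        α^σ : α ^ (q ℕ.^ s) ≈ α + z
        α^σ = begin
          α ^ (q ℕ.^ s) ≈⟨ sub^ s _ _ ⟩
          t ^ (q ℕ.^ s) - (ω * v₀) ^ (q ℕ.^ s) ≈⟨ solve 3 (λ a b c → a :- b ⊜ ((a :- c) :- b) :+ c) refl _ _ t ⟩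
          ((t ^ (q ℕ.^ s) - t) - (ω * v₀) ^ (q ℕ.^ s)) + t ≈⟨ +-congʳ (+-congʳ (trans t^σ y₀^q)) ⟩
          ((z + (ω * v₀) ^ (q ℕ.^ s) - ω * v₀) - (ω * v₀) ^ (q ℕ.^ s)) + t ≈⟨ solve 4 (λ z x y t → ((z :+ x :- y) :- x) :+ t ⊜ (t :- y) :+ z) refl _ _ _ _ ⟩
          α + z ∎

        α^Q : α ^ Q ≈ α + v₀
        α^Q = begin
          α ^ Q ≈⟨ trans (sub^ n _ _) (+-cong t^Q (-‿cong (trans (^-distrib-* _ _ Q) (*-congˡ trace-v)))) ⟩
          t - ω ^ Q * - v₀ ≈⟨ solve 4 (λ t x y v → t :- y :* (:- v) ⊜ (t :- x :* v) :+ (x :+ y) :* v) refl t ω (ω ^ Q) v₀ ⟩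
          α + (ω + ω ^ Q) * v₀ ≈⟨ +-congˡ (trans (*-congʳ ω-trace) (*-identityˡ _)) ⟩
          α + v₀ ∎

        α∉F_q : ¬ α ^ q ≈ α
        α∉F_q h = v≉0 (begin
          v₀ ≈⟨ solve 2 (λ a v → v ⊜ (a :+ v) :- a) refl α v₀ ⟩
          (α + v₀) - α ≈⟨ x≈y⇒x-y≈0 (trans (sym α^Q) (^-fixed {i = n} h)) ⟩
          0# ∎)

        α^σQ : (α ^ (q ℕ.^ s)) ^ Q ≈ α + z + V
        α^σQ = trans (^-comm α (q ℕ.^ s) Q) (trans (^-congˡ (q ℕ.^ s) α^Q) (trans (additive s _ _) (+-congʳ α^σ)))

        heavy-from : ∀ δ X → ¬ X ≈ 0# → z * X ≈ - (δ * (z + V)) * X ^ Q → Heavy δ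
        heavy-from δ X X≉0 eq = α , X , X≉0 , α∉F_q , (begin
          α ^ (q ℕ.^ s) * X + δ * ((α ^ (q ℕ.^ s)) ^ Q * X ^ Q) ≈⟨ +-cong (*-congʳ α^σ) (*-congˡ (*-congʳ α^σQ)) ⟩
          (α + z) * X + δ * ((α + z + V) * X ^ Q)
            ≈⟨ solve 6 (λ a z x d V y → (a :+ z) :* x :+ d :* ((a :+ z :+ V) :* y) ⊜ a :* (x :+ d :* y) :+ (z :* x :- (:- (d :* (z :+ V))) :* y)) refl α z X δ V (X ^ Q) ⟩
          α * (X + δ * X ^ Q) + (z * X - - (δ * (z + V)) * X ^ Q) ≈⟨ trans (+-congˡ (x≈y⇒x-y≈0 eq)) (+-identityʳ _) ⟩
          α * (X + δ * X ^ Q) ∎)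

  heavy : gcd n s ≡ 1 → ∀ δ → (δ * δ ^ Q) * (e - 1#) ≈ e → Heavy δ
  heavy coprime δ relation =
    let ω , ω-trace = trace-one 1<n
        t , t^Q , t^σ = coboundary coprime (y₀ ω ω-trace) (y₀^Q ω ω-trace)
        X , X≉0 , eq = hilbert90 1<n z (- (δ * (z + V))) z≉0 norms
    in heavy-from ω ω-trace t t^Q t^σ δ X X≉0 eq
    where
    norms : z * z ^ Q ≈ - (δ * (z + V)) * (- (δ * (z + V))) ^ Q
    norms = sym (begin
      - (δ * (z + V)) * (- (δ * (z + V))) ^ Q
        ≈⟨ *-congˡ (trans (neg^ n _) (-‿cong (trans (^-distrib-* _ _ Q) (*-congˡ (trans (additive n _ _) (+-congˡ V^Q)))))) ⟩
      - (δ * (z + V)) * - (δ ^ Q * (z ^ Q - V)) ≈⟨ solve 4 (λ d a d′ b → (:- (d :* a)) :* (:- (d′ :* b)) ⊜ (d :* d′) :* (a :* b)) refl _ _ _ _ ⟩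
      (δ * δ ^ Q) * ((z + V) * (z ^ Q - V)) ≈⟨ *-congˡ norm-z+V ⟩
      (δ * δ ^ Q) * ((e - 1#) * (v₀ * (v₀ * w))) ≈⟨ trans (sym (*-assoc _ _ _)) (*-congʳ relation) ⟩
      e * (v₀ * (v₀ * w)) ≈⟨ norm-z ⟨
      z * z ^ Q ∎)

-- Integer orders, updates of sequences and uniqueness of digits

≤-difference : ∀ {i j} → i ℤ.≤ j → ∃ λ n → j ≡ i ℤ.+ + n
≤-difference {i} {j} i≤j = ℤ.∣ j ℤ.- i ∣ , ≡.sym (≡.trans (≡.cong (λ z → i ℤ.+ z) (ℤₚ.0≤i⇒+∣i∣≡i (ℤₚ.i≤j⇒0≤j-i i≤j))) (eq i j))
  where
  eq : ∀ i j → i ℤ.+ (j ℤ.- i) ≡ j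
  eq = solve-∀

module _ {A : Set} (D : ℕ → A) (m : ℕ) (x : A) where
  update : ℕ → A
  update k = choose (k ℕ.≟ m)
    where
    choose : Dec (k ≡ m) → A
    choose (yes _) = x
    choose (no _) = D k

  update-elim : (P : ℕ → A → Set) → P m x → (∀ k → k < m → P k (D k)) → ∀ k → k < suc m → P k (update k)
  update-elim P p h k k< with k ℕ.≟ m
  ... | yes ≡.refl = p
  ... | no ne = h k (ℕₚ.≤∧≢⇒< (ℕₚ.≤-pred k<) ne)

quotient-unique : ∀ N {l l′ : ℤ} {r r′ : ℕ} → r < N → r′ < N → + r ℤ.+ l ℤ.* + N ≡ + r′ ℤ.+ l′ ℤ.* + N → l ≡ l′ × r ≡ r′
quotient-unique N {l} {l′} {r} {r′} r< r′< eq = go (ℤₚ.<-cmp l l′)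
  where
  ordered : ∀ {l l′ r r′} → r < N → l ℤ.< l′ → ¬ + r ℤ.+ l ℤ.* + N ≡ + r′ ℤ.+ l′ ℤ.* + N
  ordered {l} {l′} {r} {r′} r< l<l′ eq with ≤-difference (ℤₚ.i<j⇒suc[i]≤j l<l′)
  ... | k , ≡.refl = ℕₚ.<⇒≱ r< (≡.subst (N ≤_) (≡.sym (ℤₚ.+-injective r≡)) (ℕₚ.m≤m+n N _))
    where
    cancel : ∀ r r′ l k N → r ≡ (r ℤ.+ l ℤ.* N) ℤ.- l ℤ.* N
    cancel = solve-∀
    expand : ∀ r′ l k N → r′ ℤ.+ (+ 1 ℤ.+ l ℤ.+ k) ℤ.* N ℤ.- l ℤ.* N ≡ N ℤ.+ (k ℤ.* N ℤ.+ r′)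
    expand = solve-∀
    r≡ : + r ≡ + (N ℕ.+ (k ℕ.* N ℕ.+ r′))
    r≡ = ≡.trans (cancel (+ r) (+ r′) l (+ k) (+ N)) (≡.trans (≡.cong (ℤ._- l ℤ.* + N) eq)
      (≡.trans (expand (+ r′) l (+ k) (+ N)) (≡.cong (λ z → + N ℤ.+ (z ℤ.+ + r′)) (≡.sym (ℤₚ.pos-* k N)))))
  go : Tri (l ℤ.< l′) (l ≡ l′) (l′ ℤ.< l) → l ≡ l′ × r ≡ r′
  go (tri< lt _ _) = ⊥-elim (ordered {r′ = r′} r< lt eq)
  go (tri> _ _ gt) = ⊥-elim (ordered {r′ = r} r′< gt (≡.sym eq))
  go (tri≈ _ ≡.refl _) = ≡.refl , ℤₚ.+-injective (≡.trans (cancel (+ r) (l ℤ.* + N)) (≡.trans (≡.cong (ℤ._- l ℤ.* + N) eq) (≡.sym (cancel (+ r′) (l ℤ.* + N)))))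
    where
    cancel : ∀ r x → r ≡ r ℤ.+ x ℤ.- x
    cancel = solve-∀

-- Write q = 2 + q″ and σ = 2 + d″.  The ring is F[u, u⁻¹, v, b] modulo
-- v ^ (σ - 1) = u - (2e - 1) + c / u and b ^ q = b + (e - u) v.

module Curve (S : Setting) where

  open Setting S
  open FixedPoints S using (c; m₀; c≉0; FixedPoint)
  module K = Ring F
  open Field F isField card using (_≟_; cancel; *≉0; ^≉0; inv; inv-inverse; inv≉0; elements; IsAlgebra; module Polynomial; module Factorisation)
  open IsField isField using (1≉0)
  open K using (_≈_)

  q d : ℕ
  q = suc (suc q″)
  d = suc d″

  private
    ∸-< : ∀ {m n f} → ¬ m < suc n → m < suc f → m ℕ.∸ suc n < f
    ∸-< {m} {n} m≮ (s≤s m≤f) = ℕₚ.<-≤-trans (ℕₚ.∸-monoʳ-< {m} {suc n} {0} (s≤s z≤n) (ℕₚ.≮⇒≥ m≮)) m≤f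

    suc∸-< : ∀ {m f} → ¬ m < q → m < suc f → suc (m ℕ.∸ q) < f
    suc∸-< {m} m≮ (s≤s m≤f) = ℕₚ.<-≤-trans
      (≡.subst (suc (m ℕ.∸ q) <_) (ℕₚ.m+[n∸m]≡n (ℕₚ.≮⇒≥ m≮)) (s≤s (s≤s (ℕₚ.m≤n+m (m ℕ.∸ q) q″)))) m≤f

  abstract
    -- β is a functional on F[u, u⁻¹], given by its values on the powers of u. The table holds the
    -- value on u^k v^i of its extension, which applies β to the coefficient of v^(d-1) after v^d
    -- has been reduced. The first argument is fuel.
    v-table : ℕ → (ℤ → K.Carrier) → ℕ → ℤ → K.Carrier
    v-table zero β i k = K.0#
    v-table (suc f) β i k with i <? d
    ... | no _ = v-table f β (i ℕ.∸ d) (ℤ.suc k) K.- m₀ K.* v-table f β (i ℕ.∸ d) k K.+ c K.* v-table f β (i ℕ.∸ d) (ℤ.pred k)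
    ... | yes _ with i ℕ.≟ d″
    ...   | yes _ = β k
    ...   | no _ = K.0#

    -- The same for u^k v^i b^j: powers of b from b^q on are reduced first, then β is applied to the
    -- coefficient of v^(d-1) b^(q-1).
    table : ℕ → (ℤ → K.Carrier) → ℕ → ℕ → ℤ → K.Carrier
    table zero β i j k = K.0#
    table (suc f) β i j k with j <? q
    ... | no _ = table f β i (suc (j ℕ.∸ q)) k
                 K.+ (e K.* table f β (suc i) (j ℕ.∸ q) k K.- table f β (suc i) (j ℕ.∸ q) (ℤ.suc k))
    ... | yes _ with j ℕ.≟ suc q″
    ...   | yes _ = v-table (suc i) β i k
    ...   | no _ = K.0#

    private
      v-stable : ∀ f f′ β i k → i < f → i < f′ → v-table f β i k ≡ v-table f′ β i k
      v-stable (suc f) (suc f′) β i k i<f i<f′ with i <? d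
      ... | no i≮ = ≡.cong₂ K._+_ (≡.cong₂ K._-_ (rec (ℤ.suc k)) (≡.cong (m₀ K.*_) (rec k))) (≡.cong (c K.*_) (rec (ℤ.pred k)))
        where
        rec : ∀ k → v-table f β (i ℕ.∸ d) k ≡ v-table f′ β (i ℕ.∸ d) k
        rec k = v-stable f f′ β (i ℕ.∸ d) k (∸-< i≮ i<f) (∸-< i≮ i<f′)
      ... | yes _ with i ℕ.≟ d″
      ...   | yes _ = ≡.refl
      ...   | no _ = ≡.refl

      stable : ∀ f f′ β i j k → j < f → j < f′ → table f β i j k ≡ table f′ β i j k
      stable (suc f) (suc f′) β i j k j<f j<f′ with j <? q
      ... | no j≮ = ≡.cong₂ K._+_ (stable f f′ β i _ k (suc∸-< j≮ j<f) (suc∸-< j≮ j<f′))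
          (≡.cong₂ K._-_ (≡.cong (e K.*_) (rec k)) (rec (ℤ.suc k)))
        where
        rec : ∀ k → table f β (suc i) (j ℕ.∸ q) k ≡ table f′ β (suc i) (j ℕ.∸ q) k
        rec k = stable f f′ β (suc i) (j ℕ.∸ q) k (∸-< j≮ j<f) (∸-< j≮ j<f′)
      ... | yes _ with j ℕ.≟ suc q″
      ...   | yes _ = ≡.refl
      ...   | no _ = ≡.refl

    vt : (ℤ → K.Carrier) → ℕ → ℤ → K.Carrier
    vt β i k = v-table (suc i) β i k

    τ : (ℤ → K.Carrier) → ℕ → ℕ → ℤ → K.Carrier
    τ β i j k = table (suc j) β i j k

    vt-base : ∀ β k → vt β d″ k ≡ β k
    vt-base β k with d″ <? d
    ... | no ≮ = ⊥-elim (≮ (ℕₚ.n<1+n d″))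
    ... | yes _ with d″ ℕ.≟ d″
    ...   | yes _ = ≡.refl
    ...   | no ne = ⊥-elim (ne ≡.refl)

    vt-zero : ∀ β i k → i < d″ → vt β i k ≡ K.0#
    vt-zero β i k i<d″ with i <? d
    ... | no ≮ = ⊥-elim (≮ (ℕₚ.m<n⇒m<1+n i<d″))
    ... | yes _ with i ℕ.≟ d″
    ...   | yes i≡ = ⊥-elim (ℕₚ.<⇒≢ i<d″ i≡)
    ...   | no _ = ≡.refl

    vt-step : ∀ β i k → vt β (d ℕ.+ i) k ≡ vt β i (ℤ.suc k) K.- m₀ K.* vt β i k K.+ c K.* vt β i (ℤ.pred k)
    vt-step β i k with (d ℕ.+ i) <? d
    ... | yes lt = ⊥-elim (ℕₚ.<⇒≱ lt (ℕₚ.m≤m+n d i))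
    ... | no _ = ≡.cong₂ K._+_ (≡.cong₂ K._-_ (rec (ℤ.suc k)) (≡.cong (m₀ K.*_) (rec k))) (≡.cong (c K.*_) (rec (ℤ.pred k)))
      where
      rec : ∀ k → v-table (d ℕ.+ i) β (d ℕ.+ i ℕ.∸ d) k ≡ vt β i k
      rec k = ≡.trans (≡.cong (λ m → v-table (d ℕ.+ i) β m k) (ℕₚ.m+n∸m≡n d i))
        (v-stable (d ℕ.+ i) (suc i) β i k (s≤s (ℕₚ.m≤n+m i d″)) (ℕₚ.n<1+n i))

    τ-top : ∀ β i k → τ β i (suc q″) k ≡ vt β i k
    τ-top β i k with suc q″ <? q
    ... | no ≮ = ⊥-elim (≮ (ℕₚ.n<1+n _))
    ... | yes _ with suc q″ ℕ.≟ suc q″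
    ...   | yes _ = ≡.refl
    ...   | no ne = ⊥-elim (ne ≡.refl)

    τ-zero : ∀ β i j k → j < suc q″ → τ β i j k ≡ K.0#
    τ-zero β i j k j< with j <? q
    ... | no ≮ = ⊥-elim (≮ (ℕₚ.m<n⇒m<1+n j<))
    ... | yes _ with j ℕ.≟ suc q″
    ...   | yes j≡ = ⊥-elim (ℕₚ.<⇒≢ j< j≡)
    ...   | no _ = ≡.refl

    τ-step : ∀ β i j k → τ β i (q ℕ.+ j) k ≡ τ β i (suc j) k K.+ (e K.* τ β (suc i) j k K.- τ β (suc i) j (ℤ.suc k))
    τ-step β i j k with (q ℕ.+ j) <? q
    ... | yes lt = ⊥-elim (ℕₚ.<⇒≱ lt (ℕₚ.m≤m+n q j))
    ... | no _ = ≡.cong₂ K._+_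
        (≡.trans (≡.cong (λ m → table (q ℕ.+ j) β i (suc m) k) (ℕₚ.m+n∸m≡n q j))
          (stable (q ℕ.+ j) (suc (suc j)) β i (suc j) k (s≤s (s≤s (ℕₚ.m≤n+m j q″))) (ℕₚ.n<1+n _)))
        (≡.cong₂ K._-_ (≡.cong (e K.*_) (rec k)) (rec (ℤ.suc k)))
      where
      rec : ∀ k → table (q ℕ.+ j) β (suc i) (q ℕ.+ j ℕ.∸ q) k ≡ τ β (suc i) j k
      rec k = ≡.trans (≡.cong (λ m → table (q ℕ.+ j) β (suc i) m k) (ℕₚ.m+n∸m≡n q j))
        (stable (q ℕ.+ j) (suc j) β (suc i) j k (s≤s (ℕₚ.m≤n+m j (suc q″))) (ℕₚ.n<1+n _))

  -- Follows the reduction of b^(q+j), which lowers j at the cost of raising i; hence P has to be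
  -- proved for all i at once.
  τ-induction : (P : ℕ → ℕ → Set) →
    (∀ i j → j < suc q″ → P i j) → (∀ i → P i (suc q″)) →
    (∀ i j → P i (suc j) → P (suc i) j → P i (q ℕ.+ j)) → ∀ i j → P i j
  τ-induction P lo top step i j = go (suc j) i j (ℕₚ.n<1+n j)
    where
    go : ∀ f i j → j < f → P i j
    go (suc f) i j j<f with j <? q
    ... | yes j<q with j ℕ.≟ suc q″
    ...   | yes ≡.refl = top i
    ...   | no ne = lo i j (ℕₚ.≤∧≢⇒< (ℕₚ.≤-pred j<q) ne)
    go (suc f) i j j<f | no j≮ = ≡.subst (P i) (ℕₚ.m+[n∸m]≡n (ℕₚ.≮⇒≥ j≮))
      (step i (j ℕ.∸ q) (go f i (suc (j ℕ.∸ q)) (suc∸-< j≮ j<f)) (go f (suc i) (j ℕ.∸ q) (∸-< j≮ j<f)))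

  vt-induction : (P : ℕ → Set) → (∀ i → i < d″ → P i) → P d″ → (∀ i → P i → P (d ℕ.+ i)) → ∀ i → P i
  vt-induction P lo top step i = go (suc i) i (ℕₚ.n<1+n i)
    where
    go : ∀ f i → i < f → P i
    go (suc f) i i<f with i <? d
    ... | yes i<d with i ℕ.≟ d″
    ...   | yes ≡.refl = top
    ...   | no ne = lo i (ℕₚ.≤∧≢⇒< (ℕₚ.≤-pred i<d) ne)
    go (suc f) i i<f | no i≮ = ≡.subst P (ℕₚ.m+[n∸m]≡n (ℕₚ.≮⇒≥ i≮)) (step (i ℕ.∸ d) (go f (i ℕ.∸ d) (∸-< i≮ i<f)))

  -- The table reduces b before v, so the relation for v has to be carried through the reductions of
  -- b.
  τ-step-v : ∀ β j i k → τ β (d ℕ.+ i) j k ≈ τ β i j (ℤ.suc k) K.- m₀ K.* τ β i j k K.+ c K.* τ β i j (ℤ.pred k)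
  τ-step-v β j i = τ-induction (λ i j → ∀ k → τ β (d ℕ.+ i) j k ≈ τ β i j (ℤ.suc k) K.- m₀ K.* τ β i j k K.+ c K.* τ β i j (ℤ.pred k))
    (λ i j j< k → K.trans (K.reflexive (τ-zero β _ j k j<)) (K.trans
      (K.solve 2 (λ m c → K.con (+ 0) K.⊜ K.con (+ 0) K.:- m K.:* K.con (+ 0) K.:+ c K.:* K.con (+ 0)) K.refl m₀ c)
      (K.sym (K.+-cong (K.+-cong (K.reflexive (τ-zero β i j _ j<)) (K.-‿cong (K.*-congˡ (K.reflexive (τ-zero β i j _ j<)))))
                       (K.*-congˡ (K.reflexive (τ-zero β i j _ j<)))))))
    (λ i k → K.reflexive (≡.trans (τ-top β _ k) (≡.trans (vt-step β i k)
      (≡.sym (≡.cong₂ K._+_ (≡.cong₂ K._-_ (τ-top β i _) (≡.cong (m₀ K.*_) (τ-top β i _))) (≡.cong (c K.*_) (τ-top β i _)))))))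
    (λ i j h₁ h₂ k → K.begin
      τ β (d ℕ.+ i) (q ℕ.+ j) k K.≡⟨ τ-step β (d ℕ.+ i) j k ⟩
      τ β (d ℕ.+ i) (suc j) k K.+ (e K.* τ β (suc (d ℕ.+ i)) j k K.- τ β (suc (d ℕ.+ i)) j (ℤ.suc k))
        K.≡⟨ ≡.cong (λ i′ → τ β (d ℕ.+ i) (suc j) k K.+ (e K.* τ β i′ j k K.- τ β i′ j (ℤ.suc k))) (≡.sym (ℕₚ.+-suc d i)) ⟩
      τ β (d ℕ.+ i) (suc j) k K.+ (e K.* τ β (d ℕ.+ suc i) j k K.- τ β (d ℕ.+ suc i) j (ℤ.suc k))
        K.≈⟨ K.+-cong (h₁ k) (K.+-cong (K.*-congˡ (h₂ k)) (K.-‿cong (h₂ (ℤ.suc k)))) ⟩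
      (τ β i (suc j) (ℤ.suc k) K.- m₀ K.* τ β i (suc j) k K.+ c K.* τ β i (suc j) (ℤ.pred k))
        K.+ (e K.* (τ β (suc i) j (ℤ.suc k) K.- m₀ K.* τ β (suc i) j k K.+ c K.* τ β (suc i) j (ℤ.pred k))
          K.- (τ β (suc i) j (ℤ.suc (ℤ.suc k)) K.- m₀ K.* τ β (suc i) j (ℤ.suc k) K.+ c K.* τ β (suc i) j (ℤ.pred (ℤ.suc k))))
        K.≡⟨ ≡.cong (λ k′ → (τ β i (suc j) (ℤ.suc k) K.- m₀ K.* τ β i (suc j) k K.+ c K.* τ β i (suc j) (ℤ.pred k))
        K.+ (e K.* (τ β (suc i) j (ℤ.suc k) K.- m₀ K.* τ β (suc i) j k K.+ c K.* τ β (suc i) j (ℤ.pred k))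
          K.- (τ β (suc i) j (ℤ.suc (ℤ.suc k)) K.- m₀ K.* τ β (suc i) j (ℤ.suc k) K.+ c K.* τ β (suc i) j k′)))
          (≡.trans (ℤₚ.pred-suc k) (≡.sym (ℤₚ.suc-pred k))) ⟩
      (τ β i (suc j) (ℤ.suc k) K.- m₀ K.* τ β i (suc j) k K.+ c K.* τ β i (suc j) (ℤ.pred k))
        K.+ (e K.* (τ β (suc i) j (ℤ.suc k) K.- m₀ K.* τ β (suc i) j k K.+ c K.* τ β (suc i) j (ℤ.pred k))
          K.- (τ β (suc i) j (ℤ.suc (ℤ.suc k)) K.- m₀ K.* τ β (suc i) j (ℤ.suc k) K.+ c K.* τ β (suc i) j (ℤ.suc (ℤ.pred k))))
        K.≈⟨ K.solve 11 (λ a₁ a₂ a₃ b₁ b₂ b₃ c₁ c₃ e m c →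
              (a₁ K.:- m K.:* a₂ K.:+ c K.:* a₃) K.:+ (e K.:* (b₁ K.:- m K.:* b₂ K.:+ c K.:* b₃) K.:- (c₁ K.:- m K.:* b₁ K.:+ c K.:* c₃)) K.⊜
              (a₁ K.:+ (e K.:* b₁ K.:- c₁)) K.:- m K.:* (a₂ K.:+ (e K.:* b₂ K.:- b₁)) K.:+ c K.:* (a₃ K.:+ (e K.:* b₃ K.:- c₃)))
              K.refl _ _ _ _ _ _ _ _ _ _ _ ⟩
      (τ β i (suc j) (ℤ.suc k) K.+ (e K.* τ β (suc i) j (ℤ.suc k) K.- τ β (suc i) j (ℤ.suc (ℤ.suc k))))
        K.- m₀ K.* (τ β i (suc j) k K.+ (e K.* τ β (suc i) j k K.- τ β (suc i) j (ℤ.suc k)))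
        K.+ c K.* (τ β i (suc j) (ℤ.pred k) K.+ (e K.* τ β (suc i) j (ℤ.pred k) K.- τ β (suc i) j (ℤ.suc (ℤ.pred k))))
        K.≡⟨ ≡.sym (≡.cong₂ K._+_ (≡.cong₂ K._-_ (τ-step β i j _) (≡.cong (m₀ K.*_) (τ-step β i j _))) (≡.cong (c K.*_) (τ-step β i j _))) ⟩
      τ β i (q ℕ.+ j) (ℤ.suc k) K.- m₀ K.* τ β i (q ℕ.+ j) k K.+ c K.* τ β i (q ℕ.+ j) (ℤ.pred k) K.∎)
    i j

  Exponent : Set
  Exponent = ℤ × ℕ × ℕ

  private
    _∙_ : Exponent → Exponent → Exponent
    (k , i , j) ∙ (k′ , i′ , j′) = k ℤ.+ k′ , i ℕ.+ i′ , j ℕ.+ j′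

    triple : ∀ {k k′ : ℤ} {i i′ j j′ : ℕ} → k ≡ k′ → i ≡ i′ → j ≡ j′ → (k , i , j) ≡ (k′ , i′ , j′)
    triple ≡.refl ≡.refl ≡.refl = ≡.refl

    -- A functional β together with a monomial by which it is translated; this closes the family
    -- under multiplication by monomials.
    Index : Set
    Index = (ℤ → K.Carrier) × Exponent

    functional : Index → Exponent → K.Carrier
    functional (β , m) m′ with m ∙ m′
    ... | k , i , j = τ β i j k

    ∙-assoc : ∀ a b c → (a ∙ b) ∙ c ≡ a ∙ (b ∙ c)
    ∙-assoc (k , i , j) (k′ , i′ , j′) (k″ , i″ , j″) = triple (ℤₚ.+-assoc k k′ k″) (ℕₚ.+-assoc i i′ i″) (ℕₚ.+-assoc j j′ j″)

  abstract
    algebra : MonoidAlg F _∙_ (+ 0 , 0 , 0) functional (λ { (β , m) m′ → β , m ∙ m′ })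
    algebra = MonoidAlgebra.monoidAlg F _∙_ (+ 0 , 0 , 0) ∙-assoc
      (λ { (k , i , j) (k′ , i′ , j′) → triple (ℤₚ.+-comm k k′) (ℕₚ.+-comm i i′) (ℕₚ.+-comm j j′) })
      (λ { (k , i , j) → triple (ℤₚ.+-identityʳ k) (ℕₚ.+-identityʳ i) (ℕₚ.+-identityʳ j) })
      functional (λ { (β , m) m′ → β , m ∙ m′ })
      (λ { (β , m) m′ m″ → K.reflexive (≡.cong (λ { (k , i , j) → τ β i j k }) (∙-assoc m m′ m″)) })

  open MonoidAlg algebra public
  module R = Ring ring
  open R using () renaming (Carrier to Element; _≈_ to _≃_) public

  open R using (_*_; _+_; _-_; -_; _^_; 0#; 1#)

  private
    τ-cong : ∀ β {i i′ j j′ k k′} → i ≡ i′ → j ≡ j′ → k ≡ k′ → τ β i j k ≡ τ β i′ j′ k′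
    τ-cong β ≡.refl ≡.refl ≡.refl = ≡.refl

    mono-cong : ∀ {k k′ : ℤ} {i i′ j j′ : ℕ} → k ≡ k′ → i ≡ i′ → j ≡ j′ → mono (k , i , j) ≃ mono (k′ , i′ , j′)
    mono-cong ≡.refl ≡.refl ≡.refl = R.refl

  ι-^ : ∀ x m → ι (x K.^ m) ≃ ι x ^ m
  ι-^ x zero = ι-1
  ι-^ x (suc m) = R.trans (ι-* _ _) (R.*-congˡ (ι-^ x m))

  ι-neg : ∀ x → ι (K.- x) ≃ - ι x
  ι-neg x = R.sym (R.x-y≈0⇒x≈y _ _ (R.trans (R.sym (⁻¹-∙-commʳ (ι x) (ι (K.- x))))
    (R.trans (R.-‿cong (R.trans (R.sym (ι-+ _ _)) (R.trans (ι-cong (K.-‿inverseʳ x)) ι-0))) R.-0#≈0#)))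
    where
    ⁻¹-∙-commʳ : ∀ x y → - (x + y) ≃ - x - y
    ⁻¹-∙-commʳ x y = R.sym (R.⁻¹-∙-comm x y)

  ev-neg : ∀ i x → ev i (- x) ≈ K.- ev i x
  ev-neg i x = K.begin
    ev i (- x) K.≈⟨ K.solve 2 (λ a b → a K.⊜ (a K.:+ b) K.:- b) K.refl _ (ev i x) ⟩
    (ev i (- x) K.+ ev i x) K.- ev i x K.≈⟨ K.+-congʳ (K.trans (K.sym (ev-+ i _ _)) (K.trans (ev-cong i (R.-‿inverseˡ x)) (ev-0 i))) ⟩
    K.0# K.- ev i x K.≈⟨ K.+-identityˡ _ ⟩
    K.- ev i x K.∎

  ev-ι : ∀ {β} {m : Exponent} x → ev (β , m) (ι x) ≈ x K.* ev (β , m) (mono (+ 0 , 0 , 0))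
  ev-ι x = K.trans (ev-cong _ (R.sym (R.trans (R.*-congˡ mono-ε) (R.*-identityʳ _)))) (ev-ι* _ x _)

  -- The filtration by the pole order at u = 0

  U : ℤ → Element
  U k = mono (k , 0 , 0)

  u u⁻¹ v b : Element
  u = U (+ 1)
  u⁻¹ = U -[1+ 0 ]
  v = mono (+ 0 , 1 , 0)
  b = mono (+ 0 , 0 , 1)

  U-+ : ∀ k k′ → U (k ℤ.+ k′) ≃ U k * U k′
  U-+ k k′ = mono-∙ (k , 0 , 0) (k′ , 0 , 0)

  U-0 : U (+ 0) ≃ 1#
  U-0 = mono-ε

  uu⁻¹ : u * u⁻¹ ≃ 1#
  uu⁻¹ = R.trans (R.sym (U-+ (+ 1) -[1+ 0 ])) U-0

  v^ : ∀ i → v ^ i ≃ mono (+ 0 , i , 0)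
  v^ zero = R.sym mono-ε
  v^ (suc i) = R.trans (R.*-congˡ (v^ i)) (R.sym (mono-∙ (+ 0 , 1 , 0) (+ 0 , i , 0)))

  b^ : ∀ j → b ^ j ≃ mono (+ 0 , 0 , j)
  b^ zero = R.sym mono-ε
  b^ (suc j) = R.trans (R.*-congˡ (b^ j)) (R.sym (mono-∙ (+ 0 , 0 , 1) (+ 0 , 0 , j)))

  mono≃ : ∀ k i j → mono (k , i , j) ≃ U k * (v ^ i * b ^ j)
  mono≃ k i j = R.sym (R.trans (R.*-congˡ (R.trans (R.*-cong (v^ i) (b^ j)) (R.sym (mono-∙ (+ 0 , i , 0) (+ 0 , 0 , j)))))
    (R.trans (R.sym (mono-∙ (k , 0 , 0) (+ 0 , i ℕ.+ 0 , j)))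
      (mono-cong (ℤₚ.+-identityʳ k) (ℕₚ.+-identityʳ i) ≡.refl)))

  -- Equality in the ring means agreement of all translated functionals, so the recursion of the
  -- table becomes a relation between elements.
  v-relation : v ^ d ≃ (u - ι m₀) + ι c * u⁻¹
  v-relation = R.trans (v^ d) (separated λ { (β , k , i , j) → K.begin
    ev (β , k , i , j) (mono (+ 0 , d , 0)) K.≈⟨ ev-mono _ (+ 0 , d , 0) ⟩
    τ β (i ℕ.+ d) (j ℕ.+ 0) (k ℤ.+ + 0)
      K.≡⟨ τ-cong β (ℕₚ.+-comm i d) (ℕₚ.+-identityʳ j) (ℤₚ.+-identityʳ k) ⟩
    τ β (d ℕ.+ i) j k K.≈⟨ τ-step-v β j i k ⟩
    τ β i j (ℤ.suc k) K.- m₀ K.* τ β i j k K.+ c K.* τ β i j (ℤ.pred k)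
      K.≡⟨ ≡.cong₂ K._+_ (≡.cong₂ K._-_ (norm (ℤₚ.+-comm (+ 1) k)) (≡.cong (m₀ K.*_) (norm (≡.sym (ℤₚ.+-identityʳ k)))))
             (≡.cong (c K.*_) (norm (ℤₚ.+-comm -[1+ 0 ] k))) ⟩
    τ β (i ℕ.+ 0) (j ℕ.+ 0) (k ℤ.+ + 1) K.- m₀ K.* τ β (i ℕ.+ 0) (j ℕ.+ 0) (k ℤ.+ + 0)
      K.+ c K.* τ β (i ℕ.+ 0) (j ℕ.+ 0) (k ℤ.+ -[1+ 0 ])
      K.≈⟨ K.+-cong (K.+-cong (ev-mono _ (+ 1 , 0 , 0)) (K.trans (ev-neg _ _) (K.-‿cong (K.trans (ev-ι m₀) (K.*-congˡ (ev-mono _ (+ 0 , 0 , 0)))))))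
             (K.trans (ev-ι* _ c u⁻¹) (K.*-congˡ (ev-mono _ (-[1+ 0 ] , 0 , 0)))) ⟨
      (ev (β , k , i , j) u K.+ ev (β , k , i , j) (- ι m₀)) K.+ ev (β , k , i , j) (ι c * u⁻¹)
        K.≈⟨ K.trans (ev-+ _ _ _) (K.+-congʳ (ev-+ _ _ _)) ⟨
    ev (β , k , i , j) ((u - ι m₀) + ι c * u⁻¹) K.∎ })
    where
    norm : ∀ {β i j k k′} → k ≡ k′ → τ β i j k ≡ τ β (i ℕ.+ 0) (j ℕ.+ 0) k′
    norm {β} {i} {j} eq = τ-cong β (≡.sym (ℕₚ.+-identityʳ i)) (≡.sym (ℕₚ.+-identityʳ j)) eq

  b-relation : b ^ q ≃ b + (ι e - u) * v
  b-relation = R.trans (b^ q) (separated λ { (β , k , i , j) → K.begin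
    ev (β , k , i , j) (mono (+ 0 , 0 , q)) K.≈⟨ ev-mono _ (+ 0 , 0 , q) ⟩
    τ β (i ℕ.+ 0) (j ℕ.+ q) (k ℤ.+ + 0)
      K.≡⟨ τ-cong β (ℕₚ.+-identityʳ i) (ℕₚ.+-comm j q) (ℤₚ.+-identityʳ k) ⟩
    τ β i (q ℕ.+ j) k K.≡⟨ τ-step β i j k ⟩
    τ β i (suc j) k K.+ (e K.* τ β (suc i) j k K.- τ β (suc i) j (ℤ.suc k))
      K.≡⟨ ≡.cong₂ K._+_ (τ-cong β (≡.sym (ℕₚ.+-identityʳ i)) (ℕₚ.+-comm 1 j) (≡.sym (ℤₚ.+-identityʳ k)))
            (≡.cong₂ K._-_ (≡.cong (e K.*_) (τ-cong β (ℕₚ.+-comm 1 i) (≡.sym (ℕₚ.+-identityʳ j)) (≡.sym (ℤₚ.+-identityʳ k))))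
              (τ-cong β (ℕₚ.+-comm 1 i) (≡.sym (ℕₚ.+-identityʳ j)) (ℤₚ.+-comm (+ 1) k))) ⟩
    τ β (i ℕ.+ 0) (j ℕ.+ 1) (k ℤ.+ + 0) K.+
      (e K.* τ β (i ℕ.+ 1) (j ℕ.+ 0) (k ℤ.+ + 0) K.- τ β (i ℕ.+ 1) (j ℕ.+ 0) (k ℤ.+ + 1))
      K.≈⟨ K.+-cong (ev-mono _ (+ 0 , 0 , 1)) (K.+-cong (K.trans (ev-ι* _ e v) (K.*-congˡ (ev-mono _ (+ 0 , 1 , 0))))
             (K.trans (ev-neg _ _) (K.-‿cong (K.trans (ev-cong _ (R.sym (mono-∙ (+ 1 , 0 , 0) (+ 0 , 1 , 0)))) (ev-mono _ (+ 1 , 1 , 0)))))) ⟨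
      ev (β , k , i , j) b K.+ (ev (β , k , i , j) (ι e * v) K.+ ev (β , k , i , j) (- (u * v)))
        K.≈⟨ K.trans (ev-+ _ _ _) (K.+-congˡ (ev-+ _ _ _)) ⟨
      ev (β , k , i , j) (b + (ι e * v - u * v))
        K.≈⟨ ev-cong _ (R.+-congˡ (R.solve 3 (λ e u v → e R.:* v R.:- u R.:* v R.⊜ (e R.:- u) R.:* v) R.refl _ _ _)) ⟩
    ev (β , k , i , j) (b + (ι e - u) * v) K.∎ })

  -- At u = 0 the leading parts of the relations are v^d = c / u and b^q = e v. The place is totally
  -- ramified: b has a simple pole, v a pole of order q and u a zero of order q d.
  order : ℤ → ℕ → ℕ → ℤ
  order k i j = + q ℤ.* + i ℤ.+ + j ℤ.- + q ℤ.* + d ℤ.* k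

  -- Below M is spanned by the monomials whose pole order at the place u = 0 is at most M.
  data Below : ℤ → Element → Set where
    term : ∀ {M} x k i j n → M ≡ order k i j ℤ.+ + n → Below M (ι x * mono (k , i , j))
    zero : ∀ {M} → Below M 0#
    _⊕_ : ∀ {M x y} → Below M x → Below M y → Below M (x + y)
    resp : ∀ {M x y} → x ≃ y → Below M x → Below M y

  weaken : ∀ {M M′ x} n → M′ ≡ M ℤ.+ + n → Below M x → Below M′ x
  weaken n eq (term x k i j m eq′) = term x k i j (m ℕ.+ n)
    (≡.trans eq (≡.trans (≡.cong (ℤ._+ + n) eq′) (ℤₚ.+-assoc (order k i j) (+ m) (+ n))))
  weaken n eq zero = zero
  weaken n eq (B ⊕ B′) = weaken n eq B ⊕ weaken n eq B′
  weaken n eq (resp p B) = resp p (weaken n eq B)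

  private
    order-+ : ∀ k k′ i i′ j j′ n n′ → (order k i j ℤ.+ n) ℤ.+ (order k′ i′ j′ ℤ.+ n′) ≡ order (k ℤ.+ k′) (i ℕ.+ i′) (j ℕ.+ j′) ℤ.+ (n ℤ.+ n′)
    order-+ k k′ i i′ j j′ n n′ = eq (+ q) (+ d) k k′ (+ i) (+ i′) (+ j) (+ j′) n n′
      where
      eq : ∀ Q D k k′ i i′ j j′ n n′ → (Q ℤ.* i ℤ.+ j ℤ.- Q ℤ.* D ℤ.* k ℤ.+ n) ℤ.+ (Q ℤ.* i′ ℤ.+ j′ ℤ.- Q ℤ.* D ℤ.* k′ ℤ.+ n′) ≡
        Q ℤ.* (i ℤ.+ i′) ℤ.+ (j ℤ.+ j′) ℤ.- Q ℤ.* D ℤ.* (k ℤ.+ k′) ℤ.+ (n ℤ.+ n′)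
      eq = solve-∀

  Below-* : ∀ {M M′ x y} → Below M x → Below M′ y → Below (M ℤ.+ M′) (x * y)
  Below-* (term x k i j n eq) (term y k′ i′ j′ n′ eq′) = resp
    (R.trans (R.*-cong (ι-* x y) (mono-∙ (k , i , j) (k′ , i′ , j′)))
      (R.solve 4 (λ x y m n → (x R.:* y) R.:* (m R.:* n) R.⊜ (x R.:* m) R.:* (y R.:* n)) R.refl _ _ _ _))
    (term (x K.* y) (k ℤ.+ k′) (i ℕ.+ i′) (j ℕ.+ j′) (n ℕ.+ n′)
      (≡.trans (≡.cong₂ ℤ._+_ eq eq′) (order-+ k k′ i i′ j j′ (+ n) (+ n′))))
  Below-* (term x k i j n eq) zero = resp (R.sym (R.zeroʳ _)) zero
  Below-* B@(term x k i j n eq) (C ⊕ C′) = resp (R.sym (R.distribˡ _ _ _)) (Below-* B C ⊕ Below-* B C′)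
  Below-* B@(term x k i j n eq) (resp p C) = resp (R.*-congˡ p) (Below-* B C)
  Below-* zero C = resp (R.sym (R.zeroˡ _)) zero
  Below-* (B ⊕ B′) C = resp (R.sym (R.distribʳ _ _ _)) (Below-* B C ⊕ Below-* B′ C)
  Below-* (resp p B) C = resp (R.*-congʳ p) (Below-* B C)

  Below-mono : ∀ k i j → Below (order k i j) (mono (k , i , j))
  Below-mono k i j = resp (R.trans (R.*-congʳ ι-1) (R.*-identityˡ _)) (term K.1# k i j 0 (≡.sym (ℤₚ.+-identityʳ _)))

  Below-≡ : ∀ {M M′ x} → M ≡ M′ → Below M x → Below M′ x
  Below-≡ ≡.refl B = B

  Below-ι : ∀ x → Below (+ 0) (ι x)
  Below-ι x = resp (R.trans (R.*-congˡ mono-ε) (R.*-identityʳ _)) (Below-≡ (eq (+ q) (+ d)) (term x (+ 0) 0 0 0 ≡.refl))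
    where
    eq : ∀ Q D → Q ℤ.* + 0 ℤ.+ + 0 ℤ.- Q ℤ.* D ℤ.* + 0 ℤ.+ + 0 ≡ + 0
    eq = solve-∀

  Below-ι* : ∀ {M} x {y} → Below M y → Below M (ι x * y)
  Below-ι* {M} x B = Below-≡ (ℤₚ.+-identityˡ M) (Below-* (Below-ι x) B)

  Below-neg : ∀ {M x} → Below M x → Below M (- x)
  Below-neg B = resp (R.trans (R.*-congʳ (R.trans (ι-neg K.1#) (R.-‿cong ι-1))) (R.solve 1 (λ x → (R.:- R.con (+ 1)) R.:* x R.⊜ R.:- x) R.refl _))
    (Below-ι* (K.- K.1#) B)

  Below-- : ∀ {M x y} → Below M x → Below M y → Below M (x - y)
  Below-- B C = B ⊕ Below-neg C

  Below-1 : Below (+ 0) 1#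
  Below-1 = resp ι-1 (Below-ι K.1#)

  Below-^ : ∀ {M x} n → Below M x → Below (+ n ℤ.* M) (x ^ n)
  Below-^ zero B = Below-1
  Below-^ {M} (suc n) B = Below-≡ (eq (+ n) M) (Below-* B (Below-^ n B))
    where
    eq : ∀ n M → M ℤ.+ n ℤ.* M ≡ (+ 1 ℤ.+ n) ℤ.* M
    eq = solve-∀

  Below-∑ : ∀ {M} n {f} → (∀ i → i < n → Below M (f i)) → Below M (R.∑ n f)
  Below-∑ zero h = zero
  Below-∑ (suc n) h = Below-∑ n (λ i i<n → h i (ℕₚ.m<n⇒m<1+n i<n)) ⊕ h n (ℕₚ.n<1+n n)

  Below-U : ∀ k → Below (ℤ.- (+ q ℤ.* + d ℤ.* k)) (U k)
  Below-U k = Below-≡ (eq (+ q) (+ d) k) (Below-mono k 0 0)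
    where
    eq : ∀ Q D k → Q ℤ.* + 0 ℤ.+ + 0 ℤ.- Q ℤ.* D ℤ.* k ≡ ℤ.- (Q ℤ.* D ℤ.* k)
    eq = solve-∀

  Below-v : Below (+ q) v
  Below-v = Below-≡ (eq (+ q) (+ d)) (Below-mono (+ 0) 1 0)
    where
    eq : ∀ Q D → Q ℤ.* + 1 ℤ.+ + 0 ℤ.- Q ℤ.* D ℤ.* + 0 ≡ Q
    eq = solve-∀

  Below-b : Below (+ 1) b
  Below-b = Below-≡ (eq (+ q) (+ d)) (Below-mono (+ 0) 0 1)
    where
    eq : ∀ Q D → Q ℤ.* + 0 ℤ.+ + 1 ℤ.- Q ℤ.* D ℤ.* + 0 ≡ + 1
    eq = solve-∀

  -- The residue functional

  δ : ℤ → K.Carrier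
  δ (+ 0) = K.1#
  δ _ = K.0#

  -- The coefficient of u^0 v^(d-1) b^(q-1) in reduced form. It behaves like the residue of x times
  -- a fixed differential: it vanishes on small pole orders at either place.
  ρ : Element → K.Carrier
  ρ = ev (δ , + 0 , 0 , 0)

  ρ-cong : ∀ {x y} → x ≃ y → ρ x ≈ ρ y
  ρ-cong p = ev-cong _ p

  ρ-+ : ∀ x y → ρ (x + y) ≈ ρ x K.+ ρ y
  ρ-+ x y = ev-+ _ x y

  ρ-ι* : ∀ a x → ρ (ι a * x) ≈ a K.* ρ x
  ρ-ι* = ev-ι* _

  ρ-mono : ∀ k i j → ρ (mono (k , i , j)) ≈ τ δ i j k
  ρ-mono k i j = K.trans (ev-mono _ (k , i , j)) (K.reflexive (τ-cong δ ≡.refl ≡.refl (ℤₚ.+-identityˡ k)))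

  -- The order at u = 0 of v^(d-1) b^(q-1), the monomial on which ρ is 1.
  c₀ : ℤ
  c₀ = + q ℤ.* + d ℤ.- + 1

  private
    no-add : ∀ {M : ℤ} n → M ≡ M ℤ.+ + suc n → ⊥
    no-add {M} n eq with ℤₚ.+-injective (≡.trans (≡.trans (≡.sym (ℤₚ.+-inverseˡ M)) (≡.cong (λ z → (ℤ.- M) ℤ.+ z) eq))
                          (≡.trans (≡.sym (ℤₚ.+-assoc (ℤ.- M) M _)) (≡.trans (≡.cong (ℤ._+ + suc n) (ℤₚ.+-inverseˡ M)) (ℤₚ.+-identityˡ _))))
    ... | ()

    vt-vanish : ∀ i k n → order k i (suc q″) ℤ.+ + suc n ≡ c₀ → vt δ i k ≈ K.0#
    vt-vanish = vt-induction (λ i → ∀ k n → order k i (suc q″) ℤ.+ + suc n ≡ c₀ → vt δ i k ≈ K.0#)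
      (λ i i< k n _ → K.reflexive (vt-zero δ i k i<))
      (λ k n eq → K.trans (K.reflexive (vt-base δ k)) (δ-case k n eq))
      (λ i ih k n eq → K.trans (K.reflexive (vt-step δ i k)) (K.trans
        (K.+-cong (K.+-cong (ih (ℤ.suc k) (n ℕ.+ (q ℕ.* d ℕ.+ q ℕ.* d)) (≡.trans (e₁ (+ q) (+ d) k (+ i) (+ suc q″) (+ suc n)) eq))
            (K.-‿cong (K.*-congˡ (ih k (n ℕ.+ q ℕ.* d) (≡.trans (e₂ (+ q) (+ d) k (+ i) (+ suc q″) (+ suc n)) eq)))))
            (K.*-congˡ (ih (ℤ.pred k) n (≡.trans (e₃ (+ q) (+ d) k (+ i) (+ suc q″) (+ suc n)) eq))))
        (K.solve 2 (λ m c → K.con (+ 0) K.:- m K.:* K.con (+ 0) K.:+ c K.:* K.con (+ 0) K.⊜ K.con (+ 0)) K.refl _ _)))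
      where
      δ-case : ∀ k n → order k d″ (suc q″) ℤ.+ + suc n ≡ c₀ → δ k ≈ K.0#
      δ-case (+ 0) n eq = ⊥-elim (no-add n (≡.trans (≡.sym eq) (≡.cong (ℤ._+ + suc n) (e₀ (+ q) (+ d″)))))
        where
        e₀ : ∀ Q D → Q ℤ.* D ℤ.+ (Q ℤ.- + 1) ℤ.- Q ℤ.* (+ 1 ℤ.+ D) ℤ.* + 0 ≡ Q ℤ.* (+ 1 ℤ.+ D) ℤ.- + 1
        e₀ = solve-∀
      δ-case (+ suc _) n eq = K.refl
      δ-case -[1+ _ ] n eq = K.refl
      e₁ : ∀ Q D k i j n → Q ℤ.* i ℤ.+ j ℤ.- Q ℤ.* D ℤ.* (+ 1 ℤ.+ k) ℤ.+ (n ℤ.+ (Q ℤ.* D ℤ.+ Q ℤ.* D)) ≡ Q ℤ.* (D ℤ.+ i) ℤ.+ j ℤ.- Q ℤ.* D ℤ.* k ℤ.+ n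
      e₁ = solve-∀
      e₂ : ∀ Q D k i j n → Q ℤ.* i ℤ.+ j ℤ.- Q ℤ.* D ℤ.* k ℤ.+ (n ℤ.+ Q ℤ.* D) ≡ Q ℤ.* (D ℤ.+ i) ℤ.+ j ℤ.- Q ℤ.* D ℤ.* k ℤ.+ n
      e₂ = solve-∀
      e₃ : ∀ Q D k i j n → Q ℤ.* i ℤ.+ j ℤ.- Q ℤ.* D ℤ.* (ℤ.- + 1 ℤ.+ k) ℤ.+ n ≡ Q ℤ.* (D ℤ.+ i) ℤ.+ j ℤ.- Q ℤ.* D ℤ.* k ℤ.+ n
      e₃ = solve-∀

    -- Reductions never raise the order, and the only reduced monomial seen by δ has order exactly
    -- c₀. The hypothesis says that the order is below c₀, with an explicit slack.
    τ-vanish : ∀ i j k n → order k i j ℤ.+ + suc n ≡ c₀ → τ δ i j k ≈ K.0#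
    τ-vanish = τ-induction (λ i j → ∀ k n → order k i j ℤ.+ + suc n ≡ c₀ → τ δ i j k ≈ K.0#)
      (λ i j j< k n _ → K.reflexive (τ-zero δ i j k j<))
      (λ i k n eq → K.trans (K.reflexive (τ-top δ i k)) (vt-vanish i k n eq))
      (λ i j h₁ h₂ k n eq → K.trans (K.reflexive (τ-step δ i j k)) (K.trans
        (K.+-cong (h₁ k (n ℕ.+ suc q″) (≡.trans (e₁ (+ q) (+ d) k (+ i) (+ j) (+ suc n)) eq))
          (K.+-cong (K.*-congˡ (h₂ k n (≡.trans (e₂ (+ q) (+ d) k (+ i) (+ j) (+ suc n)) eq)))
            (K.-‿cong (h₂ (ℤ.suc k) (n ℕ.+ q ℕ.* d) (≡.trans (e₃ (+ q) (+ d) k (+ i) (+ j) (+ suc n)) eq)))))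
        (K.solve 1 (λ e → K.con (+ 0) K.:+ (e K.:* K.con (+ 0) K.:- K.con (+ 0)) K.⊜ K.con (+ 0)) K.refl _)))
      where
      e₁ : ∀ Q D k i j n → Q ℤ.* i ℤ.+ (+ 1 ℤ.+ j) ℤ.- Q ℤ.* D ℤ.* k ℤ.+ (n ℤ.+ (Q ℤ.- + 1)) ≡ Q ℤ.* i ℤ.+ (Q ℤ.+ j) ℤ.- Q ℤ.* D ℤ.* k ℤ.+ n
      e₁ = solve-∀
      e₂ : ∀ Q D k i j n → Q ℤ.* (+ 1 ℤ.+ i) ℤ.+ j ℤ.- Q ℤ.* D ℤ.* k ℤ.+ n ≡ Q ℤ.* i ℤ.+ (Q ℤ.+ j) ℤ.- Q ℤ.* D ℤ.* k ℤ.+ n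
      e₂ = solve-∀
      e₃ : ∀ Q D k i j n → Q ℤ.* (+ 1 ℤ.+ i) ℤ.+ j ℤ.- Q ℤ.* D ℤ.* (+ 1 ℤ.+ k) ℤ.+ (n ℤ.+ Q ℤ.* D) ≡ Q ℤ.* i ℤ.+ (Q ℤ.+ j) ℤ.- Q ℤ.* D ℤ.* k ℤ.+ n
      e₃ = solve-∀

  ρ-Below : ∀ {M x} n → M ℤ.+ + suc n ≡ c₀ → Below M x → ρ x ≈ K.0#
  ρ-Below n eq (term x k i j m eq′) = K.trans (ρ-ι* x _) (K.trans (K.*-congˡ (K.trans (ρ-mono k i j)
    (τ-vanish i j k (m ℕ.+ n) (≡.trans (eq″ (order k i j) (+ m) (+ n)) (≡.trans (≡.cong (ℤ._+ + suc n) (≡.sym eq′)) eq))))) (K.zeroʳ x))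
    where
    eq″ : ∀ o m n → o ℤ.+ (+ 1 ℤ.+ (m ℤ.+ n)) ≡ o ℤ.+ m ℤ.+ (+ 1 ℤ.+ n)
    eq″ = solve-∀
  ρ-Below n eq zero = ev-0 _
  ρ-Below n eq (_⊕_ {x = x} {y} B C) = K.trans (ρ-+ x y) (K.trans (K.+-cong (ρ-Below n eq B) (ρ-Below n eq C)) (K.+-identityˡ _))
  ρ-Below n eq (resp p B) = K.trans (K.sym (ρ-cong p)) (ρ-Below n eq B)

  -- Leading terms at u = 0

  e⁻¹ c⁻¹ : K.Carrier
  e⁻¹ = inv e e≉0
  c⁻¹ = inv c c≉0

  N₀ : ℕ
  N₀ = q ℕ.* d

  private
    N₀-pos : + N₀ ≡ + q ℤ.* + d
    N₀-pos = ℤₚ.pos-* q d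

  -- x has pole order exactly M at u = 0, with the leading monomial written as a multiple of u^k b^E.
  record Lead (M : ℤ) (x : Element) : Set where
    constructor lead
    field
      {coeff} : K.Carrier
      {k} : ℤ
      {E} : ℕ
      coeff≉0 : ¬ coeff ≈ K.0#
      order≡ : M ≡ order k 0 E
      rest : Below (M ℤ.- + 1) (x - ι coeff * mono (k , 0 , E))

  private
    leading-Below : ∀ {M k E} x → M ≡ order k 0 E → Below M (ι x * mono (k , 0 , E))
    leading-Below {k = k} {E} x eq = Below-≡ (≡.sym eq) (Below-ι* x (Below-mono k 0 E))

    up : ∀ {M x} → Below (M ℤ.- + 1) x → Below M x
    up {M} = weaken 1 (eq M)
      where
      eq : ∀ M → M ≡ M ℤ.- + 1 ℤ.+ + 1
      eq = solve-∀

    restore : ∀ x y → y + (x - y) ≃ x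
    restore = R.solve 2 (λ x y → y R.:+ (x R.:- y) R.⊜ x) R.refl

  Lead⇒Below : ∀ {M x} → Lead M x → Below M x
  Lead⇒Below (lead {a} a≉0 eq B) = resp (restore _ _) (leading-Below a eq ⊕ up B)

  Lead-≃ : ∀ {M x y} → x ≃ y → Lead M x → Lead M y
  Lead-≃ p (lead a≉0 eq B) = lead a≉0 eq (resp (R.+-congʳ p) B)

  Lead-≡ : ∀ {M M′ x} → M ≡ M′ → Lead M x → Lead M′ x
  Lead-≡ ≡.refl L = L

  Lead-+ : ∀ {M x y} → Lead M x → Below (M ℤ.- + 1) y → Lead M (x + y)
  Lead-+ (lead a≉0 eq B) C = lead a≉0 eq (resp (R.solve 3 (λ x y z → (x R.:- z) R.:+ y R.⊜ (x R.:+ y) R.:- z) R.refl _ _ _) (B ⊕ C))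

  Lead-- : ∀ {M x y} → Lead M x → Below (M ℤ.- + 1) y → Lead M (x - y)
  Lead-- L C = Lead-+ L (Below-neg C)

  Lead-* : ∀ {M M′ x y} → Lead M x → Lead M′ y → Lead (M ℤ.+ M′) (x * y)
  Lead-* {M} {M′} {x} {y} Lx@(lead {a} {k} {E} a≉0 eq B) Ly@(lead {a′} {k′} {E′} a′≉0 eq′ B′) =
    lead {coeff = a K.* a′} {k = k ℤ.+ k′} {E = E ℕ.+ E′} (*≉0 a≉0 a′≉0)
      (≡.trans (≡.cong₂ ℤ._+_ eq eq′) (order-sum (+ q) (+ d) k k′ (+ E) (+ E′)))
      (resp difference
        (Below-≡ (e₁ M M′) (Below-* B (Lead⇒Below Ly)) ⊕ Below-≡ (e₂ M M′) (Below-* (leading-Below a eq) B′)))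
    where
    order-sum : ∀ Q D k k′ j j′ → (Q ℤ.* + 0 ℤ.+ j ℤ.- Q ℤ.* D ℤ.* k) ℤ.+ (Q ℤ.* + 0 ℤ.+ j′ ℤ.- Q ℤ.* D ℤ.* k′) ≡
      Q ℤ.* + 0 ℤ.+ (j ℤ.+ j′) ℤ.- Q ℤ.* D ℤ.* (k ℤ.+ k′)
    order-sum = solve-∀
    e₁ : ∀ M M′ → M ℤ.- + 1 ℤ.+ M′ ≡ M ℤ.+ M′ ℤ.- + 1
    e₁ = solve-∀
    e₂ : ∀ M M′ → M ℤ.+ (M′ ℤ.- + 1) ≡ M ℤ.+ M′ ℤ.- + 1
    e₂ = solve-∀
    t = mono (k , 0 , E)
    t′ = mono (k′ , 0 , E′)
    difference : (x - ι a * t) * y + (ι a * t) * (y - ι a′ * t′) ≃ x * y - ι (a K.* a′) * mono (k ℤ.+ k′ , 0 , E ℕ.+ E′)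
    difference = R.trans
      (R.solve 6 (λ x y a t a′ t′ → (x R.:- a R.:* t) R.:* y R.:+ (a R.:* t) R.:* (y R.:- a′ R.:* t′) R.⊜
        x R.:* y R.:- (a R.:* a′) R.:* (t R.:* t′)) R.refl _ _ _ _ _ _)
      (R.+-congˡ (R.-‿cong (R.sym (R.*-cong (ι-* a a′) (mono-∙ (k , 0 , E) (k′ , 0 , E′))))))

  Lead-ι : ∀ {a} → ¬ a ≈ K.0# → Lead (+ 0) (ι a)
  Lead-ι {a} a≉0 = lead {coeff = a} {k = + 0} {E = 0} a≉0 (≡.sym (eq (+ q) (+ d)))
    (resp (R.sym (R.trans (R.+-congˡ (R.-‿cong (R.trans (R.*-congˡ mono-ε) (R.*-identityʳ _)))) (R.-‿inverseʳ _))) zero)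
    where
    eq : ∀ Q D → Q ℤ.* + 0 ℤ.+ + 0 ℤ.- Q ℤ.* D ℤ.* + 0 ≡ + 0
    eq = solve-∀

  Lead-1 : Lead (+ 0) 1#
  Lead-1 = Lead-≃ ι-1 (Lead-ι 1≉0)

  Lead-^ : ∀ {M x} n → Lead M x → Lead (+ n ℤ.* M) (x ^ n)
  Lead-^ zero L = Lead-1
  Lead-^ {M} (suc n) L = Lead-≡ (eq (+ n) M) (Lead-* L (Lead-^ n L))
    where
    eq : ∀ n M → M ℤ.+ n ℤ.* M ≡ (+ 1 ℤ.+ n) ℤ.* M
    eq = solve-∀

  Lead-mono : ∀ k E → Lead (order k 0 E) (mono (k , 0 , E))
  Lead-mono k E = lead {coeff = K.1#} {k = k} {E = E} 1≉0 ≡.refl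
    (resp (R.sym (R.trans (R.+-congˡ (R.-‿cong (R.trans (R.*-congʳ ι-1) (R.*-identityˡ _)))) (R.-‿inverseʳ _))) zero)

  Lead-U : ∀ k → Lead (ℤ.- (+ q ℤ.* + d ℤ.* k)) (U k)
  Lead-U k = Lead-≡ (eq (+ q) (+ d) k) (Lead-mono k 0)
    where
    eq : ∀ Q D k → Q ℤ.* + 0 ℤ.+ + 0 ℤ.- Q ℤ.* D ℤ.* k ≡ ℤ.- (Q ℤ.* D ℤ.* k)
    eq = solve-∀

  Lead-b : Lead (+ 1) b
  Lead-b = Lead-≡ (eq (+ q) (+ d)) (Lead-mono (+ 0) 1)
    where
    eq : ∀ Q D → Q ℤ.* + 0 ℤ.+ + 1 ℤ.- Q ℤ.* D ℤ.* + 0 ≡ + 1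
    eq = solve-∀

  private
    Below-u : Below (ℤ.- (+ q ℤ.* + d)) u
    Below-u = Below-≡ (eq (+ q) (+ d)) (Below-U (+ 1))
      where
      eq : ∀ Q D → ℤ.- (Q ℤ.* D ℤ.* + 1) ≡ ℤ.- (Q ℤ.* D)
      eq = solve-∀

    ι-inverse : ∀ {x y} → x K.* y ≈ K.1# → ι y * ι x ≃ 1#
    ι-inverse xy = R.trans (R.sym (ι-* _ _)) (R.trans (ι-cong (K.trans (K.*-comm _ _) xy)) ι-1)

    pred-N₀ : ℕ
    pred-N₀ = d″ ℕ.+ suc q″ ℕ.* d

    pred-N₀-pos : + pred-N₀ ≡ + q ℤ.* + d ℤ.- + 1
    pred-N₀-pos = ≡.trans (eq₁ (+ pred-N₀)) (≡.cong (ℤ._- + 1) N₀-pos)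
      where
      eq₁ : ∀ x → x ≡ + 1 ℤ.+ x ℤ.- + 1
      eq₁ = solve-∀

  -- The relation for b, solved for e v, gives b^q plus terms of smaller order; this is where e is
  -- inverted.
  Lead-v : Lead (+ q) v
  Lead-v = lead {coeff = e⁻¹} {k = + 0} {E = q} (inv≉0 e e≉0) (≡.sym (eq (+ q) (+ d)))
    (resp difference (Below-- (Below-ι* e⁻¹ (weaken pred-N₀ e₁ (Below-* Below-u Below-v)))
                              (Below-ι* e⁻¹ (weaken q″ (e₂ (+ q″)) Below-b))))
    where
    eq : ∀ Q D → Q ℤ.* + 0 ℤ.+ Q ℤ.- Q ℤ.* D ℤ.* + 0 ≡ Q
    eq = solve-∀
    e₁ : + q ℤ.- + 1 ≡ (ℤ.- (+ q ℤ.* + d) ℤ.+ + q) ℤ.+ + pred-N₀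
    e₁ = ≡.trans (eq′ (+ q) (+ q ℤ.* + d)) (≡.cong (λ z → (ℤ.- (+ q ℤ.* + d) ℤ.+ + q) ℤ.+ z) (≡.sym pred-N₀-pos))
      where
      eq′ : ∀ Q X → Q ℤ.- + 1 ≡ (ℤ.- X ℤ.+ Q) ℤ.+ (X ℤ.- + 1)
      eq′ = solve-∀
    e₂ : ∀ x → (+ 2 ℤ.+ x) ℤ.- + 1 ≡ + 1 ℤ.+ x
    e₂ = solve-∀
    difference : ι e⁻¹ * (u * v) - ι e⁻¹ * b ≃ v - ι e⁻¹ * mono (+ 0 , 0 , q)
    difference = R.begin
      ι e⁻¹ * (u * v) - ι e⁻¹ * b
        R.≈⟨ R.solve 5 (λ e′ e u v b → e′ R.:* (u R.:* v) R.:- e′ R.:* b R.⊜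
               (e′ R.:* e) R.:* v R.:- e′ R.:* (b R.:+ (e R.:- u) R.:* v)) R.refl (ι e⁻¹) (ι e) u v b ⟩
      (ι e⁻¹ * ι e) * v - ι e⁻¹ * (b + (ι e - u) * v)
        R.≈⟨ R.+-cong (R.trans (R.*-congʳ (ι-inverse (inv-inverse e e≉0))) (R.*-identityˡ v))
               (R.-‿cong (R.*-congˡ (R.trans (R.sym b-relation) (b^ q)))) ⟩
      v - ι e⁻¹ * mono (+ 0 , 0 , q) R.∎

  -- The leading coefficient of u⁻¹ as a multiple of b^(q d), from u⁻¹ = c⁻¹ v^d + ... and v = e⁻¹
  -- b^q + ....
  κ : K.Carrier
  κ = c⁻¹ K.* e⁻¹ K.^ d

  κ≉0 : ¬ κ ≈ K.0#
  κ≉0 = *≉0 (inv≉0 c c≉0) (^≉0 d (inv≉0 e e≉0))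

  private
    power : ∀ n {M x a E} → Below (+ E) x → M ≡ + E → Below (M ℤ.- + 1) (x - ι a * mono (+ 0 , 0 , E)) →
            Below (+ (n ℕ.* E) ℤ.- + 1) (x ^ n - ι (a K.^ n) * mono (+ 0 , 0 , n ℕ.* E))
    power zero _ _ _ = resp (R.sym (R.trans (R.+-congˡ (R.-‿cong (R.trans (R.*-cong ι-1 mono-ε) (R.*-identityˡ _)))) (R.-‿inverseʳ _))) zero
    power (suc n) {x = x} {a} {E} Bx ≡.refl B = resp
      (R.trans (R.solve 6 (λ x y a t a′ t′ → (x R.:- a R.:* t) R.:* y R.:+ (a R.:* t) R.:* (y R.:- a′ R.:* t′) R.⊜
        x R.:* y R.:- (a R.:* a′) R.:* (t R.:* t′)) R.refl _ _ _ _ _ _)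
        (R.+-congˡ (R.-‿cong (R.sym (R.*-cong (ι-* a (a K.^ n)) (mono-∙ (+ 0 , 0 , E) (+ 0 , 0 , n ℕ.* E)))))))
      (Below-≡ (e₁ (+ E) (+ (n ℕ.* E))) (Below-* B (resp (restore _ _) (lower ⊕ up (power n Bx ≡.refl B)))) ⊕
       Below-≡ (e₂ (+ E) (+ (n ℕ.* E))) (Below-* (Below-ι* a (Below-≡ (at-0 E) (Below-mono (+ 0) 0 E))) (power n Bx ≡.refl B)))
      where
      at-0 : ∀ E → order (+ 0) 0 E ≡ + E
      at-0 E = eq (+ q) (+ d) (+ E)
        where
        eq : ∀ Q D j → Q ℤ.* + 0 ℤ.+ j ℤ.- Q ℤ.* D ℤ.* + 0 ≡ j
        eq = solve-∀
      lower : Below (+ (n ℕ.* E)) (ι (a K.^ n) * mono (+ 0 , 0 , n ℕ.* E))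
      lower = Below-ι* _ (Below-≡ (at-0 (n ℕ.* E)) (Below-mono (+ 0) 0 (n ℕ.* E)))
      e₁ : ∀ E X → E ℤ.- + 1 ℤ.+ X ≡ E ℤ.+ X ℤ.- + 1
      e₁ = solve-∀
      e₂ : ∀ E X → E ℤ.+ (X ℤ.- + 1) ≡ E ℤ.+ X ℤ.- + 1
      e₂ = solve-∀

  u⁻¹-leading : Below (+ (d ℕ.* q) ℤ.- + 1) (u⁻¹ - ι κ * mono (+ 0 , 0 , d ℕ.* q))
  u⁻¹-leading = resp difference (Below-- (Below-ι* c⁻¹ (power d Below-v ≡.refl (Lead.rest Lead-v)))
      (Below-ι* c⁻¹ (Below-- (weaken (pred-N₀ ℕ.+ N₀) e₁ Below-u) (weaken pred-N₀ e₂ (Below-ι m₀)))))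
    where
    dq : + (d ℕ.* q) ≡ + q ℤ.* + d
    dq = ≡.trans (≡.cong +_ (ℕₚ.*-comm d q)) N₀-pos
    e₁ : + (d ℕ.* q) ℤ.- + 1 ≡ ℤ.- (+ q ℤ.* + d) ℤ.+ + (pred-N₀ ℕ.+ N₀)
    e₁ = ≡.trans (≡.cong (ℤ._- + 1) dq) (≡.trans (eq (+ q ℤ.* + d)) (≡.cong₂ (λ x y → ℤ.- (+ q ℤ.* + d) ℤ.+ (x ℤ.+ y)) (≡.sym pred-N₀-pos) (≡.sym N₀-pos)))
      where
      eq : ∀ X → X ℤ.- + 1 ≡ ℤ.- X ℤ.+ ((X ℤ.- + 1) ℤ.+ X)
      eq = solve-∀
    e₂ : + (d ℕ.* q) ℤ.- + 1 ≡ + 0 ℤ.+ + pred-N₀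
    e₂ = ≡.trans (≡.cong (ℤ._- + 1) dq) (≡.trans (≡.sym pred-N₀-pos) (≡.sym (ℤₚ.+-identityˡ _)))
    difference : ι c⁻¹ * (v ^ d - ι (e⁻¹ K.^ d) * mono (+ 0 , 0 , d ℕ.* q)) - ι c⁻¹ * (u - ι m₀) ≃ u⁻¹ - ι κ * mono (+ 0 , 0 , d ℕ.* q)
    difference = R.begin
      ι c⁻¹ * (v ^ d - ι (e⁻¹ K.^ d) * t) - ι c⁻¹ * (u - ι m₀)
        R.≈⟨ R.+-congʳ (R.*-congˡ (R.+-congʳ v-relation)) ⟩
      ι c⁻¹ * (((u - ι m₀) + ι c * u⁻¹) - ι (e⁻¹ K.^ d) * t) - ι c⁻¹ * (u - ι m₀)
        R.≈⟨ R.solve 6 (λ c′ u c w e t → c′ R.:* ((u R.:+ c R.:* w) R.:- e R.:* t) R.:- c′ R.:* u R.⊜ (c′ R.:* c) R.:* w R.:- (c′ R.:* e) R.:* t)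
             R.refl (ι c⁻¹) (u - ι m₀) (ι c) u⁻¹ (ι (e⁻¹ K.^ d)) t ⟩
      (ι c⁻¹ * ι c) * u⁻¹ - (ι c⁻¹ * ι (e⁻¹ K.^ d)) * t
        R.≈⟨ R.+-cong (R.trans (R.*-congʳ (ι-inverse (inv-inverse c c≉0))) (R.*-identityˡ _)) (R.-‿cong (R.*-congʳ (R.sym (ι-* _ _)))) ⟩
      u⁻¹ - ι κ * t R.∎
      where t = mono (+ 0 , 0 , d ℕ.* q)

  weaken-≤ : ∀ {M M′ x} → M ℤ.≤ M′ → Below M x → Below M′ x
  weaken-≤ M≤M′ B with ≤-difference M≤M′
  ... | n , eq = weaken n eq B

  ρ-Below-< : ∀ {M x} → M ℤ.< c₀ → Below M x → ρ x ≈ K.0#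
  ρ-Below-< {M} M<c₀ B with ≤-difference (ℤₚ.i<j⇒suc[i]≤j M<c₀)
  ... | n , eq = ρ-Below n (≡.trans (shift M (+ n)) (≡.sym eq)) B
    where
    shift : ∀ M n → M ℤ.+ (+ 1 ℤ.+ n) ≡ (+ 1 ℤ.+ M) ℤ.+ n
    shift = solve-∀

  private
    dq : + (d ℕ.* q) ≡ + q ℤ.* + d
    dq = ≡.trans (≡.cong +_ (ℕₚ.*-comm d q)) (ℤₚ.pos-* q d)

    mono-≡ : ∀ {k k′ E E′} → k ≡ k′ → E ≡ E′ → mono (k , 0 , E) ≃ mono (k′ , 0 , E′)
    mono-≡ ≡.refl ≡.refl = R.refl

    -- The monomial u^k b^E after m factors u⁻¹ have been traded for b^(q d): the order stays, the
    -- exponent of u grows by m.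
    raised : ℤ → ℕ → ℕ → Element
    raised k E m = mono (k ℤ.+ + m , 0 , E ℕ.+ m ℕ.* (d ℕ.* q))

    raised-suc : ∀ k E m → raised k E m - ι κ * raised k E (suc m) ≃
      mono (k ℤ.+ + suc m , 0 , E ℕ.+ m ℕ.* (d ℕ.* q)) * (u⁻¹ - ι κ * mono (+ 0 , 0 , d ℕ.* q))
    raised-suc k E m = R.sym (R.trans
      (R.solve 4 (λ t w κ s → t R.:* (w R.:- κ R.:* s) R.⊜ t R.:* w R.:- κ R.:* (t R.:* s)) R.refl _ _ _ _)
      (R.+-cong (R.trans (R.sym (mono-∙ (k ℤ.+ + suc m , 0 , E ℕ.+ m ℕ.* (d ℕ.* q)) (-[1+ 0 ] , 0 , 0)))
          (mono-≡ (eq k (+ m)) (ℕₚ.+-identityʳ _)))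
        (R.-‿cong (R.*-congˡ (R.trans (R.sym (mono-∙ (k ℤ.+ + suc m , 0 , E ℕ.+ m ℕ.* (d ℕ.* q)) (+ 0 , 0 , d ℕ.* q)))
          (mono-≡ (ℤₚ.+-identityʳ _) (≡.trans (ℕₚ.+-assoc E _ _) (≡.cong (E ℕ.+_) (ℕₚ.+-comm (m ℕ.* (d ℕ.* q)) (d ℕ.* q))))))))))
      where
      eq : ∀ k m → k ℤ.+ (+ 1 ℤ.+ m) ℤ.- + 1 ≡ k ℤ.+ m
      eq = solve-∀

    order-raised : ∀ k E m → order (k ℤ.+ + m) 0 (E ℕ.+ m ℕ.* (d ℕ.* q)) ≡ order k 0 E
    order-raised k E m = ≡.trans
      (≡.cong (λ z → + q ℤ.* + 0 ℤ.+ (+ E ℤ.+ z) ℤ.- + q ℤ.* + d ℤ.* (k ℤ.+ + m)) (≡.trans (ℤₚ.pos-* m (d ℕ.* q)) (≡.cong (+ m ℤ.*_) dq)))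
      (eq (+ q) (+ d) k (+ E) (+ m))
      where
      eq : ∀ Q D k E m → Q ℤ.* + 0 ℤ.+ (E ℤ.+ m ℤ.* (Q ℤ.* D)) ℤ.- Q ℤ.* D ℤ.* (k ℤ.+ m) ≡ Q ℤ.* + 0 ℤ.+ E ℤ.- Q ℤ.* D ℤ.* k
      eq = solve-∀

    order-half : ∀ k E m → order (k ℤ.+ + suc m) 0 (E ℕ.+ m ℕ.* (d ℕ.* q)) ℤ.+ (+ (d ℕ.* q) ℤ.- + 1) ≡ order k 0 E ℤ.- + 1
    order-half k E m = ≡.trans
      (≡.cong₂ (λ z w → + q ℤ.* + 0 ℤ.+ (+ E ℤ.+ z) ℤ.- + q ℤ.* + d ℤ.* (k ℤ.+ + suc m) ℤ.+ (w ℤ.- + 1)) (≡.trans (ℤₚ.pos-* m (d ℕ.* q)) (≡.cong (+ m ℤ.*_) dq)) dq)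
      (eq (+ q) (+ d) k (+ E) (+ m))
      where
      eq : ∀ Q D k E m → Q ℤ.* + 0 ℤ.+ (E ℤ.+ m ℤ.* (Q ℤ.* D)) ℤ.- Q ℤ.* D ℤ.* (k ℤ.+ (+ 1 ℤ.+ m)) ℤ.+ (Q ℤ.* D ℤ.- + 1) ≡ Q ℤ.* + 0 ℤ.+ E ℤ.- Q ℤ.* D ℤ.* k ℤ.- + 1
      eq = solve-∀

    raise : ∀ k E m → Below (order k 0 E ℤ.- + 1) (mono (k , 0 , E) - ι (κ K.^ m) * raised k E m)
    raise k E zero = resp (R.sym (R.trans (R.+-congˡ (R.-‿cong (R.trans (R.*-congʳ ι-1) (R.trans (R.*-identityˡ _)
      (mono-≡ (ℤₚ.+-identityʳ k) (ℕₚ.+-identityʳ E)))))) (R.-‿inverseʳ _))) zero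
    raise k E (suc m) = resp
      (R.trans (R.solve 5 (λ t κm s κ s′ → (t R.:- κm R.:* s) R.:+ κm R.:* (s R.:- κ R.:* s′) R.⊜ t R.:- (κ R.:* κm) R.:* s′) R.refl _ _ _ _ _)
        (R.+-congˡ (R.-‿cong (R.*-congʳ (R.sym (ι-* κ (κ K.^ m)))))))
      (raise k E m ⊕ Below-ι* (κ K.^ m) (resp (R.sym (raised-suc k E m))
        (Below-≡ (order-half k E m) (Below-* (Below-mono (k ℤ.+ + suc m) 0 (E ℕ.+ m ℕ.* (d ℕ.* q))) u⁻¹-leading))))

  Comparable : ℤ → Element → Element → Set
  Comparable M x y = ∃ λ μ → ¬ μ ≈ K.0# × Below (M ℤ.- + 1) (x - ι μ * y)

  private
    compare-≤ : ∀ {M x y} (L : Lead M x) (L′ : Lead M y) → Lead.k L ℤ.≤ Lead.k L′ → Comparable M x y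
    compare-≤ {M} {x} {y} (lead {a} {k} {E} a≉0 eq B) (lead {a′} {k′} {E′} a′≉0 eq′ B′) k≤k′
      with ≤-difference k≤k′
    ... | m , ≡.refl = μ , *≉0 (*≉0 a≉0 (^≉0 m κ≉0)) (inv≉0 a′ a′≉0) , resp difference
        ((B ⊕ Below-ι* a (Below-≡ (≡.cong (ℤ._- + 1) (≡.sym eq)) (raise k E m))) ⊕ Below-neg (Below-ι* μ B′))
      where
      μ = (a K.* κ K.^ m) K.* inv a′ a′≉0
      E′≡ : E′ ≡ E ℕ.+ m ℕ.* (d ℕ.* q)
      E′≡ = ℤₚ.+-injective (≡.trans (out (+ q) (+ q ℤ.* + d ℤ.* (k ℤ.+ + m)) (+ E′)) (≡.trans
        (≡.cong (λ z → z ℤ.+ + q ℤ.* + d ℤ.* (k ℤ.+ + m)) (≡.trans (≡.sym eq′) (≡.trans eq (≡.sym (order-raised k E m)))))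
        (≡.sym (out (+ q) (+ q ℤ.* + d ℤ.* (k ℤ.+ + m)) _))))
        where
        out : ∀ Q X E → E ≡ Q ℤ.* + 0 ℤ.+ E ℤ.- X ℤ.+ X
        out = solve-∀
      t′ = raised k E m
      t = mono (k , 0 , E)
      μa′ : ι μ * ι a′ ≃ ι a * ι (κ K.^ m)
      μa′ = R.trans (R.sym (ι-* _ _)) (R.trans (ι-cong (K.trans (K.*-assoc _ _ _)
        (K.trans (K.*-congˡ (K.trans (K.*-comm _ _) (inv-inverse a′ a′≉0))) (K.*-identityʳ _)))) (ι-* _ _))
      difference : ((x - ι a * t) + ι a * (t - ι (κ K.^ m) * t′)) - ι μ * (y - ι a′ * mono (k ℤ.+ + m , 0 , E′)) ≃ x - ι μ * y
      difference = R.begin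
        ((x - ι a * t) + ι a * (t - ι (κ K.^ m) * t′)) - ι μ * (y - ι a′ * mono (k ℤ.+ + m , 0 , E′))
          R.≈⟨ R.+-congˡ (R.-‿cong (R.*-congˡ (R.+-congˡ (R.-‿cong (R.*-congˡ (mono-≡ ≡.refl E′≡)))))) ⟩
        ((x - ι a * t) + ι a * (t - ι (κ K.^ m) * t′)) - ι μ * (y - ι a′ * t′)
          R.≈⟨ R.solve 8 (λ x a t κ t′ μ y a′ → ((x R.:- a R.:* t) R.:+ a R.:* (t R.:- κ R.:* t′)) R.:- μ R.:* (y R.:- a′ R.:* t′) R.⊜
               (x R.:- μ R.:* y) R.:+ (μ R.:* a′ R.:- a R.:* κ) R.:* t′) R.refl x (ι a) t (ι (κ K.^ m)) t′ (ι μ) y (ι a′) ⟩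
        (x - ι μ * y) + (ι μ * ι a′ - ι a * ι (κ K.^ m)) * t′
          R.≈⟨ R.+-congˡ (R.trans (R.*-congʳ (R.x≈y⇒x-y≈0 μa′)) (R.zeroˡ t′)) ⟩
        (x - ι μ * y) + 0# R.≈⟨ R.+-identityʳ _ ⟩
        x - ι μ * y R.∎

  -- Raising the smaller exponent of u to the larger one makes leading monomials of equal order
  -- coincide, so each graded piece of the filtration is a line.
  Lead-compare : ∀ {M x y} → Lead M x → Lead M y → Comparable M x y
  Lead-compare {M} {x} {y} L L′ with ℤₚ.≤-total (Lead.k L) (Lead.k L′)
  ... | inj₁ le = compare-≤ L L′ le
  ... | inj₂ ge with compare-≤ L′ L ge
  ...   | μ , μ≉0 , B = inv μ μ≉0 , inv≉0 μ μ≉0 , resp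
    (R.begin
      - (ι (inv μ μ≉0) * (y - ι μ * x))
        R.≈⟨ R.solve 4 (λ w y μ x → R.:- (w R.:* (y R.:- μ R.:* x)) R.⊜ (μ R.:* w) R.:* x R.:- w R.:* y) R.refl (ι (inv μ μ≉0)) y (ι μ) x ⟩
      (ι μ * ι (inv μ μ≉0)) * x - ι (inv μ μ≉0) * y
        R.≈⟨ R.+-congʳ (R.trans (R.*-congʳ (R.trans (R.sym (ι-* _ _)) (R.trans (ι-cong (inv-inverse μ μ≉0)) ι-1))) (R.*-identityˡ x)) ⟩
      x - ι (inv μ μ≉0) * y R.∎)
    (Below-neg (Below-ι* (inv μ μ≉0) B))

  Lead-monomial : ∀ k i j → Lead (order k i j) (mono (k , i , j))
  Lead-monomial k i j = Lead-≡ (eq (+ q) (+ d) k (+ i) (+ j))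
    (Lead-≃ (R.sym (mono≃ k i j)) (Lead-* (Lead-U k) (Lead-* (Lead-^ i Lead-v) (Lead-^ j Lead-b))))
    where
    eq : ∀ Q D k i j → ℤ.- (Q ℤ.* D ℤ.* k) ℤ.+ (i ℤ.* Q ℤ.+ j ℤ.* + 1) ≡ Q ℤ.* i ℤ.+ j ℤ.- Q ℤ.* D ℤ.* k
    eq = solve-∀

  ρ-difference : ∀ {M} x μ y → M ℤ.< c₀ → Below M (x - ι μ * y) → ρ x ≈ μ K.* ρ y
  ρ-difference x μ y M< B = K.begin
    ρ x K.≈⟨ ρ-cong (R.solve 2 (λ x z → x R.⊜ (x R.:- z) R.:+ z) R.refl x (ι μ * y)) ⟩
    ρ ((x - ι μ * y) + ι μ * y) K.≈⟨ ρ-+ _ _ ⟩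
    ρ (x - ι μ * y) K.+ ρ (ι μ * y) K.≈⟨ K.+-cong (ρ-Below-< M< B) (ρ-ι* μ y) ⟩
    K.0# K.+ μ K.* ρ y K.≈⟨ K.+-identityˡ _ ⟩
    μ K.* ρ y K.∎

  pred-< : ∀ M → M ℤ.- + 1 ℤ.< M
  pred-< M = ≡.subst (λ z → M ℤ.- + 1 ℤ.< z) (eq M) (ℤₚ.suc[i]≤j⇒i<j ℤₚ.≤-refl)
    where
    eq : ∀ M → + 1 ℤ.+ (M ℤ.- + 1) ≡ M
    eq = solve-∀

  private
    top : Element
    top = mono (+ 0 , d″ , suc q″)

    top-Lead : Lead c₀ top
    top-Lead = Lead-≡ (eq (+ q) (+ d″)) (Lead-monomial (+ 0) d″ (suc q″))
      where
      eq : ∀ Q D → Q ℤ.* D ℤ.+ (Q ℤ.- + 1) ℤ.- Q ℤ.* (+ 1 ℤ.+ D) ℤ.* + 0 ≡ Q ℤ.* (+ 1 ℤ.+ D) ℤ.- + 1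
      eq = solve-∀

    ρ-top : ρ top ≈ K.1#
    ρ-top = K.trans (ρ-mono (+ 0) d″ (suc q″)) (K.reflexive (≡.trans (τ-top δ d″ (+ 0)) (vt-base δ (+ 0))))

  -- In order c₀ every leading term is a nonzero multiple of that of `top`, and ρ ignores what lies
  -- below.
  ρ-Lead : ∀ {x} → Lead c₀ x → ¬ ρ x ≈ K.0#
  ρ-Lead {x} L ρx≈0 = let μ , μ≉0 , B = Lead-compare L top-Lead in μ≉0 (K.begin
    μ K.≈⟨ K.*-identityʳ μ ⟨
    μ K.* K.1# K.≈⟨ K.*-congˡ ρ-top ⟨
    μ K.* ρ top K.≈⟨ ρ-difference x μ top (pred-< c₀) B ⟨
    ρ x K.≈⟨ ρx≈0 ⟩
    K.0# K.∎)

  -- Nondegeneracy of the residue functional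

  ev-nil : ∀ i → ev i nil ≈ K.0#
  ev-nil i = K.trans (ev-cong i nil≈0) (ev-0 i)

  ev-cons : ∀ β k i j a k′ i′ j′ z → ev (β , k , i , j) (cons a (k′ , i′ , j′) z) ≈
    a K.* τ β (i ℕ.+ i′) (j ℕ.+ j′) (k ℤ.+ k′) K.+ ev (β , k , i , j) z
  ev-cons β k i j a k′ i′ j′ z = K.trans (ev-cong _ (cons≈ a (k′ , i′ , j′) z)) (K.trans (ev-+ _ _ _)
    (K.+-congʳ (K.trans (ev-ι* _ a _) (K.*-congˡ (ev-mono _ (k′ , i′ , j′))))))

  private
    module _ (β : ℤ → K.Carrier) where
      -- Reduction is linear over F[u, u⁻¹], so the functional of β is the convolution of β with the
      -- functional of δ; W truncates it.
      conv : ℕ → (ℤ → K.Carrier) → ℤ → K.Carrier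
      conv W f k = K.⨁ W (λ l → β l K.* f (k ℤ.- l))

      conv-0 : ∀ W {f} k → (∀ k → f k ≈ K.0#) → conv W f k ≈ K.0#
      conv-0 W k h = K.⨁-zero W λ l _ → K.trans (K.*-congˡ (h _)) (K.zeroʳ _)

      conv-cong : ∀ W {f g} k → (∀ k → f k ≈ g k) → conv W f k ≈ conv W g k
      conv-cong W k h = K.⨁-cong W λ l _ → K.*-congˡ (h _)

      conv-+ : ∀ W f g k → conv W (λ k → f k K.+ g k) k ≈ conv W f k K.+ conv W g k
      conv-+ W f g k = K.trans (K.⨁-cong W λ l _ → K.distribˡ _ _ _) (K.⨁-+ W _ _)

      conv-* : ∀ W x f k → conv W (λ k → x K.* f k) k ≈ x K.* conv W f k
      conv-* W x f k = K.trans (K.⨁-cong W λ l _ → K.solve 3 (λ b x f → b K.:* (x K.:* f) K.⊜ x K.:* (b K.:* f)) K.refl _ _ _) (K.⨁-*ˡ W x _)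

      conv-- : ∀ W f g k → conv W (λ k → f k K.- g k) k ≈ conv W f k K.- conv W g k
      conv-- W f g k = K.trans (conv-+ W f (λ k → K.- g k) k) (K.+-congˡ (K.trans
        (conv-cong W k λ k → K.solve 1 (λ x → K.:- x K.⊜ (K.:- K.con (+ 1)) K.:* x) K.refl (g k))
        (K.trans (conv-* W _ g k) (K.solve 1 (λ x → (K.:- K.con (+ 1)) K.:* x K.⊜ K.:- x) K.refl _))))

      conv-shift : ∀ W f a k → conv W (λ k → f (a ℤ.+ k)) k ≈ conv W f (a ℤ.+ k)
      conv-shift W f a k = K.⨁-cong W λ l _ → K.*-congˡ (K.reflexive (≡.cong f (≡.sym (ℤₚ.+-assoc a k (ℤ.- l)))))

      conv-δ : ∀ W k → ℤ.∣ k ∣ ≤ W → conv W δ k ≈ β k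
      conv-δ W k le = K.trans (K.⨁-single W k le λ l _ l≢k → K.trans (K.*-congˡ (δ-≢ (k ℤ.- l) λ e → l≢k (≡.sym (ℤₚ.i-j≡0⇒i≡j k l e)))) (K.zeroʳ _))
        (K.trans (K.*-congˡ (K.reflexive (≡.cong δ (ℤₚ.+-inverseʳ k)))) (K.*-identityʳ _))
        where
        δ-≢ : ∀ k → ¬ k ≡ + 0 → δ k ≈ K.0#
        δ-≢ (+ 0) ne = ⊥-elim (ne ≡.refl)
        δ-≢ (+ suc _) ne = K.refl
        δ-≢ -[1+ _ ] ne = K.refl

      shift-bound : ∀ a k {n W} → ℤ.∣ a ∣ ≤ 1 → ℤ.∣ k ∣ ℕ.+ suc n ≤ W → ℤ.∣ a ℤ.+ k ∣ ℕ.+ n ≤ W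
      shift-bound a k {n} a≤1 le = ℕₚ.≤-trans (ℕₚ.+-monoˡ-≤ n (ℕₚ.≤-trans (ℤₚ.∣i+j∣≤∣i∣+∣j∣ a k) (ℕₚ.+-monoˡ-≤ ℤ.∣ k ∣ a≤1)))
        (ℕₚ.≤-trans (ℕₚ.≤-reflexive (≡.sym (ℕₚ.+-suc ℤ.∣ k ∣ n))) le)

      vt-conv : ∀ W i k → ℤ.∣ k ∣ ℕ.+ i ≤ W → vt β i k ≈ conv W (vt δ i) k
      vt-conv W = vt-induction (λ i → ∀ k → ℤ.∣ k ∣ ℕ.+ i ≤ W → vt β i k ≈ conv W (vt δ i) k)
        (λ i i< k _ → K.trans (K.reflexive (vt-zero β i k i<)) (K.sym (conv-0 W k λ k → K.reflexive (vt-zero δ i k i<))))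
        (λ k le → K.trans (K.reflexive (vt-base β k)) (K.sym (K.trans (conv-cong W k λ k → K.reflexive (vt-base δ k))
          (conv-δ W k (ℕₚ.≤-trans (ℕₚ.m≤m+n _ _) le)))))
        (λ i ih k le → K.begin
          vt β (d ℕ.+ i) k K.≡⟨ vt-step β i k ⟩
          vt β i (ℤ.suc k) K.- m₀ K.* vt β i k K.+ c K.* vt β i (ℤ.pred k)
            K.≈⟨ K.+-cong (K.+-cong (ih (ℤ.suc k) (small (+ 1) k i ℕₚ.≤-refl le)) (K.-‿cong (K.*-congˡ (ih k (small₀ k i le)))))
                  (K.*-congˡ (ih (ℤ.pred k) (small (ℤ.- + 1) k i ℕₚ.≤-refl le))) ⟩
          conv W (vt δ i) (ℤ.suc k) K.- m₀ K.* conv W (vt δ i) k K.+ c K.* conv W (vt δ i) (ℤ.pred k)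
            K.≈⟨ K.+-cong (K.+-cong (conv-shift W (vt δ i) (+ 1) k) (K.-‿cong (conv-* W m₀ (vt δ i) k)))
                  (K.trans (conv-* W c (λ k → vt δ i (ℤ.pred k)) k) (K.*-congˡ (conv-shift W (vt δ i) (ℤ.- + 1) k))) ⟨
          conv W (λ k → vt δ i (ℤ.suc k)) k K.- conv W (λ k → m₀ K.* vt δ i k) k K.+ conv W (λ k → c K.* vt δ i (ℤ.pred k)) k
            K.≈⟨ K.trans (conv-+ W (λ k → vt δ i (ℤ.suc k) K.- m₀ K.* vt δ i k) (λ k → c K.* vt δ i (ℤ.pred k)) k)
                  (K.+-congʳ (conv-- W (λ k → vt δ i (ℤ.suc k)) (λ k → m₀ K.* vt δ i k) k)) ⟨
          conv W (λ k → vt δ i (ℤ.suc k) K.- m₀ K.* vt δ i k K.+ c K.* vt δ i (ℤ.pred k)) k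
            K.≈⟨ conv-cong W k (λ k → K.reflexive (vt-step δ i k)) ⟨
          conv W (vt δ (d ℕ.+ i)) k K.∎)
        where
        bigger : ∀ k i → ℤ.∣ k ∣ ℕ.+ (d ℕ.+ i) ≤ W → ℤ.∣ k ∣ ℕ.+ suc i ≤ W
        bigger k i le = ℕₚ.≤-trans (ℕₚ.+-monoʳ-≤ ℤ.∣ k ∣ (s≤s (ℕₚ.m≤n+m i d″))) le
        small : ∀ a k i → ℤ.∣ a ∣ ≤ 1 → ℤ.∣ k ∣ ℕ.+ (d ℕ.+ i) ≤ W → ℤ.∣ a ℤ.+ k ∣ ℕ.+ i ≤ W
        small a k i a≤1 le = shift-bound a k a≤1 (bigger k i le)
        small₀ : ∀ k i → ℤ.∣ k ∣ ℕ.+ (d ℕ.+ i) ≤ W → ℤ.∣ k ∣ ℕ.+ i ≤ W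
        small₀ k i le = ℕₚ.≤-trans (ℕₚ.+-monoʳ-≤ ℤ.∣ k ∣ (ℕₚ.n≤1+n i)) (bigger k i le)

      -- A reduction of b lowers j by at least 1 and raises i and the absolute value of k by at most
      -- 1 each. So the sum of this absolute value, i and 2 j bounds all exponents of u that occur.
      τ-conv : ∀ W i j k → ℤ.∣ k ∣ ℕ.+ (i ℕ.+ (j ℕ.+ j)) ≤ W → τ β i j k ≈ conv W (τ δ i j) k
      τ-conv W = τ-induction (λ i j → ∀ k → ℤ.∣ k ∣ ℕ.+ (i ℕ.+ (j ℕ.+ j)) ≤ W → τ β i j k ≈ conv W (τ δ i j) k)
        (λ i j j< k _ → K.trans (K.reflexive (τ-zero β i j k j<)) (K.sym (conv-0 W k λ k → K.reflexive (τ-zero δ i j k j<))))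
        (λ i k le → K.trans (K.reflexive (τ-top β i k)) (K.trans (vt-conv W i k (ℕₚ.≤-trans (ℕₚ.+-monoʳ-≤ ℤ.∣ k ∣ (ℕₚ.m≤m+n i _)) le))
          (conv-cong W k λ k → K.sym (K.reflexive (τ-top δ i k)))))
        (λ i j h₁ h₂ k le → K.begin
          τ β i (q ℕ.+ j) k K.≡⟨ τ-step β i j k ⟩
          τ β i (suc j) k K.+ (e K.* τ β (suc i) j k K.- τ β (suc i) j (ℤ.suc k))
            K.≈⟨ K.+-cong (h₁ k (ℕₚ.≤-trans (ℕₚ.+-monoʳ-≤ ℤ.∣ k ∣ (ℕₚ.+-monoʳ-≤ i (big₁ j))) le))
                  (K.+-cong (K.*-congˡ (h₂ k (ℕₚ.≤-trans (ℕₚ.+-monoʳ-≤ ℤ.∣ k ∣ (ℕₚ.≤-trans (ℕₚ.n≤1+n _) (big₂ i j))) le)))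
                    (K.-‿cong (h₂ (ℤ.suc k) (shift-bound (+ 1) k ℕₚ.≤-refl (ℕₚ.≤-trans (ℕₚ.+-monoʳ-≤ ℤ.∣ k ∣ (big₂ i j)) le))))) ⟩
          conv W (τ δ i (suc j)) k K.+ (e K.* conv W (τ δ (suc i) j) k K.- conv W (τ δ (suc i) j) (ℤ.suc k))
            K.≈⟨ K.+-congˡ (K.+-cong (conv-* W e (τ δ (suc i) j) k) (K.-‿cong (conv-shift W (τ δ (suc i) j) (+ 1) k))) ⟨
          conv W (τ δ i (suc j)) k K.+ (conv W (λ k → e K.* τ δ (suc i) j k) k K.- conv W (λ k → τ δ (suc i) j (ℤ.suc k)) k)
            K.≈⟨ K.trans (conv-+ W (τ δ i (suc j)) (λ k → e K.* τ δ (suc i) j k K.- τ δ (suc i) j (ℤ.suc k)) k)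
                  (K.+-congˡ (conv-- W (λ k → e K.* τ δ (suc i) j k) (λ k → τ δ (suc i) j (ℤ.suc k)) k)) ⟨
          conv W (λ k → τ δ i (suc j) k K.+ (e K.* τ δ (suc i) j k K.- τ δ (suc i) j (ℤ.suc k))) k
            K.≈⟨ conv-cong W k (λ k → K.reflexive (τ-step δ i j k)) ⟨
          conv W (τ δ i (q ℕ.+ j)) k K.∎)
        where
        big₁ : ∀ j → suc j ℕ.+ suc j ≤ (q ℕ.+ j) ℕ.+ (q ℕ.+ j)
        big₁ j = ℕₚ.+-mono-≤ {suc j} {q ℕ.+ j} (s≤s (ℕₚ.m≤n+m j (suc q″))) (s≤s (ℕₚ.m≤n+m j (suc q″)))
        big₂ : ∀ i j → suc (suc i ℕ.+ (j ℕ.+ j)) ≤ i ℕ.+ ((q ℕ.+ j) ℕ.+ (q ℕ.+ j))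
        big₂ i j = ℕₚ.≤-trans (ℕₚ.≤-reflexive (≡.trans (≡.cong suc (≡.sym (ℕₚ.+-suc i (j ℕ.+ j)))) (≡.sym (ℕₚ.+-suc i (suc (j ℕ.+ j))))))
          (ℕₚ.+-monoʳ-≤ i (ℕₚ.≤-trans (ℕₚ.≤-reflexive (≡.cong suc (≡.sym (ℕₚ.+-suc j j)))) (big₁ j)))

      -- β may have infinite support, but a single z involves only finitely many exponents of u, so
      -- it sees only finitely many values of β.
      window : ∀ k i j z → ∃ λ W₀ → ∀ W → W₀ ≤ W →
        ev (β , k , i , j) z ≈ K.⨁ W (λ l → β l K.* ev (δ , k ℤ.- l , i , j) z)
      window k i j = induction _
        (0 , λ W _ → K.trans (ev-nil _) (K.sym (K.⨁-zero W λ l _ → K.trans (K.*-congˡ (ev-nil _)) (K.zeroʳ _))))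
        (λ { a (k′ , i′ , j′) {z} (W₀ , h) → W₀ ℕ.+ (ℤ.∣ k ℤ.+ k′ ∣ ℕ.+ ((i ℕ.+ i′) ℕ.+ ((j ℕ.+ j′) ℕ.+ (j ℕ.+ j′)))) , λ W le → K.begin
          ev (β , k , i , j) (cons a (k′ , i′ , j′) z) K.≈⟨ ev-cons β k i j a k′ i′ j′ z ⟩
          a K.* τ β (i ℕ.+ i′) (j ℕ.+ j′) (k ℤ.+ k′) K.+ ev (β , k , i , j) z
            K.≈⟨ K.+-cong (K.*-congˡ (τ-conv W (i ℕ.+ i′) (j ℕ.+ j′) (k ℤ.+ k′) (ℕₚ.≤-trans (ℕₚ.m≤n+m _ W₀) le))) (h W (ℕₚ.≤-trans (ℕₚ.m≤m+n W₀ _) le)) ⟩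
          a K.* conv W (τ δ (i ℕ.+ i′) (j ℕ.+ j′)) (k ℤ.+ k′) K.+ K.⨁ W (λ l → β l K.* ev (δ , k ℤ.- l , i , j) z)
            K.≈⟨ K.trans (K.⨁-+ W _ _) (K.+-congʳ (K.⨁-*ˡ W a _)) ⟨
          K.⨁ W (λ l → a K.* (β l K.* τ δ (i ℕ.+ i′) (j ℕ.+ j′) (k ℤ.+ k′ ℤ.- l)) K.+ β l K.* ev (δ , k ℤ.- l , i , j) z)
            K.≈⟨ K.⨁-cong W (λ l _ → K.trans (K.+-congʳ (K.*-congˡ (K.*-congˡ (K.reflexive (≡.cong (τ δ (i ℕ.+ i′) (j ℕ.+ j′)) (swap k k′ l))))))
                 (K.trans (K.solve 4 (λ a b t y → a K.:* (b K.:* t) K.:+ b K.:* y K.⊜ b K.:* (a K.:* t K.:+ y)) K.refl _ _ _ _)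
                   (K.*-congˡ (K.sym (ev-cons δ (k ℤ.- l) i j a k′ i′ j′ z))))) ⟩
          K.⨁ W (λ l → β l K.* ev (δ , k ℤ.- l , i , j) (cons a (k′ , i′ , j′) z)) K.∎ })
        where
        swap : ∀ k k′ l → k ℤ.+ k′ ℤ.- l ≡ k ℤ.- l ℤ.+ k′
        swap = solve-∀

  ev-window : ∀ β k i j z → ∃ λ W₀ → ∀ W → W₀ ≤ W → ev (β , k , i , j) z ≈ K.⨁ W (λ l → β l K.* ev (δ , k ℤ.- l , i , j) z)
  ev-window = window

  ev-cong-index : ∀ {β β′} → (∀ k → β k ≈ β′ k) → ∀ k i j z → ev (β , k , i , j) z ≈ ev (β′ , k , i , j) z
  ev-cong-index {β} {β′} h k i j z =
    let W , w = window β k i j z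
        W′ , w′ = window β′ k i j z
    in K.trans (w (W ℕ.+ W′) (ℕₚ.m≤m+n W W′)) (K.trans (K.⨁-cong (W ℕ.+ W′) (λ l _ → K.*-congʳ (h l))) (K.sym (w′ (W ℕ.+ W′) (ℕₚ.m≤n+m W′ W))))

  ρ-mono* : ∀ k i j z → ρ (z * mono (k , i , j)) ≈ ev (δ , k , i , j) z
  ρ-mono* k i j z = K.trans (ρ-cong (R.*-comm _ _)) (K.trans (ev-mono* _ (k , i , j) z)
    (K.reflexive (≡.cong (λ k → ev (δ , k , i , j) z) (ℤₚ.+-identityˡ k))))

  ρ-nondegenerate : ∀ z → (∀ k i j → ρ (z * mono (k , i , j)) ≈ K.0#) → z ≃ 0#
  ρ-nondegenerate z h = separated λ { (β , k , i , j) → let W , w = window β k i j z in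
    K.trans (w W ℕₚ.≤-refl) (K.trans (K.⨁-zero W λ l _ → K.trans (K.*-congˡ (K.trans (K.sym (ρ-mono* _ i j z)) (h _ i j))) (K.zeroʳ _))
      (K.sym (ev-0 _))) }

  bounded : ∀ z → ∃ λ M → Below (+ M) z
  bounded = induction _ (0 , resp (R.sym nil≈0) zero)
    λ { a (k , i , j) {z} (M , B) → M ℕ.+ ℤ.∣ order k i j ∣ , resp (R.sym (cons≈ a (k , i , j) z))
        (weaken-≤ (ℤₚ.≤-trans (≤∣∣ (order k i j)) (ℤ.+≤+ (ℕₚ.m≤n+m _ M))) (Below-ι* a (Below-mono k i j)) ⊕ weaken-≤ (ℤ.+≤+ (ℕₚ.m≤m+n M _)) B) }
    where
    ≤∣∣ : ∀ i → i ℤ.≤ + ℤ.∣ i ∣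
    ≤∣∣ (+ n) = ℤₚ.≤-refl
    ≤∣∣ -[1+ n ] = ℤ.-≤+

  private
    module _ (ζ : ℤ → Element) (ζ-Lead : ∀ M → Lead M (ζ M)) {z : Element} (z⊥ζ : ∀ M → ρ (z * ζ M) ≈ K.0#) {M : ℕ} (Bz : Below (+ M) z) where
      ⊥-Below : ∀ f {O y} → c₀ ℤ.+ + f ≡ + suc M ℤ.+ O → Below O y → ρ (z * y) ≈ K.0#
      ⊥-Below zero {O} eq B = ρ-Below 0 (≡.trans (swap (+ M) O) (≡.trans (≡.sym eq) (ℤₚ.+-identityʳ c₀))) (Below-* Bz B)
        where
        swap : ∀ M O → M ℤ.+ O ℤ.+ + 1 ≡ (+ 1 ℤ.+ M) ℤ.+ O
        swap = solve-∀
      ⊥-Below (suc f) {O} eq = go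
        where
        eq-pred : c₀ ℤ.+ + f ≡ + suc M ℤ.+ (O ℤ.- + 1)
        eq-pred = ≡.trans (e₁ c₀ (+ f)) (≡.trans (≡.cong (ℤ._- + 1) eq) (e₂ (+ suc M) O))
          where
          e₁ : ∀ c f → c ℤ.+ f ≡ c ℤ.+ (+ 1 ℤ.+ f) ℤ.- + 1
          e₁ = solve-∀
          e₂ : ∀ M O → M ℤ.+ O ℤ.- + 1 ≡ M ℤ.+ (O ℤ.- + 1)
          e₂ = solve-∀
        lower : ∀ a m → Comparable O m (ζ O) → ρ (z * (ι a * m)) ≈ K.0#
        lower a m (μ , _ , B) = K.begin
          ρ (z * (ι a * m))
            K.≈⟨ ρ-cong (R.solve 5 (λ z a m μ y → z R.:* (a R.:* m) R.⊜ a R.:* (z R.:* (m R.:- μ R.:* y)) R.:+ a R.:* (μ R.:* (z R.:* y))) R.refl z (ι a) m (ι μ) (ζ O)) ⟩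
          ρ (ι a * (z * (m - ι μ * ζ O)) + ι a * (ι μ * (z * ζ O)))
            K.≈⟨ K.trans (ρ-+ _ _) (K.+-cong (ρ-ι* a _) (K.trans (ρ-ι* a _) (K.*-congˡ (ρ-ι* μ _)))) ⟩
          a K.* ρ (z * (m - ι μ * ζ O)) K.+ a K.* (μ K.* ρ (z * ζ O))
            K.≈⟨ K.+-cong (K.*-congˡ (⊥-Below f eq-pred B)) (K.*-congˡ (K.*-congˡ (z⊥ζ O))) ⟩
          a K.* K.0# K.+ a K.* (μ K.* K.0#) K.≈⟨ K.solve 2 (λ a m → a K.:* K.con (+ 0) K.:+ a K.:* (m K.:* K.con (+ 0)) K.⊜ K.con (+ 0)) K.refl a μ ⟩
          K.0# K.∎
        go : ∀ {y} → Below O y → ρ (z * y) ≈ K.0#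
        go (term a k i j (suc n) oeq) = ⊥-Below f eq-pred (term a k i j n (≡.trans (≡.cong (ℤ._- + 1) oeq) (e₁ (order k i j) (+ n))))
          where
          e₁ : ∀ o n → o ℤ.+ (+ 1 ℤ.+ n) ℤ.- + 1 ≡ o ℤ.+ n
          e₁ = solve-∀
        go (term a k i j zero oeq) =
          lower a (mono (k , i , j)) (Lead-compare (Lead-≡ (≡.sym (≡.trans oeq (ℤₚ.+-identityʳ _))) (Lead-monomial k i j)) (ζ-Lead O))
        go zero = K.trans (ρ-cong (R.zeroʳ z)) (ev-0 _)
        go (B ⊕ C) = K.trans (ρ-cong (R.distribˡ z _ _)) (K.trans (ρ-+ _ _) (K.trans (K.+-cong (go B) (go C)) (K.+-identityˡ _)))
        go (resp p B) = K.trans (ρ-cong (R.*-congˡ (R.sym p))) (go B)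
      all : ∀ k i j → ρ (z * mono (k , i , j)) ≈ K.0#
      all k i j with ℤₚ.≤-total c₀ (+ suc M ℤ.+ order k i j)
      ... | inj₁ le = let f , eq = ≤-difference le in ⊥-Below f (≡.sym eq) (Below-mono k i j)
      ... | inj₂ ge = ρ-Below-< (ℤₚ.<-≤-trans (ℤₚ.+-monoˡ-< (order k i j) (ℤ.+<+ (ℕₚ.n<1+n M))) ge)
        (Below-* Bz (Below-mono k i j))

  -- Induction on the order of y shows ρ (z y) = 0: for very small orders ρ vanishes anyway, and
  -- otherwise y differs from a combination of the ζ of its order by something of smaller order.
  separation : (ζ : ℤ → Element) → (∀ M → Lead M (ζ M)) → ∀ z → (∀ M → ρ (z * ζ M) ≈ K.0#) → z ≃ 0#
  separation ζ ζ-Lead z z⊥ζ = ρ-nondegenerate z (all ζ ζ-Lead z⊥ζ (proj₂ (bounded z)))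

  open PowerMaps F isField {r = r} prime q≡ n card using (q^≡; q^>0; x^QQ)
    renaming (additive to K-additive; neg^ to K-neg^; sub^ to K-sub^)

  private
    ι-· : ∀ m → ι (m K.· K.1#) ≃ m R.· 1#
    ι-· zero = ι-0
    ι-· (suc m) = R.trans (ι-+ _ _) (R.+-cong ι-1 (ι-· m))

    charR : p R.· 1# ≃ 0#
    charR = R.trans (R.sym (ι-· p)) (R.trans (ι-cong (PowerMaps.char F isField {r = r} prime q≡ n card)) ι-0)

  module _ (m : ℕ) where
    R-additive : R.Additive (q ℕ.^ m)
    R-additive x y = ≡.subst (λ N → (x + y) ^ N ≃ x ^ N + y ^ N) (q^≡ m) (R.frobenius^ prime charR (r ℕ.* m) x y)

    open R.Additivity (q^>0 m) R-additive public renaming (neg^ to R-neg^; sub^ to R-sub^)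

  c^Q : c K.^ Q ≈ c
  c^Q = K.trans (K-sub^ n _ _) (K.+-cong (K.trans (K.^-distrib-* _ _ Q) (K.*-cong e^Q e^Q)) (K.-‿cong e^Q))

  m₀^Q : m₀ K.^ Q ≈ m₀
  m₀^Q = K.trans (K-sub^ n _ _) (K.+-cong (K.trans (K-additive n _ _) (K.+-cong e^Q e^Q)) (K.-‿cong (K.1^ Q)))

  c^ : ℤ → K.Carrier
  c^ (+ k) = c K.^ k
  c^ -[1+ k ] = c⁻¹ K.^ suc k

  private
    c^-suc : ∀ k → c^ (ℤ.suc k) ≈ c K.* c^ k
    c^-suc (+ k) = K.refl
    c^-suc -[1+ k ] = K.sym (K.trans (K.sym (K.*-assoc _ _ _)) (K.trans (K.*-congʳ (inv-inverse c c≉0)) (K.trans (K.*-identityˡ _) (eq k))))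
      where
      eq : ∀ k → c⁻¹ K.^ k ≈ c^ (ℤ.suc -[1+ k ])
      eq zero = K.refl
      eq (suc k) = K.refl

    c^-pred : ∀ k → c^ (ℤ.pred k) ≈ c⁻¹ K.* c^ k
    c^-pred k = K.begin
      c^ (ℤ.pred k) K.≈⟨ K.*-identityˡ _ ⟨
      K.1# K.* c^ (ℤ.pred k) K.≈⟨ K.*-congʳ (inv-inverse c c≉0) ⟨
      c K.* c⁻¹ K.* c^ (ℤ.pred k) K.≈⟨ K.solve 3 (λ a b x → (a K.:* b) K.:* x K.⊜ b K.:* (a K.:* x)) K.refl c c⁻¹ _ ⟩
      c⁻¹ K.* (c K.* c^ (ℤ.pred k)) K.≈⟨ K.*-congˡ (c^-suc (ℤ.pred k)) ⟨
      c⁻¹ K.* c^ (ℤ.suc (ℤ.pred k)) K.≡⟨ ≡.cong (λ k → c⁻¹ K.* c^ k) (ℤₚ.suc-pred k) ⟩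
      c⁻¹ K.* c^ k K.∎

  c^-+ : ∀ k l → c^ (k ℤ.+ l) ≈ c^ k K.* c^ l
  c^-+ (+ zero) l = K.trans (K.reflexive (≡.cong c^ (ℤₚ.+-identityˡ l))) (K.sym (K.*-identityˡ _))
  c^-+ (+ suc k) l = K.begin
    c^ (ℤ.suc (+ k) ℤ.+ l) K.≡⟨ ≡.cong c^ (ℤₚ.+-assoc (+ 1) (+ k) l) ⟩
    c^ (ℤ.suc (+ k ℤ.+ l)) K.≈⟨ c^-suc (+ k ℤ.+ l) ⟩
    c K.* c^ (+ k ℤ.+ l) K.≈⟨ K.*-congˡ (c^-+ (+ k) l) ⟩
    c K.* (c^ (+ k) K.* c^ l) K.≈⟨ K.*-assoc _ _ _ ⟨
    c^ (+ suc k) K.* c^ l K.∎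
  c^-+ -[1+ zero ] l = K.trans (c^-pred l) (K.*-congʳ (K.sym (K.*-identityʳ _)))
  c^-+ -[1+ suc k ] l = K.begin
    c^ (ℤ.pred -[1+ k ] ℤ.+ l) K.≡⟨ ≡.cong c^ (ℤₚ.+-assoc (ℤ.- + 1) -[1+ k ] l) ⟩
    c^ (ℤ.pred (-[1+ k ] ℤ.+ l)) K.≈⟨ c^-pred (-[1+ k ] ℤ.+ l) ⟩
    c⁻¹ K.* c^ (-[1+ k ] ℤ.+ l) K.≈⟨ K.*-congˡ (c^-+ -[1+ k ] l) ⟩
    c⁻¹ K.* (c^ -[1+ k ] K.* c^ l) K.≈⟨ K.*-assoc _ _ _ ⟨
    c^ -[1+ suc k ] K.* c^ l K.∎

  c^-inverse : ∀ k → c^ k K.* c^ (ℤ.- k) ≈ K.1#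
  c^-inverse k = K.trans (K.sym (c^-+ k (ℤ.- k))) (K.reflexive (≡.cong c^ (ℤₚ.+-inverseʳ k)))

  c^-Q : ∀ k → c^ k K.^ Q ≈ c^ k
  c^-Q (+ k) = pow c^Q k
    where
    pow : ∀ {x} → x K.^ Q ≈ x → ∀ k → (x K.^ k) K.^ Q ≈ x K.^ k
    pow {x} x^Q k = K.trans (K.^-assocʳ x k Q) (K.trans (K.^-congʳ x (ℕₚ.*-comm k Q)) (K.trans (K.sym (K.^-assocʳ x Q k)) (K.^-congˡ k x^Q)))
  c^-Q -[1+ k ] = K.begin
    y K.^ Q K.≈⟨ K.*-identityʳ _ ⟨
    y K.^ Q K.* K.1# K.≈⟨ K.*-congˡ (c^-inverse (+ suc k)) ⟨
    y K.^ Q K.* (x K.* y) K.≈⟨ K.*-congˡ (K.*-congʳ (c^-Q (+ suc k))) ⟨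
    y K.^ Q K.* (x K.^ Q K.* y) K.≈⟨ K.solve 3 (λ a b z → a K.:* (b K.:* z) K.⊜ (b K.:* a) K.:* z) K.refl _ _ _ ⟩
    (x K.^ Q K.* y K.^ Q) K.* y K.≈⟨ K.*-congʳ (K.^-distrib-* x y Q) ⟨
    (x K.* y) K.^ Q K.* y K.≈⟨ K.*-congʳ (K.trans (K.^-congˡ Q (c^-inverse (+ suc k))) (K.1^ Q)) ⟩
    K.1# K.* y K.≈⟨ K.*-identityˡ y ⟩
    y K.∎
    where
    x = c^ (+ suc k)
    y = c^ -[1+ k ]

  -- The semilinear involution

  σ : ℕ
  σ = suc d

  L : Element → Element
  L y = R.∑ s (λ m → y ^ (q ℕ.^ m))

  a : Element
  a = b + L v

  v^σ : v ^ (q ℕ.^ s) ≃ v * ((u - ι m₀) + ι c * u⁻¹)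
  v^σ = R.trans (R.^-congʳ v (≡.sym σ≡)) (R.*-congˡ v-relation)

  private
    q¹ : q ℕ.^ 1 ≡ q
    q¹ = ℕₚ.*-identityʳ q

    add-q : ∀ x y → (x + y) ^ q ≃ x ^ q + y ^ q
    add-q x y = ≡.subst (λ N → (x + y) ^ N ≃ x ^ N + y ^ N) q¹ (R-additive 1 x y)

  L^q : ∀ y → L y ^ q ≃ L y + y ^ (q ℕ.^ s) - y
  L^q = R.partial-trace^q (s≤s z≤n) add-q s

  L-neg : ∀ y → L (- y) ≃ - L y
  L-neg y = R.trans (R.∑-cong s λ m _ → R-neg^ m y) (R.sym (R.∑-additive R.-0#≈0# (λ x y → R.sym (R.⁻¹-∙-comm x y)) s _))

  L-cong : ∀ {x y} → x ≃ y → L x ≃ L y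
  L-cong p = R.∑-cong s λ m _ → R.^-congˡ (q ℕ.^ m) p

  ι-sub : ∀ x y → ι (x K.- y) ≃ ι x - ι y
  ι-sub x y = R.trans (ι-+ x _) (R.+-congˡ (ι-neg y))

  -- This is the relation for b after u ↦ c / u and v ↦ - v, so b ↦ a is compatible with it. The
  -- correction comes from the telescoping of L v.
  a-relation : a ^ q ≃ a + (ι c * u⁻¹ - ι e) * v
  a-relation = R.begin
    (b + L v) ^ q R.≈⟨ add-q b (L v) ⟩
    b ^ q + L v ^ q R.≈⟨ R.+-cong b-relation (R.trans (L^q v) (R.+-congʳ (R.+-congˡ (R.trans v^σ
      (R.*-congˡ (R.+-congʳ (R.+-congˡ (R.-‿cong (R.trans (ι-sub _ _) (R.+-cong (ι-+ e e) (R.-‿cong ι-1))))))))))) ⟩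
    (b + (ι e - u) * v) + (L v + v * ((u - ((ι e + ι e) - 1#)) + ι c * u⁻¹) - v)
      R.≈⟨ R.solve 6 (λ b e u v l w → (b R.:+ (e R.:- u) R.:* v) R.:+ (l R.:+ v R.:* ((u R.:- ((e R.:+ e) R.:- R.con (+ 1))) R.:+ w) R.:- v) R.⊜
             (b R.:+ l) R.:+ (w R.:- e) R.:* v) R.refl b (ι e) u v (L v) (ι c * u⁻¹) ⟩
    a + (ι c * u⁻¹ - ι e) * v R.∎

  sgn : ℕ → K.Carrier
  sgn i = (K.- K.1#) K.^ i

  sgn² : ∀ i → sgn i K.* sgn i ≈ K.1#
  sgn² i = K.trans (K.sym (K.^-distrib-* _ _ i)) (K.trans (K.^-congˡ i (K.solve 0 ((K.:- K.con (+ 1)) K.:* (K.:- K.con (+ 1)) K.⊜ K.con (+ 1)) K.refl)) (K.1^ i))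

  -- The power by σ is additive, so (-1)^σ = -1 in every characteristic, including 2.
  sgn-d″ : sgn d″ ≈ K.- K.1#
  sgn-d″ = K.begin
    sgn d″ K.≈⟨ K.solve 1 (λ x → x K.⊜ (K.:- K.con (+ 1)) K.:* ((K.:- K.con (+ 1)) K.:* x)) K.refl (sgn d″) ⟩
    sgn (suc (suc d″)) K.≡⟨ ≡.cong sgn σ≡ ⟩
    sgn (q ℕ.^ s) K.≈⟨ K-neg^ s K.1# ⟩
    K.- (K.1# K.^ (q ℕ.^ s)) K.≈⟨ K.-‿cong (K.1^ (q ℕ.^ s)) ⟩
    K.- K.1# K.∎

  τm : Exponent → Element
  τm (k , i , j) = ι (c^ k K.* sgn i) * (U (ℤ.- k) * (v ^ i * a ^ j))

  -- Defined on formal sums. That it respects equality is proved only in `τ̄-cong`, once `ρ-τ̄` has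
  -- moved it across the functionals.
  τ̄ : Element → Element
  τ̄ = extend (λ x m → ι (x K.^ Q) * τm m)

  ρ[_] : (ℤ → K.Carrier) → Element → K.Carrier
  ρ[ β ] = ev (β , + 0 , 0 , 0)

  ev-∑ : ∀ i m f → ev i (R.∑ m f) ≈ K.∑ m (λ l → ev i (f l))
  ev-∑ i zero f = ev-0 i
  ev-∑ i (suc m) f = K.trans (ev-+ i _ _) (K.+-congʳ (ev-∑ i m f))

  private
    module _ (β : ℤ → K.Carrier) where
      M : ℤ → ℕ → ℕ → ℕ → K.Carrier
      M k i j j′ = ρ[ β ] (U k * (v ^ i * (a ^ j * b ^ j′)))

      M-0 : ∀ k i j′ → M k i 0 j′ ≈ τ β i j′ k
      M-0 k i j′ = K.trans (ev-cong _ (R.trans (R.*-congˡ (R.*-congˡ (R.*-identityˡ _))) (R.sym (mono≃ k i j′))))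
        (K.trans (ev-mono _ (k , i , j′)) (K.reflexive (≡.cong (τ β i j′) (ℤₚ.+-identityˡ k))))

      M-suc : ∀ k i j j′ → M k i (suc j) j′ ≈ M k i j (suc j′) K.+ K.∑ s (λ m → M k (i ℕ.+ q ℕ.^ m) j j′)
      M-suc k i j j′ = K.trans (ev-cong _ (R.trans
        (R.solve 6 (λ t y b l x z → t R.:* (y R.:* (((b R.:+ l) R.:* x) R.:* z)) R.⊜
           t R.:* (y R.:* (x R.:* (b R.:* z))) R.:+ (t R.:* (y R.:* (x R.:* z))) R.:* l) R.refl (U k) (v ^ i) b (L v) (a ^ j) (b ^ j′))
        (R.+-congˡ (R.trans (R.sym (R.∑-*ˡ s _ _)) (R.∑-cong s λ m _ → R.trans
          (R.solve 4 (λ t y x w → (t R.:* (y R.:* x)) R.:* w R.⊜ t R.:* ((y R.:* w) R.:* x)) R.refl (U k) (v ^ i) (a ^ j * b ^ j′) (v ^ (q ℕ.^ m)))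
          (R.*-congˡ (R.*-congʳ (R.sym (R.^-homo-* v i (q ℕ.^ m)))))))))) (K.trans (ev-+ _ _ _) (K.+-congˡ (ev-∑ _ s _)))

      M-low : ∀ j k i j′ → j ℕ.+ j′ < suc q″ → M k i j j′ ≈ K.0#
      M-low zero k i j′ lt = K.trans (M-0 k i j′) (K.reflexive (τ-zero β i j′ k lt))
      M-low (suc j) k i j′ lt = K.trans (M-suc k i j j′) (K.trans
        (K.+-cong (M-low j k i (suc j′) (≡.subst (_< suc q″) (≡.sym (ℕₚ.+-suc j j′)) lt))
          (K.∑-zero s λ m _ → M-low j k (i ℕ.+ q ℕ.^ m) j′ (ℕₚ.<-trans (ℕₚ.n<1+n _) lt))) (K.+-identityˡ _))

      -- In total degree q - 1 in a and b the partial trace L v only contributes lower degrees in b,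
      -- which the functional does not see; a may be replaced by b.
      M-top : ∀ j k i j′ → j ℕ.+ j′ ≡ suc q″ → M k i j j′ ≈ vt β i k
      M-top zero k i j′ ≡.refl = K.trans (M-0 k i j′) (K.reflexive (τ-top β i k))
      M-top (suc j) k i j′ eq = K.trans (M-suc k i j j′) (K.trans
        (K.+-cong (M-top j k i (suc j′) (≡.trans (ℕₚ.+-suc j j′) eq))
          (K.∑-zero s λ m _ → M-low j k (i ℕ.+ q ℕ.^ m) j′ (≡.subst (j ℕ.+ j′ <_) eq (ℕₚ.n<1+n _)))) (K.+-identityʳ _))

      E : ℤ → ℕ → ℕ → K.Carrier
      E k i j = ρ[ β ] (U k * (v ^ i * a ^ j))

      E≈M : ∀ k i j → E k i j ≈ M k i j 0
      E≈M k i j = ev-cong _ (R.*-congˡ (R.*-congˡ (R.sym (R.*-identityʳ _))))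

      E-step : ∀ k i j → E k i (q ℕ.+ j) ≈ E k i (suc j) K.+ (c K.* E (k ℤ.+ -[1+ 0 ]) (suc i) j K.- e K.* E k (suc i) j)
      E-step k i j = K.begin
        E k i (q ℕ.+ j) K.≈⟨ ev-cong _ (R.*-congˡ (R.*-congˡ (R.trans (R.^-homo-* a q j) (R.*-congʳ a-relation)))) ⟩
        ρ[ β ] (U k * (v ^ i * ((a + (ι c * u⁻¹ - ι e) * v) * a ^ j)))
          K.≈⟨ ev-cong _ (R.trans (R.solve 8 (λ t y a c w e v x → t R.:* (y R.:* ((a R.:+ (c R.:* w R.:- e) R.:* v) R.:* x)) R.⊜
                 t R.:* (y R.:* (a R.:* x)) R.:+ (c R.:* ((t R.:* w) R.:* ((v R.:* y) R.:* x)) R.:- e R.:* (t R.:* ((v R.:* y) R.:* x))))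
                 R.refl (U k) (v ^ i) a (ι c) u⁻¹ (ι e) v (a ^ j))
               (R.+-congˡ (R.+-congʳ (R.*-congˡ (R.*-congʳ (R.sym (U-+ k -[1+ 0 ]))))))) ⟩
        ρ[ β ] (U k * (v ^ i * a ^ suc j) + (ι c * (U (k ℤ.+ -[1+ 0 ]) * (v ^ suc i * a ^ j)) - ι e * (U k * (v ^ suc i * a ^ j))))
          K.≈⟨ K.trans (ev-+ _ _ _) (K.+-congˡ (K.trans (ev-+ _ _ _) (K.+-cong (ev-ι* _ c _) (K.trans (ev-neg _ _) (K.-‿cong (ev-ι* _ e _)))))) ⟩
        E k i (suc j) K.+ (c K.* E (k ℤ.+ -[1+ 0 ]) (suc i) j K.- e K.* E k (suc i) j) K.∎

      βᵗ : ℤ → K.Carrier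
      βᵗ k = (c^ k K.* β (ℤ.- k)) K.^ Q

      Goal : ℕ → ℤ → K.Carrier → K.Carrier → Set
      Goal i k x y = (c^ k K.* sgn i) K.* x ≈ K.- (y K.^ Q)

      Goal-0 : ∀ {i k x y} → x ≈ K.0# → y ≈ K.0# → Goal i k x y
      Goal-0 x≈0 y≈0 = K.trans (K.trans (K.*-congˡ x≈0) (K.zeroʳ _))
        (K.sym (K.trans (K.-‿cong (K.trans (K.^-congˡ Q y≈0) (K.0^ Q (q^>0 n)))) K.-0#≈0#))

      neg-suc : ∀ k → ℤ.- (+ 1 ℤ.+ k) ≡ ℤ.- + 1 ℤ.+ ℤ.- k
      neg-suc = solve-∀

      neg-pred : ∀ k → ℤ.- (ℤ.- + 1 ℤ.+ k) ≡ + 1 ℤ.+ ℤ.- k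
      neg-pred = solve-∀

      vt-twist : ∀ i k → Goal i k (vt β i (ℤ.- k)) (vt βᵗ i k)
      vt-twist = vt-induction (λ i → ∀ k → Goal i k (vt β i (ℤ.- k)) (vt βᵗ i k))
        (λ i i< k → Goal-0 {i} {k} (K.reflexive (vt-zero β i _ i<)) (K.reflexive (vt-zero βᵗ i k i<)))
        (λ k → K.begin
          (c^ k K.* sgn d″) K.* vt β d″ (ℤ.- k) K.≈⟨ K.*-cong (K.*-congˡ sgn-d″) (K.reflexive (vt-base β _)) ⟩
          (c^ k K.* (K.- K.1#)) K.* β (ℤ.- k) K.≈⟨ K.solve 2 (λ x y → (x K.:* (K.:- K.con (+ 1))) K.:* y K.⊜ K.:- (x K.:* y)) K.refl _ _ ⟩
          K.- (c^ k K.* β (ℤ.- k)) K.≈⟨ K.-‿cong (x^QQ _) ⟨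
          K.- (βᵗ k K.^ Q) K.≡⟨ ≡.cong (λ x → K.- (x K.^ Q)) (≡.sym (vt-base βᵗ k)) ⟩
          K.- (vt βᵗ d″ k K.^ Q) K.∎)
        (λ i ih k → K.begin
          (c^ k K.* sgn (d ℕ.+ i)) K.* vt β (d ℕ.+ i) (ℤ.- k)
            K.≈⟨ K.*-cong (K.*-congˡ (K.trans (K.^-homo-* _ d i) (K.trans (K.*-congʳ (K.trans (K.*-congˡ sgn-d″) (K.solve 0 ((K.:- K.con (+ 1)) K.:* (K.:- K.con (+ 1)) K.⊜ K.con (+ 1)) K.refl)))
                 (K.*-identityˡ _)))) (K.reflexive (vt-step β i (ℤ.- k))) ⟩
          (c^ k K.* sgn i) K.* (vt β i (ℤ.suc (ℤ.- k)) K.- m₀ K.* vt β i (ℤ.- k) K.+ c K.* vt β i (ℤ.pred (ℤ.- k)))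
            K.≈⟨ K.*-congʳ (K.*-congʳ (K.trans (K.reflexive (≡.cong c^ (≡.sym (ℤₚ.suc-pred k)))) (c^-suc (ℤ.pred k)))) ⟩
          ((c K.* c^ (ℤ.pred k)) K.* sgn i) K.* (vt β i (ℤ.suc (ℤ.- k)) K.- m₀ K.* vt β i (ℤ.- k) K.+ c K.* vt β i (ℤ.pred (ℤ.- k)))
            K.≈⟨ K.solve 7 (λ c p s x m y z → ((c K.:* p) K.:* s) K.:* (x K.:- m K.:* y K.:+ c K.:* z) K.⊜
                   c K.:* ((p K.:* s) K.:* x) K.:- m K.:* (((c K.:* p) K.:* s) K.:* y) K.:+ (((c K.:* (c K.:* p)) K.:* s) K.:* z)) K.refl
                   c (c^ (ℤ.pred k)) (sgn i) _ m₀ _ _ ⟩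
          c K.* ((c^ (ℤ.pred k) K.* sgn i) K.* vt β i (ℤ.suc (ℤ.- k))) K.- m₀ K.* (((c K.* c^ (ℤ.pred k)) K.* sgn i) K.* vt β i (ℤ.- k))
            K.+ (((c K.* (c K.* c^ (ℤ.pred k))) K.* sgn i) K.* vt β i (ℤ.pred (ℤ.- k)))
            K.≈⟨ K.+-cong (K.+-cong (K.*-congˡ (K.trans (K.*-congˡ (K.reflexive (≡.cong (vt β i) (≡.sym (neg-pred k))))) (ih (ℤ.pred k))))
                    (K.-‿cong (K.*-congˡ (K.trans (K.*-congʳ (K.*-congʳ (c-up k))) (ih k)))))
                  (K.trans (K.*-cong (K.*-congʳ (K.trans (K.*-congˡ (c-up k)) (K.sym (c^-suc k)))) (K.reflexive (≡.cong (vt β i) (≡.sym (neg-suc k))))) (ih (ℤ.suc k))) ⟩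
          c K.* (K.- (X ℤ.pred i k K.^ Q)) K.- m₀ K.* (K.- (X (λ k → k) i k K.^ Q)) K.+ K.- (X ℤ.suc i k K.^ Q)
            K.≈⟨ K.solve 5 (λ c m x y z → c K.:* (K.:- x) K.:- m K.:* (K.:- y) K.:+ K.:- z K.⊜ K.:- ((z K.:- m K.:* y) K.:+ c K.:* x)) K.refl c m₀ _ _ _ ⟩
          K.- ((X ℤ.suc i k K.^ Q K.- m₀ K.* X (λ k → k) i k K.^ Q) K.+ c K.* X ℤ.pred i k K.^ Q)
            K.≈⟨ K.-‿cong (K.trans (K-additive n _ _) (K.+-cong (K.trans (K-sub^ n _ _) (K.+-congˡ (K.-‿cong (K.trans (K.^-distrib-* _ _ Q) (K.*-congʳ m₀^Q)))))
                 (K.trans (K.^-distrib-* _ _ Q) (K.*-congʳ c^Q)))) ⟨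
          K.- (((X ℤ.suc i k K.- m₀ K.* X (λ k → k) i k) K.+ c K.* X ℤ.pred i k) K.^ Q)
            K.≡⟨ ≡.cong (λ x → K.- (x K.^ Q)) (≡.sym (vt-step βᵗ i k)) ⟩
          K.- (vt βᵗ (d ℕ.+ i) k K.^ Q) K.∎)
        where
        X : (ℤ → ℤ) → ℕ → ℤ → K.Carrier
        X f i k = vt βᵗ i (f k)
        c-up : ∀ k → c K.* c^ (ℤ.pred k) ≈ c^ k
        c-up k = K.trans (K.sym (c^-suc (ℤ.pred k))) (K.reflexive (≡.cong c^ (ℤₚ.suc-pred k)))

      τ-twist : ∀ i j k → Goal i k (E (ℤ.- k) i j) (τ βᵗ i j k)
      τ-twist = τ-induction (λ i j → ∀ k → Goal i k (E (ℤ.- k) i j) (τ βᵗ i j k))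
        (λ i j j< k → Goal-0 {i} {k} (K.trans (E≈M (ℤ.- k) i j) (M-low j (ℤ.- k) i 0 (≡.subst (_< suc q″) (≡.sym (ℕₚ.+-identityʳ j)) j<))) (K.reflexive (τ-zero βᵗ i j k j<)))
        (λ i k → K.trans (K.*-congˡ (K.trans (E≈M (ℤ.- k) i (suc q″)) (M-top (suc q″) (ℤ.- k) i 0 (ℕₚ.+-identityʳ _)))) (K.trans (vt-twist i k)
          (K.-‿cong (K.^-congˡ Q (K.reflexive (≡.sym (τ-top βᵗ i k)))))))
        (λ i j h₁ h₂ k → K.begin
          (c^ k K.* sgn i) K.* E (ℤ.- k) i (q ℕ.+ j) K.≈⟨ K.*-congˡ (E-step (ℤ.- k) i j) ⟩
          (c^ k K.* sgn i) K.* (E (ℤ.- k) i (suc j) K.+ (c K.* E (ℤ.- k ℤ.+ -[1+ 0 ]) (suc i) j K.- e K.* E (ℤ.- k) (suc i) j))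
            K.≈⟨ K.solve 7 (λ p s x c y e z → (p K.:* s) K.:* (x K.:+ (c K.:* y K.:- e K.:* z)) K.⊜
                   (p K.:* s) K.:* x K.:+ (e K.:* ((p K.:* ((K.:- K.con (+ 1)) K.:* s)) K.:* z) K.:- (((c K.:* p) K.:* ((K.:- K.con (+ 1)) K.:* s)) K.:* y))) K.refl
                   (c^ k) (sgn i) _ c _ e _ ⟩
          (c^ k K.* sgn i) K.* E (ℤ.- k) i (suc j) K.+ (e K.* ((c^ k K.* sgn (suc i)) K.* E (ℤ.- k) (suc i) j)
            K.- ((c K.* c^ k) K.* sgn (suc i)) K.* E (ℤ.- k ℤ.+ -[1+ 0 ]) (suc i) j)
            K.≈⟨ K.+-cong (h₁ k) (K.+-cong (K.*-congˡ (h₂ k)) (K.-‿cong (K.trans (K.*-cong (K.*-congʳ (K.sym (c^-suc k)))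
                   (K.reflexive (≡.cong (λ l → E l (suc i) j) (≡.trans (ℤₚ.+-comm (ℤ.- k) -[1+ 0 ]) (≡.sym (neg-suc k)))))) (h₂ (ℤ.suc k))))) ⟩
          (K.- (τ βᵗ i (suc j) k K.^ Q)) K.+ (e K.* (K.- (τ βᵗ (suc i) j k K.^ Q)) K.- (K.- (τ βᵗ (suc i) j (ℤ.suc k) K.^ Q)))
            K.≈⟨ K.solve 4 (λ x e y z → (K.:- x) K.:+ (e K.:* (K.:- y) K.:- (K.:- z)) K.⊜ K.:- (x K.:+ (e K.:* y K.:- z))) K.refl _ e _ _ ⟩
          K.- (τ βᵗ i (suc j) k K.^ Q K.+ (e K.* τ βᵗ (suc i) j k K.^ Q K.- τ βᵗ (suc i) j (ℤ.suc k) K.^ Q))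
            K.≈⟨ K.-‿cong (K.trans (K-additive n _ _) (K.+-congˡ (K.trans (K-sub^ n _ _) (K.+-congʳ (K.trans (K.^-distrib-* _ _ Q) (K.*-congʳ e^Q)))))) ⟨
          K.- ((τ βᵗ i (suc j) k K.+ (e K.* τ βᵗ (suc i) j k K.- τ βᵗ (suc i) j (ℤ.suc k))) K.^ Q)
            K.≡⟨ ≡.cong (λ x → K.- (x K.^ Q)) (≡.sym (τ-step βᵗ i j k)) ⟩
          K.- (τ βᵗ i (q ℕ.+ j) k K.^ Q) K.∎)

      twisted : ∀ k i j → ρ[ β ] (τm (k , i , j)) ≈ K.- (τ βᵗ i j k K.^ Q)
      twisted k i j = K.trans (ev-ι* _ _ _) (τ-twist i j k)

  -- The functional β composed with u ↦ c / u and the Q-th power on scalars.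
  twist : (ℤ → K.Carrier) → ℤ → K.Carrier
  twist β k = (c^ k K.* β (ℤ.- k)) K.^ Q

  sgn-+ : ∀ i j → sgn (i ℕ.+ j) ≈ sgn i K.* sgn j
  sgn-+ i j = K.^-homo-* _ i j

  private
    τm-* : ∀ k i j k′ i′ j′ → τm (k , i , j) * τm (k′ , i′ , j′) ≃ τm (k ℤ.+ k′ , i ℕ.+ i′ , j ℕ.+ j′)
    τm-* k i j k′ i′ j′ = R.trans
      (R.solve 8 (λ x t y z x′ t′ y′ z′ → (x R.:* (t R.:* (y R.:* z))) R.:* (x′ R.:* (t′ R.:* (y′ R.:* z′))) R.⊜
        (x R.:* x′) R.:* ((t R.:* t′) R.:* ((y R.:* y′) R.:* (z R.:* z′)))) R.refl _ _ _ _ _ _ _ _)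
      (R.sym (R.*-cong (R.trans (ι-cong (K.trans (K.*-cong (c^-+ k k′) (sgn-+ i i′))
          (K.solve 4 (λ a b x y → (a K.:* b) K.:* (x K.:* y) K.⊜ (a K.:* x) K.:* (b K.:* y)) K.refl _ _ _ _))) (ι-* _ _))
        (R.*-cong (R.trans (R.reflexive (≡.cong U (ℤₚ.neg-distrib-+ k k′))) (U-+ _ _)) (R.*-cong (R.^-homo-* v i i′) (R.^-homo-* a j j′)))))

    τ̄-nil : τ̄ nil ≃ 0#
    τ̄-nil = extend-nil _

    τ̄-cons : ∀ x m z → τ̄ (cons x m z) ≃ ι (x K.^ Q) * τm m + τ̄ z
    τ̄-cons x m z = extend-cons _ x m z

  -- τ̄ acts on the top term v^(d-1) b^(q-1) by the sign (-1)^(d-1) = -1, up to terms that do not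
  -- count; the coefficients in F[u, u⁻¹] undergo `twist`.
  ρ-τ̄ : ∀ β k i j z → ρ[ β ] (τm (k , i , j) * τ̄ z) ≈ K.- (ev (twist β , k , i , j) z K.^ Q)
  ρ-τ̄ β k i j = induction _
    (K.trans (ev-cong _ (R.trans (R.*-congˡ τ̄-nil) (R.zeroʳ _))) (K.trans (ev-0 _)
      (K.sym (K.trans (K.-‿cong (K.trans (K.^-congˡ Q (ev-nil _)) (K.0^ Q (q^>0 n)))) K.-0#≈0#))))
    (λ { x (k′ , i′ , j′) {z} ih → K.begin
      ρ[ β ] (τm (k , i , j) * τ̄ (cons x (k′ , i′ , j′) z))
        K.≈⟨ ev-cong _ (R.trans (R.*-congˡ (τ̄-cons x _ z))
             (R.trans (R.solve 4 (λ t x s z → t R.:* (x R.:* s R.:+ z) R.⊜ x R.:* (t R.:* s) R.:+ t R.:* z) R.refl _ _ _ _)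
               (R.+-congʳ (R.*-congˡ (τm-* k i j k′ i′ j′))))) ⟩
      ρ[ β ] (ι (x K.^ Q) * τm (k ℤ.+ k′ , i ℕ.+ i′ , j ℕ.+ j′) + τm (k , i , j) * τ̄ z)
        K.≈⟨ K.trans (ev-+ _ _ _) (K.+-cong (K.trans (ev-ι* _ _ _) (K.*-congˡ (twisted β _ _ _))) ih) ⟩
      x K.^ Q K.* (K.- (τ (twist β) (i ℕ.+ i′) (j ℕ.+ j′) (k ℤ.+ k′) K.^ Q)) K.+ K.- (ev (twist β , k , i , j) z K.^ Q)
        K.≈⟨ K.solve 3 (λ x y z → x K.:* (K.:- y) K.:+ K.:- z K.⊜ K.:- (x K.:* y K.:+ z)) K.refl _ _ _ ⟩
      K.- (x K.^ Q K.* τ (twist β) (i ℕ.+ i′) (j ℕ.+ j′) (k ℤ.+ k′) K.^ Q K.+ ev (twist β , k , i , j) z K.^ Q)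
        K.≈⟨ K.-‿cong (K.trans (K-additive n _ _) (K.+-congʳ (K.^-distrib-* _ _ Q))) ⟨
      K.- ((x K.* τ (twist β) (i ℕ.+ i′) (j ℕ.+ j′) (k ℤ.+ k′) K.+ ev (twist β , k , i , j) z) K.^ Q)
        K.≈⟨ K.-‿cong (K.^-congˡ Q (ev-cons (twist β) k i j x k′ i′ j′ z)) ⟨
      K.- (ev (twist β , k , i , j) (cons x (k′ , i′ , j′) z) K.^ Q) K.∎ })

  private
    -- The elements u^k v^i a^j span the ring.
    module _ (w : Element) (h : ∀ k i j → ρ (w * (U k * (v ^ i * a ^ j))) ≈ K.0#) where
      mixed : ∀ j′ k i j → ρ (w * (U k * (v ^ i * (a ^ j * b ^ j′)))) ≈ K.0#
      mixed zero k i j = K.trans (ρ-cong (R.*-congˡ (R.*-congˡ (R.*-congˡ (R.*-identityʳ _))))) (h k i j)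
      mixed (suc j′) k i j = K.begin
        ρ (w * (U k * (v ^ i * (a ^ j * b ^ suc j′))))
          K.≈⟨ ρ-cong (R.trans (R.solve 7 (λ w t y b l x z → w R.:* (t R.:* (y R.:* (x R.:* (b R.:* z)))) R.⊜
                 w R.:* (t R.:* (y R.:* (((b R.:+ l) R.:* x) R.:* z))) R.:- (w R.:* (t R.:* (y R.:* (x R.:* z)))) R.:* l) R.refl w (U k) (v ^ i) b (L v) (a ^ j) (b ^ j′))
               (R.+-congˡ (R.-‿cong (R.trans (R.sym (R.∑-*ˡ s _ _)) (R.∑-cong s λ m _ → R.trans
                 (R.solve 5 (λ w t y x r → (w R.:* (t R.:* (y R.:* x))) R.:* r R.⊜ w R.:* (t R.:* ((y R.:* r) R.:* x))) R.refl w (U k) (v ^ i) (a ^ j * b ^ j′) (v ^ (q ℕ.^ m)))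
                 (R.*-congˡ (R.*-congˡ (R.*-congʳ (R.sym (R.^-homo-* v i (q ℕ.^ m)))))))))))
           ⟩
        ρ (w * (U k * (v ^ i * (a ^ suc j * b ^ j′))) - R.∑ s (λ m → w * (U k * (v ^ (i ℕ.+ q ℕ.^ m) * (a ^ j * b ^ j′)))))
          K.≈⟨ K.trans (ρ-+ _ _) (K.+-cong (mixed j′ k i (suc j)) (K.trans (ev-neg _ _) (K.-‿cong (K.trans (ev-∑ _ s _)
               (K.∑-zero s λ m _ → mixed j′ k (i ℕ.+ q ℕ.^ m) j))))) ⟩
        K.0# K.- K.0# K.≈⟨ K.-‿inverseʳ K.0# ⟩
        K.0# K.∎

      spanning : w ≃ 0#
      spanning = ρ-nondegenerate w λ k i j → K.trans (ρ-cong (R.*-congˡ (R.trans (mono≃ k i j) (R.*-congˡ (R.*-congˡ (R.sym (R.*-identityˡ _)))))))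
        (mixed j k i 0)

  private
    -- By `spanning` the images `τm` are enough test elements, and on them `ρ-τ̄` computes. All laws
    -- of τ̄ are derived in this way.
    by-ρ : ∀ {x y} → (∀ k i j → ρ (τm (k , i , j) * x) ≈ ρ (τm (k , i , j) * y)) → x ≃ y
    by-ρ {x} {y} h = R.x-y≈0⇒x≈y _ _ (spanning (x - y) λ k i j → K.begin
      ρ ((x - y) * (U k * (v ^ i * a ^ j))) K.≡⟨ ≡.cong (λ l → ρ ((x - y) * (U l * (v ^ i * a ^ j)))) (≡.sym (ℤₚ.neg-involutive k)) ⟩
      ρ ((x - y) * (U (ℤ.- (ℤ.- k)) * (v ^ i * a ^ j)))
        K.≈⟨ ρ-cong (R.trans (R.*-congˡ (R.sym (R.*-identityˡ _))) (R.*-congˡ (R.*-congʳ (R.sym (unit k i))))) ⟩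
      ρ ((x - y) * ((ι (w k i) * ι (c^ (ℤ.- k) K.* sgn i)) * (U (ℤ.- (ℤ.- k)) * (v ^ i * a ^ j))))
        K.≈⟨ ρ-cong (R.solve 5 (λ x y w z t → (x R.:- y) R.:* ((w R.:* z) R.:* t) R.⊜ w R.:* ((z R.:* t) R.:* x R.:- (z R.:* t) R.:* y)) R.refl x y _ _ _) ⟩
      ρ (ι (w k i) * (τm (ℤ.- k , i , j) * x - τm (ℤ.- k , i , j) * y))
        K.≈⟨ K.trans (ρ-ι* _ _) (K.*-congˡ (K.trans (ρ-+ _ _) (K.+-congˡ (ev-neg _ _)))) ⟩
      w k i K.* (ρ (τm (ℤ.- k , i , j) * x) K.- ρ (τm (ℤ.- k , i , j) * y))
        K.≈⟨ K.*-congˡ (K.x≈y⇒x-y≈0 (h (ℤ.- k) i j)) ⟩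
      w k i K.* K.0# K.≈⟨ K.zeroʳ _ ⟩
      K.0# K.∎)
      where
      w : ℤ → ℕ → K.Carrier
      w k i = c^ k K.* sgn i
      unit : ∀ k i → ι (w k i) * ι (c^ (ℤ.- k) K.* sgn i) ≃ 1#
      unit k i = R.trans (R.sym (ι-* _ _)) (R.trans (ι-cong (K.trans
        (K.solve 3 (λ a b s → (a K.:* s) K.:* (b K.:* s) K.⊜ (a K.:* b) K.:* (s K.:* s)) K.refl _ _ _)
        (K.trans (K.*-cong (c^-inverse k) (sgn² i)) (K.*-identityˡ _)))) ι-1)

  τ̄-cong : ∀ {x y} → x ≃ y → τ̄ x ≃ τ̄ y
  τ̄-cong {x} {y} p = by-ρ λ k i j → K.trans (ρ-τ̄ δ k i j x) (K.trans (K.-‿cong (K.^-congˡ Q (ev-cong _ p))) (K.sym (ρ-τ̄ δ k i j y)))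

  τ̄-+ : ∀ x y → τ̄ (x + y) ≃ τ̄ x + τ̄ y
  τ̄-+ x y = by-ρ λ k i j → K.trans (ρ-τ̄ δ k i j (x + y)) (K.trans
    (K.trans (K.-‿cong (K.trans (K.^-congˡ Q (ev-+ _ x y)) (K-additive n _ _))) (K.sym (K.⁻¹-∙-comm _ _)))
    (K.sym (K.trans (ρ-cong (R.distribˡ _ _ _)) (K.trans (ρ-+ _ _) (K.+-cong (ρ-τ̄ δ k i j x) (ρ-τ̄ δ k i j y))))))

  τ̄-ι* : ∀ a x → τ̄ (ι a * x) ≃ ι (a K.^ Q) * τ̄ x
  τ̄-ι* a x = by-ρ λ k i j → K.trans (ρ-τ̄ δ k i j (ι a * x)) (K.trans
    (K.trans (K.-‿cong (K.trans (K.^-congˡ Q (ev-ι* _ a x)) (K.^-distrib-* _ _ Q))) (K.-‿distribʳ-* _ _))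
    (K.sym (K.trans (ρ-cong (R.solve 3 (λ t a x → t R.:* (a R.:* x) R.⊜ a R.:* (t R.:* x)) R.refl _ _ _))
      (K.trans (ρ-ι* _ _) (K.*-congˡ (ρ-τ̄ δ k i j x))))))

  private
    τ̄-mono* : ∀ k i j x → τ̄ (mono (k , i , j) * x) ≃ τm (k , i , j) * τ̄ x
    τ̄-mono* k′ i′ j′ x = by-ρ λ k i j → K.trans (ρ-τ̄ δ k i j (mono (k′ , i′ , j′) * x)) (K.trans
      (K.-‿cong (K.^-congˡ Q (ev-mono* _ (k′ , i′ , j′) x)))
      (K.trans (K.sym (ρ-τ̄ δ (k ℤ.+ k′) (i ℕ.+ i′) (j ℕ.+ j′) x))
        (ρ-cong (R.trans (R.*-congʳ (R.sym (τm-* k i j k′ i′ j′))) (R.*-assoc _ _ _)))))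

    τ̄-mono : ∀ k i j → τ̄ (mono (k , i , j)) ≃ τm (k , i , j)
    τ̄-mono k i j = R.begin
      τ̄ (mono (k , i , j)) R.≈⟨ τ̄-cong (R.trans (R.sym (R.trans (R.*-congʳ ι-1) (R.*-identityˡ _)))
        (R.sym (R.trans (cons≈ K.1# (k , i , j) nil) (R.trans (R.+-congˡ nil≈0) (R.+-identityʳ _))))) ⟩
      τ̄ (cons K.1# (k , i , j) nil) R.≈⟨ τ̄-cons _ _ _ ⟩
      ι (K.1# K.^ Q) * τm (k , i , j) + τ̄ nil R.≈⟨ R.+-cong (R.trans (R.*-congʳ (R.trans (ι-cong (K.1^ Q)) ι-1)) (R.*-identityˡ _)) τ̄-nil ⟩
      τm (k , i , j) + 0# R.≈⟨ R.+-identityʳ _ ⟩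
      τm (k , i , j) R.∎

  τ̄-* : ∀ x y → τ̄ (x * y) ≃ τ̄ x * τ̄ y
  τ̄-* x y = induction (λ x → τ̄ (x * y) ≃ τ̄ x * τ̄ y)
    (R.trans (τ̄-cong (R.trans (R.*-congʳ nil≈0) (R.zeroˡ y))) (R.trans (R.trans (τ̄-cong (R.sym nil≈0)) τ̄-nil)
      (R.sym (R.trans (R.*-congʳ τ̄-nil) (R.zeroˡ _)))))
    (λ { x (k , i , j) {z} ih → R.begin
      τ̄ (cons x (k , i , j) z * y) R.≈⟨ τ̄-cong (R.trans (R.*-congʳ (cons≈ x (k , i , j) z)) (R.trans (R.distribʳ _ _ _) (R.+-congʳ (R.*-assoc _ _ _)))) ⟩
      τ̄ (ι x * (mono (k , i , j) * y) + z * y) R.≈⟨ R.trans (τ̄-+ _ _) (R.+-cong (R.trans (τ̄-ι* x _) (R.*-congˡ (τ̄-mono* k i j y))) ih) ⟩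
      ι (x K.^ Q) * (τm (k , i , j) * τ̄ y) + τ̄ z * τ̄ y
        R.≈⟨ R.solve 4 (λ x t y z → x R.:* (t R.:* y) R.:+ z R.:* y R.⊜ (x R.:* t R.:+ z) R.:* y) R.refl _ _ _ _ ⟩
      (ι (x K.^ Q) * τm (k , i , j) + τ̄ z) * τ̄ y R.≈⟨ R.*-congʳ (τ̄-cons x _ z) ⟨
      τ̄ (cons x (k , i , j) z) * τ̄ y R.∎ }) x

  τ̄-1 : τ̄ 1# ≃ 1#
  τ̄-1 = R.trans (τ̄-cong (R.sym mono-ε)) (R.trans (τ̄-mono (+ 0) 0 0)
    (R.trans (R.*-cong (R.trans (ι-cong (K.*-identityˡ _)) ι-1) (R.trans (R.*-congˡ (R.*-identityˡ _)) (R.trans (R.*-identityʳ _) U-0))) (R.*-identityˡ _)))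

  τ̄-0 : τ̄ 0# ≃ 0#
  τ̄-0 = R.trans (τ̄-cong (R.sym nil≈0)) τ̄-nil

  τ̄-ι : ∀ x → τ̄ (ι x) ≃ ι (x K.^ Q)
  τ̄-ι x = R.trans (τ̄-cong (R.sym (R.*-identityʳ _))) (R.trans (τ̄-ι* x 1#) (R.trans (R.*-congˡ τ̄-1) (R.*-identityʳ _)))

  τ̄-neg : ∀ x → τ̄ (- x) ≃ - τ̄ x
  τ̄-neg x = R.x-y≈0⇒x≈y _ _ (R.trans (R.+-congˡ (R.-‿involutive _)) (R.trans (R.sym (τ̄-+ _ _)) (R.trans (τ̄-cong (R.-‿inverseˡ x)) τ̄-0)))

  τ̄-^ : ∀ x m → τ̄ (x ^ m) ≃ τ̄ x ^ m
  τ̄-^ x zero = τ̄-1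
  τ̄-^ x (suc m) = R.trans (τ̄-* _ _) (R.*-congˡ (τ̄-^ x m))

  τ̄-∑ : ∀ m f → τ̄ (R.∑ m f) ≃ R.∑ m (λ i → τ̄ (f i))
  τ̄-∑ = R.∑-additive τ̄-0 τ̄-+

  τ̄-U : ∀ k → τ̄ (U k) ≃ ι (c^ k) * U (ℤ.- k)
  τ̄-U k = R.trans (τ̄-mono k 0 0) (R.*-cong (ι-cong (K.*-identityʳ _)) (R.trans (R.*-congˡ (R.*-identityˡ _)) (R.*-identityʳ _)))

  τ̄-v : τ̄ v ≃ - v
  τ̄-v = R.trans (τ̄-mono (+ 0) 1 0) (R.trans (R.*-cong (R.trans (ι-cong (K.trans (K.*-identityˡ _) (K.*-identityʳ _))) (R.trans (ι-neg _) (R.-‿cong ι-1)))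
      (R.trans (R.*-congʳ U-0) (R.trans (R.*-identityˡ _) (R.*-identityʳ _))))
    (R.solve 1 (λ v → (R.:- R.con (+ 1)) R.:* (v R.:* R.con (+ 1)) R.⊜ R.:- v) R.refl v))

  τ̄-b : τ̄ b ≃ a
  τ̄-b = R.trans (τ̄-mono (+ 0) 0 1) (R.trans (R.*-cong (R.trans (ι-cong (K.*-identityˡ _)) ι-1) (R.trans (R.*-congʳ U-0) (R.trans (R.*-identityˡ _) (R.trans (R.*-identityˡ _) (R.*-identityʳ _)))))
    (R.*-identityˡ a))

  τ̄-L : ∀ y → τ̄ (L y) ≃ L (τ̄ y)
  τ̄-L y = R.trans (τ̄-∑ s _) (R.∑-cong s λ m _ → τ̄-^ y (q ℕ.^ m))

  τ̄-a : τ̄ a ≃ b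
  τ̄-a = R.trans (τ̄-+ b (L v)) (R.trans (R.+-cong τ̄-b (R.trans (τ̄-L v) (R.trans (L-cong τ̄-v) (L-neg v))))
    (R.solve 2 (λ b l → (b R.:+ l) R.:- l R.⊜ b) R.refl b (L v)))

  τ̄-involutive : ∀ x → τ̄ (τ̄ x) ≃ x
  τ̄-involutive = induction _ (R.trans (τ̄-cong τ̄-nil) (R.trans τ̄-0 (R.sym nil≈0)))
    λ { x (k , i , j) {z} ih → R.begin
      τ̄ (τ̄ (cons x (k , i , j) z)) R.≈⟨ R.trans (τ̄-cong (τ̄-cons x _ z)) (R.trans (τ̄-+ _ _) (R.+-cong (R.trans (τ̄-ι* _ _) (R.*-cong (ι-cong (x^QQ x)) (mono-involutive k i j))) ih)) ⟩
      ι x * mono (k , i , j) + z R.≈⟨ cons≈ x (k , i , j) z ⟨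
      cons x (k , i , j) z R.∎ }
    where
    mono-involutive : ∀ k i j → τ̄ (τm (k , i , j)) ≃ mono (k , i , j)
    mono-involutive k i j = R.begin
      τ̄ (ι (c^ k K.* sgn i) * (U (ℤ.- k) * (v ^ i * a ^ j)))
        R.≈⟨ R.trans (τ̄-ι* _ _) (R.*-cong (ι-cong (K.trans (K.^-distrib-* _ _ Q) (K.*-cong (c^-Q k) sgn^Q)))
               (R.trans (τ̄-* _ _) (R.*-cong (τ̄-U (ℤ.- k)) (R.trans (τ̄-* _ _) (R.*-cong (R.trans (τ̄-^ v i) (R.^-congˡ i (R.trans τ̄-v -v))) (R.trans (τ̄-^ a j) (R.^-congˡ j τ̄-a))))))) ⟩
      ι (c^ k K.* sgn i) * ((ι (c^ (ℤ.- k)) * U (ℤ.- (ℤ.- k))) * ((ι (K.- K.1#) * v) ^ i * b ^ j))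
        R.≈⟨ R.*-cong (ι-* _ _) (R.*-cong (R.*-congˡ (R.reflexive (≡.cong U (ℤₚ.neg-involutive k)))) (R.*-congʳ (R.trans (R.^-distrib-* _ _ i) (R.*-congʳ (R.sym (ι-^ (K.- K.1#) i)))))) ⟩
      (ι (c^ k) * ι (sgn i)) * ((ι (c^ (ℤ.- k)) * U k) * ((ι (sgn i) * v ^ i) * b ^ j))
        R.≈⟨ R.solve 6 (λ x s y t z w → (x R.:* s) R.:* ((y R.:* t) R.:* ((s R.:* z) R.:* w)) R.⊜ (x R.:* y) R.:* (s R.:* s) R.:* (t R.:* (z R.:* w))) R.refl _ _ _ _ _ _ ⟩
      (ι (c^ k) * ι (c^ (ℤ.- k))) * (ι (sgn i) * ι (sgn i)) * (U k * (v ^ i * b ^ j))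
        R.≈⟨ R.*-cong (R.*-cong (unit (c^-inverse k)) (unit (sgn² i))) (R.sym (mono≃ k i j)) ⟩
      1# * 1# * mono (k , i , j) R.≈⟨ R.trans (R.*-congʳ (R.*-identityˡ _)) (R.*-identityˡ _) ⟩
      mono (k , i , j) R.∎
      where
      unit : ∀ {x y} → x K.* y ≈ K.1# → ι x * ι y ≃ 1#
      unit h = R.trans (R.sym (ι-* _ _)) (R.trans (ι-cong h) ι-1)
      -v : - v ≃ ι (K.- K.1#) * v
      -v = R.sym (R.trans (R.*-congʳ (R.trans (ι-neg _) (R.-‿cong ι-1))) (R.solve 1 (λ v → (R.:- R.con (+ 1)) R.:* v R.⊜ R.:- v) R.refl v))
      sgn^Q : sgn i K.^ Q ≈ sgn i
      sgn^Q = K.trans (K.^-assocʳ _ i Q) (K.trans (K.^-congʳ _ (ℕₚ.*-comm i Q)) (K.trans (K.sym (K.^-assocʳ _ Q i))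
        (K.^-congˡ i (K.trans (K-neg^ n K.1#) (K.-‿cong (K.1^ Q))))))

  -- Since τ̄ exchanges u = 0 and u = ∞, this bounds the pole order at u = ∞.
  Below₂ : ℤ → Element → Set
  Below₂ M x = Below M (τ̄ x)

  -- The functional δ is fixed by `twist`, so ρ x is minus the Q-th power of ρ (τ̄ x), and the bound
  -- at u = 0 applies to τ̄ x.
  ρ-Below₂-< : ∀ {M x} → M ℤ.< c₀ → Below₂ M x → ρ x ≈ K.0#
  ρ-Below₂-< {M} {x} M< B = K.begin
    ρ x K.≈⟨ ρ-cong (R.trans (R.sym (R.*-identityˡ _)) (R.*-cong (R.trans (R.sym τ̄-1) (R.trans (τ̄-cong (R.sym mono-ε)) (τ̄-mono (+ 0) 0 0))) (R.sym (τ̄-involutive x)))) ⟩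
    ρ (τm (+ 0 , 0 , 0) * τ̄ (τ̄ x)) K.≈⟨ ρ-τ̄ δ (+ 0) 0 0 (τ̄ x) ⟩
    K.- (ρ[ twist δ ] (τ̄ x) K.^ Q) K.≈⟨ K.-‿cong (K.^-congˡ Q (twist-δ (τ̄ x))) ⟩
    K.- (ρ (τ̄ x) K.^ Q) K.≈⟨ K.-‿cong (K.trans (K.^-congˡ Q (ρ-Below-< M< B)) (K.0^ Q (q^>0 n))) ⟩
    K.- K.0# K.≈⟨ K.-0#≈0# ⟩
    K.0# K.∎
    where
    twist-δ : ∀ z → ρ[ twist δ ] z ≈ ρ z
    twist-δ = ev-cong-index pointwise (+ 0) 0 0
      where
      vanish : ∀ k → (c^ k K.* K.0#) K.^ Q ≈ K.0#
      vanish k = K.trans (K.^-congˡ Q (K.zeroʳ _)) (K.0^ Q (q^>0 n))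
      pointwise : ∀ k → twist δ k ≈ δ k
      pointwise (+ 0) = K.trans (K.^-congˡ Q (K.*-identityˡ _)) (K.1^ Q)
      pointwise (+ suc k) = vanish (+ suc k)
      pointwise -[1+ k ] = vanish -[1+ k ]

  -- Dual bases

  -- The natural number behind `c₀`; `N₀` reduces to `suc C`.
  C : ℕ
  C = d″ ℕ.+ suc q″ ℕ.* d

  qσ≡ : q ℕ.* σ ≡ suc q ℕ.+ C
  qσ≡ = eq q″ d″
    where
    eq : ∀ x y → (2 ℕ.+ x) ℕ.* (2 ℕ.+ y) ≡ (3 ℕ.+ x) ℕ.+ (y ℕ.+ (1 ℕ.+ x) ℕ.* (1 ℕ.+ y))
    eq = ℕ-Solver.solve-∀

  Below-≤ : ∀ {m m′ x} → m ≤ m′ → Below (+ m) x → Below (+ m′) x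
  Below-≤ le = weaken-≤ (ℤ.+≤+ le)

  Below-power : ∀ {m x} k → Below (+ m) x → Below (+ (k ℕ.* m)) (x ^ k)
  Below-power {m} k B = Below-≡ (≡.sym (ℤₚ.pos-* k m)) (Below-^ k B)

  Lead-power : ∀ {m x} k → Lead (+ m) x → Lead (+ (k ℕ.* m)) (x ^ k)
  Lead-power {m} k B = Lead-≡ (≡.sym (ℤₚ.pos-* k m)) (Lead-^ k B)

  private
    σ′ σ″ : ℕ
    σ′ = q ℕ.^ s′
    σ″ = ℕ.pred σ′

    σ′≡ : suc σ″ ≡ σ′
    σ′≡ = ℕₚ.suc-pred σ′ {{ℕₚ.m^n≢0 q s′}}

    q≤σ : q ≤ σ
    q≤σ = ≡.subst₂ _≤_ (ℕₚ.*-identityʳ q) (≡.sym σ≡) (ℕₚ.*-monoʳ-≤ q (q^>0 s′))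

    1<q : 1 < q
    1<q = s≤s (s≤s z≤n)

    partial : ℕ → Element
    partial m = R.∑ m (λ i → v ^ (q ℕ.^ i))

    Below-v^ : ∀ m → Below (+ (q ℕ.^ suc m)) (v ^ (q ℕ.^ m))
    Below-v^ m = Below-≡ (≡.cong +_ (ℕₚ.*-comm (q ℕ.^ m) q)) (Below-power (q ℕ.^ m) Below-v)

    Lead-b+ : ∀ {D y} → 1 ≤ D → Lead (+ suc D) y → (∀ m → m < s′ → q ℕ.^ suc m ≤ D) → Lead (+ suc D) (b + (partial s′ + y))
    Lead-b+ {D} {y} 1≤D L h = Lead-≃ (R.solve 3 (λ y b p → y R.:+ (b R.:+ p) R.⊜ b R.:+ (p R.:+ y)) R.refl y b (partial s′))
      (Lead-+ L (Below-≤ 1≤D Below-b ⊕ Below-∑ s′ λ m m<s′ → Below-≤ (h m m<s′) (Below-v^ m)))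

  -- The last term v^(q^(s-1)) of the partial trace dominates and has order q^s = σ.
  Lead-a : Lead (+ σ) a
  Lead-a = Lead-b+ (s≤s z≤n) (Lead-≡ (≡.cong +_ (≡.trans (ℕₚ.*-comm σ′ q) (≡.sym σ≡))) (Lead-power σ′ Lead-v))
    λ m m<s′ → ℕₚ.≤-pred (≡.subst (q ℕ.^ suc m <_) (≡.sym σ≡) (ℕₚ.^-monoʳ-< q 1<q (s≤s m<s′)))

  Below₂-≡ : ∀ {M M′ x} → M ≡ M′ → Below₂ M x → Below₂ M′ x
  Below₂-≡ ≡.refl B = B

  Below₂-weaken : ∀ {M M′ x} → M ℤ.≤ M′ → Below₂ M x → Below₂ M′ x
  Below₂-weaken = weaken-≤

  Below₂-≤ : ∀ {m m′ x} → m ≤ m′ → Below₂ (+ m) x → Below₂ (+ m′) x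
  Below₂-≤ = Below-≤

  Below₂-≃ : ∀ {M x y} → x ≃ y → Below₂ M x → Below₂ M y
  Below₂-≃ p B = resp (τ̄-cong p) B

  Below₂-+ : ∀ {M x y} → Below₂ M x → Below₂ M y → Below₂ M (x + y)
  Below₂-+ B B′ = resp (R.sym (τ̄-+ _ _)) (B ⊕ B′)

  Below₂-0 : ∀ {M} → Below₂ M 0#
  Below₂-0 = resp (R.sym τ̄-0) zero

  Below₂-neg : ∀ {M x} → Below₂ M x → Below₂ M (- x)
  Below₂-neg B = resp (R.sym (τ̄-neg _)) (Below-neg B)

  Below₂-- : ∀ {M x y} → Below₂ M x → Below₂ M y → Below₂ M (x - y)
  Below₂-- B B′ = Below₂-+ B (Below₂-neg B′)

  Below₂-* : ∀ {M M′ x y} → Below₂ M x → Below₂ M′ y → Below₂ (M ℤ.+ M′) (x * y)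
  Below₂-* B B′ = resp (R.sym (τ̄-* _ _)) (Below-* B B′)

  Below₂-power : ∀ {m x} k → Below₂ (+ m) x → Below₂ (+ (k ℕ.* m)) (x ^ k)
  Below₂-power k B = resp (R.sym (τ̄-^ _ k)) (Below-power k B)

  Below₂-ι : ∀ x → Below₂ (+ 0) (ι x)
  Below₂-ι x = resp (R.sym (τ̄-ι x)) (Below-ι _)

  Below₂-ι* : ∀ {M} x {y} → Below₂ M y → Below₂ M (ι x * y)
  Below₂-ι* x B = resp (R.sym (τ̄-ι* x _)) (Below-ι* _ B)

  Below₂-1 : Below₂ (+ 0) 1#
  Below₂-1 = resp (R.sym τ̄-1) Below-1

  Below₂-∑ : ∀ {M} m {f} → (∀ i → i < m → Below₂ M (f i)) → Below₂ M (R.∑ m f)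
  Below₂-∑ m h = resp (R.sym (τ̄-∑ m _)) (Below-∑ m h)

  Below₂-v : Below₂ (+ q) v
  Below₂-v = resp (R.sym τ̄-v) (Below-neg Below-v)

  Below₂-a : Below₂ (+ 1) a
  Below₂-a = resp (R.sym τ̄-a) Below-b

  Below₂-b : Below₂ (+ σ) b
  Below₂-b = resp (R.sym τ̄-b) (Lead⇒Below Lead-a)

  Below₂-U : ∀ k → Below₂ (+ N₀ ℤ.* k) (U k)
  Below₂-U k = resp (R.sym (τ̄-U k)) (Below-ι* _ (Below-≡ (eq (+ N₀) k) (Below-U (ℤ.- k))))
    where
    eq : ∀ N k → ℤ.- (N ℤ.* ℤ.- k) ≡ N ℤ.* k
    eq = solve-∀

  private
    sgn-suc-q″ : sgn (suc q″) ≈ K.1#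
    sgn-suc-q″ = K.begin
      sgn (suc q″) K.≈⟨ K.solve 1 (λ x → x K.⊜ K.:- ((K.:- K.con (+ 1)) K.:* x)) K.refl _ ⟩
      K.- sgn q K.≡⟨ ≡.cong (λ m → K.- sgn m) (≡.sym (ℕₚ.*-identityʳ q)) ⟩
      K.- sgn (q ℕ.^ 1) K.≈⟨ K.-‿cong (K-neg^ 1 K.1#) ⟩
      K.- (K.- (K.1# K.^ (q ℕ.^ 1))) K.≈⟨ K.trans (K.-‿involutive _) (K.1^ (q ℕ.^ 1)) ⟩
      K.1# K.∎

    -- b = X₂ - v^σ′ with X₂ of small order at u = ∞.

    X₂ : Element
    X₂ = a - partial s′

    b≃ : b ≃ X₂ - v ^ σ′
    b≃ = R.solve 3 (λ b p y → b R.⊜ ((b R.:+ (p R.:+ y)) R.:- p) R.:- y) R.refl b (partial s′) (v ^ σ′)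

    Below₂-X : Below₂ (+ σ′) X₂
    Below₂-X = Below₂-- (Below₂-≤ (q^>0 s′) Below₂-a)
      (Below₂-∑ s′ λ m m<s′ → Below₂-≤ (ℕₚ.^-monoʳ-≤ q m<s′) (Below₂-≡ (≡.cong +_ (ℕₚ.*-comm (q ℕ.^ m) q)) (Below₂-power (q ℕ.^ m) Below₂-v)))

    b^-expansion : ∀ m → ∃ λ w → Below₂ (+ (m ℕ.* σ)) w × b ^ suc m ≃ (- (v ^ σ′)) ^ suc m + X₂ * w
    b^-expansion zero = 1# , Below₂-1 , R.trans (R.*-congʳ b≃)
      (R.solve 2 (λ x y → (x R.:- y) R.:* R.con (+ 1) R.⊜ (R.:- y) R.:* R.con (+ 1) R.:+ x R.:* R.con (+ 1)) R.refl X₂ (v ^ σ′))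
    b^-expansion (suc m) = let w , Bw , eq = b^-expansion m in
      (- (v ^ σ′)) ^ suc m + b * w ,
      Below₂-+ (Below₂-power (suc m) (Below₂-≡ (≡.cong +_ (≡.trans (ℕₚ.*-comm σ′ q) (≡.sym σ≡))) (Below₂-neg (Below₂-power σ′ Below₂-v)))) (Below₂-* Below₂-b Bw) ,
      R.trans (R.*-congˡ eq) (R.trans (R.solve 4 (λ b y x w → b R.:* (y R.:+ x R.:* w) R.⊜ b R.:* y R.:+ x R.:* (b R.:* w)) R.refl b _ X₂ w)
        (R.trans (R.+-congʳ (R.*-congʳ b≃)) (R.solve 4 (λ x z y w → (x R.:- z) R.:* y R.:+ x R.:* w R.⊜ (R.:- z) R.:* y R.:+ x R.:* (y R.:+ w)) R.refl X₂ (v ^ σ′) _ _)))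

    w₂ : ℕ
    w₂ = σ″ ℕ.* q ℕ.+ (σ′ ℕ.+ q″ ℕ.* σ)

    -- The leading terms of v^(σ′-1) b^(q-1) and u at u = ∞ cancel.
    special₂ : Below₂ (+ w₂) (v ^ σ″ * b ^ suc q″ - u)
    special₂ = let w , Bw , eq = b^-expansion q″ in
      Below₂-≃ (R.sym (R.begin
        v ^ σ″ * b ^ suc q″ - u R.≈⟨ R.+-congʳ (R.*-congˡ (R.trans eq (R.+-congʳ sign))) ⟩
        v ^ σ″ * ((v ^ σ′) ^ suc q″ + X₂ * w) - u
          R.≈⟨ R.solve 5 (λ y z x w u → y R.:* (z R.:+ x R.:* w) R.:- u R.⊜ y R.:* (x R.:* w) R.:+ (y R.:* z R.:- u)) R.refl (v ^ σ″) ((v ^ σ′) ^ suc q″) X₂ w u ⟩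
        v ^ σ″ * (X₂ * w) + (v ^ σ″ * (v ^ σ′) ^ suc q″ - u)
          R.≈⟨ R.+-congˡ (R.+-congʳ (R.trans v-power v-relation)) ⟩
        v ^ σ″ * (X₂ * w) + (((u - ι m₀) + ι c * u⁻¹) - u)
          R.≈⟨ R.+-congˡ (R.solve 3 (λ u m z → ((u R.:- m) R.:+ z) R.:- u R.⊜ z R.:- m) R.refl u (ι m₀) (ι c * u⁻¹)) ⟩
        v ^ σ″ * (X₂ * w) + (ι c * u⁻¹ - ι m₀) R.∎))
      (Below₂-+ (Below₂-* (Below₂-power σ″ Below₂-v) (Below₂-* Below₂-X Bw))
        (Below₂-weaken (ℤ.+≤+ z≤n) (Below₂-- (Below₂-ι* c (Below₂-weaken ℤ.-≤+ (Below₂-U -[1+ 0 ]))) (Below₂-ι m₀))))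
      where
      sign : (- (v ^ σ′)) ^ suc q″ ≃ (v ^ σ′) ^ suc q″
      sign = R.trans (R.^-congˡ (suc q″) (R.sym (R.trans (R.*-congʳ (R.trans (ι-neg _) (R.-‿cong ι-1))) (R.solve 1 (λ v → (R.:- R.con (+ 1)) R.:* v R.⊜ R.:- v) R.refl _))))
        (R.trans (R.^-distrib-* _ _ (suc q″)) (R.trans (R.*-congʳ (R.trans (R.sym (ι-^ (K.- K.1#) (suc q″))) (R.trans (ι-cong sgn-suc-q″) ι-1))) (R.*-identityˡ _)))
      exponent : σ″ ℕ.+ σ′ ℕ.* suc q″ ≡ d
      exponent = ℕₚ.suc-injective (≡.trans (≡.cong (ℕ._+ σ′ ℕ.* suc q″) σ′≡) (≡.trans (≡.sym (ℕₚ.*-suc σ′ (suc q″))) (≡.trans (ℕₚ.*-comm σ′ q) (≡.sym σ≡))))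
      v-power : v ^ σ″ * (v ^ σ′) ^ suc q″ ≃ v ^ d
      v-power = R.trans (R.*-congˡ (R.^-assocʳ v σ′ (suc q″))) (R.trans (R.sym (R.^-homo-* v σ″ _)) (R.^-congʳ v exponent))

    -- The mixed digits r = i σ + l q + j. At u = 0 the orders of a, v and b are σ, q and 1, so v^l
    -- a^i b^j has order r.
    i[_] t[_] l[_] j[_] : ℕ → ℕ
    i[ r ] = r ℕ/./ σ
    t[ r ] = r ℕ/.% σ
    l[ r ] = t[ r ] ℕ/./ q
    j[ r ] = t[ r ] ℕ/.% q

    monomial : ℕ → ℕ → ℕ → Element
    monomial l i j = v ^ l * (a ^ i * b ^ j)

    correction : ∀ {t} → Dec (t ≡ d) → ℕ → Element
    correction (yes _) i = u * a ^ i
    correction (no _) i = 0#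

    Lead-f : ∀ {r} l i t j → r ≡ t ℕ.+ i ℕ.* σ → t ≡ j ℕ.+ l ℕ.* q → (t? : Dec (t ≡ d)) → Lead (+ r) (monomial l i j - correction t? i)
    Lead-f l i t j ≡.refl ≡.refl t? = Lead-- (Lead-≡ (≡.cong +_ (eq j l i q σ))
      (Lead-* (Lead-power l Lead-v) (Lead-* (Lead-power i Lead-a) (Lead-power j Lead-b)))) (lower t?)
      where
      eq : ∀ j l i q σ → l ℕ.* q ℕ.+ (i ℕ.* σ ℕ.+ j ℕ.* 1) ≡ j ℕ.+ l ℕ.* q ℕ.+ i ℕ.* σ
      eq = ℕ-Solver.solve-∀
      lower : ∀ {t} (t? : Dec (t ≡ d)) → Below (+ (t ℕ.+ i ℕ.* σ) ℤ.- + 1) (correction t? i)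
      lower (yes ≡.refl) = weaken-≤ (ℤₚ.+-monoˡ-≤ (+ (i ℕ.* σ)) { -[1+ C ]} {+ d″} ℤ.-≤+)
        (Below-≡ (≡.cong (ℤ._+ + (i ℕ.* σ)) (eq′ (+ N₀))) (Below-* (Below-U (+ 1)) (Below-power i (Lead⇒Below Lead-a))))
        where
        eq′ : ∀ N → ℤ.- (N ℤ.* + 1) ≡ ℤ.- N
        eq′ = solve-∀
      lower (no _) = zero

    C-bound : ∀ {x} → suc q ℕ.+ x ≤ q ℕ.* σ → x ≤ C
    C-bound {x} le = ℕₚ.+-cancelˡ-≤ (suc q) _ _ (≡.subst (suc q ℕ.+ x ≤_) qσ≡ le)

    -- At u = ∞ the orders of v, a and b are q, 1 and σ, and C = q σ - q - 1. The bound fails only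
    -- for l = σ′ - 1 and j = q - 1, that is for t = d, where the correction cancels the leading
    -- term.
    f₂ : ∀ l i t j → t ≡ j ℕ.+ l ℕ.* q → t ℕ.+ i ℕ.* σ < N₀ → l < σ′ → i < q → j < q → (t? : Dec (t ≡ d)) → Below₂ (+ C) (monomial l i j - correction t? i)
    f₂ l i t j t≡ r<N₀ l< i< j< (no t≢d) = Below₂-- (Below₂-≤ (C-bound bound)
        (Below₂-* (Below₂-power l Below₂-v) (Below₂-* (Below₂-power i Below₂-a) (Below₂-power j Below₂-b)))) Below₂-0
      where
      open ℕₚ.≤-Reasoning
      bound : suc q ℕ.+ (l ℕ.* q ℕ.+ (i ℕ.* 1 ℕ.+ j ℕ.* σ)) ≤ q ℕ.* σ
      bound with suc j ℕ.<? q
      ... | yes j+2≤q = begin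
        suc q ℕ.+ (l ℕ.* q ℕ.+ (i ℕ.* 1 ℕ.+ j ℕ.* σ)) ≡⟨ eq q l i j σ ⟩
        suc l ℕ.* q ℕ.+ (suc i ℕ.+ j ℕ.* σ) ≤⟨ ℕₚ.+-mono-≤ (ℕₚ.*-monoˡ-≤ q l<) (ℕₚ.+-monoˡ-≤ (j ℕ.* σ) (ℕₚ.≤-trans i< q≤σ)) ⟩
        σ′ ℕ.* q ℕ.+ (σ ℕ.+ j ℕ.* σ) ≡⟨ ≡.cong (ℕ._+ (σ ℕ.+ j ℕ.* σ)) (≡.trans (ℕₚ.*-comm σ′ q) (≡.sym σ≡)) ⟩
        suc (suc j) ℕ.* σ ≤⟨ ℕₚ.*-monoˡ-≤ σ j+2≤q ⟩
        q ℕ.* σ ∎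
        where
        eq : ∀ q l i j σ → suc q ℕ.+ (l ℕ.* q ℕ.+ (i ℕ.* 1 ℕ.+ j ℕ.* σ)) ≡ suc l ℕ.* q ℕ.+ (suc i ℕ.+ j ℕ.* σ)
        eq = ℕ-Solver.solve-∀
      -- Here j = q - 1, and t ≠ d leaves room for one more factor v: l + 2 ≤ σ′.
      ... | no j+2≰q = begin
        suc q ℕ.+ (l ℕ.* q ℕ.+ (i ℕ.* 1 ℕ.+ j ℕ.* σ)) ≡⟨ eq q l i j σ ⟩
        suc i ℕ.+ (q ℕ.+ l ℕ.* q) ℕ.+ j ℕ.* σ ≤⟨ ℕₚ.+-mono-≤ (ℕₚ.+-monoˡ-≤ (q ℕ.+ l ℕ.* q) i<) (ℕₚ.≤-reflexive (≡.cong (ℕ._* σ) j≡)) ⟩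
        suc (suc l) ℕ.* q ℕ.+ suc q″ ℕ.* σ ≤⟨ ℕₚ.+-monoˡ-≤ (suc q″ ℕ.* σ) (ℕₚ.*-monoˡ-≤ q l+2≤) ⟩
        σ′ ℕ.* q ℕ.+ suc q″ ℕ.* σ ≡⟨ ≡.cong (ℕ._+ suc q″ ℕ.* σ) (≡.trans (ℕₚ.*-comm σ′ q) (≡.sym σ≡)) ⟩
        q ℕ.* σ ∎
        where
        j≡ : j ≡ suc q″
        j≡ = ℕₚ.suc-injective (ℕₚ.≤-antisym j< (ℕₚ.≤-pred (ℕₚ.≰⇒> j+2≰q)))
        eq : ∀ q l i j σ → suc q ℕ.+ (l ℕ.* q ℕ.+ (i ℕ.* 1 ℕ.+ j ℕ.* σ)) ≡ suc i ℕ.+ (q ℕ.+ l ℕ.* q) ℕ.+ j ℕ.* σ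
        eq = ℕ-Solver.solve-∀
        l+2≤ : suc (suc l) ≤ σ′
        l+2≤ = ℕₚ.≤∧≢⇒< l< λ suc-l≡σ′ → t≢d (ℕₚ.suc-injective (≡.trans (≡.cong suc (≡.trans t≡ (≡.cong (ℕ._+ l ℕ.* q) j≡)))
          (≡.trans (≡.cong (ℕ._* q) suc-l≡σ′) (≡.trans (ℕₚ.*-comm σ′ q) (≡.sym σ≡)))))
    f₂ l i t j t≡ r<N₀ l< i< j< (yes t≡d) = Below₂-≃
        (R.trans (R.*-congˡ (R.+-congʳ (R.*-cong (R.^-congʳ v (≡.sym l≡)) (R.^-congʳ b (≡.sym j≡)))))
          (R.solve 4 (λ x y z u → x R.:* (y R.:* z R.:- u) R.⊜ y R.:* (x R.:* z) R.:- u R.:* x) R.refl (a ^ i) (v ^ l) (b ^ j) u))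
        (Below₂-≤ (C-bound bound) (Below₂-* (Below₂-power i Below₂-a) special₂))
      where
      open ℕₚ.≤-Reasoning
      full : suc j ℕ.+ l ℕ.* q ≡ q ℕ.+ σ″ ℕ.* q
      full = ≡.trans (≡.cong suc (≡.trans (≡.sym t≡) t≡d)) (≡.trans σ≡ (≡.trans (ℕₚ.*-comm q σ′) (≡.cong (ℕ._* q) (≡.sym σ′≡))))
      l≡ : l ≡ σ″
      l≡ = ℕₚ.≤-antisym (ℕₚ.≤-pred (≡.subst (suc l ≤_) (≡.sym σ′≡) l<))
        (ℕₚ.*-cancelʳ-≤ σ″ l q (ℕₚ.+-cancelˡ-≤ q _ _ (≡.subst (_≤ q ℕ.+ l ℕ.* q) full (ℕₚ.+-monoˡ-≤ (l ℕ.* q) j<))))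
      j≡ : j ≡ suc q″
      j≡ = ℕₚ.suc-injective (ℕₚ.+-cancelʳ-≡ (l ℕ.* q) (suc j) q (≡.trans full (≡.cong (λ l → q ℕ.+ l ℕ.* q) (≡.sym l≡))))
      i<q-1 : i < suc q″
      i<q-1 = ℕₚ.≰⇒> λ q-1≤i → ℕₚ.<⇒≱ r<N₀ (begin
        q ℕ.* d ≡⟨ eq q″ d″ ⟩
        d ℕ.+ suc q″ ℕ.* d ≤⟨ ℕₚ.+-mono-≤ (ℕₚ.≤-reflexive (≡.sym t≡d)) (ℕₚ.*-mono-≤ q-1≤i (ℕₚ.n≤1+n d)) ⟩
        t ℕ.+ i ℕ.* σ ∎)
        where
        eq : ∀ x y → (2 ℕ.+ x) ℕ.* (1 ℕ.+ y) ≡ (1 ℕ.+ y) ℕ.+ (1 ℕ.+ x) ℕ.* (1 ℕ.+ y)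
        eq = ℕ-Solver.solve-∀
      bound : suc q ℕ.+ (i ℕ.* 1 ℕ.+ w₂) ≤ q ℕ.* σ
      bound = begin
        suc q ℕ.+ (i ℕ.* 1 ℕ.+ w₂) ≡⟨ eq q i σ″ σ′ (q″ ℕ.* σ) ⟩
        suc σ″ ℕ.* q ℕ.+ ((σ′ ℕ.+ suc i) ℕ.+ q″ ℕ.* σ)
          ≤⟨ ℕₚ.+-mono-≤ (ℕₚ.≤-reflexive (≡.trans (≡.cong (ℕ._* q) σ′≡) (≡.trans (ℕₚ.*-comm σ′ q) (≡.sym σ≡))))
               (ℕₚ.+-monoˡ-≤ (q″ ℕ.* σ) (ℕₚ.≤-trans (ℕₚ.+-monoʳ-≤ σ′ (ℕₚ.≤-trans i<q-1 (ℕₚ.m≤m*n (suc q″) σ′ {{ℕₚ.m^n≢0 q s′}}))) (ℕₚ.≤-reflexive (≡.sym σ≡)))) ⟩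
        q ℕ.* σ ∎
        where
        eq : ∀ q i s σ w → suc q ℕ.+ (i ℕ.* 1 ℕ.+ (s ℕ.* q ℕ.+ (σ ℕ.+ w))) ≡ suc s ℕ.* q ℕ.+ ((σ ℕ.+ suc i) ℕ.+ w)
        eq = ℕ-Solver.solve-∀

  abstract
    -- The correction by a multiple of u keeps the order at u = ∞ at most C when t[ r ] = d.
    f : ℕ → Element
    f r = monomial l[ r ] i[ r ] j[ r ] - correction (t[ r ] ℕ.≟ d) i[ r ]

    f-Lead : ∀ r → Lead (+ r) (f r)
    f-Lead r = Lead-f l[ r ] i[ r ] t[ r ] j[ r ] (ℕ/.m≡m%n+[m/n]*n r σ) (ℕ/.m≡m%n+[m/n]*n t[ r ] q) (t[ r ] ℕ.≟ d)

    f-Below₂ : ∀ r → r < N₀ → Below₂ (+ C) (f r)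
    f-Below₂ r r< = f₂ l[ r ] i[ r ] t[ r ] j[ r ] (ℕ/.m≡m%n+[m/n]*n t[ r ] q) (≡.subst (_< N₀) (ℕ/.m≡m%n+[m/n]*n r σ) r<)
      (ℕ/.m<n*o⇒m/o<n (≡.subst (t[ r ] <_) (≡.trans σ≡ (ℕₚ.*-comm q σ′)) (ℕ/.m%n<n r σ)))
      (ℕ/.m<n*o⇒m/o<n (ℕₚ.<-trans r< (ℕₚ.*-monoʳ-< q (ℕₚ.n<1+n d)))) (ℕ/.m%n<n t[ r ] q) (t[ r ] ℕ.≟ d)

  ev-⨁ : ∀ i W h → ev i (R.⨁ W h) ≈ K.⨁ W (λ k → ev i (h k))
  ev-⨁ i zero h = K.refl
  ev-⨁ i (suc W) h = K.trans (ev-+ i _ _) (K.+-cong (ev-⨁ i W h) (ev-+ i _ _))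

  ⨁-*ʳ : ∀ W h x → R.⨁ W h * x ≃ R.⨁ W (λ k → h k * x)
  ⨁-*ʳ W h x = R.trans (R.*-comm _ _) (R.trans (R.sym (R.⨁-*ˡ W x h)) (R.⨁-cong W λ k _ → R.*-comm _ _))

  ∑-*ʳ : ∀ m h x → R.∑ m h * x ≃ R.∑ m (λ k → h k * x)
  ∑-*ʳ m h x = R.trans (R.*-comm _ _) (R.trans (R.sym (R.∑-*ˡ m x h)) (R.∑-cong m λ k _ → R.*-comm _ _))

  private
    escape : ∀ k {M} → M < N₀ ℕ.* suc k → ℤ.- (+ N₀ ℤ.* + suc k) ℤ.+ + (M ℕ.+ C) ℤ.< c₀
    escape k {M} M< = ≡.subst₂ (λ x y → ℤ.- x ℤ.+ + (M ℕ.+ C) ℤ.< y) (ℤₚ.pos-* N₀ (suc k)) (eq (+ (N₀ ℕ.* suc k)) (+ C))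
      (ℤₚ.+-monoʳ-< (ℤ.- (+ (N₀ ℕ.* suc k))) (ℤ.+<+ (ℕₚ.+-monoˡ-< C M<)))
      where
      eq : ∀ X C → ℤ.- X ℤ.+ (X ℤ.+ C) ≡ C
      eq = solve-∀

  ρ-U⁺ : ∀ k {M z} → M < N₀ ℕ.* suc k → Below (+ (M ℕ.+ C)) z → ρ (U (+ suc k) * z) ≈ K.0#
  ρ-U⁺ k M< B = ρ-Below-< (escape k M<) (Below-* (Below-U (+ suc k)) B)

  ρ-U⁻ : ∀ k {M z} → M < N₀ ℕ.* suc k → Below₂ (+ (M ℕ.+ C)) z → ρ (U -[1+ k ] * z) ≈ K.0#
  ρ-U⁻ k {M} {z} M< B = ρ-Below₂-< {x = U -[1+ k ] * z} (escape k M<) (Below₂-* {x = U -[1+ k ]} {z} (Below₂-≡ {x = U -[1+ k ]} (eq (+ N₀) (+ k)) (Below₂-U -[1+ k ])) B)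
    where
    eq : ∀ N k → N ℤ.* ℤ.- (+ 1 ℤ.+ k) ≡ ℤ.- (N ℤ.* (+ 1 ℤ.+ k))
    eq = solve-∀

  record Small (M : ℕ) (x : Element) : Set where
    constructor small
    field
      below : Below (+ M) x
      below₂ : Below₂ (+ M) x
  open Small public

  Small-* : ∀ {M M′ x y} → Small M x → Small M′ y → Small (M ℕ.+ M′) (x * y)
  Small-* {x = x} {y} (small B B₂) (small B′ B₂′) = small (Below-* B B′) (Below₂-* {x = x} {y} B₂ B₂′)

  ∃Small : ∀ x → ∃ λ M → Small M x
  ∃Small x =
    let M , B = bounded x
        M₂ , B₂ = bounded (τ̄ x)
    in M ℕ.+ M₂ , small (Below-≤ (ℕₚ.m≤m+n M M₂) B) (Below-≤ (ℕₚ.m≤n+m M₂ M) B₂)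

  ρ-U-Small : ∀ κ {M z} → M < N₀ ℕ.* ℤ.∣ κ ∣ → Small (M ℕ.+ C) z → ρ (U κ * z) ≈ K.0#
  ρ-U-Small (+ zero) {M} M< _ = ⊥-elim (ℕₚ.n≮0 (≡.subst (M <_) (ℕₚ.*-zeroʳ N₀) M<))
  ρ-U-Small (+ suc k) M< S = ρ-U⁺ k M< (below S)
  ρ-U-Small -[1+ k ] {z = z} M< S = ρ-U⁻ k {z = z} M< (below₂ S)

  -- The product x y has order at most 2 C at both places. The factor u^κ lowers one of them by at
  -- least N₀ > C, which brings it below c₀.
  ρ-U-off : ∀ κ {x y} → ¬ κ ≡ + 0 → Small C x → Small C y → ρ (U κ * (x * y)) ≈ K.0#
  ρ-U-off κ κ≢0 Sx Sy = ρ-U-Small κ (nonzero κ κ≢0) (Small-* Sx Sy)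
    where
    nonzero : ∀ κ → ¬ κ ≡ + 0 → C < N₀ ℕ.* ℤ.∣ κ ∣
    nonzero (+ zero) ne = ⊥-elim (ne ≡.refl)
    nonzero (+ suc k) ne = ℕₚ.m≤m*n N₀ (suc k)
    nonzero -[1+ k ] ne = ℕₚ.m≤m*n N₀ (suc k)

  -- In combination with `ρ-U-off`, orthonormality over F makes f and g dual bases over F[u, u⁻¹];
  -- `exact` ensures that their multiples by powers of u reach every order.
  record Orthonormal (f g : ℕ → Element) : Set where
    field
      small-f : ∀ r → r < N₀ → Small C (f r)
      small-g : ∀ r → r < N₀ → Small C (g r)
      exact : ∀ r → r < N₀ → ∃ λ r′ → r′ < N₀ × Lead (+ r) (f r′)
      ρ-diagonal : ∀ r → r < N₀ → ρ (f r * g r) ≈ K.1#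
      ρ-off : ∀ r r′ → r < N₀ → r′ < N₀ → ¬ r ≡ r′ → ρ (f r * g r′) ≈ K.0#

  module Completeness {f g : ℕ → Element} (O : Orthonormal f g) where
    open Orthonormal O

    coefficient : Element → ℤ → ℕ → K.Carrier
    coefficient x κ r = ρ (x * (U (ℤ.- κ) * f r))

    expansion : ℕ → Element → Element
    expansion W x = R.⨁ W (λ κ → R.∑ N₀ (λ r → ι (coefficient x κ r) * (U κ * g r)))

    private
      probe : ℤ → ℕ → Element
      probe κ r = U (ℤ.- κ) * f r

      product : ∀ κ r κ₀ r₀ → (U κ * g r) * probe κ₀ r₀ ≃ U (κ ℤ.- κ₀) * (f r₀ * g r)
      product κ r κ₀ r₀ = R.trans (R.solve 4 (λ t g s f → (t R.:* g) R.:* (s R.:* f) R.⊜ (t R.:* s) R.:* (f R.:* g)) R.refl _ _ _ _)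
        (R.*-congʳ (R.sym (U-+ κ (ℤ.- κ₀))))

      term-off : ∀ {κ κ₀ r r₀} → r < N₀ → r₀ < N₀ → ¬ κ ≡ κ₀ → ρ ((U κ * g r) * probe κ₀ r₀) ≈ K.0#
      term-off {κ} {κ₀} {r} {r₀} r< r₀< κ≢κ₀ = K.trans (ρ-cong (product κ r κ₀ r₀))
        (ρ-U-off (κ ℤ.- κ₀) (λ eq → κ≢κ₀ (ℤₚ.i-j≡0⇒i≡j κ κ₀ eq)) (small-f r₀ r₀<) (small-g r r<))

      term-on : ∀ κ r r₀ → ρ ((U κ * g r) * probe κ r₀) ≈ ρ (f r₀ * g r)
      term-on κ r r₀ = ρ-cong (R.trans (product κ r κ r₀) (R.trans (R.*-congʳ (R.trans (R.reflexive (≡.cong U (ℤₚ.+-inverseʳ κ))) U-0)) (R.*-identityˡ _)))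

      ρ-expansion : ∀ W x y → ρ (expansion W x * y) ≈ K.⨁ W (λ κ → K.∑ N₀ (λ r → coefficient x κ r K.* ρ ((U κ * g r) * y)))
      ρ-expansion W x y = K.trans (ρ-cong (⨁-*ʳ W _ y)) (K.trans (ev-⨁ _ W _) (K.⨁-cong W λ κ _ →
        K.trans (ρ-cong (∑-*ʳ N₀ _ y)) (K.trans (ev-∑ _ N₀ _) (K.∑-cong N₀ λ r _ → K.trans (ρ-cong (R.*-assoc _ _ _)) (ρ-ι* _ _)))))

      row-off : ∀ x {κ κ₀ r₀} → r₀ < N₀ → ¬ κ ≡ κ₀ → K.∑ N₀ (λ r → coefficient x κ r K.* ρ ((U κ * g r) * probe κ₀ r₀)) ≈ K.0#
      row-off x {κ} {κ₀} {r₀} r₀< ne = K.∑-zero N₀ λ r r< → K.trans (K.*-congˡ (term-off {κ} {κ₀} {r} {r₀} r< r₀< ne)) (K.zeroʳ _)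

      inside : ∀ W x κ₀ r₀ → r₀ < N₀ → ℤ.∣ κ₀ ∣ ≤ W → ρ (expansion W x * probe κ₀ r₀) ≈ coefficient x κ₀ r₀
      inside W x κ₀ r₀ r₀< le = K.begin
        ρ (expansion W x * probe κ₀ r₀) K.≈⟨ ρ-expansion W x (probe κ₀ r₀) ⟩
        K.⨁ W (λ κ → K.∑ N₀ (λ r → coefficient x κ r K.* ρ ((U κ * g r) * probe κ₀ r₀)))
          K.≈⟨ K.⨁-single W κ₀ le (λ κ _ ne → row-off x {κ} {κ₀} {r₀} r₀< ne) ⟩
        K.∑ N₀ (λ r → coefficient x κ₀ r K.* ρ ((U κ₀ * g r) * probe κ₀ r₀))
          K.≈⟨ K.∑-single N₀ r₀ r₀< (λ r r< ne → K.trans (K.*-congˡ (K.trans (term-on κ₀ r r₀) (ρ-off r₀ r r₀< r< (λ eq → ne (≡.sym eq))))) (K.zeroʳ _)) ⟩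
        coefficient x κ₀ r₀ K.* ρ ((U κ₀ * g r₀) * probe κ₀ r₀) K.≈⟨ K.*-congˡ (K.trans (term-on κ₀ r₀ r₀) (ρ-diagonal r₀ r₀<)) ⟩
        coefficient x κ₀ r₀ K.* K.1# K.≈⟨ K.*-identityʳ _ ⟩
        coefficient x κ₀ r₀ K.∎

      outside : ∀ W x {M} → Small M x → M ≤ W → ∀ κ₀ r₀ → r₀ < N₀ → W < ℤ.∣ κ₀ ∣ → ρ (expansion W x * probe κ₀ r₀) ≈ coefficient x κ₀ r₀
      outside W x {M} Sx M≤W κ₀ r₀ r₀< lt = K.trans
        (K.trans (ρ-expansion W x (probe κ₀ r₀)) (K.⨁-zero W λ κ le → row-off x {κ} {κ₀} {r₀} r₀< λ eq → ℕₚ.<⇒≱ lt (≡.subst (λ k → ℤ.∣ k ∣ ≤ W) eq le)))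
        (K.sym (K.trans (ρ-cong (R.solve 3 (λ x t f → x R.:* (t R.:* f) R.⊜ t R.:* (x R.:* f)) R.refl x (U (ℤ.- κ₀)) (f r₀)))
          (ρ-U-Small (ℤ.- κ₀) (≡.subst (λ k → M < N₀ ℕ.* k) (≡.sym (ℤₚ.∣-i∣≡∣i∣ κ₀)) (ℕₚ.≤-<-trans M≤W (ℕₚ.<-≤-trans lt (ℕₚ.m≤n*m ℤ.∣ κ₀ ∣ N₀))))
            (Small-* Sx (small-f r₀ r₀<)))))

      position : ∀ M → ∃ λ κ → ∃ λ r → r < N₀ × Lead M (probe κ r)
      position M = let r , r< , L = exact (M ℤ/.%ℕ N₀) (ℤ/.n%ℕd<d M N₀) in
        (M ℤ/./ℕ N₀) , r , r< , Lead-≡ (≡.trans (eq (+ N₀) (M ℤ/./ℕ N₀) (+ (M ℤ/.%ℕ N₀))) (≡.sym (ℤ/.a≡a%ℕn+[a/ℕn]*n M N₀))) (Lead-* (Lead-U _) L)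
        where
        eq : ∀ N κ r → ℤ.- (N ℤ.* ℤ.- κ) ℤ.+ r ≡ r ℤ.+ κ ℤ.* N
        eq = solve-∀

    -- By `separation` it suffices to pair with the elements u^(-κ) f r. Inside the window
    -- orthonormality reproduces the coefficients of x, outside both sides vanish by their orders.
    complete : ∀ {M} x → Small M x → ∀ W → M ≤ W → x ≃ expansion W x
    complete {M} x Sx W M≤W = R.x-y≈0⇒x≈y _ _ (separation (λ O → probe (proj₁ (position O)) (proj₁ (proj₂ (position O))))
      (λ O → proj₂ (proj₂ (proj₂ (position O)))) (x - expansion W x)
      λ O → vanish (proj₁ (position O)) (proj₁ (proj₂ (position O))) (proj₁ (proj₂ (proj₂ (position O)))))
      where
      agree : ∀ κ r → r < N₀ → Dec (ℤ.∣ κ ∣ ≤ W) → ρ (expansion W x * probe κ r) ≈ coefficient x κ r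
      agree κ r r< (yes le) = inside W x κ r r< le
      agree κ r r< (no nle) = outside W x Sx M≤W κ r r< (ℕₚ.≰⇒> nle)
      vanish : ∀ κ r → r < N₀ → ρ ((x - expansion W x) * probe κ r) ≈ K.0#
      vanish κ r r< = K.begin
        ρ ((x - expansion W x) * probe κ r) K.≈⟨ ρ-cong (R.solve 3 (λ x y z → (x R.:- y) R.:* z R.⊜ x R.:* z R.:- y R.:* z) R.refl _ _ _) ⟩
        ρ (x * probe κ r - expansion W x * probe κ r) K.≈⟨ K.trans (ρ-+ _ _) (K.+-congˡ (ev-neg _ _)) ⟩
        ρ (x * probe κ r) K.- ρ (expansion W x * probe κ r) K.≈⟨ K.x≈y⇒x-y≈0 (K.sym (agree κ r r< (ℤ.∣ κ ∣ ℕ.≤? W))) ⟩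
        K.0# K.∎

  f-Small : ∀ r → r < N₀ → Small C (f r)
  f-Small r r< = small (Below-≤ (ℕₚ.≤-pred r<) (Lead⇒Below (f-Lead r))) (f-Below₂ r r<)

  private
    pairing-low : ∀ i j → i ℕ.+ j < C → ρ (f i * f j) ≈ K.0#
    pairing-low i j lt = ρ-Below-< (ℤ.+<+ lt) (Below-* (Lead⇒Below (f-Lead i)) (Lead⇒Below (f-Lead j)))

    pairing-top : ∀ i j → i ℕ.+ j ≡ C → ¬ ρ (f i * f j) ≈ K.0#
    pairing-top i j eq = ρ-Lead (Lead-≡ (≡.cong +_ eq) (Lead-* (f-Lead i) (f-Lead j)))

    -- The matrix ρ (f i f j) is 0 for i + j < C and nonzero for i + j = C, so elimination inverts
    -- it one antidiagonal entry at a time. D k is dual to f (C - k) and keeps the order k of f k.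
    record Partial (m : ℕ) : Set where
      field
        D : ℕ → Element
        D-Lead : ∀ k → k < m → Lead (+ k) (D k)
        D-Small : ∀ k → k < m → Small C (D k)
        D-on : ∀ k → k < m → ρ (f (C ℕ.∸ k) * D k) ≈ K.1#
        D-off : ∀ i k → i < N₀ → k < m → ¬ i ≡ C ℕ.∸ k → ρ (f i * D k) ≈ K.0#

    module Extend {m : ℕ} (m< : m < N₀) (P : Partial m) where
      open Partial P

      λ₀ : ℕ → K.Carrier
      λ₀ k = ρ (f (C ℕ.∸ k) * f m)

      pivot : ¬ λ₀ m ≈ K.0#
      pivot = pairing-top (C ℕ.∸ m) m (ℕₚ.m∸n+n≡m (ℕₚ.≤-pred m<))

      y : Element
      y = f m - R.∑ m (λ k → ι (λ₀ k) * D k)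

      new : Element
      new = ι (inv (λ₀ m) pivot) * y

      ρ-new : ∀ i → ρ (f i * new) ≈ inv (λ₀ m) pivot K.* (ρ (f i * f m) K.- K.∑ m (λ k → λ₀ k K.* ρ (f i * D k)))
      ρ-new i = K.trans (ρ-cong (R.solve 4 (λ f x y z → f R.:* (x R.:* (y R.:- z)) R.⊜ x R.:* (f R.:* y R.:- f R.:* z)) R.refl (f i) _ (f m) _))
        (K.trans (ρ-ι* _ _) (K.*-congˡ (K.trans (ρ-+ _ _) (K.+-congˡ (K.trans (ev-neg _ _) (K.-‿cong (K.trans (ρ-cong (R.sym (R.∑-*ˡ m (f i) _)))
          (K.trans (ev-∑ _ m _) (K.∑-cong m λ k _ → K.trans (ρ-cong (R.solve 3 (λ f x d → f R.:* (x R.:* d) R.⊜ x R.:* (f R.:* d)) R.refl (f i) _ (D k))) (ρ-ι* _ _))))))))))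

      ∸-injective : ∀ {k} → k < m → ¬ C ℕ.∸ m ≡ C ℕ.∸ k
      ∸-injective {k} k<m eq = ℕₚ.<⇒≢ (ℕₚ.∸-monoʳ-< k<m (ℕₚ.≤-pred m<)) eq

      new-on : ρ (f (C ℕ.∸ m) * new) ≈ K.1#
      new-on = K.trans (ρ-new (C ℕ.∸ m)) (K.trans (K.*-congˡ (K.trans (K.+-congˡ (K.-‿cong (K.∑-zero m λ k k<m →
          K.trans (K.*-congˡ (D-off (C ℕ.∸ m) k (s≤s (ℕₚ.m∸n≤m C m)) k<m (∸-injective k<m))) (K.zeroʳ _))))
          (K.solve 1 (λ x → x K.:- K.con (+ 0) K.⊜ x) K.refl _)))
        (K.trans (K.*-comm _ _) (inv-inverse (λ₀ m) pivot)))

      new-off : ∀ i → i < N₀ → ¬ i ≡ C ℕ.∸ m → ρ (f i * new) ≈ K.0#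
      new-off i i< ne = K.trans (ρ-new i) (K.trans (K.*-congˡ (K.x≈y⇒x-y≈0 (K.sym (sum≈ (ℕₚ.<-cmp i (C ℕ.∸ m)))))) (K.zeroʳ _))
        where
        sum≈ : Tri (i < C ℕ.∸ m) (i ≡ C ℕ.∸ m) (C ℕ.∸ m < i) → K.∑ m (λ k → λ₀ k K.* ρ (f i * D k)) ≈ ρ (f i * f m)
        sum≈ (tri< lt _ _) = K.trans (K.∑-zero m λ k k<m → K.trans (K.*-congˡ (D-off i k i< k<m
            (ℕₚ.<⇒≢ (ℕₚ.<-trans lt (ℕₚ.∸-monoʳ-< k<m (ℕₚ.≤-pred m<)))))) (K.zeroʳ _))
          (K.sym (pairing-low i m (≡.subst (i ℕ.+ m <_) (ℕₚ.m∸n+n≡m (ℕₚ.≤-pred m<)) (ℕₚ.+-monoˡ-< m lt))))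
        sum≈ (tri≈ _ eq _) = ⊥-elim (ne eq)
        sum≈ (tri> _ _ gt) = K.trans (K.∑-single m k₀ k₀< λ k k<m k≢ → K.trans (K.*-congˡ (D-off i k i< k<m
            λ eq → k≢ (≡.trans (≡.sym (ℕₚ.m∸[m∸n]≡n (ℕₚ.<⇒≤ (ℕₚ.<-≤-trans k<m (ℕₚ.≤-pred m<))))) (≡.cong (C ℕ.∸_) (≡.sym eq))))) (K.zeroʳ _))
          (K.trans (K.*-congˡ (K.trans (ρ-cong (R.*-congʳ (R.reflexive (≡.cong f (≡.sym i≡))))) (D-on k₀ k₀<)))
            (K.trans (K.*-identityʳ _) (ρ-cong (R.*-congʳ (R.reflexive (≡.cong f i≡))))))
          where
          k₀ = C ℕ.∸ i
          k₀< : k₀ < m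
          k₀< = ≡.subst (k₀ <_) (ℕₚ.m∸[m∸n]≡n (ℕₚ.≤-pred m<)) (ℕₚ.∸-monoʳ-< gt (ℕₚ.≤-pred i<))
          i≡ : C ℕ.∸ k₀ ≡ i
          i≡ = ℕₚ.m∸[m∸n]≡n (ℕₚ.≤-pred i<)

      new-Lead : Lead (+ m) new
      new-Lead = Lead-≡ (ℤₚ.+-identityˡ _) (Lead-* (Lead-ι (inv≉0 (λ₀ m) pivot)) (Lead-- (f-Lead m)
        (Below-∑ m λ k k<m → Below-ι* _ (weaken-≤ (pred-bound k<m) (Lead⇒Below (D-Lead k k<m))))))
        where
        pred-bound : ∀ {k m} → k < m → + k ℤ.≤ + m ℤ.- + 1
        pred-bound {k} {suc m} (s≤s k≤m) = ℤ.+≤+ k≤m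

      new-Small : Small C new
      new-Small = small (Below-≤ (ℕₚ.≤-pred m<) (Lead⇒Below new-Lead))
        (Below₂-ι* _ {y} (Below₂-- {x = f m} (f-Below₂ m m<) (Below₂-∑ m λ k k<m → Below₂-ι* _ {D k} (below₂ (D-Small k k<m)))))

      extended : Partial (suc m)
      extended = record
        { D = update D m new
        ; D-Lead = update-elim D m new (λ k z → Lead (+ k) z) new-Lead D-Lead
        ; D-Small = update-elim D m new (λ k z → Small C z) new-Small D-Small
        ; D-on = update-elim D m new (λ k z → ρ (f (C ℕ.∸ k) * z) ≈ K.1#) new-on D-on
        ; D-off = λ i k i< k< → update-elim D m new (λ k z → ¬ i ≡ C ℕ.∸ k → ρ (f i * z) ≈ K.0#) (new-off i i<) (λ k k<m → D-off i k i< k<m) k k< }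

    partials : ∀ m → m ≤ N₀ → Partial m
    partials zero _ = record { D = λ _ → 0# ; D-Lead = λ _ () ; D-Small = λ _ () ; D-on = λ _ () ; D-off = λ _ _ _ () }
    partials (suc m) m< = Extend.extended m< (partials m (ℕₚ.<⇒≤ m<))

    open Partial (partials N₀ ℕₚ.≤-refl)

    ∸< : ∀ r → C ℕ.∸ r < N₀
    ∸< r = s≤s (ℕₚ.m∸n≤m C r)

  abstract
    f* : ℕ → Element
    f* r = D (C ℕ.∸ r)

    f*-Lead : ∀ r → Lead (+ (C ℕ.∸ r)) (f* r)
    f*-Lead r = D-Lead (C ℕ.∸ r) (∸< r)

    f*-Small : ∀ r → Small C (f* r)
    f*-Small r = D-Small (C ℕ.∸ r) (∸< r)

    ρ-f-f* : ∀ r → r < N₀ → ρ (f r * f* r) ≈ K.1#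
    ρ-f-f* r r< = K.trans (ρ-cong (R.*-congʳ (R.reflexive (≡.cong f (≡.sym (ℕₚ.m∸[m∸n]≡n (ℕₚ.≤-pred r<))))))) (D-on (C ℕ.∸ r) (∸< r))

    ρ-f-f*-off : ∀ r r′ → r < N₀ → r′ < N₀ → ¬ r ≡ r′ → ρ (f r * f* r′) ≈ K.0#
    ρ-f-f*-off r r′ r< r′< ne = D-off r (C ℕ.∸ r′) r< (∸< r′) λ eq → ne (≡.trans eq (ℕₚ.m∸[m∸n]≡n (ℕₚ.≤-pred r′<)))

  f-f* : Orthonormal f f*
  f-f* = record
    { small-f = f-Small ; small-g = λ r _ → f*-Small r
    ; exact = λ r r< → r , r< , f-Lead r
    ; ρ-diagonal = ρ-f-f* ; ρ-off = ρ-f-f*-off }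

  f*-f : Orthonormal f* f
  f*-f = record
    { small-f = λ r _ → f*-Small r ; small-g = f-Small
    ; exact = λ r r< → C ℕ.∸ r , s≤s (ℕₚ.m∸n≤m C r) , Lead-≡ (≡.cong +_ (ℕₚ.m∸[m∸n]≡n (ℕₚ.≤-pred r<))) (f*-Lead (C ℕ.∸ r))
    ; ρ-diagonal = λ r r< → K.trans (ρ-cong (R.*-comm _ _)) (ρ-f-f* r r<)
    ; ρ-off = λ r r′ r< r′< ne → K.trans (ρ-cong (R.*-comm _ _)) (ρ-f-f*-off r′ r r′< r< λ eq → ne (≡.sym eq)) }

  -- The Casimir element

  private
    τ-shift : ∀ β k₀ i j k → τ β i j (k₀ ℤ.+ k) ≈ τ (λ l → β (k₀ ℤ.+ l)) i j k
    τ-shift β k₀ = τ-induction (λ i j → ∀ k → τ β i j (k₀ ℤ.+ k) ≈ τ β′ i j k)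
      (λ i j j< k → K.reflexive (≡.trans (τ-zero β i j _ j<) (≡.sym (τ-zero β′ i j k j<))))
      (λ i k → K.trans (K.reflexive (τ-top β i _)) (K.trans (vt-shift i k) (K.reflexive (≡.sym (τ-top β′ i k)))))
      (λ i j h₁ h₂ k → K.trans (K.reflexive (τ-step β i j _)) (K.trans
        (K.+-cong (h₁ k) (K.+-cong (K.*-congˡ (h₂ k)) (K.-‿cong (K.trans (K.reflexive (≡.cong (τ β (suc i) j) (comm-suc k₀ k))) (h₂ (ℤ.suc k))))))
        (K.reflexive (≡.sym (τ-step β′ i j k)))))
      where
      β′ = λ l → β (k₀ ℤ.+ l)
      comm-suc : ∀ k₀ k → + 1 ℤ.+ (k₀ ℤ.+ k) ≡ k₀ ℤ.+ (+ 1 ℤ.+ k)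
      comm-suc = solve-∀
      comm-pred : ∀ k₀ k → ℤ.- + 1 ℤ.+ (k₀ ℤ.+ k) ≡ k₀ ℤ.+ (ℤ.- + 1 ℤ.+ k)
      comm-pred = solve-∀
      vt-shift : ∀ i k → vt β i (k₀ ℤ.+ k) ≈ vt β′ i k
      vt-shift = vt-induction (λ i → ∀ k → vt β i (k₀ ℤ.+ k) ≈ vt β′ i k)
        (λ i i< k → K.reflexive (≡.trans (vt-zero β i _ i<) (≡.sym (vt-zero β′ i k i<))))
        (λ k → K.reflexive (≡.trans (vt-base β _) (≡.sym (vt-base β′ k))))
        (λ i ih k → K.trans (K.reflexive (vt-step β i _)) (K.trans
          (K.+-cong (K.+-cong (K.trans (K.reflexive (≡.cong (vt β i) (comm-suc k₀ k))) (ih _)) (K.-‿cong (K.*-congˡ (ih k))))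
            (K.*-congˡ (K.trans (K.reflexive (≡.cong (vt β i) (comm-pred k₀ k))) (ih _))))
          (K.reflexive (≡.sym (vt-step β′ i k)))))

    ev-shift : ∀ β k₀ k i j z → ev (β , k₀ ℤ.+ k , i , j) z ≈ ev ((λ l → β (k₀ ℤ.+ l)) , k , i , j) z
    ev-shift β k₀ k i j = induction _ (K.trans (ev-nil _) (K.sym (ev-nil _)))
      λ { x (k′ , i′ , j′) {z} ih → K.trans (ev-cons β (k₀ ℤ.+ k) i j x k′ i′ j′ z) (K.trans
          (K.+-cong (K.*-congˡ (K.trans (K.reflexive (≡.cong (τ β _ _) (ℤₚ.+-assoc k₀ k k′))) (τ-shift β k₀ _ _ _))) ih)
          (K.sym (ev-cons _ k i j x k′ i′ j′ z))) }

    ev-scale : ∀ x β k i j z → ev ((λ l → x K.* β l) , k , i , j) z ≈ x K.* ev (β , k , i , j) z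
    ev-scale x β k i j z =
      let W , w = ev-window (λ l → x K.* β l) k i j z
          W′ , w′ = ev-window β k i j z
      in K.trans (w (W ℕ.+ W′) (ℕₚ.m≤m+n W W′)) (K.trans (K.⨁-cong (W ℕ.+ W′) (λ l _ → K.*-assoc _ _ _))
        (K.trans (K.⨁-*ˡ (W ℕ.+ W′) x _) (K.*-congˡ (K.sym (w′ (W ℕ.+ W′) (ℕₚ.m≤n+m W′ W))))))

    pick : ℕ → ℤ → K.Carrier
    pick zero l = c^ l
    pick (suc _) l = K.0#

  -- ρ[ χ ] is the functional with ρ[ χ ] (u^(Q+1) z) = c ρ[ χ ] z extending ρ on a window of exponents of u.
  χ : ℤ → K.Carrier
  χ k = pick (k ℤ/.%ℕ suc Q) (k ℤ/./ℕ suc Q)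

  χ-value : ∀ r l → r < suc Q → χ (+ r ℤ.+ l ℤ.* + suc Q) ≈ pick r l
  χ-value r l r< = let l≡ , r≡ = quotient-unique (suc Q) (ℤ/.n%ℕd<d k (suc Q)) r< (≡.sym (ℤ/.a≡a%ℕn+[a/ℕn]*n k (suc Q))) in
    K.reflexive (≡.cong₂ pick r≡ l≡)
    where k = + r ℤ.+ l ℤ.* + suc Q

  χ-shift : ∀ l k → χ (l ℤ.* + suc Q ℤ.+ k) ≈ c^ l K.* χ k
  χ-shift l k = K.trans (K.reflexive (≡.cong χ position)) (K.trans (χ-value r₁ (l ℤ.+ l₀) (ℤ/.n%ℕd<d k (suc Q))) (pick-+ r₁))
    where
    r₁ = k ℤ/.%ℕ suc Q
    l₀ = k ℤ/./ℕ suc Q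
    position : l ℤ.* + suc Q ℤ.+ k ≡ + r₁ ℤ.+ (l ℤ.+ l₀) ℤ.* + suc Q
    position = ≡.trans (≡.cong (λ z → l ℤ.* + suc Q ℤ.+ z) (ℤ/.a≡a%ℕn+[a/ℕn]*n k (suc Q))) (eq (+ suc Q) l l₀ (+ r₁))
      where
      eq : ∀ N l l₀ r → l ℤ.* N ℤ.+ (r ℤ.+ l₀ ℤ.* N) ≡ r ℤ.+ (l ℤ.+ l₀) ℤ.* N
      eq = solve-∀
    pick-+ : ∀ r → pick r (l ℤ.+ l₀) ≈ c^ l K.* pick r l₀
    pick-+ zero = c^-+ l l₀
    pick-+ (suc _) = K.sym (K.zeroʳ _)

  ρ[χ]-shift : ∀ l z → ρ[ χ ] (U (l ℤ.* + suc Q) * z) ≈ c^ l K.* ρ[ χ ] z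
  ρ[χ]-shift l z = K.begin
    ρ[ χ ] (U k * z) K.≈⟨ ev-mono* _ (k , 0 , 0) z ⟩
    ev (χ , + 0 ℤ.+ k , 0 , 0) z K.≡⟨ ≡.cong (λ k → ev (χ , k , 0 , 0) z) (ℤₚ.+-comm (+ 0) k) ⟩
    ev (χ , k ℤ.+ + 0 , 0 , 0) z K.≈⟨ ev-shift χ k (+ 0) 0 0 z ⟩
    ev ((λ m → χ (k ℤ.+ m)) , + 0 , 0 , 0) z K.≈⟨ ev-cong-index (χ-shift l) (+ 0) 0 0 z ⟩
    ev ((λ m → c^ l K.* χ m) , + 0 , 0 , 0) z K.≈⟨ ev-scale (c^ l) χ (+ 0) 0 0 z ⟩
    c^ l K.* ρ[ χ ] z K.∎
    where k = l ℤ.* + suc Q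

  Φ : Element → Element
  Φ x = τ̄ x ^ Q

  Φ-cong : ∀ {x y} → x ≃ y → Φ x ≃ Φ y
  Φ-cong p = R.^-congˡ Q (τ̄-cong p)

  Φ-+ : ∀ x y → Φ (x + y) ≃ Φ x + Φ y
  Φ-+ x y = R.trans (R.^-congˡ Q (τ̄-+ x y)) (R-additive n _ _)

  Φ-* : ∀ x y → Φ (x * y) ≃ Φ x * Φ y
  Φ-* x y = R.trans (R.^-congˡ Q (τ̄-* x y)) (R.^-distrib-* _ _ Q)

  Φ-0 : Φ 0# ≃ 0#
  Φ-0 = R.trans (R.^-congˡ Q τ̄-0) (R.0^ Q (q^>0 n))

  Φ-ι : ∀ x → Φ (ι x) ≃ ι x
  Φ-ι x = R.trans (R.^-congˡ Q (τ̄-ι x)) (R.trans (R.sym (ι-^ _ Q)) (ι-cong (x^QQ x)))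

  Φ-ι* : ∀ a x → Φ (ι a * x) ≃ ι a * Φ x
  Φ-ι* a x = R.trans (Φ-* _ _) (R.*-congʳ (Φ-ι a))

  Φ-∑ : ∀ m h → Φ (R.∑ m h) ≃ R.∑ m (λ i → Φ (h i))
  Φ-∑ = R.∑-additive Φ-0 Φ-+

  Φ-⨁ : ∀ W h → Φ (R.⨁ W h) ≃ R.⨁ W (λ k → Φ (h k))
  Φ-⨁ zero h = R.refl
  Φ-⨁ (suc W) h = R.trans (Φ-+ _ _) (R.+-cong (Φ-⨁ W h) (Φ-+ _ _))

  U-^ : ∀ k m → U k ^ m ≃ U (k ℤ.* + m)
  U-^ k zero = R.sym (R.trans (R.reflexive (≡.cong U (ℤₚ.*-zeroʳ k))) U-0)
  U-^ k (suc m) = R.trans (R.*-congˡ (U-^ k m)) (R.trans (R.sym (U-+ k _)) (R.reflexive (≡.cong U (eq k (+ m)))))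
    where
    eq : ∀ k m → k ℤ.+ k ℤ.* m ≡ k ℤ.* (+ 1 ℤ.+ m)
    eq = solve-∀

  Φ-U : ∀ k → Φ (U k) ≃ ι (c^ k) * U (ℤ.- k ℤ.* + Q)
  Φ-U k = R.trans (R.^-congˡ Q (τ̄-U k)) (R.trans (R.^-distrib-* _ _ Q) (R.*-cong (R.trans (R.sym (ι-^ _ Q)) (ι-cong (c^-Q k))) (U-^ (ℤ.- k) Q)))

  -- Since Φ u = c u^(-Q), the elements u and Φ u differ by the factor u^(Q+1) / c, to which ρ[ χ ]
  -- is insensitive. Hence powers of u may pass between the two factors of the Casimir element even
  -- after Φ.
  ρ[χ]-Φ-U : ∀ κ z → ρ[ χ ] (Φ (U κ) * z) ≈ ρ[ χ ] (U κ * z)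
  ρ[χ]-Φ-U κ z = K.begin
    ρ[ χ ] (Φ (U κ) * z) K.≈⟨ ev-cong _ (R.trans (R.*-congʳ (Φ-U κ)) (R.*-assoc _ _ _)) ⟩
    ρ[ χ ] (ι (c^ κ) * (U (ℤ.- κ ℤ.* + Q) * z)) K.≈⟨ ev-ι* _ _ _ ⟩
    c^ κ K.* ρ[ χ ] (U (ℤ.- κ ℤ.* + Q) * z) K.≈⟨ ρ[χ]-shift κ _ ⟨
    ρ[ χ ] (U (κ ℤ.* + suc Q) * (U (ℤ.- κ ℤ.* + Q) * z))
      K.≈⟨ ev-cong _ (R.trans (R.sym (R.*-assoc _ _ _)) (R.*-congʳ (R.trans (R.sym (U-+ _ _)) (R.reflexive (≡.cong U (eq κ (+ Q))))))) ⟩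
    ρ[ χ ] (U κ * z) K.∎
    where
    eq : ∀ κ Q → κ ℤ.* (+ 1 ℤ.+ Q) ℤ.+ ℤ.- κ ℤ.* Q ≡ κ
    eq = solve-∀

  𝒦 : Element
  𝒦 = R.∑ N₀ (λ r → f r * Φ (f* r))

  private
    module P = Completeness f*-f
    module P* = Completeness f-f*

    sum-out : ∀ W g y (x : ℤ → ℕ → K.Carrier) (w : ℤ → ℕ → Element) →
      y ≃ R.⨁ W (λ κ → R.∑ N₀ (λ r → ι (x κ r) * w κ r)) →
      ρ[ χ ] (y * g) ≈ K.⨁ W (λ κ → K.∑ N₀ (λ r → x κ r K.* ρ[ χ ] (w κ r * g)))
    sum-out W g y x w eq = K.trans (ev-cong _ (R.trans (R.*-congʳ eq) (⨁-*ʳ W _ g))) (K.trans (ev-⨁ _ W _) (K.⨁-cong W λ κ _ →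
      K.trans (ev-cong _ (∑-*ʳ N₀ _ g)) (K.trans (ev-∑ _ N₀ _) (K.∑-cong N₀ λ r _ → K.trans (ev-cong _ (R.*-assoc _ _ _)) (ev-ι* _ _ _)))))

  private
    -- Multiplication by x is expanded in the f r on one side and in the f* r on the other. Both
    -- matrices have the entries ρ (x u^(-κ) f i f* r), so the two double sums agree.
    casimir-Small : ∀ {M} x → Small M x → ∀ g → ρ[ χ ] (g * (x * 𝒦)) ≈ ρ[ χ ] (g * (Φ x * 𝒦))
    casimir-Small {M} x Sx g = K.begin
      ρ[ χ ] (g * (x * 𝒦))
        K.≈⟨ ev-cong _ (R.trans (R.sym (R.*-assoc _ _ _)) (R.trans (R.sym (R.∑-*ˡ N₀ _ _)) (R.∑-cong N₀ λ i _ →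
               R.solve 4 (λ g x f h → (g R.:* x) R.:* (f R.:* h) R.⊜ (x R.:* f) R.:* (g R.:* h)) R.refl g x (f i) (Φ (f* i))))) ⟩
      ρ[ χ ] (R.∑ N₀ (λ i → (x * f i) * (g * Φ (f* i)))) K.≈⟨ ev-∑ _ N₀ _ ⟩
      K.∑ N₀ (λ i → ρ[ χ ] ((x * f i) * (g * Φ (f* i))))
        K.≈⟨ K.∑-cong N₀ (λ i i< → sum-out W (g * Φ (f* i)) (x * f i) (P.coefficient (x * f i)) (λ κ r → U κ * f r)
               (P.complete (x * f i) (Small-* Sx (f-Small i i<)) W ℕₚ.≤-refl)) ⟩
      K.∑ N₀ (λ i → K.⨁ W (λ κ → K.∑ N₀ (λ r → P.coefficient (x * f i) κ r K.* ρ[ χ ] ((U κ * f r) * (g * Φ (f* i))))))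
        K.≈⟨ K.⨁-∑-comm W N₀ _ ⟨
      K.⨁ W (λ κ → K.∑ N₀ (λ i → K.∑ N₀ (λ r → P.coefficient (x * f i) κ r K.* ρ[ χ ] ((U κ * f r) * (g * Φ (f* i))))))
        K.≈⟨ K.⨁-cong W (λ κ _ → K.trans (K.∑-comm N₀ N₀ _) (K.∑-cong N₀ λ r _ → K.∑-cong N₀ λ i _ → K.*-cong (coefficients κ i r) (terms κ i r))) ⟩
      K.⨁ W (λ κ → K.∑ N₀ (λ r → K.∑ N₀ (λ i → P*.coefficient (x * f* r) κ i K.* ρ[ χ ] ((Φ (U κ * f* i)) * (g * f r)))))
        K.≈⟨ K.⨁-∑-comm W N₀ _ ⟩
      K.∑ N₀ (λ r → K.⨁ W (λ κ → K.∑ N₀ (λ i → P*.coefficient (x * f* r) κ i K.* ρ[ χ ] ((Φ (U κ * f* i)) * (g * f r)))))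
        K.≈⟨ K.∑-cong N₀ (λ r r< → sum-out W (g * f r) (Φ (x * f* r)) (P*.coefficient (x * f* r)) (λ κ i → Φ (U κ * f* i))
               (R.trans (Φ-cong (P*.complete (x * f* r) (Small-* Sx (f*-Small r)) W ℕₚ.≤-refl)) (R.trans (Φ-⨁ W _) (R.⨁-cong W λ κ _ →
                 R.trans (Φ-∑ N₀ _) (R.∑-cong N₀ λ i _ → Φ-ι* _ _))))) ⟨
      K.∑ N₀ (λ r → ρ[ χ ] (Φ (x * f* r) * (g * f r))) K.≈⟨ ev-∑ _ N₀ _ ⟨
      ρ[ χ ] (R.∑ N₀ (λ r → Φ (x * f* r) * (g * f r)))
        K.≈⟨ ev-cong _ (R.trans (R.sym (R.*-assoc _ _ _)) (R.trans (R.sym (R.∑-*ˡ N₀ _ _)) (R.∑-cong N₀ λ r _ → R.trans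
               (R.solve 4 (λ g x f h → (g R.:* x) R.:* (f R.:* h) R.⊜ (x R.:* h) R.:* (g R.:* f)) R.refl g (Φ x) (f r) (Φ (f* r)))
               (R.*-congʳ (R.sym (Φ-* _ _)))))) ⟨
      ρ[ χ ] (g * (Φ x * 𝒦)) K.∎
      where
      W = M ℕ.+ C
      coefficients : ∀ κ i r → P.coefficient (x * f i) κ r ≈ P*.coefficient (x * f* r) κ i
      coefficients κ i r = ρ-cong (R.solve 4 (λ x f t h → (x R.:* f) R.:* (t R.:* h) R.⊜ (x R.:* h) R.:* (t R.:* f)) R.refl x (f i) (U (ℤ.- κ)) (f* r))
      terms : ∀ κ i r → ρ[ χ ] ((U κ * f r) * (g * Φ (f* i))) ≈ ρ[ χ ] (Φ (U κ * f* i) * (g * f r))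
      terms κ i r = K.trans (ev-cong _ (R.solve 4 (λ t f g h → (t R.:* f) R.:* (g R.:* h) R.⊜ t R.:* (h R.:* (g R.:* f))) R.refl (U κ) (f r) g (Φ (f* i))))
        (K.trans (K.sym (ρ[χ]-Φ-U κ _)) (ev-cong _ (R.trans (R.sym (R.*-assoc _ _ _)) (R.*-congʳ (R.sym (Φ-* _ _))))))

  -- Multiplication by x may be moved from the first to the second factor of the Casimir element Σ f r ⊗ f* r.
  casimir : ∀ x g → ρ[ χ ] (g * (x * 𝒦)) ≈ ρ[ χ ] (g * (Φ x * 𝒦))
  casimir x = casimir-Small x (proj₂ (∃Small x))

  -- An ideal containing all x - Φ x by `casimir`; it is to be shown that it contains 1 when there
  -- is no fixed point.
  J : Element → Set
  J y = ∀ g → ρ[ χ ] (g * (y * 𝒦)) ≈ K.0#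

  J-≃ : ∀ {x y} → x ≃ y → J x → J y
  J-≃ p j g = K.trans (ev-cong _ (R.*-congˡ (R.*-congʳ (R.sym p)))) (j g)

  J-* : ∀ x {y} → J y → J (x * y)
  J-* x {y} j g = K.trans (ev-cong _ (R.solve 4 (λ g x y z → g R.:* ((x R.:* y) R.:* z) R.⊜ (g R.:* x) R.:* (y R.:* z)) R.refl g x y 𝒦)) (j (g * x))

  J-+ : ∀ {x y} → J x → J y → J (x + y)
  J-+ {x} {y} j j′ g = K.trans (ev-cong _ (R.solve 4 (λ g x y z → g R.:* ((x R.:+ y) R.:* z) R.⊜ g R.:* (x R.:* z) R.:+ g R.:* (y R.:* z)) R.refl g x y 𝒦))
    (K.trans (ev-+ _ _ _) (K.trans (K.+-cong (j g) (j′ g)) (K.+-identityˡ _)))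

  J-neg : ∀ {x} → J x → J (- x)
  J-neg {x} j = J-≃ (R.solve 1 (λ x → (R.:- R.con (+ 1)) R.:* x R.⊜ R.:- x) R.refl x) (J-* (- 1#) j)

  J-Φ : ∀ x → J (x - Φ x)
  J-Φ x g = K.trans (ev-cong _ (R.solve 4 (λ g x y z → g R.:* ((x R.:- y) R.:* z) R.⊜ g R.:* (x R.:* z) R.:- g R.:* (y R.:* z)) R.refl g x (Φ x) 𝒦))
    (K.trans (ev-+ _ _ _) (K.trans (K.+-congˡ (ev-neg _ _)) (K.x≈y⇒x-y≈0 (casimir x g))))

  private
    ι-isAlgebra : IsAlgebra ring ι
    ι-isAlgebra = record { ι-cong = ι-cong ; ι-+ = ι-+ ; ι-* = ι-* ; ι-0 = ι-0 ; ι-1 = ι-1 }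

    open Polynomial ι-isAlgebra using (∏[_-_])

    Φ² : ∀ x → Φ (Φ x) ≃ x ^ (Q ℕ.* Q)
    Φ² x = R.trans (R.^-congˡ Q (R.trans (τ̄-^ _ Q) (R.^-congˡ Q (τ̄-involutive x)))) (R.^-assocʳ x Q Q)

    1<N : 1 < Q ℕ.* Q
    1<N = ℕₚ.*-mono-< 1<Q 1<Q
      where
      1<Q : 1 < Q
      1<Q = ℕₚ.^-monoʳ-< q (s≤s (s≤s z≤n)) {0} {n} (ℕₚ.≤-trans (s≤s z≤n) (ℕₚ.≤-trans (ℕₚ.≤-reflexive (ℕₚ.+-comm 1 (3 ℕ.* suc s′ ℕ.+ 1))) (ℕₚ.≤-trans (ℕₚ.≤-reflexive (ℕₚ.+-assoc (3 ℕ.* suc s′) 1 1)) n≥)))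

    -- Φ (Φ x) = x^(Q²), so x^(Q²) - x lies in J, and it is the product of all x - z with z in F.
    J-∏ : ∀ x → J ∏[ x - elements ]
    J-∏ x = J-≃ (Factorisation.x^N-x ι-isAlgebra 1<N x) (J-≃ (R.trans (R.solve 3 (λ x y z → R.:- ((x R.:- y) R.:+ (y R.:- z)) R.⊜ z R.:- x) R.refl x (Φ x) (Φ (Φ x))) (R.+-congʳ (Φ² x)))
      (J-neg (J-+ (J-Φ x) (J-Φ (Φ x)))))

    -- Strips off the factors x - z one at a time: on the remaining product times y, x acts modulo J
    -- as the scalar z. P records the scalars already found for other generators and must survive
    -- multiplication.
    peel : (P : Element → Set) → (∀ w y → P y → P (w * y)) → ∀ x →
           (∀ z y → P y → J ((x - ι z) * y) → J y) → ∀ y → P y → J y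
    peel P P-* x step y Py = go (elements) (J-≃ (R.*-comm y _) (J-* y (J-∏ x)))
      where
      go : ∀ {m} (zs : Vec K.Carrier m) → J (∏[ x - zs ] * y) → J y
      go [] j = J-≃ (R.*-identityˡ y) j
      go (z ∷ zs) j = go zs (step z (∏[ x - zs ] * y) (P-* _ y Py) (J-≃ (R.*-assoc _ _ _) j))

  -- x and x′ act alike on y modulo J; a relation x ∼ ι z says that y is an eigenvector of x.
  record _∼_[_] (x x′ y : Element) : Set where
    constructor congruent
    field unpack : J ((x - x′) * y)
  open _∼_[_]

  private
    module _ {y : Element} where
      ∼-≃ : ∀ {x x′} → x ≃ x′ → x ∼ x′ [ y ]
      ∼-≃ p = congruent (J-≃ (R.sym (R.trans (R.*-congʳ (R.x≈y⇒x-y≈0 p)) (R.zeroˡ y))) J-0)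
        where
        J-0 : J 0#
        J-0 g = K.trans (ev-cong _ (R.trans (R.*-congˡ (R.zeroˡ _)) (R.zeroʳ g))) (ev-0 _)

      ∼-sym : ∀ {x x′} → x ∼ x′ [ y ] → x′ ∼ x [ y ]
      ∼-sym {x} {x′} h = congruent (J-≃ (R.solve 3 (λ x z y → R.:- ((x R.:- z) R.:* y) R.⊜ (z R.:- x) R.:* y) R.refl x x′ y) (J-neg (unpack h)))

      ∼-trans : ∀ {x x′ x″} → x ∼ x′ [ y ] → x′ ∼ x″ [ y ] → x ∼ x″ [ y ]
      ∼-trans {x} {x′} {x″} h h′ = congruent (J-≃ (R.solve 4 (λ x z w y → (x R.:- z) R.:* y R.:+ (z R.:- w) R.:* y R.⊜ (x R.:- w) R.:* y) R.refl x x′ x″ y) (J-+ (unpack h) (unpack h′)))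

      ∼-+ : ∀ {x x′ z z′} → x ∼ x′ [ y ] → z ∼ z′ [ y ] → (x + z) ∼ (x′ + z′) [ y ]
      ∼-+ {x} {x′} {z} {z′} h h′ = congruent (J-≃ (R.solve 5 (λ x x′ z z′ y → (x R.:- x′) R.:* y R.:+ (z R.:- z′) R.:* y R.⊜ ((x R.:+ z) R.:- (x′ R.:+ z′)) R.:* y) R.refl x x′ z z′ y) (J-+ (unpack h) (unpack h′)))

      ∼-* : ∀ {x x′ z z′} → x ∼ x′ [ y ] → z ∼ z′ [ y ] → (x * z) ∼ (x′ * z′) [ y ]
      ∼-* {x} {x′} {z} {z′} h h′ = congruent (J-≃ (R.solve 5 (λ x x′ z z′ y → z R.:* ((x R.:- x′) R.:* y) R.:+ x′ R.:* ((z R.:- z′) R.:* y) R.⊜ (x R.:* z R.:- x′ R.:* z′) R.:* y) R.refl x x′ z z′ y)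
        (J-+ (J-* z (unpack h)) (J-* x′ (unpack h′))))

      ∼-neg : ∀ {x x′} → x ∼ x′ [ y ] → (- x) ∼ (- x′) [ y ]
      ∼-neg {x} {x′} h = congruent (J-≃ (R.solve 3 (λ x z y → R.:- ((x R.:- z) R.:* y) R.⊜ (R.:- x R.:- R.:- z) R.:* y) R.refl x x′ y) (J-neg (unpack h)))

      ∼-^ : ∀ {x z} m → x ∼ ι z [ y ] → (x ^ m) ∼ ι (z K.^ m) [ y ]
      ∼-^ zero h = ∼-≃ (R.sym ι-1)
      ∼-^ {x} {z} (suc m) h = ∼-trans (∼-* h (∼-^ m h)) (∼-≃ (R.sym (ι-* _ _)))

      ∼-∑ : ∀ m {h h′} → (∀ i → h i ∼ ι (h′ i) [ y ]) → R.∑ m h ∼ ι (K.∑ m h′) [ y ]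
      ∼-∑ zero eq = ∼-≃ (R.sym ι-0)
      ∼-∑ (suc m) eq = ∼-trans (∼-+ (∼-∑ m eq) (eq m)) (∼-≃ (R.sym (ι-+ _ _)))

      ∼-ι+ : ∀ {x x′ z z′} → x ∼ ι z [ y ] → x′ ∼ ι z′ [ y ] → (x + x′) ∼ ι (z K.+ z′) [ y ]
      ∼-ι+ h h′ = ∼-trans (∼-+ h h′) (∼-≃ (R.sym (ι-+ _ _)))

      ∼-ι* : ∀ {x x′ z z′} → x ∼ ι z [ y ] → x′ ∼ ι z′ [ y ] → (x * x′) ∼ ι (z K.* z′) [ y ]
      ∼-ι* h h′ = ∼-trans (∼-* h h′) (∼-≃ (R.sym (ι-* _ _)))

      ∼-ι-neg : ∀ {x z} → x ∼ ι z [ y ] → (- x) ∼ ι (K.- z) [ y ]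
      ∼-ι-neg h = ∼-trans (∼-neg h) (∼-≃ (R.sym (ι-neg _)))

      distinct : ∀ {x z z′} → x ∼ ι z [ y ] → x ∼ ι z′ [ y ] → ¬ z ≈ z′ → J y
      distinct {x} {z} {z′} h h′ z≉z′ = J-≃
        (R.trans (R.trans (R.sym (R.*-assoc _ _ _)) (R.*-congʳ (R.trans (R.*-congˡ (R.sym (ι-sub z z′))) (R.trans (R.sym (ι-* _ _)) (R.trans (ι-cong
          (K.trans (K.*-comm _ _) (inv-inverse w w≉0))) ι-1))))) (R.*-identityˡ y))
        (J-* (ι (inv w w≉0)) (unpack (∼-trans (∼-sym h) h′)))
        where
        w = z K.- z′
        w≉0 : ¬ w ≈ K.0#
        w≉0 eq = z≉z′ (K.x-y≈0⇒x≈y _ _ eq)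

  private
    module _ (noFP : ¬ FixedPoint) (u₀ v₀ b₀ : K.Carrier) (y : Element) (hu : u ∼ ι u₀ [ y ]) (hv : v ∼ ι v₀ [ y ]) (hb : b ∼ ι b₀ [ y ]) where
      ∼Φ : ∀ x → x ∼ Φ x [ y ]
      ∼Φ x = congruent (J-≃ (R.*-comm y _) (J-* y (J-Φ x)))

      norm-∼ : (u * u ^ Q) ∼ ι c [ y ]
      norm-∼ = ∼-trans (∼-* (∼Φ u) (∼-≃ R.refl)) (∼-≃ (R.begin
        Φ u * u ^ Q R.≈⟨ R.*-cong (Φ-U (+ 1)) (U-^ (+ 1) Q) ⟩
        (ι (c^ (+ 1)) * U (ℤ.- + 1 ℤ.* + Q)) * U (+ 1 ℤ.* + Q) R.≈⟨ R.trans (R.*-assoc _ _ _) (R.*-cong (ι-cong (K.*-identityʳ c)) (R.sym (U-+ _ _))) ⟩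
        ι c * U (ℤ.- + 1 ℤ.* + Q ℤ.+ + 1 ℤ.* + Q) R.≈⟨ R.*-congˡ (R.trans (R.reflexive (≡.cong U (eq (+ Q)))) U-0) ⟩
        ι c * 1# R.≈⟨ R.*-identityʳ _ ⟩
        ι c R.∎))
        where
        eq : ∀ Q → ℤ.- + 1 ℤ.* Q ℤ.+ + 1 ℤ.* Q ≡ + 0
        eq = solve-∀

      -- If u, v and b act on y by scalars, every equation of a fixed point that these scalars
      -- violate gives one element two different eigenvalues on y; their difference is a unit,
      -- whence y lies in J.
      eigen : J y
      eigen = case₁ (u₀ K.* u₀ K.^ Q ≟ c)
        where
        case₅ : u₀ K.* u₀ K.^ Q ≈ c → v₀ K.^ Q ≈ K.- v₀ → u₀ K.* v₀ K.^ d ≈ (u₀ K.- m₀) K.* u₀ K.+ c → b₀ K.^ q ≈ b₀ K.+ (e K.- u₀) K.* v₀ →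
          Dec ((b₀ K.+ K.∑ s (λ m → v₀ K.^ (q ℕ.^ m))) K.^ Q ≈ b₀) → J y
        case₅ h₁ h₂ h₃ h₄ (yes h₅) = ⊥-elim (noFP (record { u₀ = u₀ ; v₀ = v₀ ; b₀ = b₀ ; norm-u = h₁ ; trace-v = h₂ ; uv = h₃ ; bv = h₄ ; bL = h₅ }))
        case₅ _ _ _ _ (no ne) = distinct (∼-^ Q (∼-ι+ hb (∼-∑ s λ m → ∼-^ (q ℕ.^ m) hv)))
          (∼-trans (∼-sym (∼-trans (∼Φ b) (∼-≃ (R.^-congˡ Q τ̄-b)))) hb) ne
        case₄ : u₀ K.* u₀ K.^ Q ≈ c → v₀ K.^ Q ≈ K.- v₀ → u₀ K.* v₀ K.^ d ≈ (u₀ K.- m₀) K.* u₀ K.+ c → Dec (b₀ K.^ q ≈ b₀ K.+ (e K.- u₀) K.* v₀) → J y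
        case₄ h₁ h₂ h₃ (yes h₄) = case₅ h₁ h₂ h₃ h₄ (_ ≟ _)
        case₄ _ _ _ (no ne) = distinct (∼-^ q hb)
          (∼-trans (∼-≃ b-relation) (∼-ι+ hb (∼-ι* (∼-ι+ (∼-≃ R.refl) (∼-ι-neg hu)) hv))) ne
        case₃ : u₀ K.* u₀ K.^ Q ≈ c → v₀ K.^ Q ≈ K.- v₀ → Dec (u₀ K.* v₀ K.^ d ≈ (u₀ K.- m₀) K.* u₀ K.+ c) → J y
        case₃ h₁ h₂ (yes h₃) = case₄ h₁ h₂ h₃ (_ ≟ _)
        case₃ _ _ (no ne) = distinct (∼-ι* hu (∼-^ d hv))
          (∼-trans (∼-≃ (R.trans (R.*-congˡ v-relation) (R.trans (R.solve 4 (λ u m c w → u R.:* ((u R.:- m) R.:+ c R.:* w) R.⊜ (u R.:- m) R.:* u R.:+ c R.:* (u R.:* w)) R.refl u (ι m₀) (ι c) u⁻¹)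
              (R.+-congˡ (R.trans (R.*-congˡ uu⁻¹) (R.*-identityʳ _))))))
            (∼-ι+ (∼-ι* (∼-ι+ hu (∼-ι-neg (∼-≃ R.refl))) hu) (∼-≃ R.refl))) ne
        case₂ : u₀ K.* u₀ K.^ Q ≈ c → Dec (v₀ K.^ Q ≈ K.- v₀) → J y
        case₂ h₁ (yes h₂) = case₃ h₁ h₂ (_ ≟ _)
        case₂ _ (no ne) = distinct (∼-^ Q hv)
          (∼-trans (∼-≃ (R.trans (R.solve 1 (λ x → x R.⊜ R.:- R.:- x) R.refl (v ^ Q)) (R.-‿cong (R.trans (R.sym (R-neg^ n v)) (R.^-congˡ Q (R.sym τ̄-v))))))
            (∼-ι-neg (∼-trans (∼-sym (∼Φ v)) hv))) ne
        case₁ : Dec (u₀ K.* u₀ K.^ Q ≈ c) → J y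
        case₁ (yes h₁) = case₂ h₁ (_ ≟ _)
        case₁ (no ne) = distinct (∼-ι* hu (∼-^ Q hu)) norm-∼ ne

  ∼-scale : ∀ {x x′} w y → x ∼ x′ [ y ] → x ∼ x′ [ w * y ]
  ∼-scale {x} {x′} w y h = congruent (J-≃ (R.solve 4 (λ w x z y → w R.:* ((x R.:- z) R.:* y) R.⊜ (x R.:- z) R.:* (w R.:* y)) R.refl w x x′ y) (J-* w (unpack h)))

  trace-vanishes : ¬ FixedPoint → ∀ g → ρ[ χ ] (g * 𝒦) ≈ K.0#
  trace-vanishes noFP g = K.trans (ev-cong _ (R.*-congˡ (R.sym (R.*-identityˡ 𝒦)))) (J-1 g)
    where
    J-1 : J 1#
    J-1 = peel (λ _ → ⊤) (λ _ _ _ → tt) u (λ u₀ y _ hu → peel (λ y → u ∼ ι u₀ [ y ]) (λ w y → ∼-scale w y) v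
      (λ v₀ y hu hv → peel (λ y → u ∼ ι u₀ [ y ] × v ∼ ι v₀ [ y ]) (λ w y (hu , hv) → ∼-scale w y hu , ∼-scale w y hv) b
        (λ b₀ y (hu , hv) hb → eigen noFP u₀ v₀ b₀ y hu hv (congruent hb)) y (hu , congruent hv)) y (congruent hu)) 1# tt

  open LinearSystem F isField card using (Solution; kernel; first-nonzero)

  -- The linear system

  private
    -- The bound n ≥ 3 s + 2 in the form in which it is needed: it gives q₁² ≤ q q₂ below.
    s-bound : s ℕ.+ suc s ≤ n ℕ.∸ suc s
    s-bound = ℕₚ.m+n≤o⇒m≤o∸n (s ℕ.+ suc s) (≡.subst (_≤ n) (eq s) n≥)
      where
      eq : ∀ s → 3 ℕ.* s ℕ.+ 2 ≡ s ℕ.+ suc s ℕ.+ suc s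
      eq = ℕ-Solver.solve-∀

    s<n : suc s ≤ n
    s<n = ℕₚ.≤-trans (ℕₚ.m≤n+m (suc s) s) (ℕₚ.≤-trans s-bound (ℕₚ.m∸n≤m n (suc s)))

  abstract
    -- Q = q₂ q₁ splits Φ into Φ₂ and the q₁-th power. Here q₁ = q σ = C + q + 1, so elements of
    -- order C - N with N ≥ q₁ have a zero of order more than q at u = 0.
    q₁ q₂ w : ℕ
    q₁ = q ℕ.^ suc s
    q₂ = q ℕ.^ (n ℕ.∸ suc s)
    w = q₂ ℕ.∸ N₀

    q₁≡ : q₁ ≡ suc (C ℕ.+ q)
    q₁≡ = ≡.trans (≡.cong (q ℕ.*_) (≡.sym σ≡)) (≡.trans qσ≡ (≡.cong suc (ℕₚ.+-comm q C)))

    q₁≤q₂ : q₁ ≤ q₂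
    q₁≤q₂ = ℕₚ.^-monoʳ-≤ q (ℕₚ.≤-trans (ℕₚ.m≤n+m (suc s) s) s-bound)

    N₀≤q₁ : N₀ ≤ q₁
    N₀≤q₁ = ≡.subst (N₀ ≤_) (≡.sym q₁≡) (s≤s (ℕₚ.m≤m+n C q))

    q₂≡ : q₂ ≡ N₀ ℕ.+ w
    q₂≡ = ≡.sym (ℕₚ.m+[n∸m]≡n (ℕₚ.≤-trans N₀≤q₁ q₁≤q₂))

    Q≡ : Q ≡ q₂ ℕ.* q₁
    Q≡ = ≡.trans (≡.cong (q ℕ.^_) (≡.sym (ℕₚ.m∸n+n≡m s<n))) (ℕₚ.^-distribˡ-+-* q (n ℕ.∸ suc s) (suc s))

    N₀q₁≤ : N₀ ℕ.* q₁ ≤ q ℕ.* q₂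
    N₀q₁≤ = ℕₚ.≤-trans (ℕₚ.*-monoˡ-≤ q₁ N₀≤q₁) (ℕₚ.≤-trans (ℕₚ.≤-reflexive (≡.sym (ℕₚ.^-distribˡ-+-* q (suc s) (suc s))))
      (ℕₚ.*-monoʳ-≤ q (ℕₚ.^-monoʳ-≤ q s-bound)))

    R-additive₁ : R.Additive q₁
    R-additive₁ = R-additive (suc s)

    R-additive₂ : R.Additive q₂
    R-additive₂ = R-additive (n ℕ.∸ suc s)

    q₁>0 : 0 < q₁
    q₁>0 = q^>0 (suc s)

    q₂>0 : 0 < q₂
    q₂>0 = q^>0 (n ℕ.∸ suc s)

  instance
    q₁-nonZero : ℕ.NonZero q₁
    q₁-nonZero = ℕ.>-nonZero q₁>0

    q₂-nonZero : ℕ.NonZero q₂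
    q₂-nonZero = ℕ.>-nonZero q₂>0

  -- The largest o for which the order estimate in `beyond-q₂` still holds, with nothing to spare; o
  -- + m = A₁ becomes the diagonal of the triangular system.
  A₁ : ℕ
  A₁ = q₁ ℕ.* w ℕ.+ C

  private
    q₁ℤ : + q₁ ≡ + 1 ℤ.+ (+ C ℤ.+ + q)
    q₁ℤ = ≡.cong +_ q₁≡

    q₂ℤ : + q₂ ≡ + 1 ℤ.+ (+ C ℤ.+ + w)
    q₂ℤ = ≡.cong +_ q₂≡

    Qℤ : + Q ≡ + q₂ ℤ.* + q₁
    Qℤ = ≡.trans (≡.cong +_ Q≡) (ℤₚ.pos-* q₂ q₁)

    A₁ℤ : + A₁ ≡ + q₁ ℤ.* + w ℤ.+ + C
    A₁ℤ = ≡.cong (ℤ._+ + C) (ℤₚ.pos-* q₁ w)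

    ρ-slack : ∀ {M x} k → M ℤ.+ + suc k ≡ c₀ → Below₂ M x → ρ x ≈ K.0#
    ρ-slack {M} {x} k eq B = ρ-Below₂-< {x = x} (≡.subst (M ℤ.<_) eq (≡.subst (ℤ._< M ℤ.+ + suc k) (ℤₚ.+-identityʳ M) (ℤₚ.+-monoʳ-< M (ℤ.+<+ (s≤s z≤n))))) B

    Below₂-pow : ∀ {M x} k → Below₂ M x → Below₂ (+ k ℤ.* M) (x ^ k)
    Below₂-pow k B = resp (R.sym (τ̄-^ _ k)) (Below-^ k B)

    τ̄-pow-Below₂ : ∀ {M x} k → Below M x → Below₂ (+ k ℤ.* M) (τ̄ x ^ k)
    τ̄-pow-Below₂ k B = resp (R.sym (R.trans (τ̄-^ _ k) (R.^-congˡ k (τ̄-involutive _)))) (Below-^ k B)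

    shifted-order : ∀ k → ℤ.- + 1 ≡ ℤ.- (+ N₀ ℤ.* (+ 1 ℤ.+ + k)) ℤ.+ + C ℤ.+ + (N₀ ℕ.* k)
    shifted-order k = ≡.trans (eq (+ C) (+ k)) (≡.cong (λ z → ℤ.- (+ N₀ ℤ.* (+ 1 ℤ.+ + k)) ℤ.+ + C ℤ.+ z) (≡.sym (ℤₚ.pos-* N₀ k)))
      where
      eq : ∀ C k → ℤ.- + 1 ≡ ℤ.- ((+ 1 ℤ.+ C) ℤ.* (+ 1 ℤ.+ k)) ℤ.+ C ℤ.+ (+ 1 ℤ.+ C) ℤ.* k
      eq = solve-∀

    -- Multiplication by u^(±1) makes the order of elements of order at most C negative at u = 0, respectively at u = ∞.
    Below-U* : ∀ k {x} → Below (+ C) x → Below (ℤ.- + 1) (U (+ suc k) * x)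
    Below-U* k B = weaken (N₀ ℕ.* k) (shifted-order k) (Below-* (Below-U (+ suc k)) B)

    Below₂-U* : ∀ k {x} → Below₂ (+ C) x → Below₂ (ℤ.- + 1) (U -[1+ k ] * x)
    Below₂-U* k {x} B = weaken (N₀ ℕ.* k) (shifted-order k) (Below₂-* {x = U -[1+ k ]} {x} (Below₂-≡ {x = U -[1+ k ]} (eq (+ N₀) (+ 1 ℤ.+ + k)) (Below₂-U -[1+ k ])) B)
      where
      eq : ∀ N k → N ℤ.* ℤ.- k ≡ ℤ.- (N ℤ.* k)
      eq = solve-∀

    digits : ∀ N → + N ≡ + (N ℕ/.% N₀) ℤ.+ + (N ℕ/./ N₀) ℤ.* + N₀
    digits N = ≡.trans (≡.cong +_ (ℕ/.m≡m%n+[m/n]*n N N₀)) (≡.cong (λ z → + (N ℕ/.% N₀) ℤ.+ z) (ℤₚ.pos-* (N ℕ/./ N₀) N₀))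

    digit< : ∀ N → N ℕ/.% N₀ < N₀
    digit< N = ℕ/.m%n<n N N₀

    C∸-ℤ : ∀ N → + (C ℕ.∸ N ℕ/.% N₀) ≡ + C ℤ.- + (N ℕ/.% N₀)
    C∸-ℤ N = ≡.trans (eq (+ (C ℕ.∸ N ℕ/.% N₀)) (+ (N ℕ/.% N₀))) (≡.cong (λ z → + z ℤ.- + (N ℕ/.% N₀)) (ℕₚ.m∸n+n≡m (ℕₚ.≤-pred (digit< N))))
      where
      eq : ∀ x y → x ≡ x ℤ.+ y ℤ.- y
      eq = solve-∀

    dual-order : ∀ N → ℤ.- (+ N₀ ℤ.* + (N ℕ/./ N₀)) ℤ.+ + (C ℕ.∸ N ℕ/.% N₀) ≡ + C ℤ.- + N
    dual-order N = ≡.trans (≡.cong (λ z → ℤ.- (+ N₀ ℤ.* + (N ℕ/./ N₀)) ℤ.+ z) (C∸-ℤ N))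
      (≡.trans (eq (+ N₀) (+ (N ℕ/./ N₀)) (+ C) (+ (N ℕ/.% N₀))) (≡.cong (λ z → + C ℤ.- z) (≡.sym (digits N))))
      where
      eq : ∀ N κ C r → ℤ.- (N ℤ.* κ) ℤ.+ (C ℤ.- r) ≡ C ℤ.- (r ℤ.+ κ ℤ.* N)
      eq = solve-∀

    -‿antitone : ∀ {m k} → m ≤ k → + C ℤ.- + k ℤ.≤ + C ℤ.- + m
    -‿antitone le = ℤₚ.+-monoʳ-≤ (+ C) (ℤₚ.neg-mono-≤ (ℤ.+≤+ le))

  -- With N = r + κ N₀, the β N have the orders N at u = 0, and the β* N, of orders C - N, are dual
  -- to them under ρ. The γ t have the orders C - t; g₂ is taken from their span.
  β β* γ : ℕ → Element
  β N = U (ℤ.- + (N ℕ/./ N₀)) * f (N ℕ/.% N₀)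
  β* N = U (+ (N ℕ/./ N₀)) * f* (N ℕ/.% N₀)
  γ t = U (+ (t ℕ/./ N₀)) * f (C ℕ.∸ t ℕ/.% N₀)

  private
    β-Lead : ∀ N → Lead (+ N) (β N)
    β-Lead N = Lead-≡ (≡.trans (eq (+ N₀) (+ (N ℕ/./ N₀)) (+ (N ℕ/.% N₀))) (≡.sym (digits N))) (Lead-* (Lead-U _) (f-Lead (N ℕ/.% N₀)))
      where
      eq : ∀ N κ r → ℤ.- (N ℤ.* ℤ.- κ) ℤ.+ r ≡ r ℤ.+ κ ℤ.* N
      eq = solve-∀

    β*-Lead : ∀ N → Lead (+ C ℤ.- + N) (β* N)
    β*-Lead N = Lead-≡ (dual-order N) (Lead-* (Lead-U _) (f*-Lead (N ℕ/.% N₀)))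

    γ-Lead : ∀ N → Lead (+ C ℤ.- + N) (γ N)
    γ-Lead N = Lead-≡ (dual-order N) (Lead-* (Lead-U _) (f-Lead (C ℕ.∸ N ℕ/.% N₀)))

    β-Below₂′ : ∀ {N} → N₀ ≤ N → Below₂ (ℤ.- + 1) (β N)
    β-Below₂′ {N} le = go (N ℕ/./ N₀) (ℕ/.m≥n⇒m/n>0 le)
      where
      go : ∀ k → 0 < k → Below₂ (ℤ.- + 1) (U (ℤ.- + k) * f (N ℕ/.% N₀))
      go (suc k) _ = Below₂-U* k {f (N ℕ/.% N₀)} (f-Below₂ _ (digit< N))

    β-Below₂ : ∀ N → Below₂ (+ C) (β N)
    β-Below₂ N = go (N ℕ/./ N₀)
      where
      x = f (N ℕ/.% N₀)
      go : ∀ k → Below₂ (+ C) (U (ℤ.- + k) * x)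
      go zero = Below₂-≃ {x = x} (R.sym (R.trans (R.*-congʳ U-0) (R.*-identityˡ _))) (f-Below₂ _ (digit< N))
      go (suc k) = Below₂-weaken {x = U (ℤ.- + suc k) * x} ℤ.-≤+ (Below₂-U* k {x} (f-Below₂ _ (digit< N)))

    γ-Below₂ : ∀ t → t < N₀ ℕ.* q₁ → Below₂ (+ (q ℕ.* q₂)) (γ t)
    γ-Below₂ t t< = Below₂-weaken {x = γ t} (≡.subst (ℤ._≤ + (q ℕ.* q₂)) (≡.cong (ℤ._+ + C) (ℤₚ.pos-* N₀ κ₀)) (ℤ.+≤+ bound))
      (Below₂-* {x = U (+ κ₀)} {f (C ℕ.∸ t ℕ/.% N₀)} (Below₂-U (+ κ₀)) (f-Below₂ (C ℕ.∸ t ℕ/.% N₀) (s≤s (ℕₚ.m∸n≤m C (t ℕ/.% N₀)))))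
      where
      κ₀ = t ℕ/./ N₀
      κ₀<q₁ : κ₀ < q₁
      κ₀<q₁ = ℕ/.m<n*o⇒m/o<n (≡.subst (t <_) (ℕₚ.*-comm N₀ q₁) t<)
      bound : N₀ ℕ.* κ₀ ℕ.+ C ≤ q ℕ.* q₂
      bound = ℕₚ.≤-trans (ℕₚ.+-monoʳ-≤ (N₀ ℕ.* κ₀) (ℕₚ.n≤1+n C)) (ℕₚ.≤-trans (ℕₚ.≤-reflexive (≡.trans (ℕₚ.+-comm (N₀ ℕ.* κ₀) N₀) (≡.sym (ℕₚ.*-suc N₀ κ₀))))
        (ℕₚ.≤-trans (ℕₚ.*-monoʳ-≤ N₀ κ₀<q₁) N₀q₁≤))

  Φ₂ : Element → Element
  Φ₂ x = τ̄ x ^ q₂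

  private
    -- Evaluates A on the expansion of y in the β* N with coefficients ρ (y β N), discarding
    -- negative powers of u and large N. A is only assumed additive, since the maps in question
    -- involve q₁-th and q₂-th powers.
    module Expand (A : Element → K.Carrier) (A-cong : ∀ {x y} → x ≃ y → A x ≈ A y) (A-0 : A 0# ≈ K.0#)
      (A-+ : ∀ x y → A (x + y) ≈ A x K.+ A y) where

      A-∑ : ∀ m h → A (R.∑ m h) ≈ K.∑ m (λ i → A (h i))
      A-∑ zero h = A-0
      A-∑ (suc m) h = K.trans (A-+ _ _) (K.+-congʳ (A-∑ m h))

      A-⨁ : ∀ W h → A (R.⨁ W h) ≈ K.⨁ W (λ k → A (h k))
      A-⨁ zero h = K.refl
      A-⨁ (suc W) h = K.trans (A-+ _ _) (K.+-cong (A-⨁ W h) (A-+ _ _))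

      expand-Small : ∀ {M} y → Small M y → ∀ B →
        (∀ k r → r < N₀ → A (ι (P*.coefficient y -[1+ k ] r) * (U -[1+ k ] * f* r)) ≈ K.0#) →
        (∀ N → B ≤ N → A (ι (ρ (y * β N)) * β* N) ≈ K.0#) →
        A y ≈ K.∑ B (λ N → A (ι (ρ (y * β N)) * β* N))
      expand-Small {M} y Sy B neg big = K.begin
        A y K.≈⟨ A-cong (P*.complete y Sy W (ℕₚ.m≤m+n M B)) ⟩
        A (P*.expansion W y) K.≈⟨ K.trans (A-⨁ W _) (K.⨁-cong W λ κ _ → A-∑ N₀ _) ⟩
        K.⨁ W (λ κ → K.∑ N₀ (λ r → A (ι (P*.coefficient y κ r) * (U κ * f* r)))) K.≈⟨ K.⨁-nonneg W (λ k → K.∑-zero N₀ λ r r< → neg k r r<) ⟩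
        K.∑ (suc W) (λ k → K.∑ N₀ (λ r → A (ι (P*.coefficient y (+ k) r) * (U (+ k) * f* r))))
          K.≈⟨ K.∑-flatten (suc W) N₀ (λ k r → A (ι (P*.coefficient y (+ k) r) * (U (+ k) * f* r))) ⟩
        K.∑ (suc W ℕ.* N₀) (λ N → A (ι (ρ (y * β N)) * β* N))
          K.≈⟨ K.∑-truncate _ (ℕₚ.≤-trans (ℕₚ.m≤n+m B M) (ℕₚ.≤-trans (ℕₚ.n≤1+n W) (ℕₚ.m≤m*n (suc W) N₀))) big ⟩
        K.∑ B (λ N → A (ι (ρ (y * β N)) * β* N)) K.∎
        where W = M ℕ.+ B

      expand : ∀ y B →
        (∀ k r → r < N₀ → A (ι (P*.coefficient y -[1+ k ] r) * (U -[1+ k ] * f* r)) ≈ K.0#) →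
        (∀ N → B ≤ N → A (ι (ρ (y * β N)) * β* N) ≈ K.0#) →
        A y ≈ K.∑ B (λ N → A (ι (ρ (y * β N)) * β* N))
      expand y = expand-Small y (proj₂ (∃Small y))

  private
    Φ-pow : ∀ x → Φ x ≃ Φ₂ x ^ q₁
    Φ-pow x = R.trans (R.^-congʳ (τ̄ x) Q≡) (R.sym (R.^-assocʳ (τ̄ x) q₂ q₁))

    Φ-Below : ∀ r → Below (+ Q ℤ.* + C) (Φ (f* r))
    Φ-Below r = Below-^ Q (below₂ (f*-Small r))

    module _ (o : ℕ) (o≤ : o ≤ A₁) (g₂ : Element) (Bg : Below (+ C) g₂) (Bg₂ : Below₂ (+ (q ℕ.* q₂)) g₂) where
      g : Element
      g = β o * g₂ ^ q₁

      Below-g : Below (+ A₁ ℤ.+ + q₁ ℤ.* + C) g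
      Below-g = Below-* (Below-≤ o≤ (Lead⇒Below (β-Lead o))) (Below-^ q₁ Bg)

      Below₂-g : Below₂ (+ C ℤ.+ + q₁ ℤ.* (+ q ℤ.* + q₂)) g
      Below₂-g = Below₂-* {x = β o} {g₂ ^ q₁} (β-Below₂ o) (Below₂-≡ {x = g₂ ^ q₁} (≡.cong (+ q₁ ℤ.*_) (ℤₚ.pos-* q q₂)) (Below₂-pow {x = g₂} q₁ Bg₂))

      Below-𝒦 : Below (+ C ℤ.+ + Q ℤ.* + C) 𝒦
      Below-𝒦 = Below-∑ N₀ λ r r< → Below-* (below (f-Small r r<)) (Φ-Below r)

      Below₂-𝒦 : Below₂ (+ C ℤ.+ + Q ℤ.* + C) 𝒦
      Below₂-𝒦 = Below₂-∑ N₀ λ r r< → Below₂-* {x = f r} {Φ (f* r)} (f-Below₂ r r<) (τ̄-pow-Below₂ Q (below (f*-Small r)))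

      negative : ∀ k → suc Q ≤ suc k → ρ (U (+ suc k) * (g * 𝒦)) ≈ K.0#
      negative k le = ρ-Below q₁ (≡.trans
        (≡.cong₂ (λ a y → ℤ.- (+ N₀ ℤ.* (+ 1 ℤ.+ y)) ℤ.+ ((a ℤ.+ + q₁ ℤ.* + C) ℤ.+ (+ C ℤ.+ y ℤ.* + C)) ℤ.+ (+ 1 ℤ.+ + q₁)) A₁ℤ
          (≡.trans Qℤ (≡.cong (ℤ._* + q₁) q₂ℤ)))
        (eq (+ C) (+ w) (+ q₁)))
        (Below-* (weaken-≤ (ℤₚ.neg-mono-≤ (ℤₚ.*-monoˡ-≤-nonNeg (+ N₀) (ℤ.+≤+ le))) (Below-U (+ suc k))) (Below-* Below-g Below-𝒦))
        where
        eq : ∀ C w x → ℤ.- ((+ 1 ℤ.+ C) ℤ.* (+ 1 ℤ.+ (+ 1 ℤ.+ (C ℤ.+ w)) ℤ.* x)) ℤ.+ (((x ℤ.* w ℤ.+ C) ℤ.+ x ℤ.* C) ℤ.+ (C ℤ.+ (+ 1 ℤ.+ (C ℤ.+ w)) ℤ.* x ℤ.* C)) ℤ.+ (+ 1 ℤ.+ x) ≡ C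
        eq = solve-∀

      positive : ∀ k → suc Q ℕ.+ suc Q ≤ suc k → ρ (U -[1+ k ] * (g * 𝒦)) ≈ K.0#
      positive k le = ρ-slack {x = U -[1+ k ] * (g * 𝒦)} (N₀ ℕ.+ (q ℕ.* d″ ℕ.* Q ℕ.+ Q)) (≡.trans
        (≡.cong₂ (λ y z → ℤ.- (+ N₀ ℤ.* (+ 1 ℤ.+ + Q ℤ.+ (+ 1 ℤ.+ + Q))) ℤ.+ ((+ C ℤ.+ y) ℤ.+ (+ C ℤ.+ + Q ℤ.* + C)) ℤ.+ (+ 1 ℤ.+ (+ N₀ ℤ.+ (z ℤ.+ + Q))))
          (≡.trans (eq₁ (+ q₁) (+ q) (+ q₂)) (≡.cong (+ q ℤ.*_) (≡.sym Qℤ)))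
          (≡.trans (ℤₚ.pos-* (q ℕ.* d″) Q) (≡.cong (ℤ._* + Q) (ℤₚ.pos-* q d″))))
        (≡.trans (≡.cong₂ (λ N C → ℤ.- (N ℤ.* (+ 1 ℤ.+ + Q ℤ.+ (+ 1 ℤ.+ + Q))) ℤ.+ ((C ℤ.+ + q ℤ.* + Q) ℤ.+ (C ℤ.+ + Q ℤ.* C)) ℤ.+ (+ 1 ℤ.+ (N ℤ.+ (+ q ℤ.* + d″ ℤ.* + Q ℤ.+ + Q))))
             N₀≡ C≡)
          (≡.trans (eq₂ (+ q) (+ d″) (+ Q)) (≡.sym C≡))))
        (Below₂-* {x = U -[1+ k ]} {g * 𝒦} (Below₂-weaken {x = U -[1+ k ]} order≤ (Below₂-U -[1+ k ])) (Below₂-* {x = g} {𝒦} Below₂-g Below₂-𝒦))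
        where
        N₀≡ : + N₀ ≡ + q ℤ.* (+ 1 ℤ.+ + d″)
        N₀≡ = ℤₚ.pos-* q d
        C≡ : + C ≡ + q ℤ.* (+ 1 ℤ.+ + d″) ℤ.- + 1
        C≡ = ≡.refl
        eq₁ : ∀ x q y → x ℤ.* (q ℤ.* y) ≡ q ℤ.* (y ℤ.* x)
        eq₁ = solve-∀
        eq₂ : ∀ q d Q → ℤ.- ((q ℤ.* (+ 1 ℤ.+ d)) ℤ.* (+ 1 ℤ.+ Q ℤ.+ (+ 1 ℤ.+ Q))) ℤ.+ (((q ℤ.* (+ 1 ℤ.+ d) ℤ.- + 1) ℤ.+ q ℤ.* Q) ℤ.+ ((q ℤ.* (+ 1 ℤ.+ d) ℤ.- + 1) ℤ.+ Q ℤ.* (q ℤ.* (+ 1 ℤ.+ d) ℤ.- + 1)))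
          ℤ.+ (+ 1 ℤ.+ ((q ℤ.* (+ 1 ℤ.+ d)) ℤ.+ (q ℤ.* d ℤ.* Q ℤ.+ Q))) ≡ q ℤ.* (+ 1 ℤ.+ d) ℤ.- + 1
        eq₂ = solve-∀
        order≤ : + N₀ ℤ.* -[1+ k ] ℤ.≤ ℤ.- (+ N₀ ℤ.* (+ suc Q ℤ.+ + suc Q))
        order≤ = ≡.subst (ℤ._≤ ℤ.- (+ N₀ ℤ.* (+ suc Q ℤ.+ + suc Q))) (ℤₚ.neg-distribʳ-* (+ N₀) (+ suc k))
          (ℤₚ.neg-mono-≤ (ℤₚ.*-monoˡ-≤-nonNeg (+ N₀) (ℤ.+≤+ le)))

      trace-term : ℕ → K.Carrier
      trace-term N = ρ (g * (β N * Φ (β* N)))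

      -- At u = ∞ the factor Φ (β* N) has order at most - Q (q + 1), which outweighs the order q Q
      -- of g₂^q₁.
      beyond-q₁ : ∀ N → q₁ ≤ N → trace-term N ≈ K.0#
      beyond-q₁ N le = ρ-slack {x = g * (β N * Φ (β* N))} Q (≡.trans
        (≡.cong₂ (λ x y → (+ C ℤ.+ x ℤ.* (+ q ℤ.* + q₂)) ℤ.+ (ℤ.- + 1 ℤ.+ y ℤ.* (+ C ℤ.- x)) ℤ.+ (+ 1 ℤ.+ y)) q₁ℤ (≡.trans Qℤ (≡.cong (+ q₂ ℤ.*_) q₁ℤ)))
        (eq (+ C) (+ q) (+ q₂)))
        (Below₂-* {x = g} {β N * Φ (β* N)} Below₂-g (Below₂-* {x = β N} {Φ (β* N)} (β-Below₂′ {N} (ℕₚ.≤-trans N₀≤q₁ le))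
          (τ̄-pow-Below₂ Q (weaken-≤ (-‿antitone le) (Lead⇒Below (β*-Lead N))))))
        where
        eq : ∀ C q y → (C ℤ.+ (+ 1 ℤ.+ (C ℤ.+ q)) ℤ.* (q ℤ.* y)) ℤ.+ (ℤ.- + 1 ℤ.+ y ℤ.* (+ 1 ℤ.+ (C ℤ.+ q)) ℤ.* (C ℤ.- (+ 1 ℤ.+ (C ℤ.+ q)))) ℤ.+ (+ 1 ℤ.+ y ℤ.* (+ 1 ℤ.+ (C ℤ.+ q))) ≡ C
        eq = solve-∀

      window-term : ℤ → K.Carrier
      window-term l = χ l K.* ρ (U (ℤ.- l) * (g * 𝒦))

      χ-multiple : ∀ m → χ (+ (m ℕ.* suc Q)) ≈ c^ (+ m)
      χ-multiple m = K.trans (K.reflexive (≡.cong χ (≡.trans (ℤₚ.pos-* m (suc Q)) (≡.sym (ℤₚ.+-identityˡ _))))) (χ-value 0 (+ m) (s≤s z≤n))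

      window-negative : ∀ k → window-term -[1+ k ] ≈ K.0#
      window-negative k = go (l ℤ/.%ℕ suc Q) (l ℤ/./ℕ suc Q) (ℤ/.n%ℕd<d l (suc Q)) (ℤ/.a≡a%ℕn+[a/ℕn]*n l (suc Q))
        where
        l = -[1+ k ]
        go : ∀ r₁ m → r₁ < suc Q → l ≡ + r₁ ℤ.+ m ℤ.* + suc Q → window-term l ≈ K.0#
        go (suc r₁) m r< eq = K.trans (K.*-congʳ (K.trans (K.reflexive (≡.cong χ eq)) (χ-value (suc r₁) m r<))) (K.zeroˡ _)
        go zero (+ m) _ eq with ≡.trans eq (≡.trans (ℤₚ.+-identityˡ _) (≡.sym (ℤₚ.pos-* m (suc Q))))
        ... | ()
        go zero -[1+ m ] _ eq = K.trans (K.*-congˡ (negative k (≡.subst (suc Q ≤_) (≡.sym suc-k≡) (ℕₚ.m≤n*m (suc Q) (suc m))))) (K.zeroʳ _)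
          where
          suc-k≡ : suc k ≡ suc m ℕ.* suc Q
          suc-k≡ = ℤₚ.+-injective (≡.trans (≡.cong ℤ.-_ (≡.trans eq (ℤₚ.+-identityˡ (-[1+ m ] ℤ.* + suc Q)))) (≡.trans (ℤₚ.neg-distribˡ-* -[1+ m ] (+ suc Q)) (≡.sym (ℤₚ.pos-* (suc m) (suc Q)))))

      -- The factor c^m u^(-m (Q+1)) equals u^(-m) Φ (u^m); its two parts turn f r into β N and f* r
      -- into β* N for N = r + m N₀.
      multiple-term : ∀ m → window-term (+ (m ℕ.* suc Q)) ≈ K.∑ N₀ (λ r → ρ (g * ((U (ℤ.- + m) * f r) * Φ (U (+ m) * f* r))))
      multiple-term m = K.begin
        χ (+ (m ℕ.* suc Q)) K.* ρ (U (ℤ.- + (m ℕ.* suc Q)) * (g * 𝒦)) K.≈⟨ K.*-congʳ (χ-multiple m) ⟩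
        c^ (+ m) K.* ρ (U (ℤ.- + (m ℕ.* suc Q)) * (g * 𝒦)) K.≈⟨ ρ-ι* _ _ ⟨
        ρ (ι (c^ (+ m)) * (U (ℤ.- + (m ℕ.* suc Q)) * (g * 𝒦)))
          K.≈⟨ ρ-cong (R.trans (R.solve 4 (λ x t g k → x R.:* (t R.:* (g R.:* k)) R.⊜ (x R.:* (t R.:* g)) R.:* k) R.refl _ _ _ _)
                 (R.trans (R.sym (R.∑-*ˡ N₀ _ _)) (R.∑-cong N₀ λ r _ → R.begin
                   (ι (c^ (+ m)) * (U (ℤ.- + (m ℕ.* suc Q)) * g)) * (f r * Φ (f* r))
                     R.≈⟨ R.*-congʳ (R.*-congˡ (R.*-congʳ (R.trans (R.reflexive (≡.cong U (exponent m))) (U-+ _ _)))) ⟩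
                   (ι (c^ (+ m)) * ((U (ℤ.- + m) * U (ℤ.- + m ℤ.* + Q)) * g)) * (f r * Φ (f* r))
                     R.≈⟨ R.solve 6 (λ x t t′ g f h → (x R.:* ((t R.:* t′) R.:* g)) R.:* (f R.:* h) R.⊜ g R.:* ((t R.:* f) R.:* ((x R.:* t′) R.:* h))) R.refl _ _ _ _ _ _ ⟩
                   g * ((U (ℤ.- + m) * f r) * ((ι (c^ (+ m)) * U (ℤ.- + m ℤ.* + Q)) * Φ (f* r)))
                     R.≈⟨ R.*-congˡ (R.*-congˡ (R.sym (R.trans (Φ-* _ _) (R.*-congʳ (Φ-U (+ m)))))) ⟩
                   g * ((U (ℤ.- + m) * f r) * Φ (U (+ m) * f* r)) R.∎))) ⟩
        ρ (R.∑ N₀ (λ r → g * ((U (ℤ.- + m) * f r) * Φ (U (+ m) * f* r)))) K.≈⟨ ev-∑ _ N₀ _ ⟩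
        K.∑ N₀ (λ r → ρ (g * ((U (ℤ.- + m) * f r) * Φ (U (+ m) * f* r)))) K.∎
        where
        exponent : ∀ m → ℤ.- + (m ℕ.* suc Q) ≡ ℤ.- + m ℤ.+ ℤ.- + m ℤ.* + Q
        exponent m = ≡.trans (≡.cong ℤ.-_ (ℤₚ.pos-* m (suc Q))) (eq (+ m) (+ Q))
          where
          eq : ∀ m Q → ℤ.- (m ℤ.* (+ 1 ℤ.+ Q)) ≡ ℤ.- m ℤ.+ ℤ.- m ℤ.* Q
          eq = solve-∀

      -- Only the exponents 0 and Q + 1 of u contribute to ρ[ χ ] (g 𝒦).
      trace-sum : ρ[ χ ] (g * 𝒦) ≈ K.∑ q₁ trace-term
      trace-sum = let W₀ , window = ev-window χ (+ 0) 0 0 (g * 𝒦) in go W₀ window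
        where
        block : ℕ → ℕ → K.Carrier
        block m r₁ = window-term (+ (r₁ ℕ.+ m ℕ.* suc Q))
        block-zero : ∀ m r₁ → r₁ < suc Q → ¬ r₁ ≡ 0 → block m r₁ ≈ K.0#
        block-zero m zero _ ne = ⊥-elim (ne ≡.refl)
        block-zero m (suc r₁) r< _ = K.trans (K.*-congʳ (K.trans (K.reflexive (≡.cong (λ z → χ (+ suc r₁ ℤ.+ z)) (ℤₚ.pos-* m (suc Q)))) (χ-value (suc r₁) (+ m) r<))) (K.zeroˡ _)
        far : ∀ m → 2 ≤ m → block m 0 ≈ K.0#
        far m@(suc m′) 2≤m = K.trans (K.*-congˡ (positive (Q ℕ.+ m′ ℕ.* suc Q)
          (ℕₚ.≤-trans (ℕₚ.≤-reflexive (≡.cong (suc Q ℕ.+_) (≡.sym (ℕₚ.+-identityʳ (suc Q))))) (ℕₚ.*-monoˡ-≤ (suc Q) 2≤m)))) (K.zeroʳ _)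
        go : ∀ W₀ → (∀ W → W₀ ≤ W → ρ[ χ ] (g * 𝒦) ≈ K.⨁ W (λ l → χ l K.* ev (δ , + 0 ℤ.- l , 0 , 0) (g * 𝒦))) → ρ[ χ ] (g * 𝒦) ≈ K.∑ q₁ trace-term
        go W₀ window = K.begin
          ρ[ χ ] (g * 𝒦) K.≈⟨ window W (ℕₚ.≤-trans (ℕₚ.≤-trans (ℕₚ.n≤1+n W₀) (ℕₚ.m≤m*n (suc W₀) (suc Q))) (ℕₚ.m≤n+m _ Q)) ⟩
          K.⨁ W (λ l → χ l K.* ev (δ , + 0 ℤ.- l , 0 , 0) (g * 𝒦))
            K.≈⟨ K.⨁-cong W (λ l _ → K.*-congˡ (K.sym (ev-mono* _ (ℤ.- l , 0 , 0) (g * 𝒦)))) ⟩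
          K.⨁ W window-term K.≈⟨ K.⨁-nonneg W window-negative ⟩
          K.∑ (suc W) (λ l → window-term (+ l)) K.≈⟨ K.∑-cong (suc W) (λ l _ → K.reflexive (≡.cong (λ z → window-term (+ z)) (ℕ/.m≡m%n+[m/n]*n l (suc Q)))) ⟩
          K.∑ (suc W) (λ l → block (l ℕ/./ suc Q) (l ℕ/.% suc Q)) K.≈⟨ K.∑-flatten (suc (suc W₀)) (suc Q) block ⟨
          K.∑ (suc (suc W₀)) (λ m → K.∑ (suc Q) (block m)) K.≈⟨ K.∑-cong (suc (suc W₀)) (λ m _ → K.∑-single (suc Q) 0 (s≤s z≤n) (block-zero m)) ⟩
          K.∑ (suc (suc W₀)) (λ m → block m 0) K.≈⟨ K.∑-truncate {2} {suc (suc W₀)} (λ m → block m 0) (s≤s (s≤s z≤n)) far ⟩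
          K.∑ 2 (λ m → block m 0) K.≈⟨ K.∑-cong 2 (λ m _ → multiple-term m) ⟩
          K.∑ 2 (λ m → K.∑ N₀ (λ r → ρ (g * ((U (ℤ.- + m) * f r) * Φ (U (+ m) * f* r)))))
            K.≈⟨ K.∑-flatten 2 N₀ (λ m r → ρ (g * ((U (ℤ.- + m) * f r) * Φ (U (+ m) * f* r)))) ⟩
          K.∑ (2 ℕ.* N₀) trace-term K.≈⟨ K.∑-truncate trace-term q₁≤2N₀ beyond-q₁ ⟩
          K.∑ q₁ trace-term K.∎
          where
          -- Then `suc W` is `suc (suc W₀) ℕ.* suc Q`, a whole number of blocks of length Q + 1, and
          -- W is at least W₀.
          W = Q ℕ.+ suc W₀ ℕ.* suc Q
          q₁≤2N₀ : q₁ ≤ 2 ℕ.* N₀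
          q₁≤2N₀ = ≡.subst (_≤ 2 ℕ.* N₀) (≡.sym q₁≡) (ℕₚ.+-mono-≤ {N₀} {N₀} ℕₚ.≤-refl (ℕₚ.≤-trans (ℕₚ.m≤m*n q d) (ℕₚ.m≤m+n N₀ 0)))

  -- The part of a trace term that depends only on the first test factor β o; `Ŷ` is the part that
  -- depends only on g₂, as a coefficient of g₂ Φ₂ (β* N).
  X̂ : ℕ → ℕ → ℕ → K.Carrier
  X̂ o N N′ = ρ (β o * (β N * β* N′ ^ q₁))

  Ŷ : Element → ℕ → ℕ → K.Carrier
  Ŷ g₂ N N′ = ρ ((g₂ * Φ₂ (β* N)) * β N′)

  private
    module _ (o : ℕ) (o≤ : o ≤ A₁) (N : ℕ) (N<q₁ : N < q₁) where
      A : Element → K.Carrier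
      A y = ρ (β o * (β N * y ^ q₁))

      A-ι : ∀ x y → A (ι x * y) ≈ x K.^ q₁ K.* A y
      A-ι x y = K.trans (ρ-cong (R.trans (R.*-congˡ (R.*-congˡ (R.trans (R.^-distrib-* _ _ q₁) (R.*-congʳ (R.sym (ι-^ x q₁))))))
        (R.solve 4 (λ a b x y → a R.:* (b R.:* (x R.:* y)) R.⊜ x R.:* (a R.:* (b R.:* y))) R.refl _ _ _ _))) (ρ-ι* _ _)

      open Expand A (λ p → ρ-cong (R.*-congˡ (R.*-congˡ (R.^-congˡ q₁ p))))
        (K.trans (ρ-cong (R.trans (R.*-congˡ (R.trans (R.*-congˡ (R.0^ q₁ q₁>0)) (R.zeroʳ _))) (R.zeroʳ _))) (ev-0 _))
        (λ x y → K.trans (ρ-cong (R.trans (R.*-congˡ (R.*-congˡ (R-additive₁ x y))) (R.solve 4 (λ a b x y → a R.:* (b R.:* (x R.:+ y)) R.⊜ a R.:* (b R.:* x) R.:+ a R.:* (b R.:* y)) R.refl _ _ _ _)))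
          (ρ-+ _ _))

      beyond-q₂ : ∀ N′ → q₂ ≤ N′ → X̂ o N N′ ≈ K.0#
      beyond-q₂ N′ le = ρ-Below 0 (≡.trans
        (≡.cong (λ a → a ℤ.+ (+ (C ℕ.+ q) ℤ.+ + q₁ ℤ.* (+ C ℤ.- + q₂)) ℤ.+ + 1) A₁ℤ)
        (≡.trans (≡.cong₂ (λ x y → (x ℤ.* + w ℤ.+ + C) ℤ.+ (+ (C ℕ.+ q) ℤ.+ x ℤ.* (+ C ℤ.- y)) ℤ.+ + 1) q₁ℤ q₂ℤ) (eq (+ C) (+ q) (+ w))))
        (Below-* (Below-≤ o≤ (Lead⇒Below (β-Lead o))) (Below-* (Below-≤ (ℕₚ.≤-pred (≡.subst (N <_) q₁≡ N<q₁)) (Lead⇒Below (β-Lead N)))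
          (Below-^ q₁ (weaken-≤ (-‿antitone le) (Lead⇒Below (β*-Lead N′))))))
        where
        eq : ∀ C q w → ((+ 1 ℤ.+ (C ℤ.+ q)) ℤ.* w ℤ.+ C) ℤ.+ ((C ℤ.+ q) ℤ.+ (+ 1 ℤ.+ (C ℤ.+ q)) ℤ.* (C ℤ.- (+ 1 ℤ.+ (C ℤ.+ w)))) ℤ.+ + 1 ≡ C
        eq = solve-∀

      negative-index : ∀ k r → A (U -[1+ k ] * f* r) ≈ K.0#
      negative-index k r = ρ-slack {x = β o * (β N * (U -[1+ k ] * f* r) ^ q₁)} q (≡.trans
        (≡.cong (λ x → + C ℤ.+ (+ C ℤ.+ x ℤ.* ℤ.- + 1) ℤ.+ (+ 1 ℤ.+ + q)) q₁ℤ) (eq (+ C) (+ q)))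
        (Below₂-* {x = β o} {β N * (U -[1+ k ] * f* r) ^ q₁} (β-Below₂ o) (Below₂-* {x = β N} {(U -[1+ k ] * f* r) ^ q₁} (β-Below₂ N)
          (Below₂-pow {x = U -[1+ k ] * f* r} q₁ (Below₂-U* k {f* r} (below₂ (f*-Small r))))))
        where
        eq : ∀ C q → C ℤ.+ (C ℤ.+ (+ 1 ℤ.+ (C ℤ.+ q)) ℤ.* ℤ.- + 1) ℤ.+ (+ 1 ℤ.+ q) ≡ C
        eq = solve-∀

      -- g₂ and Φ (β* N) occur only through the q₁-th power of g₂ Φ₂ (β* N); expanding this element
      -- before taking the power splits each summand into X̂ and a q₁-th power of Ŷ.
      separate : ∀ g₂ → ρ ((β o * g₂ ^ q₁) * (β N * Φ (β* N))) ≈ K.∑ q₂ (λ N′ → X̂ o N N′ K.* Ŷ g₂ N N′ K.^ q₁)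
      separate g₂ = K.begin
        ρ ((β o * g₂ ^ q₁) * (β N * Φ (β* N)))
          K.≈⟨ ρ-cong (R.trans (R.*-congˡ (R.*-congˡ (Φ-pow (β* N)))) (R.trans
                 (R.solve 4 (λ a g b y → (a R.:* g) R.:* (b R.:* y) R.⊜ a R.:* (b R.:* (g R.:* y))) R.refl _ _ _ _)
                 (R.*-congˡ (R.*-congˡ (R.sym (R.^-distrib-* _ _ q₁)))))) ⟩
        A y
          K.≈⟨ expand y q₂ (λ k r _ → K.trans (A-ι _ _) (K.trans (K.*-congˡ (negative-index k r)) (K.zeroʳ _)))
                 (λ N′ le → K.trans (A-ι _ _) (K.trans (K.*-congˡ (beyond-q₂ N′ le)) (K.zeroʳ _))) ⟩
        K.∑ q₂ (λ N′ → A (ι (ρ (y * β N′)) * β* N′)) K.≈⟨ K.∑-cong q₂ (λ N′ _ → K.trans (A-ι _ _) (K.*-comm _ _)) ⟩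
        K.∑ q₂ (λ N′ → X̂ o N N′ K.* Ŷ g₂ N N′ K.^ q₁) K.∎
        where y = g₂ * Φ₂ (β* N)

  private
    -- Enumerates the pairs (N, N′) so that N + q₁ (C - N′), the order of β N times the q₁-th power
    -- of β* N′, increases by one with each m.
    n₁ n₂ : ℕ → ℕ
    n₁ m = m ℕ/.% q₁
    n₂ m = q₂ ℕ.∸ suc (m ℕ/./ q₁)

    X : ℕ → ℕ → K.Carrier
    X o m = X̂ o (n₁ m) (n₂ m)

    Y : Element → ℕ → K.Carrier
    Y g₂ m = Ŷ g₂ (n₁ m) (n₂ m)

    X-Lead : ∀ o m → m < Q → Lead (+ C ℤ.+ (+ (o ℕ.+ m) ℤ.- + A₁)) (β o * (β (n₁ m) * β* (n₂ m) ^ q₁))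
    X-Lead o m m< = Lead-≡ order≡ (Lead-* (β-Lead o) (Lead-* (β-Lead (n₁ m)) (Lead-^ q₁ (β*-Lead (n₂ m)))))
      where
      a₁ = m ℕ/./ q₁
      a₁<q₂ : a₁ < q₂
      a₁<q₂ = ℕ/.m<n*o⇒m/o<n (≡.subst (m <_) Q≡ m<)
      n₂≡ : + n₂ m ≡ + C ℤ.+ + w ℤ.- + a₁
      n₂≡ = ≡.trans (shift (+ n₂ m) (+ a₁)) (≡.cong (λ z → z ℤ.- + 1 ℤ.- + a₁) (≡.trans (≡.cong +_ (ℕₚ.m∸n+n≡m a₁<q₂)) q₂ℤ))
        where
        shift : ∀ x a → x ≡ (x ℤ.+ (+ 1 ℤ.+ a)) ℤ.- + 1 ℤ.- a
        shift = solve-∀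
      m≡ : + m ≡ + n₁ m ℤ.+ + a₁ ℤ.* + q₁
      m≡ = ≡.trans (≡.cong +_ (ℕ/.m≡m%n+[m/n]*n m q₁)) (≡.cong (λ z → + n₁ m ℤ.+ z) (ℤₚ.pos-* a₁ q₁))
      order≡ : + o ℤ.+ (+ n₁ m ℤ.+ + q₁ ℤ.* (+ C ℤ.- + n₂ m)) ≡ + C ℤ.+ (+ (o ℕ.+ m) ℤ.- + A₁)
      order≡ = ≡.trans (≡.cong (λ z → + o ℤ.+ (+ n₁ m ℤ.+ + q₁ ℤ.* (+ C ℤ.- z))) n₂≡)
        (≡.trans (eq (+ o) (+ n₁ m) (+ q₁) (+ C) (+ w) (+ a₁)) (≡.sym (≡.cong₂ (λ x y → + C ℤ.+ (+ o ℤ.+ x ℤ.- y)) m≡ A₁ℤ)))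
        where
        eq : ∀ o N x C w a → o ℤ.+ (N ℤ.+ x ℤ.* (C ℤ.- (C ℤ.+ w ℤ.- a))) ≡ C ℤ.+ (o ℤ.+ (N ℤ.+ a ℤ.* x) ℤ.- (x ℤ.* w ℤ.+ C))
        eq = solve-∀

    X-below : ∀ o m → m < Q → o ℕ.+ m < A₁ → X o m ≈ K.0#
    X-below o m m< lt = ρ-Below-< (≡.subst (+ C ℤ.+ (+ (o ℕ.+ m) ℤ.- + A₁) ℤ.<_) (eq (+ C) (+ A₁))
      (ℤₚ.+-monoʳ-< (+ C) (ℤₚ.+-monoˡ-< (ℤ.- + A₁) (ℤ.+<+ lt)))) (Lead⇒Below (X-Lead o m m<))
      where
      eq : ∀ C A → C ℤ.+ (A ℤ.- A) ≡ C
      eq = solve-∀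

    X-top : ∀ o m → m < Q → o ℕ.+ m ≡ A₁ → ¬ X o m ≈ K.0#
    X-top o m m< eq = ρ-Lead (Lead-≡ (≡.trans (≡.cong (λ z → + C ℤ.+ (+ z ℤ.- + A₁)) eq) (eq′ (+ C) (+ A₁))) (X-Lead o m m<))
      where
      eq′ : ∀ C A → C ℤ.+ (A ℤ.- A) ≡ C
      eq′ = solve-∀

    relation : ¬ FixedPoint → ∀ o → o ≤ A₁ → ∀ g₂ → Below (+ C) g₂ → Below₂ (+ (q ℕ.* q₂)) g₂ → K.∑ Q (λ m → X o m K.* Y g₂ m K.^ q₁) ≈ K.0#
    relation noFP o o≤ g₂ Bg Bg₂ = K.begin
      K.∑ Q (λ m → X o m K.* Y g₂ m K.^ q₁) K.≡⟨ ≡.cong (λ k → K.∑ k (λ m → X o m K.* Y g₂ m K.^ q₁)) Q≡ ⟩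
      K.∑ (q₂ ℕ.* q₁) (λ m → X o m K.* Y g₂ m K.^ q₁) K.≈⟨ K.∑-flatten q₂ q₁ (λ a N → T N (q₂ ℕ.∸ suc a)) ⟨
      K.∑ q₂ (λ a → K.∑ q₁ (λ N → T N (q₂ ℕ.∸ suc a))) K.≈⟨ K.∑-reverse q₂ (λ N′ → K.∑ q₁ (λ N → T N N′)) ⟨
      K.∑ q₂ (λ N′ → K.∑ q₁ (λ N → T N N′)) K.≈⟨ K.∑-comm q₁ q₂ T ⟨
      K.∑ q₁ (λ N → K.∑ q₂ (T N)) K.≈⟨ K.∑-cong q₁ (λ N N< → separate o o≤ N N< g₂) ⟨
      K.∑ q₁ (λ N → ρ ((β o * g₂ ^ q₁) * (β N * Φ (β* N)))) K.≈⟨ trace-sum o o≤ g₂ Bg Bg₂ ⟨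
      ρ[ χ ] ((β o * g₂ ^ q₁) * 𝒦) K.≈⟨ trace-vanishes noFP _ ⟩
      K.0# K.∎
      where
      T : ℕ → ℕ → K.Carrier
      T N N′ = X̂ o N N′ K.* Ŷ g₂ N N′ K.^ q₁

    -- Triangularity of X turns the relations into the vanishing of Y, once Y vanishes beyond A₁.
    Y-vanishes : ¬ FixedPoint → ∀ g₂ → Below (+ C) g₂ → Below₂ (+ (q ℕ.* q₂)) g₂ → (∀ m → A₁ < m → m < Q → Y g₂ m ≈ K.0#) → ∀ m → m < Q → Y g₂ m ≈ K.0#
    Y-vanishes noFP g₂ Bg Bg₂ high m m< = go (suc A₁) m (s≤s (ℕₚ.m∸n≤m A₁ m)) m<
      where
      root : ∀ {y} k → y K.^ k ≈ K.0# → y ≈ K.0#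
      root {y} k h = decide (y ≟ K.0#)
        where
        decide : Dec (y ≈ K.0#) → y ≈ K.0#
        decide (yes e) = e
        decide (no ne) = ⊥-elim (^≉0 k ne h)
      go : ∀ fuel m → A₁ ℕ.∸ m < fuel → m < Q → Y g₂ m ≈ K.0#
      go (suc fuel) m lt m<Q = cases (m ℕ.≤? A₁)
        where
        cases : Dec (m ≤ A₁) → Y g₂ m ≈ K.0#
        cases (no m≰) = high m (ℕₚ.≰⇒> m≰) m<Q
        cases (yes m≤) = root q₁ (cancel (X-top o m m<Q o+m≡) (K.trans (K.sym (K.∑-single Q m m<Q others)) (relation noFP o (ℕₚ.m∸n≤m A₁ m) g₂ Bg Bg₂)))
          where
          o = A₁ ℕ.∸ m
          o+m≡ : o ℕ.+ m ≡ A₁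
          o+m≡ = ℕₚ.m∸n+n≡m m≤
          others : ∀ i → i < Q → ¬ i ≡ m → X o i K.* Y g₂ i K.^ q₁ ≈ K.0#
          others i i< ne = compare (ℕₚ.<-cmp i m)
            where
            compare : Tri (i < m) (i ≡ m) (m < i) → X o i K.* Y g₂ i K.^ q₁ ≈ K.0#
            compare (tri< i<m _ _) = K.trans (K.*-congʳ (X-below o i i< (≡.subst (o ℕ.+ i <_) o+m≡ (ℕₚ.+-monoʳ-< o i<m)))) (K.zeroˡ _)
            compare (tri≈ _ eq _) = ⊥-elim (ne eq)
            compare (tri> _ _ m<i) = K.trans (K.*-congˡ (K.trans (K.^-congˡ q₁ (above (i ℕ.≤? A₁))) (K.0^ q₁ q₁>0))) (K.zeroʳ _)
              where
              above : Dec (i ≤ A₁) → Y g₂ i ≈ K.0#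
              above (no i≰) = high i (ℕₚ.≰⇒> i≰) i<
              above (yes i≤) = go fuel i (ℕₚ.<-≤-trans (ℕₚ.∸-monoʳ-< m<i i≤) (ℕₚ.≤-pred lt)) i<

    -- g₂ has T₀ = N₀ q₁ free coefficients. Making Y vanish beyond A₁ costs Q - A₁ - 1 = N₀ q₁ - N₀
    -- equations, fewer than the unknowns.
    T₀ R₀ : ℕ
    T₀ = N₀ ℕ.* q₁
    R₀ = Q ℕ.∸ suc A₁

    R₀<T₀ : R₀ < T₀
    R₀<T₀ = ℕₚ.m<n+o⇒m∸n<o Q (suc A₁) {T₀} {{ℕₚ.m*n≢0 N₀ q₁}} (≡.subst (_< suc A₁ ℕ.+ T₀) (≡.sym Q≡′) (s≤s (bound C (q₁ ℕ.* w) T₀)))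
      where
      Q≡′ : Q ≡ q₁ ℕ.* w ℕ.+ T₀
      Q≡′ = ≡.trans Q≡ (≡.trans (≡.cong (ℕ._* q₁) q₂≡) (eq N₀ w q₁))
        where
        eq : ∀ N w x → (N ℕ.+ w) ℕ.* x ≡ x ℕ.* w ℕ.+ N ℕ.* x
        eq = ℕ-Solver.solve-∀
      bound : ∀ C x t → x ℕ.+ t ≤ x ℕ.+ C ℕ.+ t
      bound C x t = ℕₚ.+-monoˡ-≤ t (ℕₚ.m≤m+n x C)

    combination : (ℕ → K.Carrier) → Element
    combination x = R.∑ T₀ (λ t → ι (x t) * γ t)

    row : ℕ → ℕ → K.Carrier
    row i t = Ŷ (γ t) (n₁ (suc A₁ ℕ.+ i)) (n₂ (suc A₁ ℕ.+ i))

    Ŷ-combination : ∀ x N N′ → Ŷ (combination x) N N′ ≈ K.∑ T₀ (λ t → Ŷ (γ t) N N′ K.* x t)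
    Ŷ-combination x N N′ = K.trans (ρ-cong (R.trans (R.*-assoc _ _ _) (∑-*ʳ T₀ _ _))) (K.trans (ev-∑ _ T₀ _) (K.∑-cong T₀ λ t _ →
      K.trans (ρ-cong (R.solve 4 (λ x g y z → (x R.:* g) R.:* (y R.:* z) R.⊜ x R.:* ((g R.:* y) R.:* z)) R.refl _ _ _ _)) (K.trans (ρ-ι* _ _) (K.*-comm _ _))))

    Lead-∑ : ∀ {M} m h t₀ → t₀ < m → Lead M (h t₀) → (∀ t → t < m → ¬ t ≡ t₀ → Below (M ℤ.- + 1) (h t)) → Lead M (R.∑ m h)
    Lead-∑ {M} (suc m) h t₀ t₀< L rest = cases (ℕₚ.m≤n⇒m<n∨m≡n (ℕₚ.≤-pred t₀<))
      where
      cases : t₀ < m ⊎ t₀ ≡ m → Lead M (R.∑ (suc m) h)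
      cases (inj₁ lt) = Lead-+ (Lead-∑ m h t₀ lt L λ t t< → rest t (ℕₚ.m<n⇒m<1+n t<)) (rest m (ℕₚ.n<1+n m) λ eq → ℕₚ.<⇒≢ lt (≡.sym eq))
      cases (inj₂ ≡.refl) = Lead-≃ (R.+-comm _ _) (Lead-+ L (Below-∑ m λ t t< → rest t (ℕₚ.m<n⇒m<1+n t<) (ℕₚ.<⇒≢ t<)))

    module _ (g₂ : Element) (Bg₂ : Below₂ (+ (q ℕ.* q₂)) g₂) (Ŷ≈0 : ∀ N N′ → N < q₁ → N′ < q₂ → Ŷ g₂ N N′ ≈ K.0#)
      (t₀ : ℕ) (t₀< : t₀ < T₀) (g₂-Lead : Lead (+ C ℤ.- + t₀) g₂) where

      -- From t₀ = N′ + t₂ q₂ the product of g₂, the q₂-th power of f t₂ and β N′ has order exactly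
      -- (C - t₀) + q₂ t₂ + N′ = C, so its residue is nonzero.
      N′ t₂ : ℕ
      N′ = t₀ ℕ/.% q₂
      t₂ = t₀ ℕ/./ q₂

      t₂<N₀ : t₂ < N₀
      t₂<N₀ = ℕₚ.<-≤-trans (ℕ/.m<n*o⇒m/o<n (ℕₚ.<-≤-trans t₀< N₀q₁≤)) (ℕₚ.m≤m*n q d)

      -- Chosen so that Φ₂ h is the q₂-th power of f t₂.
      h : Element
      h = τ̄ (f t₂)

      A₂ : Element → K.Carrier
      A₂ y = ρ ((g₂ * Φ₂ y) * β N′)

      A₂-ι : ∀ x y → A₂ (ι x * y) ≈ (x K.^ Q) K.^ q₂ K.* A₂ y
      A₂-ι x y = K.trans (ρ-cong (R.trans (R.*-congʳ (R.*-congˡ (R.trans (R.^-congˡ q₂ (τ̄-ι* x y)) (R.trans (R.^-distrib-* _ _ q₂) (R.*-congʳ (R.sym (ι-^ _ q₂)))))))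
        (R.solve 4 (λ a b x y → (a R.:* (x R.:* y)) R.:* b R.⊜ x R.:* ((a R.:* y) R.:* b)) R.refl _ _ _ _))) (ρ-ι* _ _)

      open Expand A₂ (λ p → ρ-cong (R.*-congʳ (R.*-congˡ (R.^-congˡ q₂ (τ̄-cong p)))))
        (K.trans (ρ-cong (R.trans (R.*-congʳ (R.trans (R.*-congˡ (R.trans (R.^-congˡ q₂ τ̄-0) (R.0^ q₂ q₂>0))) (R.zeroʳ _))) (R.zeroˡ _))) (ev-0 _))
        (λ x y → K.trans (ρ-cong (R.trans (R.*-congʳ (R.*-congˡ (R.trans (R.^-congˡ q₂ (τ̄-+ x y)) (R-additive₂ _ _))))
          (R.solve 4 (λ a b x y → (a R.:* (x R.:+ y)) R.:* b R.⊜ (a R.:* x) R.:* b R.:+ (a R.:* y) R.:* b) R.refl _ _ _ _))) (ρ-+ _ _))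

      A₂-nonzero : ¬ A₂ h ≈ K.0#
      A₂-nonzero = ρ-Lead (Lead-≡ order≡ (Lead-* (Lead-* g₂-Lead (Lead-≃ (R.^-congˡ q₂ (R.sym (τ̄-involutive (f t₂)))) (Lead-^ q₂ (f-Lead t₂)))) (β-Lead N′)))
        where
        order≡ : + C ℤ.- + t₀ ℤ.+ + q₂ ℤ.* + t₂ ℤ.+ + N′ ≡ + C
        order≡ = ≡.trans (≡.cong (λ z → + C ℤ.- z ℤ.+ + q₂ ℤ.* + t₂ ℤ.+ + N′) (≡.trans (≡.cong +_ (ℕ/.m≡m%n+[m/n]*n t₀ q₂)) (≡.cong (λ z → + N′ ℤ.+ z) (ℤₚ.pos-* t₂ q₂))))
          (eq (+ C) (+ N′) (+ t₂) (+ q₂))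
          where
          eq : ∀ C N t y → C ℤ.- (N ℤ.+ t ℤ.* y) ℤ.+ y ℤ.* t ℤ.+ N ≡ C
          eq = solve-∀

      scaled-zero : ∀ {x y} → A₂ y ≈ K.0# → A₂ (ι x * y) ≈ K.0#
      scaled-zero {x} {y} e = K.trans (A₂-ι x y) (K.trans (K.*-congˡ e) (K.zeroʳ _))

      -- In the expansion of h the terms with N < q₁ are multiples of entries of Ŷ, those with N ≥
      -- q₁ vanish by the order at u = ∞, and negative powers of u do not occur because f t₂ has
      -- order at most C there.
      A₂-zero : A₂ h ≈ K.0#
      A₂-zero = K.trans (expand h q₁ neg (λ N le → scaled-zero (beyond N le)))
        (K.∑-zero q₁ λ N N< → scaled-zero (Ŷ≈0 N N′ N< (ℕ/.m%n<n t₀ q₂)))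
        where
        neg : ∀ k r → r < N₀ → A₂ (ι (P*.coefficient h -[1+ k ] r) * (U -[1+ k ] * f* r)) ≈ K.0#
        neg k r r< = K.trans (A₂-ι _ _) (K.trans (K.*-congʳ (K.trans (K.^-congˡ q₂ (K.trans (K.^-congˡ Q vanish) (K.0^ Q (q^>0 n)))) (K.0^ q₂ q₂>0))) (K.zeroˡ _))
          where
          vanish : P*.coefficient h -[1+ k ] r ≈ K.0#
          vanish = ρ-Below 0 (eq (+ C)) (Below-* (f-Below₂ t₂ t₂<N₀) (Below-U* k (below (f-Small r r<))))
            where
            eq : ∀ C → C ℤ.+ ℤ.- + 1 ℤ.+ + 1 ≡ C
            eq = solve-∀
        beyond : ∀ N → q₁ ≤ N → A₂ (β* N) ≈ K.0#
        beyond N le = ρ-slack {x = (g₂ * Φ₂ (β* N)) * β N′} (ℕ.pred q₂) (≡.trans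
          (≡.cong₂ (λ x y → + q ℤ.* + q₂ ℤ.+ + q₂ ℤ.* (+ C ℤ.- x) ℤ.+ + C ℤ.+ + y) q₁ℤ (ℕₚ.suc-pred q₂)) (eq (+ C) (+ q) (+ q₂)))
          (Below₂-* {x = g₂ * Φ₂ (β* N)} {β N′} (Below₂-* {x = g₂} {Φ₂ (β* N)} (Below₂-≡ {x = g₂} (ℤₚ.pos-* q q₂) Bg₂)
            (τ̄-pow-Below₂ q₂ (weaken-≤ (-‿antitone le) (Lead⇒Below (β*-Lead N))))) (β-Below₂ N′))
          where
          eq : ∀ C q y → q ℤ.* y ℤ.+ y ℤ.* (C ℤ.- (+ 1 ℤ.+ (C ℤ.+ q))) ℤ.+ C ℤ.+ y ≡ C
          eq = solve-∀

      contradiction : ⊥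
      contradiction = A₂-nonzero A₂-zero

  ¬¬fixedPoint : ¬ ¬ FixedPoint
  ¬¬fixedPoint noFP = from-solution (kernel R₀ row R₀<T₀)
    where
    from-solution : Solution R₀ T₀ row → ⊥
    -- The orders C - t of the γ t decrease, so the first nonzero coefficient determines the leading
    -- term of g₂ at u = 0.
    from-solution (x , (t₁ , t₁< , xt₁≉0) , sol) = cases (first-nonzero T₀ x)
      where
      g₂ = combination x
      Bg : Below (+ C) g₂
      Bg = Below-∑ T₀ λ t _ → Below-ι* (x t) (weaken-≤ (≡.subst (+ C ℤ.- + t ℤ.≤_) (ℤₚ.+-identityʳ (+ C)) (-‿antitone {0} {t} z≤n)) (Lead⇒Below (γ-Lead t)))
      Bg₂ : Below₂ (+ (q ℕ.* q₂)) g₂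
      Bg₂ = Below₂-∑ T₀ λ t t< → Below₂-ι* (x t) {γ t} (γ-Below₂ t t<)
      high : ∀ m → A₁ < m → m < Q → Y g₂ m ≈ K.0#
      high m A₁<m m<Q = K.trans (Ŷ-combination x (n₁ m) (n₂ m)) (K.trans
        (K.reflexive (≡.cong (λ m → K.∑ T₀ (λ t → Ŷ (γ t) (n₁ m) (n₂ m) K.* x t)) (≡.sym (ℕₚ.m+[n∸m]≡n A₁<m))))
        (sol (m ℕ.∸ suc A₁) (ℕₚ.∸-monoˡ-< m<Q A₁<m)))
      Y≈0 : ∀ m → m < Q → Y g₂ m ≈ K.0#
      Y≈0 = Y-vanishes noFP g₂ Bg Bg₂ high
      Ŷ≈0 : ∀ N N′ → N < q₁ → N′ < q₂ → Ŷ g₂ N N′ ≈ K.0#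
      Ŷ≈0 N N′ N< N′< = K.trans (K.reflexive (≡.sym (≡.cong₂ (Ŷ g₂) remainder n₂≡))) (Y≈0 m m<Q)
        where
        a₁ = q₂ ℕ.∸ suc N′
        m = N ℕ.+ a₁ ℕ.* q₁
        remainder : n₁ m ≡ N
        remainder = ≡.trans (ℕ/.[m+kn]%n≡m%n N a₁ q₁) (ℕ/.m<n⇒m%n≡m N<)
        quotient : m ℕ/./ q₁ ≡ a₁
        quotient = ≡.trans (ℕ/.+-distrib-/-∣ʳ N (divides a₁ ≡.refl)) (≡.trans (≡.cong₂ ℕ._+_ (ℕ/.m<n⇒m/n≡0 N<) (ℕ/.m*n/n≡m a₁ q₁)) ≡.refl)
        suc-a₁ : suc a₁ ≡ q₂ ℕ.∸ N′
        suc-a₁ = ≡.sym (ℕₚ.+-∸-assoc 1 N′<)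
        n₂≡ : n₂ m ≡ N′
        n₂≡ = ≡.trans (≡.cong (λ a → q₂ ℕ.∸ suc a) quotient) (≡.trans (≡.cong (q₂ ℕ.∸_) suc-a₁) (ℕₚ.m∸[m∸n]≡n (ℕₚ.<⇒≤ N′<)))
        m<Q : m < Q
        m<Q = ≡.subst (m <_) (≡.sym Q≡) (ℕₚ.<-≤-trans (ℕₚ.+-monoˡ-< (a₁ ℕ.* q₁) N<) (ℕₚ.*-monoˡ-≤ q₁ (≡.subst (_≤ q₂) (≡.sym suc-a₁) (ℕₚ.m∸n≤m q₂ N′))))
      cases : (∃ λ i → i < T₀ × ¬ x i ≈ K.0# × (∀ j → j < i → x j ≈ K.0#)) ⊎ (∀ i → i < T₀ → x i ≈ K.0#) → ⊥
      cases (inj₂ z) = xt₁≉0 (z t₁ t₁<)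
      cases (inj₁ (t₀ , t₀< , xt₀≉0 , z)) = contradiction g₂ Bg₂ Ŷ≈0 t₀ t₀<
        (Lead-∑ T₀ (λ t → ι (x t) * γ t) t₀ t₀< (Lead-≡ (ℤₚ.+-identityˡ _) (Lead-* (Lead-ι xt₀≉0) (γ-Lead t₀))) lower)
        where
        lower : ∀ t → t < T₀ → ¬ t ≡ t₀ → Below (+ C ℤ.- + t₀ ℤ.- + 1) (ι (x t) * γ t)
        lower t _ ne = compare (ℕₚ.<-cmp t t₀)
          where
          eq : ∀ C t → C ℤ.- (+ 1 ℤ.+ t) ≡ C ℤ.- t ℤ.- + 1
          eq = solve-∀
          compare : Tri (t < t₀) (t ≡ t₀) (t₀ < t) → Below (+ C ℤ.- + t₀ ℤ.- + 1) (ι (x t) * γ t)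
          compare (tri< t<t₀ _ _) = resp (R.sym (R.trans (R.*-congʳ (R.trans (ι-cong (z t t<t₀)) ι-0)) (R.zeroˡ _))) zero
          compare (tri≈ _ e _) = ⊥-elim (ne e)
          compare (tri> _ _ t₀<t) = Below-ι* (x t) (weaken-≤ (≡.subst (+ C ℤ.- + t ℤ.≤_) (eq (+ C) (+ t₀)) (-‿antitone t₀<t)) (Lead⇒Below (γ-Lead t)))

-- Non-scatteredness for δ of norm one and of norm different from one

open import Data.Nat using (_*_; _^_)

theorem4p1 : (q n s : ℕ) → IsPrimePower q →
    1 ≤ n → 1 ≤ s → gcd n s ≡ 1 → s < 2 * n → nBound q s ≤ n →
    (F : CommutativeRing 0ℓ 0ℓ) → IsField F → HasCardinality F (q ^ (2 * n)) →
    (δ : CommutativeRing.Carrier F) → ¬ (CommutativeRing._≈_ F δ (CommutativeRing.0# F)) →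
    ¬ LinearSet.Scattered F q n δ s
theorem4p1 q n (suc s′) (p , k , p-prime , 1≤k , q≡) 1≤n 1≤s coprime s<2n bound F isField card δ δ≉0 scattered = from-q (1<⇒2+ 1<q)
  where
  s = suc s′
  1<q : 1 < q
  1<q = ≡.subst (1 <_) (≡.sym q≡) (ℕₚ.^-monoʳ-< p (ℕ.nonTrivial⇒n>1 p {{prime⇒nonTrivial p-prime}}) 1≤k)

  4s+1≤n : 4 ℕ.* s ℕ.+ 1 ≤ n
  4s+1≤n = weakest (((q ℕ.≡ᵇ 3) ∧ (1 ℕ.<ᵇ s)) ∨ ((q ℕ.≡ᵇ 2) ∧ (2 ℕ.<ᵇ s))) bound
    where
    weakest : ∀ t → (if t then 4 ℕ.* s ℕ.+ 2 else 4 ℕ.* s ℕ.+ 1) ≤ n → 4 ℕ.* s ℕ.+ 1 ≤ n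
    weakest true le = ℕₚ.≤-trans (ℕₚ.+-monoʳ-≤ (4 ℕ.* s) (s≤s z≤n)) le
    weakest false le = le

  3s+2≤n : 3 ℕ.* s ℕ.+ 2 ≤ n
  3s+2≤n = ℕₚ.≤-trans (≡.subst₂ _≤_ (eq₁ s) (eq₂ s) (ℕₚ.+-monoʳ-≤ (3 ℕ.* s ℕ.+ 1) (s≤s (z≤n {s′})))) 4s+1≤n
    where
    eq₁ : ∀ s → 3 ℕ.* s ℕ.+ 1 ℕ.+ 1 ≡ 3 ℕ.* s ℕ.+ 2
    eq₁ = ℕ-Solver.solve-∀
    eq₂ : ∀ s → 3 ℕ.* s ℕ.+ 1 ℕ.+ s ≡ 4 ℕ.* s ℕ.+ 1
    eq₂ = ℕ-Solver.solve-∀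

  from-q : (∃ λ q″ → q ≡ suc (suc q″)) → ⊥
  from-q (q″ , ≡.refl) = decide (D ≟ K.1#)
    where
    Q = q ℕ.^ n
    card′ : HasCardinality F (Q ℕ.* Q)
    card′ = ≡.subst (HasCardinality F) (≡.trans (≡.cong (λ m → q ℕ.^ (n ℕ.+ m)) (ℕₚ.+-identityʳ n)) (ℕₚ.^-distribˡ-+-* q n n)) card
    module K = Ring F
    open Field F isField card′
    open PowerMaps F isField {r = k} p-prime q≡ n card′
    open Points F isField {r = k} p-prime q≡ n card′ s

    D : K.Carrier
    D = δ K.* δ K.^ Q

    D^Q : D K.^ Q K.≈ D
    D^Q = K.trans (K.^-distrib-* _ _ Q) (K.trans (K.*-comm _ _) (K.*-congʳ (x^QQ δ)))

    ¬heavy : ¬ Heavy δ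
    ¬heavy h = heavy⇒¬scattered (ℕₚ.≤-trans (ℕₚ.<⇒≤ s<2n) (ℕₚ.≤-reflexive (≡.cong (n ℕ.+_) (ℕₚ.+-identityʳ n)))) h scattered

    decide : Dec (D K.≈ K.1#) → ⊥
    decide (yes D≈1) = ¬heavy (heavy-norm-one (ℕₚ.≤-trans (ℕₚ.m≤n+m 2 (3 ℕ.* s)) 3s+2≤n) δ D≈1)
    decide (no D≉1) = Curve.¬¬fixedPoint S (λ fp → ¬heavy (FromFixedPoint.heavy S fp coprime δ relation))
      where
      D-1≉0 : ¬ D K.- K.1# K.≈ K.0#
      D-1≉0 h = D≉1 (K.x-y≈0⇒x≈y _ _ h)
      i e : K.Carrier
      i = inv (D K.- K.1#) D-1≉0
      e = D K.* i
      i-inverse : (D K.- K.1#) K.* i K.≈ K.1#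
      i-inverse = inv-inverse (D K.- K.1#) D-1≉0
      i≈ : e K.- K.1# K.≈ i
      i≈ = K.trans (K.+-congˡ (K.-‿cong (K.sym i-inverse))) (K.solve 2 (λ d i → d K.:* i K.:- (d K.:- K.con (+ 1)) K.:* i K.⊜ i) K.refl D i)
      relation : D K.* (e K.- K.1#) K.≈ e
      relation = K.*-congˡ i≈
      σ : ∃ λ d″ → q ℕ.^ s ≡ suc (suc d″)
      σ = 1<⇒2+ (ℕₚ.^-monoʳ-< q 1<q {0} {s} (s≤s z≤n))
      S : Setting
      S = record
        { F = F ; isField = isField ; p = p ; r = k ; s′ = s′ ; n = n ; q″ = q″ ; d″ = proj₁ σ ; prime = p-prime ; q≡ = q≡
        ; σ≡ = ≡.sym (proj₂ σ) ; card = card′ ; e = e ; n≥ = 3s+2≤n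
        ; e≉0 = *≉0 (*≉0 δ≉0 (^≉0 Q δ≉0)) (inv≉0 _ D-1≉0)
        ; e≉1 = λ h → inv≉0 _ D-1≉0 (K.trans (K.sym i≈) (K.x≈y⇒x-y≈0 h))
        ; e^Q = K.trans (K.^-distrib-* _ _ Q) (K.*-cong D^Q (inv-fixed (D K.- K.1#) D-1≉0 (K.trans (sub^ n _ _) (K.+-cong D^Q (K.-‿cong (K.1^ Q))))))
        }
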